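{- Let $q>2$ be a prime power and let $\mathcal{S}$ be a hypersurface of $\mathrm{PG}(6,q^2)$, defined over $\mathrm{GF}(q^2)$, of degree $q+1$, not containing any solid (projective $3$-dimensional subspace), and having exactly $q^{11}+q^9+q^7+q^4+q^2+1$ $\mathrm{GF}(q^2)$-rational points. Then every solid of $\mathrm{PG}(6,q^2)$ meets $\mathcal{S}$ in at least $q^4+q^2+1$ rational points. Moreover, if there exists at least one solid $\Sigma_3$ such that $\Sigma_3\cap\mathcal{S}$ contains exactly $q^4+q^2+1$ rational points, then $\mathcal{S}$ is a non-singular Hermitian variety of $\mathrm{PG}(6,q^2)$.
   Context: A Hermitian variety of $\mathrm{PG}(r,q^2)$ is the set of points $\langle v\rangle$ with $\eta(v,v)=0$ for a Hermitian (sesquilinear) form $\eta$ on $\mathrm{GF}(q^2)^{r+1}$; it is non-singular (denoted $\mathcal{H}(r,q^2)$) when $\eta$ is non-degenerate. Rational points of a hypersurface defined over $\mathrm{GF}(q^2)$ are its points in $\mathrm{PG}(6,q^2)$. -}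

module Defs where

open import Level using (Level; _⊔_) renaming (suc to lsuc)
open import Algebra.Bundles using (CommutativeRing)
open import Data.Nat as ℕ using (ℕ; zero; suc)
open import Data.Nat.Primality using (Prime)
open import Data.Bool using (Bool; true; false; not; _∧_; if_then_else_)
open import Data.Fin using (Fin)
open import Data.Vec as V using (Vec; []; _∷_)
open import Data.List as L using (List; []; _∷_; length; filterᵇ; concatMap)
open import Data.List.Relation.Unary.Any using (Any)
open import Data.List.Relation.Unary.AllPairs using (AllPairs)
open import Data.Product using (Σ; _×_; _,_; ∃)
open import Relation.Nullary using (¬_; Dec; yes; no)
open import Relation.Nullary.Decidable using (⌊_⌋)
open import Relation.Binary using (Decidable)
open import Relation.Binary.PropositionalEquality using (_≡_)

IsPrimePower : ℕ → Set
IsPrimePower q = Σ ℕ λ p → Σ ℕ λ k → Prime p × q ≡ p ℕ.^ suc k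

record FiniteField (c ℓ : Level) : Set (lsuc (c ⊔ ℓ)) where
  field
    commRing : CommutativeRing c ℓ
  open CommutativeRing commRing public
  field
    0≉1      : ¬ (0# ≈ 1#)
    inverse  : ∀ x → ¬ (x ≈ 0#) → Σ Carrier λ y → x * y ≈ 1#
    _≟_      : Decidable _≈_
    elements : List Carrier
    complete : ∀ x → Any (x ≈_) elements
    distinct : AllPairs (λ x y → ¬ (x ≈ y)) elements

  order : ℕ
  order = length elements

module Geometry {c ℓ : Level} (F : FiniteField c ℓ) where
  open FiniteField F hiding (Carrier; _≈_; 0#)
  open FiniteField F public using (Carrier; _≈_; 0#)

  pow : Carrier → ℕ → Carrier
  pow x zero    = 1#
  pow x (suc n) = x * pow x n

  isZeroᵇ : Carrier → Bool
  isZeroᵇ x = ⌊ x ≟ 0# ⌋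

  allVecs : (n : ℕ) → List (Vec Carrier n)
  allVecs zero    = [] ∷ []
  allVecs (suc n) = concatMap (λ x → L.map (x ∷_) (allVecs n)) elements

  -- canonical representatives of projective points: nonzero vectors whose
  -- first nonzero coordinate equals 1 (each point ⟨v⟩ of PG(n-1,F) has
  -- exactly one such representative)
  normalisedᵇ : ∀ {n} → Vec Carrier n → Bool
  normalisedᵇ []       = false
  normalisedᵇ (x ∷ xs) = if isZeroᵇ x then normalisedᵇ xs else ⌊ x ≟ 1# ⌋

  countPoints : (n : ℕ) → (Vec Carrier n → Bool) → ℕ
  countPoints n P = length (filterᵇ (λ v → normalisedᵇ v ∧ P v) (allVecs n))

  sumᵥ : ∀ {n} → Vec Carrier n → Carrier
  sumᵥ = V.foldr _ _+_ 0#

  _·ᵥ_ : ∀ {n} → Carrier → Vec Carrier n → Vec Carrier n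
  a ·ᵥ v = V.map (a *_) v

  _+ᵥ_ : ∀ {n} → Vec Carrier n → Vec Carrier n → Vec Carrier n
  _+ᵥ_ = V.zipWith _+_

  _≈ᵥ_ : ∀ {n} → Vec Carrier n → Vec Carrier n → Set ℓ
  u ≈ᵥ v = ∀ i → V.lookup u i ≈ V.lookup v i

  zeroᵥ : ∀ {n} → Vec Carrier n
  zeroᵥ = V.replicate _ 0#

  lincomb : ∀ {k n} → Vec Carrier k → Vec (Vec Carrier n) k → Vec Carrier n
  lincomb []       []       = zeroᵥ
  lincomb (a ∷ as) (b ∷ bs) = (a ·ᵥ b) +ᵥ lincomb as bs

  LinearlyIndependent : ∀ {k n} → Vec (Vec Carrier n) k → Set (c ⊔ ℓ)
  LinearlyIndependent {k} bs =
    ∀ (cs : Vec Carrier k) → lincomb cs bs ≈ᵥ zeroᵥ → ∀ i → V.lookup cs i ≈ 0#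

  monomials : ℕ → (n : ℕ) → List (Vec ℕ n)
  monomials d zero    = if ⌊ d ℕ.≟ 0 ⌋ then [] ∷ [] else []
  monomials d (suc n) =
    concatMap (λ e → L.map (e ∷_) (monomials (d ℕ.∸ e) n)) (L.upTo (suc d))

  -- a form of degree d in n variables is given by a coefficient function
  -- on exponent vectors (only its values on `monomials d n` matter)

  monomialValue : ∀ {n} → Vec ℕ n → Vec Carrier n → Carrier
  monomialValue e v = V.foldr _ _*_ 1# (V.zipWith pow v e)

  eval : (d n : ℕ) → (Vec ℕ n → Carrier) → Vec Carrier n → Carrier
  eval d n f v = L.foldr _+_ 0# (L.map (λ e → f e * monomialValue e v) (monomials d n))

  NonZeroForm : (d n : ℕ) → (Vec ℕ n → Carrier) → Set ℓ
  NonZeroForm d n f = Any (λ e → ¬ (f e ≈ 0#)) (monomials d n)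

  -- Hermitian forms over F = GF(q²): conjugation x ↦ x^q

  module _ (q : ℕ) where
    conj : Carrier → Carrier
    conj x = pow x q

    record HermitianForm (n : ℕ) : Set (c ⊔ ℓ) where
      field
        η        : Vec Carrier n → Vec Carrier n → Carrier
        η-cong   : ∀ {u u′ v v′} → u ≈ᵥ u′ → v ≈ᵥ v′ → η u v ≈ η u′ v′
        η-addʳ   : ∀ u v w → η u (v +ᵥ w) ≈ η u v + η u w
        η-scaleʳ : ∀ a u v → η u (a ·ᵥ v) ≈ a * η u v
        η-addˡ   : ∀ u v w → η (u +ᵥ v) w ≈ η u w + η v w
        η-scaleˡ : ∀ a u v → η (a ·ᵥ u) v ≈ conj a * η u v
        η-herm   : ∀ u v → η u v ≈ conj (η v u)

      NonDegenerate : Set (c ⊔ ℓ)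
      NonDegenerate = ∀ u → (∀ v → η u v ≈ 0#) → u ≈ᵥ zeroᵥ

{-# OPTIONS --safe #-}

-- Let K = GF(q²), V = K⁷, and let B(z,u) be the coefficient of s in f(z + su). Reversing the
-- polynomial, B(z,u) is also the coefficient of s^q in f(u + sz), so B is linear in u and
-- B(cz,u) = c^q B(z,u). Everything is counted by vectors instead of points.
--
-- Let f vanish on a subspace U, and let n(v) be the number of zeros of f on v + U. If B(u,v) ≠ 0 for
-- some u ∈ U, then f(z + su) has degree q in s for every z ∈ v + U, so n(v) ≤ |U|/q; if
-- B(U,v) = 0 and f does not vanish on v + U, then even n(v) ≤ |U|/(q + 1). When n(v) = |U|/q, every
-- line z + Ku carries q distinct zeros; this forces f to be invariant on v + U under the
-- u ∈ U with B(u,v) = 0, and B(·,v) to be additive on U.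
--
-- Comparing Σ n(v) = |U|·#zeros with these bounds produces a point, a line and a plane inside the
-- hypersurface. For a plane U, as there is no solid, few v are exceptional; the kernel {v | B(U,v) = 0} is
-- U + K w₀ and f is a nonzero constant on w₀ + U, so n = 0 on the kernel outside U, and then the count
-- leaves n(v) = |U|/q for all v outside the kernel. For such w and B(u,w) = 1,
-- two independent functionals on U give f(w + su) = f(w) + cs + s^q with c the same for all w.
-- Having two roots in s, this yields c^(q+1) = 1 and f(w)^q = γ f(w) with γ = c^q. Hence f^q = γ f everywhere,
-- B(u,v)^q = γ B(v,u), and B divided by f(w₀) is Hermitian with diagonal f / f(w₀); its radical is zero,
-- since otherwise the kernel would be too large.
--
-- Finally f takes at most q values, each at most q + 1 times on a line through a point off the
-- hypersurface, so it has a zero there; averaging over such lines in a solid bounds its zeros below.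
module Submission where

open import Defs
open import Level using (Level; 0ℓ)
open import Algebra.Bundles using (CommutativeRing; RawRing)
open import Algebra.Structures using (IsCommutativeRing; IsCommutativeMonoid)
import Algebra.Properties.Ring
import Algebra.Solver.Ring
import Algebra.Solver.Ring.AlmostCommutativeRing as ACR
open import Data.Bool using (Bool; true; false; _∧_; if_then_else_)
open import Data.Empty using (⊥; ⊥-elim)
open import Data.Fin as Fin using (Fin)
open import Data.Integer as ℤ using (ℤ; -[1+_]; _⊖_; _◃_) renaming (+_ to pos)
import Data.Integer.Properties as ℤₚ
open import Data.List as L using (List; []; _∷_; _++_; length; filterᵇ; concatMap; allFin)
open import Data.List.Membership.Propositional.Properties using (∈-allFin)
open import Data.List.Properties using (length-tabulate; map-tabulate; tabulate-lookup)
open import Data.List.Relation.Unary.All as All using (All; []; _∷_)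
import Data.List.Relation.Unary.All.Properties as Allₚ
open import Data.List.Relation.Unary.AllPairs using (AllPairs; []; _∷_)
open import Data.List.Relation.Unary.Any as Any using (Any; here; there)
open import Data.List.Relation.Unary.Any.Properties using (lookup-index)
open import Data.List.Relation.Unary.Unique.Propositional.Properties using (allFin⁺)
open import Data.Maybe using (Maybe; just; nothing)
open import Data.Nat as ℕ using (ℕ; zero; suc; _≤_; _<_; z≤n; s≤s; s≤s⁻¹; _∸_)
open import Data.Nat.Combinatorics using (_C_; nCk+nC[k+1]≡[n+1]C[k+1]; k>n⇒nCk≡0; nCn≡1; nC1≡n)
open import Data.Nat.Divisibility using (_∣_; divides; ∣⇒≤)
open import Data.Nat.Primality using (Prime; euclidsLemma; prime⇒nonZero)
import Data.Nat.Properties as ℕₚ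
open import Data.Nat.Solver using (module +-*-Solver)
open import Data.Product using (Σ; _×_; _,_; proj₁; proj₂)
import Data.Sign as Sign
open import Data.Sum using (inj₁; inj₂)
open import Data.Unit using (⊤; tt)
open import Data.Vec as V using (Vec; []; _∷_; head; tail; lookup)
open import Data.Vec.Properties using (≡-dec; lookup-map; lookup-zipWith; lookup-replicate; tabulate∘lookup; lookup∘tabulate; tabulate-cong)
open import Function using (_∘_; id)
open import Relation.Binary using (DecidableEquality)
open import Relation.Binary.PropositionalEquality as ≡ using (_≡_; _≢_; refl; sym; trans; cong; cong₂; subst; subst₂; module ≡-Reasoning)
open import Relation.Nullary using (¬_; Dec; yes; no)
open import Relation.Nullary.Decidable using (¬?; _×-dec_; decidable-stable; ⌊_⌋)

-- The obstacle is the asymmetry of B. In its second argument it is linear for reasons of degree; in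
-- the first only scaling is known, and additivity there has to be extracted from the fibres
-- attaining the bound |U|/q. Such fibres abound because q^13 + q^6 - q^7 of the q^14 vectors are
-- zeros: the average of n(v) almost equals the bound, and the total deficit cannot feed many
-- exceptions. A subspace on which every vector loses zeros is therefore played off against a lower
-- bound for its size, which for a line and a plane itself rests on additivity. For a plane the
-- balance is exact: if the vectors of U are charged as well, the deficit is q^13, that is q^5 for
-- each of the q^8 vectors of the kernel, and nothing remains for the others. The condition q > 2
-- enters through 3q ≤ q²: a polynomial of degree q + 1 along a line is then determined by its
-- values at nonzero parameters, and the powers of q in the estimates stay separated.

-- Finite fields with propositional equality; solvers for ring and vector identities.

record DiscreteField : Set₁ where
  infixl 6 _+_ _-_
  infixl 7 _*_
  infix  8 -_
  infix  4 _≟_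
  field
    Carrier : Set
    _+_ _*_ : Carrier → Carrier → Carrier
    -_      : Carrier → Carrier
    0# 1#   : Carrier
    isCommutativeRing : IsCommutativeRing _≡_ _+_ _*_ -_ 0# 1#
    0≢1      : 0# ≢ 1#
    inverse  : ∀ x → x ≢ 0# → Σ Carrier λ y → x * y ≡ 1#
    _≟_      : DecidableEquality Carrier
    elements : List Carrier
    complete : ∀ x → Any (x ≡_) elements
    distinct : AllPairs _≢_ elements

  _-_ : Carrier → Carrier → Carrier
  x - y = x + (- y)

  commutativeRing : CommutativeRing 0ℓ 0ℓ
  commutativeRing = record { isCommutativeRing = isCommutativeRing }

module RingSolver (D : DiscreteField) where
  open DiscreteField D
  open IsCommutativeRing isCommutativeRing
    using (+-assoc; +-comm; +-identityˡ; +-identityʳ; *-assoc; *-comm; *-identityˡ; *-identityʳ;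
           distribˡ; distribʳ; -‿inverseˡ; -‿inverseʳ; zeroˡ; zeroʳ)
  open Algebra.Properties.Ring (CommutativeRing.ring commutativeRing)
    using (-‿distribˡ-*; -‿distribʳ-*; -‿involutive; -‿+-comm; -0#≈0#)

  -- The separate clause for one makes `ι 1` reduce to `1#` and not to `1# + 0#`, so that the solver
  -- constants `:0` and `:1` evaluate definitionally to the constants of the field.
  ι : ℕ → Carrier
  ι zero          = 0#
  ι (suc zero)    = 1#
  ι (suc (suc n)) = 1# + ι (suc n)

  ι-suc : ∀ n → ι (suc n) ≡ 1# + ι n
  ι-suc zero    = sym (+-identityʳ 1#)
  ι-suc (suc n) = refl

  ι-+ : ∀ m n → ι (m ℕ.+ n) ≡ ι m + ι n
  ι-+ zero n    = sym (+-identityˡ _)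
  ι-+ (suc m) n = trans (ι-suc (m ℕ.+ n)) (trans (cong (1# +_) (ι-+ m n))
    (trans (sym (+-assoc _ _ _)) (cong (_+ ι n) (sym (ι-suc m)))))

  ι-* : ∀ m n → ι (m ℕ.* n) ≡ ι m * ι n
  ι-* zero n    = sym (zeroˡ _)
  ι-* (suc m) n = trans (ι-+ n (m ℕ.* n)) (trans (cong₂ _+_ (sym (*-identityˡ _)) (ι-* m n))
    (trans (sym (distribʳ _ _ _)) (cong (_* ι n) (sym (ι-suc m)))))

  -- The solver computes with integer coefficients: their equality is decidable, and an identity
  -- with such coefficients holds in every characteristic.
  ιᶻ : ℤ → Carrier
  ιᶻ (pos n)    = ι n
  ιᶻ -[1+ n ] = - ι (suc n)

  ιᶻ-⊖ : ∀ m n → ιᶻ (m ⊖ n) ≡ ι m - ι n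
  ιᶻ-⊖ m zero = sym (trans (cong (ι m +_) -0#≈0#) (+-identityʳ (ι m)))
  ιᶻ-⊖ zero (suc n) = sym (+-identityˡ _)
  ιᶻ-⊖ (suc m) (suc n) = trans (cong ιᶻ (ℤₚ.[1+m]⊖[1+n]≡m⊖n m n)) (trans (ιᶻ-⊖ m n) (sym lem))
    where
    lem : ι (suc m) - ι (suc n) ≡ ι m - ι n
    lem = begin
      ι (suc m) - ι (suc n)            ≡⟨ cong₂ (λ a b → a - b) (ι-suc m) (ι-suc n) ⟩
      (1# + ι m) - (1# + ι n)          ≡⟨ cong₂ _+_ (+-comm _ _) (sym (-‿+-comm _ _)) ⟩
      (ι m + 1#) + (- 1# + - ι n)      ≡⟨ +-assoc _ _ _ ⟩
      ι m + (1# + (- 1# + - ι n))      ≡⟨ cong (ι m +_) (sym (+-assoc _ _ _)) ⟩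
      ι m + ((1# + - 1#) + - ι n)      ≡⟨ cong (λ z → ι m + (z + - ι n)) (-‿inverseʳ 1#) ⟩
      ι m + (0# + - ι n)               ≡⟨ cong (ι m +_) (+-identityˡ _) ⟩
      ι m - ι n                        ∎
      where open ≡-Reasoning

  ιᶻ-+ : ∀ i j → ιᶻ (i ℤ.+ j) ≡ ιᶻ i + ιᶻ j
  ιᶻ-+ (pos m) (pos n) = ι-+ m n
  ιᶻ-+ (pos m) -[1+ n ] = ιᶻ-⊖ m (suc n)
  ιᶻ-+ -[1+ m ] (pos n) = trans (ιᶻ-⊖ n (suc m)) (+-comm _ _)
  ιᶻ-+ -[1+ m ] -[1+ n ] = trans (cong -_ (trans (cong (λ k → ι (suc k)) (sym (ℕₚ.+-suc m n)))
    (ι-+ (suc m) (suc n)))) (sym (-‿+-comm _ _))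

  ιᶻ-◃- : ∀ n → ιᶻ (Sign.- ◃ n) ≡ - ι n
  ιᶻ-◃- zero    = sym -0#≈0#
  ιᶻ-◃- (suc n) = refl

  ιᶻ-◃+ : ∀ n → ιᶻ (Sign.+ ◃ n) ≡ ι n
  ιᶻ-◃+ zero    = refl
  ιᶻ-◃+ (suc n) = refl

  ιᶻ-* : ∀ i j → ιᶻ (i ℤ.* j) ≡ ιᶻ i * ιᶻ j
  ιᶻ-* (pos m) (pos n) = trans (ιᶻ-◃+ (m ℕ.* n)) (ι-* m n)
  ιᶻ-* (pos m) -[1+ n ] = trans (ιᶻ-◃- (m ℕ.* suc n)) (trans (cong -_ (ι-* m (suc n))) (-‿distribʳ-* _ _))
  ιᶻ-* -[1+ m ] (pos n) = trans (ιᶻ-◃- (suc m ℕ.* n)) (trans (cong -_ (ι-* (suc m) n)) (-‿distribˡ-* _ _))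
  ιᶻ-* -[1+ m ] -[1+ n ] = trans (ι-* (suc m) (suc n)) (sym
    (trans (sym (-‿distribˡ-* _ _)) (trans (cong -_ (sym (-‿distribʳ-* _ _))) (-‿involutive _))))

  ιᶻ-neg : ∀ i → ιᶻ (ℤ.- i) ≡ - ιᶻ i
  ιᶻ-neg (pos zero)  = sym -0#≈0#
  ιᶻ-neg (pos (suc n)) = refl
  ιᶻ-neg -[1+ n ]  = sym (-‿involutive _)

  private
    ℤ-raw : RawRing 0ℓ 0ℓ
    ℤ-raw = record { Carrier = ℤ ; _≈_ = _≡_ ; _+_ = ℤ._+_ ; _*_ = ℤ._*_ ; -_ = ℤ.-_ ; 0# = pos 0 ; 1# = pos 1 }

    target : ACR.AlmostCommutativeRing 0ℓ 0ℓ
    target = ACR.fromCommutativeRing commutativeRing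

    morphism : ℤ-raw ACR.-Raw-AlmostCommutative⟶ target
    morphism = record { ⟦_⟧ = ιᶻ ; +-homo = ιᶻ-+ ; *-homo = ιᶻ-* ; -‿homo = ιᶻ-neg ; 0-homo = refl ; 1-homo = refl }

    _coeff≟_ : ∀ i j → Maybe (ιᶻ i ≡ ιᶻ j)
    i coeff≟ j with i ℤ.≟ j
    ... | yes eq = just (cong ιᶻ eq)
    ... | no _   = nothing

  open Algebra.Solver.Ring ℤ-raw target morphism _coeff≟_ public
    using (Polynomial; solve; _:=_; _:+_; _:*_; _:-_; :-_)
  module Solver = Algebra.Solver.Ring ℤ-raw target morphism _coeff≟_

  :0 :1 : ∀ {n} → Polynomial n
  :0 = Solver.con (pos 0)
  :1 = Solver.con (pos 1)

toFiniteField : DiscreteField → FiniteField 0ℓ 0ℓ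
toFiniteField D = record
  { commRing = commutativeRing ; 0≉1 = 0≢1 ; inverse = inverse ; _≟_ = _≟_
  ; elements = elements ; complete = complete ; distinct = distinct }
  where open DiscreteField D

lookup-ext : ∀ {A : Set} {n} {u v : Vec A n} → (∀ i → lookup u i ≡ lookup v i) → u ≡ v
lookup-ext {u = u} {v} h = trans (sym (tabulate∘lookup u)) (trans (tabulate-cong h) (tabulate∘lookup v))

module VectorSolver (D : DiscreteField) where
  open DiscreteField D
  open RingSolver D
  open Geometry (toFiniteField D) using (_+ᵥ_; _·ᵥ_; zeroᵥ)

  infixl 6 _:⊕_
  infixr 7 _:⊙_
  infix  4 _:≋_

  data Expr (m k : ℕ) : Set where
    atom : Fin m → Expr m k
    _:⊕_ : Expr m k → Expr m k → Expr m k
    _:⊙_ : Polynomial k → Expr m k → Expr m k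
    :𝟎   : Expr m k

  _:≋_ : ∀ {m k} → Expr m k → Expr m k → Expr m k × Expr m k
  _:≋_ = _,_

  ⟦_⟧ᵥ : ∀ {m k n} → Expr m k → Vec Carrier k → Vec (Vec Carrier n) m → Vec Carrier n
  ⟦ atom i ⟧ᵥ  ρ σ = lookup σ i
  ⟦ e :⊕ e′ ⟧ᵥ ρ σ = ⟦ e ⟧ᵥ ρ σ +ᵥ ⟦ e′ ⟧ᵥ ρ σ
  ⟦ p :⊙ e ⟧ᵥ  ρ σ = Solver.⟦ p ⟧ ρ ·ᵥ ⟦ e ⟧ᵥ ρ σ
  ⟦ :𝟎 ⟧ᵥ      ρ σ = zeroᵥ

  -- The test by `≡ᵇ` evaluates on concrete indices, so the collected coefficients become explicit
  -- polynomials that the ring solver can normalise.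
  coefficient : ∀ {m k} → Expr m k → Fin m → Polynomial k
  coefficient (atom i) j  = if Fin.toℕ i ℕ.≡ᵇ Fin.toℕ j then :1 else :0
  coefficient (e :⊕ e′) j = coefficient e j :+ coefficient e′ j
  coefficient (p :⊙ e) j  = p :* coefficient e j
  coefficient :𝟎 j        = :0

  private
    ∑ : ∀ {m} → (Fin m → Carrier) → Carrier
    ∑ {zero}  g = 0#
    ∑ {suc m} g = g Fin.zero + ∑ (λ i → g (Fin.suc i))

    ∑-cong : ∀ {m} {g h : Fin m → Carrier} → (∀ i → g i ≡ h i) → ∑ g ≡ ∑ h
    ∑-cong {zero}  e = refl
    ∑-cong {suc m} e = cong₂ _+_ (e Fin.zero) (∑-cong (λ i → e (Fin.suc i)))

    ∑-+ : ∀ {m} (g h : Fin m → Carrier) → ∑ g + ∑ h ≡ ∑ (λ i → g i + h i)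
    ∑-+ {zero}  g h = lem
      where
      lem : 0# + 0# ≡ 0#
      lem = solve 0 (:0 :+ :0 := :0) refl
    ∑-+ {suc m} g h = trans lem (cong ((g Fin.zero + h Fin.zero) +_) (∑-+ (λ i → g (Fin.suc i)) (λ i → h (Fin.suc i))))
      where
      lem : (g Fin.zero + ∑ (λ i → g (Fin.suc i))) + (h Fin.zero + ∑ (λ i → h (Fin.suc i)))
          ≡ (g Fin.zero + h Fin.zero) + (∑ (λ i → g (Fin.suc i)) + ∑ (λ i → h (Fin.suc i)))
      lem = solve 4 (λ g i h a → g :+ i :+ (h :+ a) := g :+ h :+ (i :+ a)) refl (g Fin.zero) (∑ (λ i → g (Fin.suc i))) (h Fin.zero) (∑ (λ i → h (Fin.suc i)))

    ∑-* : ∀ {m} a (g : Fin m → Carrier) → a * ∑ g ≡ ∑ (λ i → a * g i)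
    ∑-* {zero}  a g = lem
      where
      lem : a * 0# ≡ 0#
      lem = solve 1 (λ a → a :* :0 := :0) refl a
    ∑-* {suc m} a g = trans lem (cong (a * g Fin.zero +_) (∑-* a (λ i → g (Fin.suc i))))
      where
      lem : a * (g Fin.zero + ∑ (λ i → g (Fin.suc i))) ≡ a * g Fin.zero + a * ∑ (λ i → g (Fin.suc i))
      lem = solve 3 (λ a g i → a :* (g :+ i) := a :* g :+ a :* i) refl a (g Fin.zero) (∑ (λ i → g (Fin.suc i)))

    ∑-zero : ∀ {m} (g : Fin m → Carrier) → 0# ≡ ∑ (λ i → 0# * g i)
    ∑-zero {zero}  g = refl
    ∑-zero {suc m} g = trans lem (cong (0# * g Fin.zero +_) (∑-zero (λ i → g (Fin.suc i))))
      where
      lem : 0# ≡ 0# * g Fin.zero + 0#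
      lem = solve 1 (λ g → :0 := :0 :* g :+ :0) refl (g Fin.zero)

    ∑-δ : ∀ {m k} (ρ : Vec Carrier k) (g : Fin m → Carrier) i →
          g i ≡ ∑ (λ j → Solver.⟦ if Fin.toℕ i ℕ.≡ᵇ Fin.toℕ j then :1 else :0 ⟧ ρ * g j)
    ∑-δ {suc m} ρ g Fin.zero = trans lem (cong (1# * g Fin.zero +_) (∑-zero (λ i → g (Fin.suc i))))
      where
      lem : g Fin.zero ≡ 1# * g Fin.zero + 0#
      lem = solve 1 (λ g → g := :1 :* g :+ :0) refl (g Fin.zero)
    ∑-δ {suc m} ρ g (Fin.suc i) = trans (∑-δ ρ (λ j → g (Fin.suc j)) i) lem
      where
      rest = ∑ (λ j → Solver.⟦ if Fin.toℕ i ℕ.≡ᵇ Fin.toℕ j then :1 else :0 ⟧ ρ * g (Fin.suc j))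
      lem : rest ≡ 0# * g Fin.zero + rest
      lem = solve 2 (λ rest g → rest := :0 :* g :+ rest) refl rest (g Fin.zero)

    expand : ∀ {m k n} (e : Expr m k) (ρ : Vec Carrier k) (σ : Vec (Vec Carrier n) m) t →
             lookup (⟦ e ⟧ᵥ ρ σ) t ≡ ∑ (λ i → Solver.⟦ coefficient e i ⟧ ρ * lookup (lookup σ i) t)
    expand (atom i) ρ σ t = ∑-δ ρ (λ j → lookup (lookup σ j) t) i
    expand {m} (e :⊕ e′) ρ σ t = trans (lookup-zipWith _+_ t (⟦ e ⟧ᵥ ρ σ) (⟦ e′ ⟧ᵥ ρ σ))
      (trans (cong₂ _+_ (expand e ρ σ t) (expand e′ ρ σ t)) (trans (∑-+ {m} (term e) (term e′))
        (∑-cong {m} (λ i → lem (Solver.⟦ coefficient e i ⟧ ρ) (Solver.⟦ coefficient e′ i ⟧ ρ) (lookup (lookup σ i) t)))))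
      where
      term : Expr m _ → Fin m → Carrier
      term e i = Solver.⟦ coefficient e i ⟧ ρ * lookup (lookup σ i) t
      lem : ∀ a b c → a * c + b * c ≡ (a + b) * c
      lem a b c = solve 3 (λ a c b → a :* c :+ b :* c := (a :+ b) :* c) refl a c b
    expand {m} (p :⊙ e) ρ σ t = trans (lookup-map t (Solver.⟦ p ⟧ ρ *_) (⟦ e ⟧ᵥ ρ σ))
      (trans (cong (Solver.⟦ p ⟧ ρ *_) (expand e ρ σ t))
        (trans (∑-* {m} (Solver.⟦ p ⟧ ρ) (λ i → Solver.⟦ coefficient e i ⟧ ρ * lookup (lookup σ i) t))
        (∑-cong {m} (λ i → lem (Solver.⟦ p ⟧ ρ) (Solver.⟦ coefficient e i ⟧ ρ) (lookup (lookup σ i) t)))))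
      where
      lem : ∀ a b c → a * (b * c) ≡ (a * b) * c
      lem a b c = solve 3 (λ a b c → a :* (b :* c) := a :* b :* c) refl a b c
    expand :𝟎 ρ σ t = trans (lookup-replicate t 0#) (∑-zero (λ i → lookup (lookup σ i) t))

  -- An identity between linear combinations follows from the identities of the coefficients of each vector variable.
  vsolve : ∀ {m k n} (ρ : Vec Carrier k) (σ : Vec (Vec Carrier n) m)
           (f : Vec (Polynomial k) k → Vec (Expr m k) m → Expr m k × Expr m k) →
           let e = f (V.tabulate Solver.var) (V.tabulate atom) in
           V.tabulate (λ i → Solver.⟦ coefficient (proj₁ e) i ⟧↓ ρ) ≡ V.tabulate (λ i → Solver.⟦ coefficient (proj₂ e) i ⟧↓ ρ) →
           ⟦ proj₁ e ⟧ᵥ ρ σ ≡ ⟦ proj₂ e ⟧ᵥ ρ σ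
  vsolve {m} {k} ρ σ f h = lookup-ext λ t → trans (expand e ρ σ t) (trans
    (∑-cong {m} (λ i → cong (_* lookup (lookup σ i) t) (Solver.prove ρ (coefficient e i) (coefficient e′ i) (agree i))))
    (sym (expand e′ ρ σ t)))
    where
    e e′ : Expr m k
    e = proj₁ (f (V.tabulate Solver.var) (V.tabulate atom))
    e′ = proj₂ (f (V.tabulate Solver.var) (V.tabulate atom))
    agree : ∀ i → Solver.⟦ coefficient e i ⟧↓ ρ ≡ Solver.⟦ coefficient e′ i ⟧↓ ρ
    agree i = trans (sym (lookup∘tabulate (λ i → Solver.⟦ coefficient e i ⟧↓ ρ) i)) (trans (cong (λ v → lookup v i) h) (lookup∘tabulate (λ i → Solver.⟦ coefficient e′ i ⟧↓ ρ) i))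

-- Finite sums, indicator functions and enumerated types.

module FiniteSums where
  open import Data.Nat using (_+_; _*_; _^_)
  open import Data.Nat.Properties hiding (_≟_)

  χ : ∀ {a} {P : Set a} → Dec P → ℕ
  χ (yes _) = 1
  χ (no _)  = 0

  χ-yes : ∀ {a} {P : Set a} (d : Dec P) → P → χ d ≡ 1
  χ-yes (yes _) p = refl
  χ-yes (no ¬p) p = ⊥-elim (¬p p)

  χ-no : ∀ {a} {P : Set a} (d : Dec P) → ¬ P → χ d ≡ 0
  χ-no (yes p) ¬p = ⊥-elim (¬p p)
  χ-no (no _)  ¬p = refl

  χ≤1 : ∀ {a} {P : Set a} (d : Dec P) → χ d ≤ 1
  χ≤1 (yes _) = s≤s z≤n
  χ≤1 (no _)  = z≤n

  χ-mono : ∀ {a b} {P : Set a} {Q : Set b} (d : Dec P) (e : Dec Q) → (P → Q) → χ d ≤ χ e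
  χ-mono (yes p) (yes q) f = ≤-refl
  χ-mono (yes p) (no ¬q) f = ⊥-elim (¬q (f p))
  χ-mono (no _)  e       f = z≤n

  χ-cong : ∀ {a b} {P : Set a} {Q : Set b} (d : Dec P) (e : Dec Q) → (P → Q) → (Q → P) → χ d ≡ χ e
  χ-cong d e f g = ≤-antisym (χ-mono d e f) (χ-mono e d g)

  ∑ : ∀ {a} {A : Set a} → List A → (A → ℕ) → ℕ
  ∑ []       g = 0
  ∑ (x ∷ xs) g = g x + ∑ xs g

  module _ {a} {A : Set a} where
    ∑-cong : ∀ (xs : List A) {g h} → (∀ x → g x ≡ h x) → ∑ xs g ≡ ∑ xs h
    ∑-cong []       e = refl
    ∑-cong (x ∷ xs) e = cong₂ _+_ (e x) (∑-cong xs e)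

    ∑-mono : ∀ (xs : List A) {g h} → (∀ x → g x ≤ h x) → ∑ xs g ≤ ∑ xs h
    ∑-mono []       e = z≤n
    ∑-mono (x ∷ xs) e = +-mono-≤ (e x) (∑-mono xs e)

    ∑-+ : ∀ (xs : List A) g h → ∑ xs (λ x → g x + h x) ≡ ∑ xs g + ∑ xs h
    ∑-+ []       g h = refl
    ∑-+ (x ∷ xs) g h = trans (cong (g x + h x +_) (∑-+ xs g h))
      (solve 4 (λ a b c d → (a :+ b) :+ (c :+ d) := (a :+ c) :+ (b :+ d)) refl (g x) (h x) (∑ xs g) (∑ xs h))
      where open +-*-Solver

    ∑-*ʳ : ∀ (xs : List A) g c → ∑ xs (λ x → g x * c) ≡ ∑ xs g * c
    ∑-*ʳ []       g c = refl
    ∑-*ʳ (x ∷ xs) g c = trans (cong (g x * c +_) (∑-*ʳ xs g c)) (sym (*-distribʳ-+ c (g x) (∑ xs g)))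

    ∑-*ˡ : ∀ (xs : List A) c g → ∑ xs (λ x → c * g x) ≡ c * ∑ xs g
    ∑-*ˡ xs c g = trans (∑-cong xs (λ x → *-comm c (g x))) (trans (∑-*ʳ xs g c) (*-comm (∑ xs g) c))

    ∑-zero : ∀ (xs : List A) → ∑ xs (λ _ → 0) ≡ 0
    ∑-zero []       = refl
    ∑-zero (x ∷ xs) = ∑-zero xs

    ∑-++ : ∀ (xs ys : List A) g → ∑ (xs ++ ys) g ≡ ∑ xs g + ∑ ys g
    ∑-++ []       ys g = refl
    ∑-++ (x ∷ xs) ys g = trans (cong (g x +_) (∑-++ xs ys g)) (sym (+-assoc (g x) (∑ xs g) (∑ ys g)))

    ∑-search : ∀ (xs : List A) {P : A → Set} (P? : ∀ x → Dec (P x)) → 1 ≤ ∑ xs (λ x → χ (P? x)) → Σ A P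
    ∑-search (x ∷ xs) P? h with P? x
    ... | yes p = x , p
    ... | no _  = ∑-search xs P? h

  ∑-map : ∀ {a b} {A : Set a} {B : Set b} (h : A → B) xs g → ∑ (L.map h xs) g ≡ ∑ xs (g ∘ h)
  ∑-map h []       g = refl
  ∑-map h (x ∷ xs) g = cong (g (h x) +_) (∑-map h xs g)

  ∑-concatMap : ∀ {a b} {A : Set a} {B : Set b} (h : A → List B) xs g → ∑ (concatMap h xs) g ≡ ∑ xs (λ x → ∑ (h x) g)
  ∑-concatMap h []       g = refl
  ∑-concatMap h (x ∷ xs) g = trans (∑-++ (h x) (concatMap h xs) g) (cong (∑ (h x) g +_) (∑-concatMap h xs g))

  ∑-swap : ∀ {A B : Set} (xs : List A) (ys : List B) (g : A → B → ℕ) →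
           ∑ xs (λ x → ∑ ys (g x)) ≡ ∑ ys (λ y → ∑ xs (λ x → g x y))
  ∑-swap []       ys g = sym (∑-zero ys)
  ∑-swap (x ∷ xs) ys g = trans (cong (∑ ys (g x) +_) (∑-swap xs ys g))
    (sym (∑-+ ys (g x) (λ y → ∑ xs (λ x → g x y))))

  -- The single equation `once` contains both completeness and the absence of repetitions, in the
  -- form in which sums against an indicator are evaluated.
  record Enumeration (A : Set) : Set where
    infix 4 _≟_
    field
      _≟_  : DecidableEquality A
      list : List A
      once : ∀ a → ∑ list (λ x → χ (x ≟ a)) ≡ 1

    size : ℕ
    size = ∑ list (λ _ → 1)

    sum : (A → ℕ) → ℕ
    sum = ∑ list

    count : {P : A → Set} → (∀ x → Dec (P x)) → ℕ
    count P? = sum (λ x → χ (P? x))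

    sum-const : ∀ c → sum (λ _ → c) ≡ size * c
    sum-const c = trans (∑-cong list (λ _ → sym (*-identityˡ c))) (∑-*ʳ list (λ _ → 1) c)

    sum-δ : ∀ a g → sum (λ x → χ (x ≟ a) * g x) ≡ g a
    sum-δ a g = trans (∑-cong list pointwise) (trans (∑-*ʳ list (λ x → χ (x ≟ a)) (g a))
      (trans (cong (_* g a) (once a)) (*-identityˡ (g a))))
      where
      pointwise : ∀ x → χ (x ≟ a) * g x ≡ χ (x ≟ a) * g a
      pointwise x with x ≟ a
      ... | yes refl = refl
      ... | no _     = refl

    sum-strict : ∀ {g h} a → (∀ x → g x ≤ h x) → g a < h a → sum g < sum h
    sum-strict {g} {h} a le lt = subst (_≤ sum h)
      (trans (∑-+ list (λ x → χ (x ≟ a)) g) (cong (_+ sum g) (once a))) (∑-mono list pointwise)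
      where
      pointwise : ∀ x → χ (x ≟ a) + g x ≤ h x
      pointwise x with x ≟ a
      ... | yes refl = lt
      ... | no _     = le x

    member : ∀ {g} a → g a ≤ sum g
    member {g} a = subst (_≤ sum g) (sum-δ a g) (∑-mono list λ x → ≤-trans (*-monoˡ-≤ (g x) (χ≤1 (x ≟ a))) (≤-reflexive (*-identityˡ (g x))))

    search : {P : A → Set} → (∀ x → Dec (P x)) → Dec (Σ A P)
    search {P} P? with 0 <? count P?
    ... | yes h = yes (∑-search list P? h)
    ... | no ¬h = no λ { (a , p) → ¬h (≤-trans (≤-reflexive (sym (χ-yes (P? a) p))) (member {λ x → χ (P? x)} a)) }

    decideAll : {P : A → Set} → (∀ x → Dec (P x)) → Dec (∀ x → P x)
    decideAll P? with search (λ x → ¬? (P? x))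
    ... | yes (a , ¬p) = no λ h → ¬p (h a)
    ... | no none      = yes λ x → decidable-stable (P? x) (λ ¬p → none (x , ¬p))

    find : {P : A → Set} → (∀ x → Dec (P x)) → ¬ (∀ x → ¬ P x) → Σ A P
    find P? h = decidable-stable (search P?) λ none → h λ x p → none (x , p)

  open Enumeration using (size; sum; count)

  module _ {A B : Set} (E : Enumeration A) (F : Enumeration B) where
    private
      module E = Enumeration E
      module F = Enumeration F

    -- Each `g (h x)` is spread over the indicator of y = h x; after exchanging the sums,
    -- injectivity says that every y is hit at most once.
    sum-injective : ∀ (h : A → B) → (∀ {x y} → h x ≡ h y → x ≡ y) → ∀ g → E.sum (g ∘ h) ≤ F.sum g
    sum-injective h inj g = begin
      E.sum (g ∘ h)                                           ≡⟨ ∑-cong E.list (λ x → F.sum-δ (h x) g) ⟨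
      E.sum (λ x → F.sum (λ y → χ (y F.≟ h x) * g y))         ≡⟨ ∑-swap E.list F.list (λ x y → χ (y F.≟ h x) * g y) ⟩
      F.sum (λ y → E.sum (λ x → χ (y F.≟ h x) * g y))         ≡⟨ ∑-cong F.list (λ y → ∑-*ʳ E.list (λ x → χ (y F.≟ h x)) (g y)) ⟩
      F.sum (λ y → E.count (λ x → y F.≟ h x) * g y)           ≤⟨ ∑-mono F.list (λ y → *-monoˡ-≤ (g y) (fibre y)) ⟩
      F.sum (λ y → 1 * g y)                                   ≡⟨ ∑-cong F.list (λ y → *-identityˡ (g y)) ⟩
      F.sum g                                                 ∎
      where
      open ≤-Reasoning
      fibre : ∀ y → E.count (λ x → y F.≟ h x) ≤ 1
      fibre y with E.search (λ x → y F.≟ h x)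
      ... | yes (a , refl) = ≤-trans (∑-mono E.list λ x → χ-mono (h a F.≟ h x) (x E.≟ a) (λ e → sym (inj e))) (≤-reflexive (E.once a))
      ... | no none = ≤-trans (≤-reflexive (trans (∑-cong E.list λ x → χ-no (y F.≟ h x) (λ e → none (x , e))) (∑-zero E.list))) z≤n

  module _ {A : Set} (E : Enumeration A) where
    private module E = Enumeration E

    sum-bijective : ∀ (h h⁻¹ : A → A) → (∀ x → h (h⁻¹ x) ≡ x) → (∀ x → h⁻¹ (h x) ≡ x) →
                    ∀ g → E.sum (g ∘ h) ≡ E.sum g
    sum-bijective h k hk kh g = ≤-antisym (sum-injective E E h (inj k kh) g)
      (≤-trans (≤-reflexive (∑-cong E.list (λ x → cong g (sym (hk x))))) (sum-injective E E k (inj h hk) (g ∘ h)))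
      where
      inj : ∀ {f : A → A} (f′ : A → A) → (∀ x → f′ (f x) ≡ x) → ∀ {x y} → f x ≡ f y → x ≡ y
      inj f′ e {x} {y} p = trans (sym (e x)) (trans (cong f′ p) (e y))

    abstract
      vectors : (n : ℕ) → List (Vec A n)
      vectors zero    = [] ∷ []
      vectors (suc n) = concatMap (λ x → L.map (x ∷_) (vectors n)) E.list

      ∑-vectors-zero : ∀ g → ∑ (vectors zero) g ≡ g []
      ∑-vectors-zero g = +-identityʳ (g [])

      ∑-vectors : ∀ n g → ∑ (vectors (suc n)) g ≡ E.sum (λ x → ∑ (vectors n) (λ v → g (x ∷ v)))
      ∑-vectors n g = trans (∑-concatMap (λ x → L.map (x ∷_) (vectors n)) E.list g)
        (∑-cong E.list (λ x → ∑-map (x ∷_) (vectors n) g))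

      vectors-once : ∀ n (v : Vec A n) → ∑ (vectors n) (λ u → χ (≡-dec E._≟_ u v)) ≡ 1
      vectors-once zero    []      = refl
      vectors-once (suc n) (a ∷ v) = trans (∑-vectors n _) (trans (∑-cong E.list pointwise) (E.sum-δ a (λ _ → 1)))
        where
        pointwise : ∀ x → ∑ (vectors n) (λ u → χ (≡-dec E._≟_ (x ∷ u) (a ∷ v))) ≡ χ (x E.≟ a) * 1
        pointwise x = by (x E.≟ a)
          where
          by : Dec (x ≡ a) → ∑ (vectors n) (λ u → χ (≡-dec E._≟_ (x ∷ u) (a ∷ v))) ≡ χ (x E.≟ a) * 1
          by (yes refl) = trans (∑-cong (vectors n) (λ u → χ-cong (≡-dec E._≟_ (a ∷ u) (a ∷ v)) (≡-dec E._≟_ u v) (λ { refl → refl }) (cong (a ∷_))))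
            (trans (vectors-once n v) (sym (cong (_* 1) (χ-yes (a E.≟ a) refl))))
          by (no ≢) = trans (∑-cong (vectors n) (λ u → χ-no (≡-dec E._≟_ (x ∷ u) (a ∷ v)) (λ { refl → ≢ refl })))
            (trans (∑-zero (vectors n)) (sym (cong (_* 1) (χ-no (x E.≟ a) ≢))))

    enumerateVectors : (n : ℕ) → Enumeration (Vec A n)
    enumerateVectors n = record { _≟_ = ≡-dec E._≟_ ; list = vectors n ; once = vectors-once n }

    size-vectors : ∀ n → size (enumerateVectors n) ≡ E.size ^ n
    size-vectors zero    = ∑-vectors-zero (λ _ → 1)
    size-vectors (suc n) = trans (∑-vectors n (λ _ → 1)) (trans (E.sum-const (size (enumerateVectors n)))
      (cong (E.size *_) (size-vectors n)))

open FiniteSums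

module Fold {A : Set} (_≟_ : (x y : A) → Dec (x ≡ y)) {_∙_ : A → A → A} {ε : A}
            (isCM : IsCommutativeMonoid _≡_ _∙_ ε) where
  open IsCommutativeMonoid isCM using (assoc; comm)

  fold : List A → A
  fold []       = ε
  fold (x ∷ xs) = x ∙ fold xs

  occurrences : List A → A → ℕ
  occurrences xs a = ∑ xs (λ x → χ (x ≟ a))

  remove : ∀ a ys → 1 ≤ occurrences ys a →
           Σ (List A) λ zs → (fold ys ≡ a ∙ fold zs) × (∀ b → occurrences ys b ≡ χ (a ≟ b) ℕ.+ occurrences zs b)
  remove a (y ∷ ys) h with y ≟ a
  ... | yes refl = ys , refl , λ b → refl
  ... | no _ with remove a ys h
  ...   | zs , e , o = y ∷ zs ,
          trans (cong (y ∙_) e) (trans (sym (assoc y a _)) (trans (cong (_∙ fold zs) (comm y a)) (assoc a y _))) ,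
          λ b → trans (cong (χ (y ≟ b) ℕ.+_) (o b)) (trans (sym (ℕₚ.+-assoc (χ (y ≟ b)) (χ (a ≟ b)) _))
                  (trans (cong (ℕ._+ occurrences zs b) (ℕₚ.+-comm (χ (y ≟ b)) (χ (a ≟ b)))) (ℕₚ.+-assoc (χ (a ≟ b)) (χ (y ≟ b)) _)))

  -- By commutativity a fold depends only on multiplicities: the head of the first list is located
  -- in the second, moved to its front and cancelled from both counts.
  fold-occurrences : ∀ xs ys → (∀ a → occurrences xs a ≡ occurrences ys a) → fold xs ≡ fold ys
  fold-occurrences [] []       h = refl
  fold-occurrences [] (y ∷ ys) h with trans (h y) (cong (ℕ._+ occurrences ys y) (χ-yes (y ≟ y) refl))
  ... | ()
  fold-occurrences (x ∷ xs) ys h with remove x ys (subst (1 ≤_) (trans (cong (ℕ._+ occurrences xs x) (sym (χ-yes (x ≟ x) refl))) (h x)) (s≤s z≤n))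
  ... | zs , e , o = trans (cong (x ∙_) (fold-occurrences xs zs λ a → ℕₚ.+-cancelˡ-≡ (χ (x ≟ a)) _ _ (trans (h a) (o a)))) (sym e)

  -- Reindexes a sum or product over the whole field by a permutation. The equality with `_≟_` makes
  -- both counts of occurrences use the same decision procedure.
  fold-bijective : (E : Enumeration A) → Enumeration._≟_ E ≡ _≟_ → ∀ (h k : A → A) → (∀ x → h (k x) ≡ x) → (∀ x → k (h x) ≡ x) →
                   ∀ (g : A → A) → fold (L.map (g ∘ h) (Enumeration.list E)) ≡ fold (L.map g (Enumeration.list E))
  fold-bijective E refl h k hk kh g = fold-occurrences (L.map (g ∘ h) (Enumeration.list E)) (L.map g (Enumeration.list E)) λ a →
    trans (∑-map (g ∘ h) list (λ x → χ (x ≟ a))) (trans (sum-bijective E h k hk kh (λ x → χ (g x ≟ a)))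
      (sym (∑-map g list (λ x → χ (x ≟ a)))))
    where open Enumeration E using (list)

-- Characteristic, Fermat's theorem and the Frobenius map.

module FieldTheory (D : DiscreteField) where
  open DiscreteField D public
  open IsCommutativeRing isCommutativeRing public
    using (+-assoc; +-comm; +-identityˡ; +-identityʳ; *-assoc; *-comm; *-identityˡ; *-identityʳ; zeroˡ; zeroʳ;
           +-isCommutativeMonoid; *-isCommutativeMonoid)
  open RingSolver D public using (ι; ι-suc; ι-+; ι-*; solve; _:=_; _:+_; _:*_; _:-_; :-_; :0; :1)
  open VectorSolver D public using (vsolve; _:≋_; _:⊕_; _:⊙_; :𝟎)
  open Geometry (toFiniteField D) public using (pow)

  private
    occurs-once : ∀ xs → AllPairs _≢_ xs → ∀ a → Any (a ≡_) xs → ∑ xs (λ x → χ (x ≟ a)) ≡ 1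
    occurs-once (x ∷ xs) (ap ∷ d) a (here refl) = cong₂ ℕ._+_ (χ-yes (x ≟ x) refl) (none xs ap)
      where
      none : ∀ ys → All (x ≢_) ys → ∑ ys (λ y → χ (y ≟ x)) ≡ 0
      none []       []       = refl
      none (y ∷ ys) (p ∷ ps) = cong₂ ℕ._+_ (χ-no (y ≟ x) (λ e → p (sym e))) (none ys ps)
    occurs-once (x ∷ xs) (ap ∷ d) a (there i) = cong₂ ℕ._+_ (χ-no (x ≟ a) (λ e → differs ap i e)) (occurs-once xs d a i)
      where
      differs : ∀ {ys} → All (x ≢_) ys → Any (a ≡_) ys → x ≢ a
      differs (p ∷ ps) (here refl) e = p e
      differs (p ∷ ps) (there j)   e = differs ps j e

  𝔽 : Enumeration Carrier
  𝔽 = record { _≟_ = _≟_ ; list = elements ; once = λ a → occurs-once elements distinct a (complete a) }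

  Q : ℕ
  Q = Enumeration.size 𝔽

  _⁻¹ : ∀ {x} → x ≢ 0# → Carrier
  nz ⁻¹ = proj₁ (inverse _ nz)

  ⁻¹-inverse : ∀ {x} (nz : x ≢ 0#) → x * (nz ⁻¹) ≡ 1#
  ⁻¹-inverse nz = proj₂ (inverse _ nz)

  *-cancelˡ : ∀ {x y z} → x ≢ 0# → x * y ≡ x * z → y ≡ z
  *-cancelˡ {x} {y} {z} nz e = begin
    y                    ≡⟨ lem y ⟨
    (nz ⁻¹) * (x * y)    ≡⟨ cong ((nz ⁻¹) *_) e ⟩
    (nz ⁻¹) * (x * z)    ≡⟨ lem z ⟩
    z                    ∎
    where
    open ≡-Reasoning
    lem : ∀ w → (nz ⁻¹) * (x * w) ≡ w
    lem w = trans (eq w) (trans (cong (_* w) (⁻¹-inverse nz)) (*-identityˡ w))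
      where
      eq : ∀ w → (nz ⁻¹) * (x * w) ≡ (x * (nz ⁻¹)) * w
      eq w = solve 3 (λ n x w → n :* (x :* w) := x :* n :* w) refl (nz ⁻¹) x w

  *-integral : ∀ {x y} → x ≢ 0# → x * y ≡ 0# → y ≡ 0#
  *-integral {x} nz e = *-cancelˡ nz (trans e (sym (zeroʳ x)))

  *-nonzero : ∀ {x y} → x ≢ 0# → y ≢ 0# → x * y ≢ 0#
  *-nonzero nx ny e = ny (*-integral nx e)

  1≢0 : 1# ≢ 0#
  1≢0 e = 0≢1 (sym e)

  ⁻¹-nonzero : ∀ {x} (nz : x ≢ 0#) → (nz ⁻¹) ≢ 0#
  ⁻¹-nonzero {x} nz e = 1≢0 (trans (sym (⁻¹-inverse nz)) (trans (cong (x *_) e) (zeroʳ x)))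

  difference-zero : ∀ {x y} → x - y ≡ 0# → x ≡ y
  difference-zero {x} {y} e = trans lem (trans (cong (_+ y) e) (+-identityˡ y))
    where
    lem : x ≡ (x - y) + y
    lem = solve 2 (λ x y → x := x :- y :+ y) refl x y

  difference-nonzero : ∀ {x y} → x ≢ y → x - y ≢ 0#
  difference-nonzero ne e = ne (difference-zero e)

  pow-1# : ∀ n → pow 1# n ≡ 1#
  pow-1# zero    = refl
  pow-1# (suc n) = trans (*-identityˡ _) (pow-1# n)

  pow-0# : ∀ n → 0 < n → pow 0# n ≡ 0#
  pow-0# (suc n) _ = zeroˡ _

  pow-1 : ∀ x → pow x 1 ≡ x
  pow-1 = *-identityʳ

  pow-+ : ∀ x m n → pow x (m ℕ.+ n) ≡ pow x m * pow x n
  pow-+ x zero    n = sym (*-identityˡ _)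
  pow-+ x (suc m) n = trans (cong (x *_) (pow-+ x m n)) (sym (*-assoc x _ _))

  pow-product : ∀ x y n → pow (x * y) n ≡ pow x n * pow y n
  pow-product x y zero    = sym (*-identityˡ _)
  pow-product x y (suc n) = trans (cong (x * y *_) (pow-product x y n)) (lem (pow x n) (pow y n))
    where
    lem : ∀ a b → x * y * (a * b) ≡ x * a * (y * b)
    lem a b = solve 4 (λ x y a b → x :* y :* (a :* b) := x :* a :* (y :* b)) refl x y a b

  pow-* : ∀ x m n → pow x (m ℕ.* n) ≡ pow (pow x m) n
  pow-* x m zero    = cong (pow x) (ℕₚ.*-zeroʳ m)
  pow-* x m (suc n) = trans (cong (pow x) (ℕₚ.*-suc m n)) (trans (pow-+ x m (m ℕ.* n)) (cong (pow x m *_) (pow-* x m n)))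

  pow-nonzero : ∀ {x} n → x ≢ 0# → pow x n ≢ 0#
  pow-nonzero zero    nz = 1≢0
  pow-nonzero (suc n) nz = *-nonzero nz (pow-nonzero n nz)

  ι-^ : ∀ m n → ι (m ℕ.^ n) ≡ pow (ι m) n
  ι-^ m zero    = refl
  ι-^ m (suc n) = trans (ι-* m (m ℕ.^ n)) (cong (ι m *_) (ι-^ m n))

  -- Translation by 1 permutes the field, so the sum of all elements equals itself plus Q times 1.
  ι-Q : ι Q ≡ 0#
  ι-Q = add-cancel (trans (sym (shifted elements)) (fold-bijective 𝔽 refl (_+ 1#) (_- 1#) (λ x → sum₁ x) (λ x → sum₂ x) (λ x → x)))
    where
    open Fold _≟_ +-isCommutativeMonoid
    sum₁ : ∀ x → (x - 1#) + 1# ≡ x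
    sum₁ x = solve 1 (λ x → x :- :1 :+ :1 := x) refl x
    sum₂ : ∀ x → (x + 1#) - 1# ≡ x
    sum₂ x = solve 1 (λ x → x :+ :1 :- :1 := x) refl x
    shifted : ∀ xs → fold (L.map (_+ 1#) xs) ≡ fold (L.map (λ x → x) xs) + ι (∑ xs (λ _ → 1))
    shifted []       = sym (+-identityʳ _)
    shifted (x ∷ xs) = trans (cong (x + 1# +_) (shifted xs)) (trans lem (cong (x + fold (L.map (λ x → x) xs) +_) (sym (ι-suc (∑ xs (λ _ → 1))))))
      where
      lem : x + 1# + (fold (L.map (λ x → x) xs) + ι (∑ xs (λ _ → 1))) ≡ x + fold (L.map (λ x → x) xs) + (1# + ι (∑ xs (λ _ → 1)))
      lem = solve 3 (λ x a b → x :+ :1 :+ (a :+ b) := x :+ a :+ (:1 :+ b)) refl x (fold (L.map (λ x → x) xs)) (ι (∑ xs (λ _ → 1)))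
    add-cancel : ∀ {x y} → x + y ≡ x → y ≡ 0#
    add-cancel {x} {y} e = trans lem (trans (cong (_- x) e) lem′)
      where
      lem : y ≡ (x + y) - x
      lem = solve 2 (λ y x → y := x :+ y :- x) refl y x
      lem′ : x - x ≡ 0#
      lem′ = solve 1 (λ x → x :- x := :0) refl x

  -- Multiplication by x ≠ 0 permutes the nonzero elements; comparing their product before and after
  -- gives x^(Q-1) = 1.
  fermat : ∀ x → pow x Q ≡ x
  fermat x with x ≟ 0#
  ... | yes refl = pow-0# Q (subst (1 ≤_) refl (Enumeration.member 𝔽 {λ _ → 1} 0#))
  ... | no nz = trans (cong (pow x) size-split) (trans (cong (x *_) unit) (*-identityʳ x))
    where
    open Fold _≟_ *-isCommutativeMonoid
    -- Replacing 0 by 1 lets the product of the nonzero elements run over the whole list; only the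
    -- nonzero entries contribute a factor x.
    g : Carrier → Carrier
    g y with y ≟ 0#
    ... | yes _ = 1#
    ... | no _  = y
    g-nonzero : ∀ y → g y ≢ 0#
    g-nonzero y with y ≟ 0#
    ... | yes _ = 1≢0
    ... | no n  = n
    nonzero : List Carrier → ℕ
    nonzero xs = ∑ xs (λ y → χ (¬? (y ≟ 0#)))
    g-scale : ∀ y → g (x * y) ≡ pow x (χ (¬? (y ≟ 0#))) * g y
    g-scale y with y ≟ 0# | x * y ≟ 0#
    ... | yes _    | yes _ = sym (*-identityˡ 1#)
    ... | yes refl | no n  = ⊥-elim (n (zeroʳ x))
    ... | no n     | yes e = ⊥-elim (*-nonzero nz n e)
    ... | no _     | no _  = cong (_* y) (sym (*-identityʳ x))
    scaled : ∀ ys → fold (L.map (g ∘ (x *_)) ys) ≡ pow x (nonzero ys) * fold (L.map g ys)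
    scaled []       = sym (*-identityˡ 1#)
    scaled (y ∷ ys) = trans (cong₂ _*_ (g-scale y) (scaled ys)) (trans lem (cong (_* (g y * fold (L.map g ys))) (sym (pow-+ x (χ (¬? (y ≟ 0#))) (nonzero ys)))))
      where
      lem : pow x (χ (¬? (y ≟ 0#))) * g y * (pow x (nonzero ys) * fold (L.map g ys))
          ≡ pow x (χ (¬? (y ≟ 0#))) * pow x (nonzero ys) * (g y * fold (L.map g ys))
      lem = solve 4 (λ p g a b → p :* g :* (a :* b) := p :* a :* (g :* b)) refl (pow x (χ (¬? (y ≟ 0#)))) (g y) (pow x (nonzero ys)) (fold (L.map g ys))
    total-nonzero : ∀ ys → fold (L.map g ys) ≢ 0#
    total-nonzero []       = 1≢0
    total-nonzero (y ∷ ys) = *-nonzero (g-nonzero y) (total-nonzero ys)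
    unit : pow x (nonzero elements) ≡ 1#
    unit = *-cancelˡ (total-nonzero elements) (trans (*-comm _ _) (trans (sym (scaled elements))
      (trans (fold-bijective 𝔽 refl (x *_) ((nz ⁻¹) *_) inv₁ inv₂ g) (sym (*-identityʳ _)))))
      where
      inv₁ : ∀ y → x * ((nz ⁻¹) * y) ≡ y
      inv₁ y = trans (sym (*-assoc x _ y)) (trans (cong (_* y) (⁻¹-inverse nz)) (*-identityˡ y))
      inv₂ : ∀ y → (nz ⁻¹) * (x * y) ≡ y
      inv₂ y = trans lem (inv₁ y)
        where
        lem : (nz ⁻¹) * (x * y) ≡ x * ((nz ⁻¹) * y)
        lem = solve 3 (λ n x y → n :* (x :* y) := x :* (n :* y)) refl (nz ⁻¹) x y
    size-split : Q ≡ suc (nonzero elements)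
    size-split = trans (∑-cong elements both) (trans (∑-+ elements (λ y → χ (y ≟ 0#)) (λ y → χ (¬? (y ≟ 0#)))) (cong (ℕ._+ nonzero elements) (Enumeration.once 𝔽 0#)))
      where
      both : ∀ y → 1 ≡ χ (y ≟ 0#) ℕ.+ χ (¬? (y ≟ 0#))
      both y with y ≟ 0#
      ... | yes _ = refl
      ... | no _  = refl

  -- n is the number of coefficients: evalN n c t = Σ_{j<n} c j · t^j.
  evalN : ℕ → (ℕ → Carrier) → Carrier → Carrier
  evalN zero    c t = 0#
  evalN (suc n) c t = c 0 + t * evalN n (c ∘ suc) t

  evalN-cong : ∀ n {c d} t → (∀ j → j < n → c j ≡ d j) → evalN n c t ≡ evalN n d t
  evalN-cong zero    t h = refl
  evalN-cong (suc n) t h = cong₂ (λ a b → a + t * b) (h 0 (s≤s z≤n)) (evalN-cong n t (λ j j<n → h (suc j) (s≤s j<n)))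

  evalN-+ : ∀ n c d t → evalN n (λ j → c j + d j) t ≡ evalN n c t + evalN n d t
  evalN-+ zero    c d t = sym (+-identityˡ 0#)
  evalN-+ (suc n) c d t = trans (cong (λ z → c 0 + d 0 + t * z) (evalN-+ n (c ∘ suc) (d ∘ suc) t)) (lem (evalN n (c ∘ suc) t) (evalN n (d ∘ suc) t))
    where
    lem : ∀ a b → c 0 + d 0 + t * (a + b) ≡ (c 0 + t * a) + (d 0 + t * b)
    lem a b = solve 5 (λ c d t a b → c :+ d :+ t :* (a :+ b) := c :+ t :* a :+ (d :+ t :* b)) refl (c 0) (d 0) t a b

  evalN-scale : ∀ n a c t → evalN n (λ j → a * c j) t ≡ a * evalN n c t
  evalN-scale zero    a c t = sym (zeroʳ a)
  evalN-scale (suc n) a c t = trans (cong (λ z → a * c 0 + t * z) (evalN-scale n a (c ∘ suc) t)) (lem (evalN n (c ∘ suc) t))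
    where
    lem : ∀ b → a * c 0 + t * (a * b) ≡ a * (c 0 + t * b)
    lem b = solve 4 (λ a c t b → a :* c :+ t :* (a :* b) := a :* (c :+ t :* b)) refl a (c 0) t b

  evalN-zero : ∀ n c t → (∀ j → j < n → c j ≡ 0#) → evalN n c t ≡ 0#
  evalN-zero zero    c t h = refl
  evalN-zero (suc n) c t h = trans (cong₂ (λ a b → a + t * b) (h 0 (s≤s z≤n)) (evalN-zero n (c ∘ suc) t (λ j l → h (suc j) (s≤s l))))
    (trans (+-identityˡ _) (zeroʳ t))

  evalN-snoc : ∀ n c t → evalN (suc n) c t ≡ evalN n c t + c n * pow t n
  evalN-snoc zero    c t = lem (c 0)
    where
    lem : ∀ a → a + t * 0# ≡ 0# + a * 1#
    lem a = solve 2 (λ a t → a :+ t :* :0 := :0 :+ a :* :1) refl a t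
  evalN-snoc (suc n) c t = trans (cong (λ z → c 0 + t * z) (evalN-snoc n (c ∘ suc) t)) (lem (evalN n (c ∘ suc) t) (pow t n))
    where
    lem : ∀ a b → c 0 + t * (a + c (suc n) * b) ≡ c 0 + t * a + c (suc n) * (t * b)
    lem a b = solve 5 (λ c t a d b → c :+ t :* (a :+ d :* b) := c :+ t :* a :+ d :* (t :* b)) refl (c 0) t a (c (suc n)) b

  -- Serves to show that a prime p divides its inner binomial coefficients: with n + 1 = p the right
  -- side is visibly a multiple of p.
  absorption : ∀ n k → suc k ℕ.* (suc n C suc k) ≡ suc n ℕ.* (n C k)
  absorption zero zero = refl
  absorption zero (suc k) = trans (cong (suc (suc k) ℕ.*_) (k>n⇒nCk≡0 {1} {suc (suc k)} (s≤s (s≤s z≤n)))) (trans (ℕₚ.*-zeroʳ (suc (suc k)))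
    (sym (trans (ℕₚ.*-identityˡ _) (k>n⇒nCk≡0 {0} {suc k} (s≤s z≤n)))))
  absorption (suc n) zero = trans (ℕₚ.*-identityˡ _) (trans (sym (nCk+nC[k+1]≡[n+1]C[k+1] (suc n) 0)) (trans (cong suc (trans (sym (ℕₚ.*-identityˡ _)) (absorption n 0)))
    (cong suc refl)))
  absorption (suc n) (suc k) = begin
    suc (suc k) ℕ.* (suc (suc n) C suc (suc k))
      ≡⟨ cong (suc (suc k) ℕ.*_) (sym (nCk+nC[k+1]≡[n+1]C[k+1] (suc n) (suc k))) ⟩
    suc (suc k) ℕ.* (a ℕ.+ b)
      ≡⟨ ℕₚ.*-distribˡ-+ (suc (suc k)) a b ⟩
    (a ℕ.+ suc k ℕ.* a) ℕ.+ suc (suc k) ℕ.* b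
      ≡⟨ cong₂ (λ x y → (a ℕ.+ x) ℕ.+ y) (absorption n k) (absorption n (suc k)) ⟩
    (a ℕ.+ suc n ℕ.* (n C k)) ℕ.+ suc n ℕ.* (n C suc k)
      ≡⟨ ℕₚ.+-assoc a _ _ ⟩
    a ℕ.+ (suc n ℕ.* (n C k) ℕ.+ suc n ℕ.* (n C suc k))
      ≡⟨ cong (a ℕ.+_) (sym (ℕₚ.*-distribˡ-+ (suc n) (n C k) (n C suc k))) ⟩
    a ℕ.+ suc n ℕ.* ((n C k) ℕ.+ (n C suc k))
      ≡⟨ cong (λ z → a ℕ.+ suc n ℕ.* z) (nCk+nC[k+1]≡[n+1]C[k+1] n k) ⟩
    suc (suc n) ℕ.* (suc n C suc k) ∎
    where
    open ≡-Reasoning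
    a = suc n C suc k
    b = suc n C suc (suc k)

  binomial : ∀ n t → pow (1# + t) n ≡ evalN (suc n) (λ k → ι (n C k)) t
  binomial zero t = lem
    where
    lem : 1# ≡ 1# + t * 0#
    lem = solve 1 (λ t → :1 := :1 :+ t :* :0) refl t
  binomial (suc n) t = begin
    (1# + t) * pow (1# + t) n                                     ≡⟨ cong ((1# + t) *_) (binomial n t) ⟩
    (1# + t) * (1# + t * r)                                       ≡⟨ lem r ⟩
    1# + t * ((1# + t * r) + (r + 0# * pow t n))                  ≡⟨ cong (λ z → 1# + t * ((1# + t * r) + (r + z * pow t n))) (sym (cong ι (k>n⇒nCk≡0 {n} {suc n} (s≤s ℕₚ.≤-refl)))) ⟩
    1# + t * ((1# + t * r) + (r + ι (n C suc n) * pow t n))       ≡⟨ cong (λ z → 1# + t * ((1# + t * r) + z)) (sym (evalN-snoc n (λ k → ι (n C suc k)) t)) ⟩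
    1# + t * (evalN (suc n) (λ k → ι (n C k)) t + evalN (suc n) (λ k → ι (n C suc k)) t)
      ≡⟨ cong (λ z → 1# + t * z) (sym (evalN-+ (suc n) (λ k → ι (n C k)) (λ k → ι (n C suc k)) t)) ⟩
    1# + t * evalN (suc n) (λ k → ι (n C k) + ι (n C suc k)) t
      ≡⟨ cong (λ z → 1# + t * z) (evalN-cong (suc n) t (λ k _ → trans (sym (ι-+ (n C k) (n C suc k))) (cong ι (nCk+nC[k+1]≡[n+1]C[k+1] n k)))) ⟩
    1# + t * evalN (suc n) (λ k → ι (suc n C suc k)) t            ∎
    where
    open ≡-Reasoning
    r = evalN n (λ k → ι (n C suc k)) t
    lem : ∀ r → (1# + t) * (1# + t * r) ≡ 1# + t * ((1# + t * r) + (r + 0# * pow t n))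
    lem r = solve 3 (λ t r p → (:1 :+ t) :* (:1 :+ t :* r) := :1 :+ t :* (:1 :+ t :* r :+ (r :+ :0 :* p))) refl t r (pow t n)

  module Frobenius {p : ℕ} (pr : Prime p) (char : ι p ≡ 0#) where
    private
      multiple : ∀ {m} → p ∣ m → ι m ≡ 0#
      multiple (divides k refl) = trans (ι-* k p) (trans (cong (ι k *_) char) (zeroʳ (ι k)))

    -- By `absorption` p divides (j + 1) times the binomial coefficient, and it cannot divide j + 1
    -- < p.
    middle : ∀ p′ → p ≡ suc p′ → ∀ j → j < p′ → ι (p C suc j) ≡ 0#
    middle p′ refl j j<p′ with euclidsLemma (suc j) (p C suc j) pr (divides (p′ C j) (trans (absorption p′ j) (ℕₚ.*-comm p (p′ C j))))
    ... | inj₁ p∣j = ⊥-elim (ℕₚ.<⇒≱ (s≤s j<p′) (∣⇒≤ p∣j))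
    ... | inj₂ p∣c = multiple p∣c

    private
      prime-suc : ∀ {p} → Prime p → Σ ℕ λ p′ → p ≡ suc p′
      prime-suc {zero} pr with prime⇒nonZero pr
      ... | record { nonZero = () }
      prime-suc {suc p} pr = p , refl

    one-plus : ∀ t → pow (1# + t) p ≡ 1# + pow t p
    one-plus t with prime-suc pr
    ... | p′ , refl = begin
      pow (1# + t) p                                            ≡⟨ binomial p t ⟩
      1# + t * evalN p (λ k → ι (p C suc k)) t                  ≡⟨ cong (λ z → 1# + t * z) (evalN-snoc p′ (λ k → ι (p C suc k)) t) ⟩
      1# + t * (evalN p′ (λ k → ι (p C suc k)) t + ι (p C p) * pow t p′)
        ≡⟨ cong₂ (λ a b → 1# + t * (a + ι b * pow t p′)) (evalN-zero p′ (λ k → ι (p C suc k)) t (middle p′ refl)) (nCn≡1 p) ⟩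
      1# + t * (0# + 1# * pow t p′)                             ≡⟨ lem (pow t p′) ⟩
      1# + pow t p                                              ∎
      where
      open ≡-Reasoning
      lem : ∀ a → 1# + t * (0# + 1# * a) ≡ 1# + t * a
      lem a = solve 2 (λ t a → :1 :+ t :* (:0 :+ :1 :* a) := :1 :+ t :* a) refl t a

    -- Dividing by a nonzero x reduces this to `one-plus`, so that the binomial theorem is needed
    -- only for (1 + t)^p.
    pow-p-+ : ∀ x y → pow (x + y) p ≡ pow x p + pow y p
    pow-p-+ x y with x ≟ 0# | prime-suc pr
    ... | yes refl | p′ , refl = trans (cong (λ z → pow z p) (+-identityˡ y)) (sym (trans (cong (_+ pow y p) (pow-0# p (s≤s z≤n))) (+-identityˡ _)))
    ... | no nz | _ = begin
      pow (x + y) p                           ≡⟨ cong (λ z → pow z p) split ⟩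
      pow (x * (1# + (nz ⁻¹) * y)) p          ≡⟨ pow-product x _ p ⟩
      pow x p * pow (1# + (nz ⁻¹) * y) p      ≡⟨ cong (pow x p *_) (one-plus ((nz ⁻¹) * y)) ⟩
      pow x p * (1# + pow ((nz ⁻¹) * y) p)    ≡⟨ lem (pow x p) (pow ((nz ⁻¹) * y) p) ⟩
      pow x p + pow x p * pow ((nz ⁻¹) * y) p ≡⟨ cong (pow x p +_) (sym (pow-product x _ p)) ⟩
      pow x p + pow (x * ((nz ⁻¹) * y)) p     ≡⟨ cong (λ z → pow x p + pow z p) cancel ⟩
      pow x p + pow y p                       ∎
      where
      open ≡-Reasoning
      lem : ∀ a b → a * (1# + b) ≡ a + a * b
      lem a b = solve 2 (λ a b → a :* (:1 :+ b) := a :+ a :* b) refl a b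
      cancel : x * ((nz ⁻¹) * y) ≡ y
      cancel = trans (sym (*-assoc x _ y)) (trans (cong (_* y) (⁻¹-inverse nz)) (*-identityˡ y))
      split : x + y ≡ x * (1# + (nz ⁻¹) * y)
      split = sym (trans (lem x ((nz ⁻¹) * y)) (cong (x +_) cancel))

    pow-p^-+ : ∀ k x y → pow (x + y) (p ℕ.^ k) ≡ pow x (p ℕ.^ k) + pow y (p ℕ.^ k)
    pow-p^-+ zero    x y = lem
      where
      lem : (x + y) * 1# ≡ x * 1# + y * 1#
      lem = solve 2 (λ x y → (x :+ y) :* :1 := x :* :1 :+ y :* :1) refl x y
    pow-p^-+ (suc k) x y = trans (pow-* (x + y) p (p ℕ.^ k)) (trans (cong (λ z → pow z (p ℕ.^ k)) (pow-p-+ x y))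
      (trans (pow-p^-+ k (pow x p) (pow y p)) (sym (cong₂ _+_ (pow-* x p (p ℕ.^ k)) (pow-* y p (p ℕ.^ k))))))

  -- The order of the field is a power of p and vanishes in the field, so p vanishes there too; the
  -- Frobenius map with exponent p is then iterated.
  pow-q-+ : ∀ q → IsPrimePower q → Q ≡ q ℕ.^ 2 → ∀ x y → pow (x + y) q ≡ pow x q + pow y q
  pow-q-+ q (p , k , pr , refl) Q≡q² = Frobenius.pow-p^-+ pr char (suc k)
    where
    char : ι p ≡ 0#
    char with ι p ≟ 0#
    ... | yes e = e
    ... | no nz = ⊥-elim (pow-nonzero (suc k ℕ.* 2) nz (trans (sym (ι-^ p (suc k ℕ.* 2)))
                    (trans (cong ι (trans (sym (ℕₚ.^-*-assoc p (suc k) 2)) (sym Q≡q²))) ι-Q)))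

-- Roots of polynomials in one variable; total degree in several variables.

module Polynomials (D : DiscreteField) where
  open FieldTheory D
  open Enumeration 𝔽 using (once; search) renaming (count to countK)

  roots : ℕ → (ℕ → Carrier) → ℕ
  roots n c = countK (λ s → evalN n c s ≟ 0#)

  roots≤Q : ∀ {P : Carrier → Set} (P? : ∀ s → Dec (P s)) → countK P? ≤ Q
  roots≤Q P? = ∑-mono elements (λ s → χ≤1 (P? s))

  count-all : ∀ {P : Carrier → Set} (P? : ∀ s → Dec (P s)) → (∀ s → P s) → countK P? ≡ Q
  count-all P? h = ∑-cong elements (λ s → χ-yes (P? s) (h s))

  count-nonzero : Q ≡ suc (countK (λ s → ¬? (s ≟ 0#)))
  count-nonzero = trans (∑-cong elements both) (trans (∑-+ elements (λ y → χ (y ≟ 0#)) (λ y → χ (¬? (y ≟ 0#))))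
      (cong (ℕ._+ countK (λ s → ¬? (s ≟ 0#))) (once 0#)))
    where
    both : ∀ y → 1 ≡ χ (y ≟ 0#) ℕ.+ χ (¬? (y ≟ 0#))
    both y with y ≟ 0#
    ... | yes _ = refl
    ... | no _  = refl

  cons : Carrier → (ℕ → Carrier) → ℕ → Carrier
  cons a c zero    = a
  cons a c (suc j) = c j

  -- Synthetic division by s - r: the lowest coefficient of the quotient is the value at r of the
  -- tail of c.
  divide : ∀ n c r → Σ (ℕ → Carrier) λ c′ → ∀ s → evalN (suc n) c s ≡ evalN (suc n) c r + (s - r) * evalN n c′ s
  divide zero c r = c , λ s → lem (c 0) s
    where
    lem : ∀ a s → a + s * 0# ≡ (a + r * 0#) + (s - r) * 0#
    lem a s = solve 3 (λ a s r → a :+ s :* :0 := a :+ r :* :0 :+ (s :- r) :* :0) refl a s r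
  divide (suc n) c r = let (c′ , h) = divide n (c ∘ suc) r in
    cons (evalN (suc n) (c ∘ suc) r) c′ , λ s → trans (cong (λ z → c 0 + s * z) (h s)) (lem (c 0) (evalN (suc n) (c ∘ suc) r) s (evalN n c′ s))
    where
    lem : ∀ a e s g → a + s * (e + (s - r) * g) ≡ (a + r * e) + (s - r) * (e + s * g)
    lem a e s g = solve 5 (λ a s e r g → a :+ s :* (e :+ (s :- r) :* g) := a :+ r :* e :+ (s :- r) :* (e :+ s :* g)) refl a s e r g

  -- Nonvanishing is witnessed by a point and not by a coefficient, since a point with nonzero value
  -- passes directly to the quotient by a linear factor.
  root-bound : ∀ n c s₀ → evalN (suc n) c s₀ ≢ 0# → roots (suc n) c ≤ n
  root-bound zero c s₀ ne = ℕₚ.≤-reflexive (trans (∑-cong elements (λ s → χ-no (evalN 1 c s ≟ 0#) (λ e → ne (trans (lem s₀ s) e)))) (∑-zero elements))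
    where
    lem : ∀ s s′ → c 0 + s * 0# ≡ c 0 + s′ * 0#
    lem s s′ = solve 3 (λ c s s′ → c :+ s :* :0 := c :+ s′ :* :0) refl (c 0) s s′
  root-bound (suc n) c s₀ ne with search (λ s → evalN (suc (suc n)) c s ≟ 0#)
  ... | no none = ℕₚ.≤-trans (ℕₚ.≤-reflexive (trans (∑-cong elements (λ s → χ-no (evalN (suc (suc n)) c s ≟ 0#) (λ e → none (s , e)))) (∑-zero elements))) z≤n
  ... | yes (r , e) = let (c′ , h) = divide (suc n) c r in bound c′ h
    where
    bound : ∀ c′ → (∀ s → evalN (suc (suc n)) c s ≡ evalN (suc (suc n)) c r + (s - r) * evalN (suc n) c′ s) → roots (suc (suc n)) c ≤ suc n
    bound c′ h = ℕₚ.≤-trans (∑-mono elements pointwise) (ℕₚ.≤-trans (ℕₚ.≤-reflexive (∑-+ elements (λ s → χ (s ≟ r)) (λ s → χ (evalN (suc n) c′ s ≟ 0#))))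
      (ℕₚ.+-mono-≤ (ℕₚ.≤-reflexive (once r)) (root-bound n c′ s₀ ne′)))
      where
      h′ : ∀ s → evalN (suc (suc n)) c s ≡ (s - r) * evalN (suc n) c′ s
      h′ s = trans (h s) (trans (cong (_+ (s - r) * evalN (suc n) c′ s) e) (+-identityˡ _))
      ne′ : evalN (suc n) c′ s₀ ≢ 0#
      ne′ z = ne (trans (h′ s₀) (trans (cong ((s₀ - r) *_) z) (zeroʳ _)))
      pointwise : ∀ s → χ (evalN (suc (suc n)) c s ≟ 0#) ≤ χ (s ≟ r) ℕ.+ χ (evalN (suc n) c′ s ≟ 0#)
      pointwise s with s ≟ r
      ... | yes _ = ℕₚ.≤-trans (χ≤1 (evalN (suc (suc n)) c s ≟ 0#)) (ℕₚ.m≤m+n 1 _)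
      ... | no s≢r = χ-mono (evalN (suc (suc n)) c s ≟ 0#) (evalN (suc n) c′ s ≟ 0#)
                       (λ z → *-integral (difference-nonzero s≢r) (trans (sym (h′ s)) z))

  vanish : ∀ n c → n ≤ roots n c → ∀ s → evalN n c s ≡ 0#
  vanish zero    c h s = refl
  vanish (suc n) c h s with evalN (suc n) c s ≟ 0#
  ... | yes e = e
  ... | no ne = ⊥-elim (ℕₚ.<-irrefl refl (ℕₚ.≤-trans h (root-bound n c s ne)))

  -- With n roots the polynomial vanishes on the whole field. The value at 0 removes the constant
  -- term, and the tail then has all Q - 1 nonzero elements as roots, enough for the induction.
  coefficients-zero : ∀ n c → n ≤ roots n c → ∀ j → j < n → c j ≡ 0#
  coefficients-zero (suc n) c h zero    _   = trans (lem (c 0) (evalN n (c ∘ suc) 0#)) (vanish (suc n) c h 0#)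
    where
    lem : ∀ a b → a ≡ a + 0# * b
    lem a b = solve 2 (λ a b → a := a :+ :0 :* b) refl a b
  coefficients-zero (suc n) c h (suc j) j<n = coefficients-zero n (c ∘ suc) enough j (s≤s⁻¹ j<n)
    where
    tail-zero : ∀ s → s ≢ 0# → evalN n (c ∘ suc) s ≡ 0#
    tail-zero s ne = *-integral ne (trans (lem (evalN n (c ∘ suc) s)) (trans (cong₂ _-_ (vanish (suc n) c h s) (coefficients-zero (suc n) c h zero (s≤s z≤n))) lem′))
      where
      lem : ∀ b → s * b ≡ (c 0 + s * b) - c 0
      lem b = solve 3 (λ s b c → s :* b := c :+ s :* b :- c) refl s b (c 0)
      lem′ : 0# - 0# ≡ 0#
      lem′ = solve 0 (:0 :- :0 := :0) refl
    enough : n ≤ roots n (c ∘ suc)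
    enough = s≤s⁻¹ (ℕₚ.≤-trans h (ℕₚ.≤-trans (roots≤Q (λ s → evalN (suc n) c s ≟ 0#)) (ℕₚ.≤-trans (ℕₚ.≤-reflexive count-nonzero)
      (s≤s (∑-mono elements (λ s → χ-mono (¬? (s ≟ 0#)) (evalN n (c ∘ suc) s ≟ 0#) (tail-zero s)))))))

  zero-everywhere : ∀ n c → n ≤ Q → (∀ s → evalN n c s ≡ 0#) → ∀ j → j < n → c j ≡ 0#
  zero-everywhere n c n≤Q h = coefficients-zero n c (ℕₚ.≤-trans n≤Q (ℕₚ.≤-reflexive (sym (count-all (λ s → evalN n c s ≟ 0#) h))))

  zero-off-zero : ∀ n c → n < Q → (∀ s → s ≢ 0# → evalN n c s ≡ 0#) → ∀ j → j < n → c j ≡ 0#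
  zero-off-zero n c n<Q h = coefficients-zero n c (ℕₚ.≤-trans (s≤s⁻¹ (ℕₚ.≤-trans n<Q (ℕₚ.≤-reflexive count-nonzero)))
    (∑-mono elements (λ s → χ-mono (¬? (s ≟ 0#)) (evalN n c s ≟ 0#) (h s))))

  evalN-difference : ∀ n c d s → evalN n (λ j → c j - d j) s ≡ evalN n c s - evalN n d s
  evalN-difference n c d s = trans (evalN-+ n c (λ j → - d j) s) (cong (evalN n c s +_)
    (trans (evalN-cong n s (λ j _ → lem (d j))) (trans (evalN-scale n (- 1#) d s) (sym (lem (evalN n d s))))))
    where
    lem : ∀ a → - a ≡ (- 1#) * a
    lem a = solve 1 (λ a → :- a := (:- :1) :* a) refl a

  private
    self-difference : ∀ {x y} → x ≡ y → x - y ≡ 0#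
    self-difference {x} refl = lem
      where
      lem : x - x ≡ 0#
      lem = solve 1 (λ x → x :- x := :0) refl x

  equal-everywhere : ∀ n c d → n ≤ Q → (∀ s → evalN n c s ≡ evalN n d s) → ∀ j → j < n → c j ≡ d j
  equal-everywhere n c d n≤Q h j j<n = difference-zero (zero-everywhere n _ n≤Q
    (λ s → trans (evalN-difference n c d s) (self-difference (h s))) j j<n)

  equal-off-zero : ∀ n c d → n < Q → (∀ s → s ≢ 0# → evalN n c s ≡ evalN n d s) → ∀ j → j < n → c j ≡ d j
  equal-off-zero n c d n<Q h j j<n = difference-zero (zero-off-zero n _ n<Q
    (λ s ne → trans (evalN-difference n c d s) (self-difference (h s ne))) j j<n)

  reverse-eval : ∀ d c s t → s * t ≡ 1# → pow s d * evalN (suc d) c t ≡ evalN (suc d) (λ j → c (d ∸ j)) s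
  reverse-eval zero c s t st = lem (c 0)
    where
    lem : ∀ a → 1# * (a + t * 0#) ≡ a + s * 0#
    lem a = solve 3 (λ a t s → :1 :* (a :+ t :* :0) := a :+ s :* :0) refl a t s
  reverse-eval (suc d) c s t st = begin
    s * pow s d * (c 0 + t * e)                            ≡⟨ lem₁ (pow s d) (c 0) e ⟩
    (s * t) * (pow s d * e) + c 0 * (s * pow s d)          ≡⟨ cong₂ (λ x y → x * y + c 0 * (s * pow s d)) st (reverse-eval d (c ∘ suc) s t st) ⟩
    1# * evalN (suc d) (λ j → c (suc (d ∸ j))) s + c 0 * pow s (suc d)
      ≡⟨ cong (_+ c 0 * pow s (suc d)) (*-identityˡ _) ⟩
    evalN (suc d) (λ j → c (suc (d ∸ j))) s + c 0 * pow s (suc d)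
      ≡⟨ cong₂ _+_ (evalN-cong (suc d) s (λ j j<d → cong c (sym (ℕₚ.+-∸-assoc 1 (s≤s⁻¹ j<d))))) (cong (λ k → c k * pow s (suc d)) (sym (ℕₚ.n∸n≡0 (suc d)))) ⟩
    evalN (suc d) (λ j → c (suc d ∸ j)) s + c (suc d ∸ suc d) * pow s (suc d)
      ≡⟨ sym (evalN-snoc (suc d) (λ j → c (suc d ∸ j)) s) ⟩
    evalN (suc (suc d)) (λ j → c (suc d ∸ j)) s            ∎
    where
    open ≡-Reasoning
    e = evalN (suc d) (c ∘ suc) t
    lem₁ : ∀ p a e → s * p * (a + t * e) ≡ (s * t) * (p * e) + a * (s * p)
    lem₁ p a e = solve 5 (λ s p a t e → s :* p :* (a :+ t :* e) := s :* t :* (p :* e) :+ a :* (s :* p)) refl s p a t e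

  -- Pol n d φ: the function φ is given by a polynomial of total degree ≤ d in n variables, in Horner form for the first one.
  data Pol : (n d : ℕ) → (Vec Carrier n → Carrier) → Set where
    point    : ∀ {d φ} → Pol zero d φ
    constant : ∀ {n φ} a → Pol n zero a → (∀ t x → φ (t ∷ x) ≡ a x) → Pol (suc n) zero φ
    step     : ∀ {n d φ} a ψ → Pol n (suc d) a → Pol (suc n) d ψ →
               (∀ t x → φ (t ∷ x) ≡ a x + t * ψ (t ∷ x)) → Pol (suc n) (suc d) φ

  private
    absorb-zero : ∀ a t → a ≡ a + t * 0#
    absorb-zero a t = solve 2 (λ a t → a := a :+ t :* :0) refl a t

  Pol-cong : ∀ {n d φ ψ} → (∀ v → φ v ≡ ψ v) → Pol n d ψ → Pol n d φ
  Pol-cong h point            = point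
  Pol-cong h (constant a p e) = constant a p (λ t x → trans (h (t ∷ x)) (e t x))
  Pol-cong h (step a ψ p r e) = step a ψ p r (λ t x → trans (h (t ∷ x)) (e t x))

  Pol-const : ∀ n d k → Pol n d (λ _ → k)
  Pol-const zero    d       k = point
  Pol-const (suc n) zero    k = constant (λ _ → k) (Pol-const n zero k) (λ _ _ → refl)
  Pol-const (suc n) (suc d) k = step (λ _ → k) (λ _ → 0#) (Pol-const n (suc d) k) (Pol-const (suc n) d 0#) (λ t _ → absorb-zero k t)

  Pol-+ : ∀ {n d φ ψ} → Pol n d φ → Pol n d ψ → Pol n d (λ v → φ v + ψ v)
  Pol-+ point point = point
  Pol-+ (constant a p e) (constant b r e′) = constant (λ x → a x + b x) (Pol-+ p r) (λ t x → cong₂ _+_ (e t x) (e′ t x))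
  Pol-+ (step a φ p p′ e) (step b ψ r r′ e′) =
    step (λ x → a x + b x) (λ v → φ v + ψ v) (Pol-+ p r) (Pol-+ p′ r′)
      (λ t x → trans (cong₂ _+_ (e t x) (e′ t x)) (lem (a x) (b x) t (φ (t ∷ x)) (ψ (t ∷ x))))
    where
    lem : ∀ a b t c d → (a + t * c) + (b + t * d) ≡ (a + b) + t * (c + d)
    lem a b t c d = solve 5 (λ a t c b d → a :+ t :* c :+ (b :+ t :* d) := a :+ b :+ t :* (c :+ d)) refl a t c b d

  Pol-suc : ∀ {n d φ} → Pol n d φ → Pol n (suc d) φ
  Pol-suc point = point
  Pol-suc {suc n} (constant a p e) = step a (λ _ → 0#) (Pol-suc p) (Pol-const (suc n) zero 0#) (λ t x → trans (e t x) (absorb-zero (a x) t))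
  Pol-suc (step a ψ p r e) = step a ψ (Pol-suc p) (Pol-suc r) e

  Pol-≤ : ∀ {n d e φ} → d ≤ e → Pol n d φ → Pol n e φ
  Pol-≤ {n} {d} {e} {φ} d≤e p = subst (λ k → Pol n k φ) (ℕₚ.m∸n+n≡m d≤e) (go (e ∸ d))
    where
    go : ∀ k → Pol n (k ℕ.+ d) φ
    go zero    = p
    go (suc k) = Pol-suc (go k)

  Pol-tail : ∀ {n d α} → Pol n d α → Pol (suc n) d (λ v → α (tail v))
  Pol-tail {n} {zero}  {α} p = constant α p (λ _ _ → refl)
  Pol-tail {n} {suc d} {α} p = step α (λ _ → 0#) p (Pol-const (suc n) d 0#) (λ t x → absorb-zero (α x) t)

  Pol-head-* : ∀ {n d θ} → Pol (suc n) d θ → Pol (suc n) (suc d) (λ v → head v * θ v)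
  Pol-head-* {n} {d} {θ} p = step (λ _ → 0#) θ (Pol-const n (suc d) 0#) p (λ t x → lem t (θ (t ∷ x)))
    where
    lem : ∀ t b → t * b ≡ 0# + t * b
    lem t b = solve 2 (λ t b → t :* b := :0 :+ t :* b) refl t b

  mutual
    Pol-tail-* : ∀ {n a b α ψ} → Pol n a α → Pol (suc n) b ψ → Pol (suc n) (a ℕ.+ b) (λ v → α (tail v) * ψ v)
    Pol-tail-* {α = α} p (constant β r e) = Pol-cong (λ { (t ∷ x) → cong (α x *_) (e t x) }) (Pol-tail (Pol-* p r))
    Pol-tail-* {n} {a} {suc b} {α} p (step β ψ r r′ e) =
      Pol-cong (λ { (t ∷ x) → trans (cong (α x *_) (e t x)) (lem (α x) (β x) t (ψ (t ∷ x))) })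
        (Pol-+ (Pol-tail (Pol-* p r))
          (subst (λ k → Pol (suc n) k (λ v → head v * (α (tail v) * ψ v))) (sym (ℕₚ.+-suc a b)) (Pol-head-* (Pol-tail-* p r′))))
      where
      lem : ∀ x y t z → x * (y + t * z) ≡ x * y + t * (x * z)
      lem x y t z = solve 4 (λ x y t z → x :* (y :+ t :* z) := x :* y :+ t :* (x :* z)) refl x y t z

    Pol-* : ∀ {n a b φ ψ} → Pol n a φ → Pol n b ψ → Pol n (a ℕ.+ b) (λ v → φ v * ψ v)
    Pol-* point r = point
    Pol-* {ψ = ψ} (constant α p e) r = Pol-cong (λ { (t ∷ x) → cong (_* ψ (t ∷ x)) (e t x) }) (Pol-tail-* p r)
    Pol-* {ψ = ψ} (step α φ p p′ e) r =
      Pol-cong (λ { (t ∷ x) → trans (cong (_* ψ (t ∷ x)) (e t x)) (lem (α x) t (φ (t ∷ x)) (ψ (t ∷ x))) })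
        (Pol-+ (Pol-tail-* p r) (Pol-head-* (Pol-* p′ r)))
      where
      lem : ∀ x t y z → (x + t * y) * z ≡ x * z + t * (y * z)
      lem x t y z = solve 4 (λ x t y z → (x :+ t :* y) :* z := x :* z :+ t :* (y :* z)) refl x t y z

  Pol-pow : ∀ {n d φ} e → Pol n d φ → Pol n (e ℕ.* d) (λ v → pow (φ v) e)
  Pol-pow {n} zero    p = Pol-const n 0 1#
  Pol-pow     (suc e) p = Pol-* p (Pol-pow e p)

  Pol-evalN : ∀ {n e} m c {g} → Pol n e g → Pol n (m ℕ.* e) (λ v → evalN (suc m) c (g v))
  Pol-evalN {n} zero c {g} p = Pol-cong (λ v → sym (absorb-zero (c 0) (g v))) (Pol-const n 0 (c 0))
  Pol-evalN {n} (suc m) c p = Pol-+ (Pol-const n _ (c 0)) (Pol-* p (Pol-evalN m (c ∘ suc) p))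

  Pol-coordinate : ∀ {n} → Pol (suc n) 1 head
  Pol-coordinate {n} = Pol-cong (λ { (t ∷ x) → sym (*-identityʳ t) }) (Pol-head-* (Pol-const (suc n) 0 1#))

  -- The degree bound matters as much as the expansion: total degree d leaves at most d - j in the
  -- other variables for the coefficient of t^j.
  extract : ∀ {n d φ} → Pol (suc n) d φ → Σ (ℕ → Vec Carrier n → Carrier) λ p →
            (∀ j → j ≤ d → Pol n (d ∸ j) (p j)) × (∀ t x → φ (t ∷ x) ≡ evalN (suc d) (λ j → p j x) t)
  extract (constant a p e) = (λ _ → a) , (λ { zero _ → p }) , λ t x → trans (e t x) (absorb-zero (a x) t)
  extract {n} {suc d} (step a ψ p r e) with extract r
  ... | c , degs , e′ = c′ , degs′ , λ t x → trans (e t x) (cong (λ z → a x + t * z) (e′ t x))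
    where
    c′ : ℕ → Vec Carrier n → Carrier
    c′ zero    = a
    c′ (suc j) = c j
    degs′ : ∀ j → j ≤ suc d → Pol n (suc d ∸ j) (c′ j)
    degs′ zero    _   = p
    degs′ (suc j) j≤d = degs j (s≤s⁻¹ j≤d)

  append : ℕ → (ℕ → Carrier) → (ℕ → Carrier) → ℕ → Carrier
  append zero    a c j       = c j
  append (suc n) a c zero    = a 0
  append (suc n) a c (suc j) = append n (a ∘ suc) c j

  append-right : ∀ n a c j → append n a c (n ℕ.+ j) ≡ c j
  append-right zero    a c j = refl
  append-right (suc n) a c j = append-right n (a ∘ suc) c j

  evalN-append : ∀ n m a c t → evalN (n ℕ.+ m) (append n a c) t ≡ evalN n a t + pow t n * evalN m c t
  evalN-append zero    m a c t = lem (evalN m c t)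
    where
    lem : ∀ e → e ≡ 0# + 1# * e
    lem e = solve 1 (λ e → e := :0 :+ :1 :* e) refl e
  evalN-append (suc n) m a c t = trans (cong (λ z → a 0 + t * z) (evalN-append n m (a ∘ suc) c t)) (lem (a 0) (evalN n (a ∘ suc) t) (pow t n) (evalN m c t))
    where
    lem : ∀ x y p e → x + t * (y + p * e) ≡ (x + t * y) + t * p * e
    lem x y p e = solve 5 (λ x t y p e → x :+ t :* (y :+ p :* e) := x :+ t :* y :+ t :* p :* e) refl x t y p e

  evalN-pad : ∀ m k c t → evalN (m ℕ.+ k) (append m c (λ _ → 0#)) t ≡ evalN m c t
  evalN-pad m k c t = trans (evalN-append m k c (λ _ → 0#) t) (trans (cong (λ z → evalN m c t + pow t m * z) (evalN-zero k (λ _ → 0#) t (λ _ _ → refl))) (lem (evalN m c t) (pow t m)))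
    where
    lem : ∀ e p → e + p * 0# ≡ e
    lem e p = solve 2 (λ e p → e :+ p :* :0 := e) refl e p

  -- As N + m ≤ Q, both sides agree as polynomials and not only as functions; the left one has only
  -- terms below t^N, the right one only terms from t^N on.
  degree-gap : ∀ m m′ N c c′ → m′ ≤ N → N ℕ.+ m ≤ Q → (∀ t → evalN m′ c′ t ≡ pow t N * evalN m c t) → ∀ j → j < m → c j ≡ 0#
  degree-gap m m′ N c c′ m′≤N small h j j<m = trans (sym (append-right N a c j)) (zero-everywhere (N ℕ.+ m) (append N a c) small vanishes (N ℕ.+ j) (ℕₚ.+-monoʳ-< N j<m))
    where
    a : ℕ → Carrier
    a i = (- 1#) * append m′ c′ (λ _ → 0#) i
    vanishes : ∀ t → evalN (N ℕ.+ m) (append N a c) t ≡ 0#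
    vanishes t = trans (evalN-append N m a c t) (trans (cong (_+ pow t N * evalN m c t) (trans (evalN-scale N (- 1#) (append m′ c′ (λ _ → 0#)) t)
        (cong ((- 1#) *_) (trans (cong (λ k → evalN k (append m′ c′ (λ _ → 0#)) t) (sym (ℕₚ.m+[n∸m]≡n m′≤N))) (trans (evalN-pad m′ (N ∸ m′) c′ t) (h t)))))) (lem (pow t N * evalN m c t)))
      where
      lem : ∀ e → (- 1#) * e + e ≡ 0#
      lem e = solve 1 (λ e → (:- :1) :* e :+ e := :0) refl e

  monomial : ℕ → Carrier → ℕ → Carrier
  monomial k a = append k (λ _ → 0#) (λ _ → a)

  evalN-monomial : ∀ k a t → evalN (suc k) (monomial k a) t ≡ a * pow t k
  evalN-monomial k a t = trans (cong (λ n → evalN n (monomial k a) t) (ℕₚ.+-comm 1 k)) (trans (evalN-append k 1 (λ _ → 0#) (λ _ → a) t)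
      (trans (cong (_+ pow t k * (a + t * 0#)) (evalN-zero k (λ _ → 0#) t (λ _ _ → refl))) (lem (pow t k))))
    where
    lem : ∀ p → 0# + p * (a + t * 0#) ≡ a * p
    lem p = solve 3 (λ p a t → :0 :+ p :* (a :+ t :* :0) := a :* p) refl p a t

  roots-bound : ∀ m c j → j < suc m → c j ≢ 0# → roots (suc m) c ≤ m
  roots-bound m c j j< ne with roots (suc m) c ℕₚ.≤? m
  ... | yes h = h
  ... | no ¬h = ⊥-elim (ne (coefficients-zero (suc m) c (ℕₚ.≰⇒> ¬h) j j<))

  drop-top : ∀ m c s → c m ≡ 0# → evalN (suc m) c s ≡ evalN m c s
  drop-top m c s e = trans (evalN-snoc m c s) (trans (cong (λ a → evalN m c s + a * pow s m) e) (lem (evalN m c s) (pow s m)))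
    where
    lem : ∀ a p → a + 0# * p ≡ a
    lem a p = solve 2 (λ a p → a :+ :0 :* p := a) refl a p

suc-square : ∀ m → suc m ℕ.* suc m ≡ suc (m ℕ.* suc (suc m))
suc-square = solve 1 (λ m → (con 1 :+ m) :* (con 1 :+ m) := con 1 :+ m :* (con 2 :+ m)) refl
  where open +-*-Solver

-- Linear combinations, and invariance of sums under translation and dilation.

module LinearSums (F : DiscreteField) where
  open FieldTheory F
  open Geometry (toFiniteField F) using (lincomb) renaming (_+ᵥ_ to infixl 6 _⊕_; _·ᵥ_ to infixr 7 _⊙_; zeroᵥ to 𝟎)

  𝕍 : ∀ n → Enumeration (Vec Carrier n)
  𝕍 n = enumerateVectors 𝔽 n

  lincomb-𝟎 : ∀ {k n} (b : Vec (Vec Carrier n) k) → lincomb 𝟎 b ≡ 𝟎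
  lincomb-𝟎 []       = refl
  lincomb-𝟎 (b ∷ bs) = trans (cong (0# ⊙ b ⊕_) (lincomb-𝟎 bs)) lem
    where
    lem : 0# ⊙ b ⊕ 𝟎 ≡ 𝟎
    lem = vsolve [] (b ∷ []) (λ { [] (b ∷ []) → :0 :⊙ b :⊕ :𝟎 :≋ :𝟎 }) refl

  lincomb-addscale : ∀ {k n} (x y : Vec Carrier k) s (b : Vec (Vec Carrier n) k) →
                     lincomb (x ⊕ s ⊙ y) b ≡ lincomb x b ⊕ s ⊙ lincomb y b
  lincomb-addscale []       []       s []       = lem
    where
    lem : ∀ {n} → 𝟎 {n} ≡ 𝟎 ⊕ s ⊙ 𝟎
    lem = vsolve (s ∷ []) [] (λ { (s ∷ []) [] → :𝟎 :≋ :𝟎 :⊕ s :⊙ :𝟎 }) refl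
  lincomb-addscale (x ∷ xs) (y ∷ ys) s (b ∷ bs) = trans (cong ((x + s * y) ⊙ b ⊕_) (lincomb-addscale xs ys s bs))
    (lem (lincomb xs bs) (lincomb ys bs))
    where
    lem : ∀ v w → (x + s * y) ⊙ b ⊕ (v ⊕ s ⊙ w) ≡ (x ⊙ b ⊕ v) ⊕ s ⊙ (y ⊙ b ⊕ w)
    lem v w = vsolve (x ∷ s ∷ y ∷ []) (b ∷ v ∷ w ∷ []) (λ { (x ∷ s ∷ y ∷ []) (b ∷ v ∷ w ∷ []) → (x :+ s :* y) :⊙ b :⊕ (v :⊕ s :⊙ w) :≋ x :⊙ b :⊕ v :⊕ s :⊙ (y :⊙ b :⊕ w) }) refl

  lincomb-⊕ : ∀ {k n} (x y : Vec Carrier k) (b : Vec (Vec Carrier n) k) → lincomb (x ⊕ y) b ≡ lincomb x b ⊕ lincomb y b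
  lincomb-⊕ x y b = trans (cong (λ w → lincomb w b) lem₁) (trans (lincomb-addscale x y 1# b) (lem₂ (lincomb x b) (lincomb y b)))
    where
    lem₁ : x ⊕ y ≡ x ⊕ 1# ⊙ y
    lem₁ = vsolve [] (x ∷ y ∷ []) (λ { [] (x ∷ y ∷ []) → x :⊕ y :≋ x :⊕ :1 :⊙ y }) refl
    lem₂ : ∀ v w → v ⊕ 1# ⊙ w ≡ v ⊕ w
    lem₂ v w = vsolve [] (v ∷ w ∷ []) (λ { [] (v ∷ w ∷ []) → v :⊕ :1 :⊙ w :≋ v :⊕ w }) refl

  lincomb-⊙ : ∀ {k n} s (x : Vec Carrier k) (b : Vec (Vec Carrier n) k) → lincomb (s ⊙ x) b ≡ s ⊙ lincomb x b
  lincomb-⊙ s x b = trans (cong (λ w → lincomb w b) lem₁) (trans (lincomb-addscale 𝟎 x s b) (trans (cong (_⊕ s ⊙ lincomb x b) (lincomb-𝟎 b)) (lem₂ (lincomb x b))))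
    where
    lem₁ : s ⊙ x ≡ 𝟎 ⊕ s ⊙ x
    lem₁ = vsolve (s ∷ []) (x ∷ []) (λ { (s ∷ []) (x ∷ []) → s :⊙ x :≋ :𝟎 :⊕ s :⊙ x }) refl
    lem₂ : ∀ v → 𝟎 ⊕ s ⊙ v ≡ s ⊙ v
    lem₂ v = vsolve (s ∷ []) (v ∷ []) (λ { (s ∷ []) (v ∷ []) → :𝟎 :⊕ s :⊙ v :≋ s :⊙ v }) refl

  module _ {n : ℕ} where
    open Enumeration (𝕍 n) using (sum)

    sum-translate : ∀ (u : Vec Carrier n) g → sum (λ v → g (v ⊕ u)) ≡ sum g
    sum-translate u = sum-bijective (𝕍 n) (_⊕ u) (_⊕ (- 1#) ⊙ u) lem₁ lem₂
      where
      lem₁ : ∀ v → (v ⊕ (- 1#) ⊙ u) ⊕ u ≡ v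
      lem₁ v = vsolve [] (v ∷ u ∷ []) (λ { [] (v ∷ u ∷ []) → v :⊕ (:- :1) :⊙ u :⊕ u :≋ v }) refl
      lem₂ : ∀ v → (v ⊕ u) ⊕ (- 1#) ⊙ u ≡ v
      lem₂ v = vsolve [] (v ∷ u ∷ []) (λ { [] (v ∷ u ∷ []) → v :⊕ u :⊕ (:- :1) :⊙ u :≋ v }) refl

    sum-dilate : ∀ {s} → s ≢ 0# → ∀ g → sum (λ v → g (s ⊙ v)) ≡ sum g
    sum-dilate {s} nz = sum-bijective (𝕍 n) (s ⊙_) ((nz ⁻¹) ⊙_) lem₁ lem₂
      where
      unit : ∀ v → 1# ⊙ v ≡ v
      unit v = vsolve [] (v ∷ []) (λ { [] (v ∷ []) → :1 :⊙ v :≋ v }) refl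
      lem₁ : ∀ v → s ⊙ (nz ⁻¹) ⊙ v ≡ v
      lem₁ v = trans (eq v) (trans (cong (_⊙ v) (⁻¹-inverse nz)) (unit v))
        where
        eq : ∀ v → s ⊙ (nz ⁻¹) ⊙ v ≡ (s * (nz ⁻¹)) ⊙ v
        eq v = vsolve (s ∷ (nz ⁻¹) ∷ []) (v ∷ []) (λ { (s ∷ n ∷ []) (v ∷ []) → s :⊙ n :⊙ v :≋ (s :* n) :⊙ v }) refl
      lem₂ : ∀ v → (nz ⁻¹) ⊙ s ⊙ v ≡ v
      lem₂ v = trans (eq v) (lem₁ v)
        where
        eq : ∀ v → (nz ⁻¹) ⊙ s ⊙ v ≡ s ⊙ (nz ⁻¹) ⊙ v
        eq v = vsolve ((nz ⁻¹) ∷ s ∷ []) (v ∷ []) (λ { (n ∷ s ∷ []) (v ∷ []) → n :⊙ s :⊙ v :≋ s :⊙ n :⊙ v }) refl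

  private module K = Enumeration 𝔽

  scalar-sum-dilate : ∀ {s} → s ≢ 0# → ∀ g → K.sum (λ t → g (s * t)) ≡ K.sum g
  scalar-sum-dilate {s} nz = sum-bijective 𝔽 (s *_) ((nz ⁻¹) *_) lem₁ lem₂
    where
    lem₁ : ∀ v → s * ((nz ⁻¹) * v) ≡ v
    lem₁ v = trans (sym (*-assoc s _ v)) (trans (cong (_* v) (⁻¹-inverse nz)) (*-identityˡ v))
    lem₂ : ∀ v → (nz ⁻¹) * (s * v) ≡ v
    lem₂ v = trans (eq v) (lem₁ v)
      where
      eq : ∀ v → (nz ⁻¹) * (s * v) ≡ s * ((nz ⁻¹) * v)
      eq v = solve 3 (λ n s v → n :* (s :* v) := s :* (n :* v)) refl (nz ⁻¹) s v

-- Of a form of degree q + 1 the argument only uses that it is homogeneous and polynomial on affine planes.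
record Form (F : DiscreteField) (q n : ℕ) : Set where
  open FieldTheory F using (Carrier; Q; pow; _+_; _*_)
  open Polynomials F using (Pol)
  open Geometry (toFiniteField F) using () renaming (_+ᵥ_ to infixl 6 _⊕_; _·ᵥ_ to infixr 7 _⊙_)
  field
    2<q         : 2 < q
    Q≡q²        : Q ≡ q ℕ.* q
    frobenius   : ∀ x y → pow (x + y) q ≡ pow x q + pow y q
    f           : Vec Carrier n → Carrier
    homogeneous : ∀ s v → f (s ⊙ v) ≡ pow s (suc q) * f v
    planar      : ∀ z u u′ → Pol 2 (suc q) (λ v → f (z ⊕ head v ⊙ u ⊕ head (tail v) ⊙ u′))

-- Inequalities between powers of q.

module Estimates (q : ℕ) (3≤q : 3 ≤ q) where
  open import Data.Nat
  open import Data.Nat.Properties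
  open +-*-Solver using (solve; _:+_; _:*_; _:=_; con)

  instance
    q≢0 : NonZero q
    q≢0 = >-nonZero (≤-trans (s≤s z≤n) 3≤q)

  power-≤ : ∀ i j {_ : i ≤ j} → q ^ i ≤ q ^ j
  power-≤ i j {i≤j} = ^-monoʳ-≤ q i≤j

  power-3 : ∀ i → q ^ i + (q ^ i + q ^ i) ≤ q ^ suc i
  power-3 i = ≤-trans (≤-reflexive (solve 1 (λ a → a :+ (a :+ a) := con 3 :* a) refl (q ^ i))) (*-monoˡ-≤ (q ^ i) 3≤q)

  power>0 : ∀ i → 0 < q ^ i
  power>0 i = m^n>0 q i

  power-< : ∀ i → q ^ i < q ^ suc i
  power-< i = ≤-trans (≤-trans (≤-reflexive (+-comm 1 (q ^ i))) (+-monoʳ-≤ (q ^ i) (≤-trans (power>0 i) (m≤m+n (q ^ i) (q ^ i))))) (power-3 i)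

  module _ {Z : ℕ} (count : Z + q ^ 7 ≡ q ^ 13 + q ^ 6) where

    scaled : ∀ i → q ^ i * Z + q ^ (i + 7) ≡ q ^ (i + 13) + q ^ (i + 6)
    scaled i = begin
      q ^ i * Z + q ^ (i + 7)               ≡⟨ cong (q ^ i * Z +_) (^-distribˡ-+-* q i 7) ⟩
      q ^ i * Z + q ^ i * q ^ 7             ≡⟨ *-distribˡ-+ (q ^ i) Z (q ^ 7) ⟨
      q ^ i * (Z + q ^ 7)                   ≡⟨ cong (q ^ i *_) count ⟩
      q ^ i * (q ^ 13 + q ^ 6)              ≡⟨ *-distribˡ-+ (q ^ i) (q ^ 13) (q ^ 6) ⟩
      q ^ i * q ^ 13 + q ^ i * q ^ 6        ≡⟨ cong₂ _+_ (^-distribˡ-+-* q i 13) (^-distribˡ-+-* q i 6) ⟨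
      q ^ (i + 13) + q ^ (i + 6)            ∎
      where open ≡-Reasoning

    -- Substitutes q^i times the zero count and cancels q^(i+13). The negative term of the count
    -- moves to the other side, so natural numbers suffice.
    eliminate : ∀ i {x y} → q ^ i * Z + x ≤ q ^ (i + 13) + y → x + q ^ (i + 6) ≤ y + q ^ (i + 7)
    eliminate i {x} {y} h = +-cancelˡ-≤ (q ^ i * Z + q ^ (i + 13)) _ _ (begin
      (q ^ i * Z + q ^ (i + 13)) + (x + q ^ (i + 6))
        ≡⟨ solve 4 (λ z a x b → (z :+ a) :+ (x :+ b) := (z :+ x) :+ (a :+ b)) refl (q ^ i * Z) (q ^ (i + 13)) x (q ^ (i + 6)) ⟩
      (q ^ i * Z + x) + (q ^ (i + 13) + q ^ (i + 6))
        ≤⟨ +-mono-≤ h (≤-reflexive (sym (scaled i))) ⟩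
      (q ^ (i + 13) + y) + (q ^ i * Z + q ^ (i + 7))
        ≡⟨ solve 4 (λ z a y b → (a :+ y) :+ (z :+ b) := (z :+ a) :+ (y :+ b)) refl (q ^ i * Z) (q ^ (i + 13)) y (q ^ (i + 7)) ⟩
      (q ^ i * Z + q ^ (i + 13)) + (y + q ^ (i + 7)) ∎)
      where open ≤-Reasoning

    two-zeros : 2 ≤ Z
    two-zeros = ≤-trans (≤-trans 3≤q′ (power-≤ 1 6 {s≤s z≤n})) (+-cancelʳ-≤ (q ^ 7) _ _ (begin
      q ^ 6 + q ^ 7   ≡⟨ +-comm (q ^ 6) (q ^ 7) ⟩
      q ^ 7 + q ^ 6   ≤⟨ +-monoˡ-≤ (q ^ 6) (power-≤ 7 13 {m≤m+n 7 6}) ⟩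
      q ^ 13 + q ^ 6  ≡⟨ count ⟨
      Z + q ^ 7       ∎))
      where
      open ≤-Reasoning
      3≤q′ : 2 ≤ q ^ 1
      3≤q′ = ≤-trans (≤-trans (n≤1+n 2) 3≤q) (≤-reflexive (sym (*-identityʳ q)))

    -- Here x is the size of the kernel of an isotropic point. One linear condition leaves q^12
    -- vectors, but at a loss of one zero each the deficit pays only for about q^9.
    point-estimate : ∀ {x} → q ^ 2 * Z + x ≤ q ^ 15 + q ^ 4 → q ^ 12 ≤ x → ⊥
    point-estimate {x} h x≥ = <-irrefl refl (begin-strict
      q ^ 12 + q ^ 8   ≤⟨ +-monoˡ-≤ (q ^ 8) x≥ ⟩
      x + q ^ 8        ≤⟨ eliminate 2 h ⟩
      q ^ 4 + q ^ 9    ≤⟨ +-monoˡ-≤ (q ^ 9) (power-≤ 4 8 {m≤m+n 4 4}) ⟩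
      q ^ 8 + q ^ 9    <⟨ +-monoʳ-< (q ^ 8) (≤-trans (power-< 9) (power-≤ 10 12 {m≤m+n 10 2})) ⟩
      q ^ 8 + q ^ 12   ≡⟨ +-comm (q ^ 8) (q ^ 12) ⟩
      q ^ 12 + q ^ 8   ∎)
      where open ≤-Reasoning

    line-bad : ∀ {x} → q ^ 4 * Z + x ≤ q ^ 17 + q ^ 8 → x ≤ q ^ 8 + q ^ 11
    line-bad {x} h = ≤-trans (m≤m+n x (q ^ 10)) (eliminate 4 h)

    -- Here x is the size of the kernel of an isotropic line, which two conditions keep at q^10 or
    -- more. A loss of one zero each would still fit into the deficit; the loss of q does not.
    line-estimate : ∀ {x} → q ^ 4 * Z + q * x ≤ q ^ 17 + q ^ 8 → q ^ 10 ≤ x → ⊥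
    line-estimate {x} h x≥ = <-irrefl refl (begin-strict
      q ^ 11 + q ^ 8    <⟨ +-monoʳ-< (q ^ 11) (≤-trans (power-< 8) (power-≤ 9 10 {m≤m+n 9 1})) ⟩
      q ^ 11 + q ^ 10   ≤⟨ +-monoˡ-≤ (q ^ 10) (*-monoʳ-≤ q x≥) ⟩
      q * x + q ^ 10    ≤⟨ eliminate 4 h ⟩
      q ^ 8 + q ^ 11    ≡⟨ +-comm (q ^ 8) (q ^ 11) ⟩
      q ^ 11 + q ^ 8    ∎)
      where open ≤-Reasoning

    plane-bad : ∀ {x} → q ^ 6 * Z + x ≤ q ^ 19 + q ^ 12 → x ≤ q ^ 13
    plane-bad {x} h = +-cancelʳ-≤ (q ^ 12) _ _ (≤-trans (eliminate 6 h) (≤-reflexive (+-comm (q ^ 12) (q ^ 13))))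

    plane-kernel : ∀ {x} → q ^ 6 * Z + suc (q ^ 3) * x ≤ q ^ 19 + q ^ 12 → x < q ^ 10
    plane-kernel {x} h with x <? q ^ 10
    ... | yes lt = lt
    ... | no ¬lt = ⊥-elim (<-irrefl refl (begin-strict
      q ^ 13                  <⟨ m<n+m (q ^ 13) (power>0 10) ⟩
      q ^ 10 + q ^ 13         ≡⟨ cong (q ^ 10 +_) (^-distribˡ-+-* q 3 10) ⟩
      suc (q ^ 3) * q ^ 10    ≤⟨ *-monoʳ-≤ (suc (q ^ 3)) (≮⇒≥ ¬lt) ⟩
      suc (q ^ 3) * x         ≤⟨ plane-bad h ⟩
      q ^ 13                  ∎))
      where open ≤-Reasoning

    -- The deficit is q^13. A kernel of q^8 vectors losing q^5 zeros each spends it entirely, so the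
    -- additional 1 is a contradiction.
    all-good : ∀ {x} → q ^ 6 * Z + (1 + q ^ 5 * x) ≤ q ^ 19 + q ^ 12 → q ^ 8 ≤ x → ⊥
    all-good {x} h x≥ = <-irrefl refl (begin-strict
      q ^ 13              ≡⟨ ^-distribˡ-+-* q 5 8 ⟩
      q ^ 5 * q ^ 8       ≤⟨ *-monoʳ-≤ (q ^ 5) x≥ ⟩
      q ^ 5 * x           <⟨ ≤-refl ⟩
      1 + q ^ 5 * x       ≤⟨ plane-bad h ⟩
      q ^ 13              ∎)
      where open ≤-Reasoning

  -- The summands bound the vectors of the line U, the bad vectors and a hyperplane. As they do not
  -- exhaust the space, a linear functional vanishing at all good vectors is zero.
  line-many : q ^ 4 + (q ^ 8 + q ^ 11) + q ^ 12 < q ^ 14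
  line-many = begin-strict
    q ^ 4 + (q ^ 8 + q ^ 11) + q ^ 12     ≤⟨ +-monoˡ-≤ (q ^ 12) (+-mono-≤ (power-≤ 4 11 {m≤m+n 4 7}) (+-monoˡ-≤ (q ^ 11) (power-≤ 8 11 {m≤m+n 8 3}))) ⟩
    q ^ 11 + (q ^ 11 + q ^ 11) + q ^ 12   ≤⟨ +-monoˡ-≤ (q ^ 12) (power-3 11) ⟩
    q ^ 12 + q ^ 12                       <⟨ +-monoʳ-< (q ^ 12) (m<m+n (q ^ 12) (power>0 12)) ⟩
    q ^ 12 + (q ^ 12 + q ^ 12)            ≤⟨ power-3 12 ⟩
    q ^ 13                                ≤⟨ power-≤ 13 14 {n≤1+n 13} ⟩
    q ^ 14                                ∎
    where open ≤-Reasoning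

  plane-many : q ^ 6 + q ^ 13 + q ^ 12 < q ^ 14
  plane-many = begin-strict
    q ^ 6 + q ^ 13 + q ^ 12             ≤⟨ +-monoˡ-≤ (q ^ 12) (+-monoˡ-≤ (q ^ 13) (power-≤ 6 13 {m≤m+n 6 7})) ⟩
    q ^ 13 + q ^ 13 + q ^ 12            <⟨ +-monoʳ-< (q ^ 13 + q ^ 13) (power-< 12) ⟩
    q ^ 13 + q ^ 13 + q ^ 13            ≡⟨ +-assoc (q ^ 13) (q ^ 13) (q ^ 13) ⟩
    q ^ 13 + (q ^ 13 + q ^ 13)          ≤⟨ power-3 13 ⟩
    q ^ 14                              ∎
    where open ≤-Reasoning

  nice-estimate : ∀ {x} → (q ∸ 1) * x ≤ q ^ 14 → q ^ 14 ≤ x + q ^ 12 → ⊥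
  nice-estimate {x} h x≥ = <-irrefl refl (begin-strict
    q ^ 14 + (q ^ 12 + q ^ 12)                       <⟨ +-monoʳ-< (q ^ 14) (≤-trans (≤-trans (≤-reflexive (+-comm 1 _)) (+-monoʳ-≤ (q ^ 12 + q ^ 12) (power>0 12)))
                                                          (≤-trans (≤-reflexive (+-assoc (q ^ 12) (q ^ 12) (q ^ 12))) (≤-trans (power-3 12) (power-≤ 13 14 {n≤1+n 13})))) ⟩
    q ^ 14 + q ^ 14                                  ≡⟨ solve 1 (λ a → a :+ a := con 2 :* a) refl (q ^ 14) ⟩
    2 * q ^ 14                                       ≤⟨ *-monoʳ-≤ 2 x≥ ⟩
    2 * (x + q ^ 12)                                 ≡⟨ solve 2 (λ x a → con 2 :* (x :+ a) := con 2 :* x :+ (a :+ a)) refl x (q ^ 12) ⟩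
    2 * x + (q ^ 12 + q ^ 12)                        ≤⟨ +-monoˡ-≤ (q ^ 12 + q ^ 12) (≤-trans (*-monoˡ-≤ x (∸-monoˡ-≤ 1 3≤q)) h) ⟩
    q ^ 14 + (q ^ 12 + q ^ 12)                       ∎)
    where open ≤-Reasoning

  private
    from-product : ∀ {x e m N} → suc q * x ≤ N → N < suc q * (m ∸ e + 1) → e ≤ m → x + e ≤ m
    from-product {x} {e} {m} {N} h lt e≤m with x ≤? m ∸ e
    ... | yes le = ≤-trans (+-monoˡ-≤ e le) (≤-reflexive (m∸n+n≡m e≤m))
    ... | no ¬le = ⊥-elim (<-irrefl refl (<-≤-trans lt (≤-trans (*-monoʳ-≤ (suc q) (≤-trans (≤-reflexive (+-comm (m ∸ e) 1)) (≰⇒> ¬le))) h)))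

  -- By q² = (q + 1)(q - 1) + 1 the gap below |U|/q is 1. For lines and planes the gaps q and q^3 +
  -- 1 are claimed below, less than division by q + 1 would give but enough for the counts.
  point-fibre : ∀ {x} → suc q * x ≤ q ^ 2 → x + 1 ≤ q
  point-fibre {x} h = from-product {x} {1} {q} h (begin-strict
    q ^ 2                     ≡⟨ cong (q *_) (*-identityʳ q) ⟩
    q * q                     <⟨ *-monoˡ-< q (n<1+n q) ⟩
    suc q * q                 ≡⟨ cong (suc q *_) (sym (m∸n+n≡m (≤-trans (s≤s z≤n) 3≤q))) ⟩
    suc q * (q ∸ 1 + 1)       ∎) (≤-trans (s≤s z≤n) 3≤q)
    where open ≤-Reasoning

  line-fibre : ∀ {x} → suc q * x ≤ q ^ 4 → x + q ≤ q ^ 3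
  line-fibre {x} h = from-product {x} {q} {q ^ 3} h (+-cancelʳ-< (suc q * q) _ _ (begin-strict
    q ^ 4 + suc q * q                 ≡⟨ cong (q ^ 4 +_) (solve 1 (λ a → (con 1 :+ a) :* a := a :+ a :* (a :* con 1)) refl q) ⟩
    q ^ 4 + (q + q ^ 2)               <⟨ +-monoʳ-< (q ^ 4) (≤-trans small (power-3 2)) ⟩
    q ^ 4 + q ^ 3                     ≡⟨ +-comm (q ^ 4) (q ^ 3) ⟩
    suc q * q ^ 3                     ≤⟨ *-monoʳ-≤ (suc q) (≤-trans (≤-reflexive (sym (m∸n+n≡m q≤q³))) (+-monoˡ-≤ q (m≤m+n (q ^ 3 ∸ q) 1))) ⟩
    suc q * (q ^ 3 ∸ q + 1 + q)       ≡⟨ *-distribˡ-+ (suc q) (q ^ 3 ∸ q + 1) q ⟩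
    suc q * (q ^ 3 ∸ q + 1) + suc q * q ∎)) q≤q³
    where
    open ≤-Reasoning
    q≤q³ : q ≤ q ^ 3
    q≤q³ = ≤-trans (≤-reflexive (sym (*-identityʳ q))) (power-≤ 1 3 {s≤s z≤n})
    small : suc (q + q ^ 2) ≤ q ^ 2 + (q ^ 2 + q ^ 2)
    small = +-mono-≤ (power>0 2) (+-monoˡ-≤ (q ^ 2) (≤-trans (≤-reflexive (sym (*-identityʳ q))) (power-≤ 1 2 {s≤s z≤n})))

  plane-fibre : ∀ {x} → suc q * x ≤ q ^ 6 → x + suc (q ^ 3) ≤ q ^ 5
  plane-fibre {x} h = from-product {x} {suc (q ^ 3)} {q ^ 5} h (+-cancelʳ-< (suc q * q ^ 3) _ _ (begin-strict
    q ^ 6 + suc q * q ^ 3                     <⟨ +-monoʳ-< (q ^ 6) (≤-trans (s≤s (+-monoˡ-≤ (q ^ 4) (power-≤ 3 4 {n≤1+n 3}))) (≤-trans enlarge (power-3 4))) ⟩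
    q ^ 6 + q ^ 5                             ≡⟨ +-comm (q ^ 6) (q ^ 5) ⟩
    suc q * q ^ 5                             ≡⟨ cong (suc q *_) (sym (m∸n+n≡m q³<q⁵)) ⟩
    suc q * (q ^ 5 ∸ suc (q ^ 3) + suc (q ^ 3)) ≡⟨ cong (suc q *_) (sym (+-assoc (q ^ 5 ∸ suc (q ^ 3)) 1 (q ^ 3))) ⟩
    suc q * (q ^ 5 ∸ suc (q ^ 3) + 1 + q ^ 3) ≡⟨ *-distribˡ-+ (suc q) (q ^ 5 ∸ suc (q ^ 3) + 1) (q ^ 3) ⟩
    suc q * (q ^ 5 ∸ suc (q ^ 3) + 1) + suc q * q ^ 3 ∎)) q³<q⁵
    where
    open ≤-Reasoning
    q³<q⁵ : q ^ 3 < q ^ 5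
    q³<q⁵ = ≤-trans (power-< 3) (power-≤ 4 5 {n≤1+n 4})
    enlarge : suc (q ^ 4 + q ^ 4) ≤ q ^ 4 + (q ^ 4 + q ^ 4)
    enlarge = +-mono-≤ (power>0 4) ≤-refl

-- The coefficients of f along lines and the polar form.

module FormTheory {F : DiscreteField} {q n : ℕ} (𝓕 : Form F q n) where
  open FieldTheory F
  open Polynomials F
  open LinearSums F
  open Form 𝓕
  open Geometry (toFiniteField F) using (lincomb) renaming (_+ᵥ_ to infixl 6 _⊕_; _·ᵥ_ to infixr 7 _⊙_; zeroᵥ to 𝟎)
  private
    module K = Enumeration 𝔽
    module Y = Enumeration (𝕍 n)

  V : Set
  V = Vec Carrier n

  3≤q : 3 ≤ q
  3≤q = 2<q

  3q≤Q : 3 ℕ.* q ≤ Q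
  3q≤Q = subst (3 ℕ.* q ≤_) (sym Q≡q²) (ℕₚ.*-monoˡ-≤ q 3≤q)

  q+2<Q : suc (suc q) < Q
  q+2<Q = ℕₚ.≤-trans (ℕₚ.≤-trans (ℕₚ.≤-reflexive (ℕₚ.+-comm 3 q)) (ℕₚ.+-monoʳ-≤ q (ℕₚ.≤-trans 3≤q (ℕₚ.m≤m+n q _)))) 3q≤Q

  q+2≤Q : suc (suc q) ≤ Q
  q+2≤Q = ℕₚ.<⇒≤ q+2<Q

  1<Q : 1 < Q
  1<Q = ℕₚ.≤-trans (s≤s (s≤s z≤n)) q+2≤Q

  pow-Q : ∀ x → pow (pow x q) q ≡ x
  pow-Q x = trans (sym (pow-* x q q)) (trans (cong (pow x) (sym Q≡q²)) (fermat x))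

  ι-q : ι q ≡ 0#
  ι-q with ι q ≟ 0#
  ... | yes e = e
  ... | no nz = ⊥-elim (*-nonzero nz nz (trans (sym (ι-* q q)) (trans (cong ι (sym Q≡q²)) ι-Q)))

  evalN-dilate : ∀ m c a s → evalN m (λ j → pow c j * a j) s ≡ evalN m a (c * s)
  evalN-dilate zero    c a s = refl
  evalN-dilate (suc m) c a s = trans (cong (λ z → 1# * a 0 + s * z) (trans (evalN-cong m s (λ j _ → *-assoc c (pow c j) (a (suc j))))
      (trans (evalN-scale m c (λ j → pow c j * a (suc j)) s) (cong (c *_) (evalN-dilate m c (a ∘ suc) s)))))
    (lem (a 0) (evalN m (a ∘ suc) (c * s)))
    where
    lem : ∀ x y → 1# * x + s * (c * y) ≡ x + c * s * y
    lem x y = solve 4 (λ x s c y → :1 :* x :+ s :* (c :* y) := x :+ c :* s :* y) refl x s c y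

  abstract
    coef : V → V → ℕ → Carrier
    coef z u j = proj₁ (extract (planar z u 𝟎)) j (0# ∷ [])

    line : ∀ z u s → f (z ⊕ s ⊙ u) ≡ evalN (suc (suc q)) (coef z u) s
    line z u s = trans (cong f lem) (proj₂ (proj₂ (extract (planar z u 𝟎))) s (0# ∷ []))
      where
      lem : z ⊕ s ⊙ u ≡ z ⊕ s ⊙ u ⊕ 0# ⊙ 𝟎
      lem = vsolve (s ∷ []) (z ∷ u ∷ []) (λ { (s ∷ []) (z ∷ u ∷ []) → z :⊕ s :⊙ u :≋ z :⊕ s :⊙ u :⊕ :0 :⊙ :𝟎 }) refl

  -- The q + 2 coefficients are determined by Q values. Hence every equality of f along two lines
  -- becomes an equality of coefficients, in particular of values of B.
  coef-unique : ∀ z u c → (∀ s → f (z ⊕ s ⊙ u) ≡ evalN (suc (suc q)) c s) → ∀ j → j ≤ suc q → coef z u j ≡ c j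
  coef-unique z u c h j j≤ = equal-everywhere (suc (suc q)) (coef z u) c q+2≤Q (λ s → trans (sym (line z u s)) (h s)) j (s≤s j≤)

  coef-cong-line : ∀ z u z′ u′ → (∀ s → f (z ⊕ s ⊙ u) ≡ f (z′ ⊕ s ⊙ u′)) → ∀ j → j ≤ suc q → coef z u j ≡ coef z′ u′ j
  coef-cong-line z u z′ u′ h = coef-unique z u (coef z′ u′) (λ s → trans (h s) (line z′ u′ s))

  coef-0 : ∀ z u → coef z u 0 ≡ f z
  coef-0 z u = trans (lem₁ (coef z u 0) (evalN (suc q) (coef z u ∘ suc) 0#)) (trans (sym (line z u 0#)) (cong f lem₂))
    where
    lem₁ : ∀ a b → a ≡ a + 0# * b
    lem₁ a b = solve 2 (λ a b → a := a :+ :0 :* b) refl a b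
    lem₂ : z ⊕ 0# ⊙ u ≡ z
    lem₂ = vsolve [] (z ∷ u ∷ []) (λ { [] (z ∷ u ∷ []) → z :⊕ :0 :⊙ u :≋ z }) refl

  -- By homogeneity z + su = s(u + s⁻¹z) reverses the coefficients. This is available for s ≠ 0
  -- only, whence the strict inequality q + 2 < Q.
  coef-reverse : ∀ z u j → j ≤ suc q → coef z u j ≡ coef u z (suc q ∸ j)
  coef-reverse z u j j≤ = equal-off-zero (suc (suc q)) (coef z u) (λ j → coef u z (suc q ∸ j)) q+2<Q agree j (s≤s j≤)
    where
    agree : ∀ s → s ≢ 0# → evalN (suc (suc q)) (coef z u) s ≡ evalN (suc (suc q)) (λ j → coef u z (suc q ∸ j)) s
    agree s nz = begin
      evalN (suc (suc q)) (coef z u) s                         ≡⟨ line z u s ⟨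
      f (z ⊕ s ⊙ u)                                            ≡⟨ cong f lem ⟩
      f (s ⊙ (u ⊕ t ⊙ z))                                      ≡⟨ homogeneous s _ ⟩
      pow s (suc q) * f (u ⊕ t ⊙ z)                            ≡⟨ cong (pow s (suc q) *_) (line u z t) ⟩
      pow s (suc q) * evalN (suc (suc q)) (coef u z) t         ≡⟨ reverse-eval (suc q) (coef u z) s t (⁻¹-inverse nz) ⟩
      evalN (suc (suc q)) (λ j → coef u z (suc q ∸ j)) s       ∎
      where
      open ≡-Reasoning
      t = nz ⁻¹
      lem : z ⊕ s ⊙ u ≡ s ⊙ (u ⊕ t ⊙ z)
      lem = trans lem₁ (trans (cong (λ r → s ⊙ u ⊕ r ⊙ z) (sym (⁻¹-inverse nz))) lem₂)
        where
        lem₁ : z ⊕ s ⊙ u ≡ s ⊙ u ⊕ 1# ⊙ z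
        lem₁ = vsolve (s ∷ []) (z ∷ u ∷ []) (λ { (s ∷ []) (z ∷ u ∷ []) → z :⊕ s :⊙ u :≋ s :⊙ u :⊕ :1 :⊙ z }) refl
        lem₂ : s ⊙ u ⊕ (s * t) ⊙ z ≡ s ⊙ (u ⊕ t ⊙ z)
        lem₂ = vsolve (s ∷ t ∷ []) (u ∷ z ∷ []) (λ { (s ∷ t ∷ []) (u ∷ z ∷ []) → s :⊙ u :⊕ (s :* t) :⊙ z :≋ s :⊙ (u :⊕ t :⊙ z) }) refl

  -- The polar form: B z u is the linear coefficient of f along z + su, hence the coefficient of s^q along u + sz.
  B : V → V → Carrier
  B z u = coef z u 1

  coef-q : ∀ z u → coef z u q ≡ B u z
  coef-q z u = trans (coef-reverse z u q (ℕₚ.n≤1+n q)) (cong (coef u z) (trans (ℕₚ.+-∸-assoc 1 (ℕₚ.≤-refl {q})) (cong suc (ℕₚ.n∸n≡0 q))))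

  coef-q+1 : ∀ z u → coef z u (suc q) ≡ f u
  coef-q+1 z u = trans (coef-reverse z u (suc q) ℕₚ.≤-refl) (trans (cong (coef u z) (ℕₚ.n∸n≡0 q)) (coef-0 u z))

  1≤q : 1 ≤ q
  1≤q = ℕₚ.≤-trans (s≤s z≤n) 3≤q

  coef-scale : ∀ z u c j → j ≤ suc q → coef z (c ⊙ u) j ≡ pow c j * coef z u j
  coef-scale z u c = coef-unique z (c ⊙ u) (λ j → pow c j * coef z u j) λ s →
    trans (cong f (lem s)) (trans (line z u (c * s)) (sym (evalN-dilate (suc (suc q)) c (coef z u) s)))
    where
    lem : ∀ s → z ⊕ s ⊙ (c ⊙ u) ≡ z ⊕ (c * s) ⊙ u
    lem s = vsolve (s ∷ c ∷ []) (z ∷ u ∷ []) (λ { (s ∷ c ∷ []) (z ∷ u ∷ []) → z :⊕ s :⊙ c :⊙ u :≋ z :⊕ (c :* s) :⊙ u }) refl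

  B-scaleʳ : ∀ c z u → B z (c ⊙ u) ≡ c * B z u
  B-scaleʳ c z u = trans (coef-scale z u c 1 (s≤s z≤n)) (cong (_* B z u) (pow-1 c))

  B-scaleˡ : ∀ c z u → B (c ⊙ z) u ≡ pow c q * B z u
  B-scaleˡ c z u = trans (sym (coef-q u (c ⊙ z))) (trans (coef-scale u z c q (ℕₚ.n≤1+n q)) (cong (pow c q *_) (coef-q u z)))

  -- On the affine plane at w the total degree q + 1 leaves degree q + 1 - j in t. For j = q this is
  -- affine dependence, the source of linearity of B; smaller j enter the comparison of degrees for
  -- dual pairs.
  coef-polynomial : ∀ w w′ u j → j ≤ suc q → Pol 1 (suc q ∸ j) (λ v → coef (w ⊕ head v ⊙ w′) u j)
  coef-polynomial w w′ u j j≤ with extract (planar w u w′)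
  ... | p , degs , e = Pol-cong (λ { (t ∷ []) → coef-unique (w ⊕ t ⊙ w′) u (λ j → p j (t ∷ [])) (λ s → trans (cong f (lem s t)) (e s (t ∷ []))) j j≤ }) (degs j j≤)
    where
    lem : ∀ s t → w ⊕ t ⊙ w′ ⊕ s ⊙ u ≡ w ⊕ s ⊙ u ⊕ t ⊙ w′
    lem s t = vsolve (t ∷ s ∷ []) (w ∷ w′ ∷ u ∷ []) (λ { (t ∷ s ∷ []) (w ∷ w′ ∷ u ∷ []) → w :⊕ t :⊙ w′ :⊕ s :⊙ u :≋ w :⊕ s :⊙ u :⊕ t :⊙ w′ }) refl

  univariate : ∀ {d φ} → Pol 1 d φ → Σ (ℕ → Carrier) λ c → ∀ t → φ (t ∷ []) ≡ evalN (suc d) c t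
  univariate p with extract p
  ... | c , _ , e = (λ j → c j []) , λ t → e t []

  private
    affine : ∀ z u u′ → Σ Carrier λ k → ∀ t → B z (u ⊕ t ⊙ u′) ≡ B z u + t * k
    affine z u u′ = c 1 , λ t → trans (B≡ t) (cong₂ (λ a b → a + t * b) (sym c0) (lem (c 1) t))
      where
      φ : Vec Carrier 1 → Carrier
      φ v = coef (u ⊕ head v ⊙ u′) z q
      degree : suc q ∸ q ≡ 1
      degree = trans (ℕₚ.+-∸-assoc 1 (ℕₚ.≤-refl {q})) (cong suc (ℕₚ.n∸n≡0 q))
      expansion : Σ (ℕ → Carrier) λ c → ∀ t → φ (t ∷ []) ≡ evalN 2 c t
      expansion = univariate {1} {φ} (subst (λ k → Pol 1 k φ) degree (coef-polynomial u u′ z q (ℕₚ.n≤1+n q)))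
      c = proj₁ expansion
      lem : ∀ a t → a + t * 0# ≡ a
      lem a t = solve 2 (λ a t → a :+ t :* :0 := a) refl a t
      B≡ : ∀ t → B z (u ⊕ t ⊙ u′) ≡ c 0 + t * (c 1 + t * 0#)
      B≡ t = trans (sym (coef-q (u ⊕ t ⊙ u′) z)) (proj₂ expansion t)
      c0 : B z u ≡ c 0
      c0 = trans (cong (B z) lem₁) (trans (B≡ 0#) (lem₂ (c 0) (c 1 + 0# * 0#)))
        where
        lem₁ : u ≡ u ⊕ 0# ⊙ u′
        lem₁ = vsolve [] (u ∷ u′ ∷ []) (λ { [] (u ∷ u′ ∷ []) → u :≋ u :⊕ :0 :⊙ u′ }) refl
        lem₂ : ∀ a b → a + 0# * b ≡ a
        lem₂ a b = solve 2 (λ a b → a :+ :0 :* b := a) refl a b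

  -- `affine` leaves the slope k undetermined. Writing u + su′ as s(u′ + s⁻¹u) gives the same values
  -- with u and u′ exchanged, and comparing coefficients identifies k.
  B-addscaleʳ : ∀ z u u′ t → B z (u ⊕ t ⊙ u′) ≡ B z u + t * B z u′
  B-addscaleʳ z u u′ t = trans (h t) (cong (λ a → B z u + t * a) k≡)
    where
    k = proj₁ (affine z u u′)
    h = proj₂ (affine z u u′)
    k′ = proj₁ (affine z u′ u)
    h′ = proj₂ (affine z u′ u)
    c d : ℕ → Carrier
    c = cons (B z u) (λ _ → k)
    d = cons k′ (λ _ → B z u′)
    agree : ∀ s → s ≢ 0# → evalN 2 c s ≡ evalN 2 d s
    agree s nz = begin
      B z u + s * (k + s * 0#)                ≡⟨ lem₁ (B z u) k s ⟩
      B z u + s * k                           ≡⟨ h s ⟨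
      B z (u ⊕ s ⊙ u′)                        ≡⟨ cong (B z) vec ⟩
      B z (s ⊙ (u′ ⊕ (nz ⁻¹) ⊙ u))            ≡⟨ B-scaleʳ s z _ ⟩
      s * B z (u′ ⊕ (nz ⁻¹) ⊙ u)              ≡⟨ cong (s *_) (h′ (nz ⁻¹)) ⟩
      s * (B z u′ + (nz ⁻¹) * k′)             ≡⟨ lem₂ (B z u′) (nz ⁻¹) k′ s ⟩
      (s * (nz ⁻¹)) * k′ + s * (B z u′ + s * 0#) ≡⟨ cong (λ r → r * k′ + s * (B z u′ + s * 0#)) (⁻¹-inverse nz) ⟩
      1# * k′ + s * (B z u′ + s * 0#)         ≡⟨ cong (_+ s * (B z u′ + s * 0#)) (*-identityˡ k′) ⟩
      k′ + s * (B z u′ + s * 0#)              ∎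
      where
      open ≡-Reasoning
      lem₁ : ∀ a b s → a + s * (b + s * 0#) ≡ a + s * b
      lem₁ a b s = solve 3 (λ a s b → a :+ s :* (b :+ s :* :0) := a :+ s :* b) refl a s b
      lem₂ : ∀ a i b s → s * (a + i * b) ≡ s * i * b + s * (a + s * 0#)
      lem₂ a i b s = solve 4 (λ s a i b → s :* (a :+ i :* b) := s :* i :* b :+ s :* (a :+ s :* :0)) refl s a i b
      vec : u ⊕ s ⊙ u′ ≡ s ⊙ (u′ ⊕ (nz ⁻¹) ⊙ u)
      vec = trans lem₃ (trans (cong (λ r → r ⊙ u ⊕ s ⊙ u′) (sym (⁻¹-inverse nz))) lem₄)
        where
        lem₃ : u ⊕ s ⊙ u′ ≡ 1# ⊙ u ⊕ s ⊙ u′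
        lem₃ = vsolve (s ∷ []) (u ∷ u′ ∷ []) (λ { (s ∷ []) (u ∷ u′ ∷ []) → u :⊕ s :⊙ u′ :≋ :1 :⊙ u :⊕ s :⊙ u′ }) refl
        lem₄ : (s * (nz ⁻¹)) ⊙ u ⊕ s ⊙ u′ ≡ s ⊙ (u′ ⊕ (nz ⁻¹) ⊙ u)
        lem₄ = vsolve (s ∷ (nz ⁻¹) ∷ []) (u ∷ u′ ∷ []) (λ { (s ∷ n ∷ []) (u ∷ u′ ∷ []) → (s :* n) :⊙ u :⊕ s :⊙ u′ :≋ s :⊙ (u′ :⊕ n :⊙ u) }) refl
    k≡ : k ≡ B z u′
    k≡ = equal-off-zero 2 c d (ℕₚ.≤-trans 3≤q (ℕₚ.≤-trans (ℕₚ.m≤n+m q 2) q+2≤Q)) agree 1 (s≤s (s≤s z≤n))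

  B-addʳ : ∀ z u u′ → B z (u ⊕ u′) ≡ B z u + B z u′
  B-addʳ z u u′ = trans (cong (B z) lem) (trans (B-addscaleʳ z u u′ 1#) (cong (B z u +_) (*-identityˡ _)))
    where
    lem : u ⊕ u′ ≡ u ⊕ 1# ⊙ u′
    lem = vsolve [] (u ∷ u′ ∷ []) (λ { [] (u ∷ u′ ∷ []) → u :⊕ u′ :≋ u :⊕ :1 :⊙ u′ }) refl

  -- Along its own direction f is f(z)(1 + s)^(q+1), whose linear coefficient is (q + 1)f(z), and q
  -- vanishes in the field.
  B-diagonal : ∀ z → B z z ≡ f z
  B-diagonal z = trans (coef-unique z z c expand 1 (s≤s z≤n)) (trans (cong (λ k → f z * ι k) (nC1≡n (suc q)))
      (trans (cong (f z *_) (trans (ι-suc q) (trans (cong (1# +_) ι-q) (+-identityʳ 1#)))) (*-identityʳ (f z))))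
    where
    c : ℕ → Carrier
    c j = f z * ι (suc q C j)
    expand : ∀ s → f (z ⊕ s ⊙ z) ≡ evalN (suc (suc q)) c s
    expand s = trans (cong f lem) (trans (homogeneous (1# + s) z) (trans (*-comm _ _)
      (trans (cong (f z *_) (binomial (suc q) s)) (sym (evalN-scale (suc (suc q)) (f z) (λ j → ι (suc q C j)) s)))))
      where
      lem : z ⊕ s ⊙ z ≡ (1# + s) ⊙ z
      lem = vsolve (s ∷ []) (z ∷ []) (λ { (s ∷ []) (z ∷ []) → z :⊕ s :⊙ z :≋ (:1 :+ s) :⊙ z }) refl

  f-𝟎 : f 𝟎 ≡ 0#
  f-𝟎 = trans (cong f lem) (trans (homogeneous 0# 𝟎) (trans (cong (_* f 𝟎) (zeroˡ (pow 0# q))) (zeroˡ (f 𝟎))))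
    where
    lem : 𝟎 ≡ 0# ⊙ 𝟎
    lem = vsolve [] [] (λ { [] [] → :𝟎 :≋ :0 :⊙ :𝟎 }) refl

  coef-vanishing : ∀ z u → (∀ s → f (z ⊕ s ⊙ u) ≡ 0#) → ∀ j → j ≤ suc q → coef z u j ≡ 0#
  coef-vanishing z u h = coef-unique z u (λ _ → 0#) λ s → trans (h s) (sym (evalN-zero (suc (suc q)) (λ _ → 0#) s (λ _ _ → refl)))

  pow-neg : ∀ c → pow (- c) q ≡ - pow c q
  pow-neg c = trans (lem (pow (- c) q) (pow c q)) (trans (cong (_- pow c q) (trans (sym (frobenius (- c) c)) (trans (cong (λ a → pow a q) lem′) (pow-0# q 1≤q)))) (+-identityˡ _))
    where
    lem : ∀ a e → a ≡ (a + e) - e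
    lem a e = solve 2 (λ a e → a := a :+ e :- e) refl a e
    lem′ : - c + c ≡ 0#
    lem′ = solve 1 (λ c → (:- c) :+ c := :0) refl c

  pow-sub : ∀ a c → pow (a - c) q ≡ pow a q - pow c q
  pow-sub a c = trans (frobenius a (- c)) (cong (pow a q +_) (pow-neg c))

  evalN-frobenius : ∀ n c t → pow (evalN n c t) q ≡ evalN n (λ j → pow (c j) q) (pow t q)
  evalN-frobenius zero    c t = pow-0# q 1≤q
  evalN-frobenius (suc n) c t = trans (frobenius _ _) (cong (pow (c 0) q +_) (trans (pow-product t _ q) (cong (pow t q *_) (evalN-frobenius n (c ∘ suc) t))))

  count-line : ∀ z u m c → (∀ s → f (z ⊕ s ⊙ u) ≡ evalN m c s) → K.count (λ s → f (z ⊕ s ⊙ u) ≟ 0#) ≡ roots m c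
  count-line z u m c h = ∑-cong elements (λ s → χ-cong (f (z ⊕ s ⊙ u) ≟ 0#) (evalN m c s ≟ 0#) (trans (sym (h s))) (trans (h s)))

  zeros : ℕ
  zeros = Y.count (λ v → f v ≟ 0#)

  Independent : ∀ {k} → Vec V k → Set
  Independent b = ∀ cs → lincomb cs b ≡ 𝟎 → cs ≡ 𝟎

  Isotropic : ∀ {k} → Vec V k → Set
  Isotropic b = ∀ x → f (lincomb x b) ≡ 0#

  InSpan : ∀ {k} → Vec V k → V → Set
  InSpan {k} b v = Σ (Vec Carrier k) λ x → v ≡ lincomb x b

  independent-∷ : ∀ {k} (b : Vec V k) v → Independent b → ¬ InSpan b v → Independent (v ∷ b)
  independent-∷ b v ind ¬span (c ∷ cs) e with c ≟ 0#
  ... | yes refl = cong (0# ∷_) (ind cs (trans (lem v (lincomb cs b)) e))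
    where
    lem : ∀ v w → w ≡ 0# ⊙ v ⊕ w
    lem v w = vsolve [] (w ∷ v ∷ []) (λ { [] (w ∷ v ∷ []) → w :≋ :0 :⊙ v :⊕ w }) refl
  ... | no nz = ⊥-elim (¬span ((- (nz ⁻¹)) ⊙ cs , trans (lem v (lincomb cs b))
          (trans (cong (λ w → (1# - c * (nz ⁻¹)) ⊙ v ⊕ (nz ⁻¹) ⊙ w ⊕ (- (nz ⁻¹)) ⊙ lincomb cs b) e)
            (trans (cong (λ a → (1# - a) ⊙ v ⊕ (nz ⁻¹) ⊙ 𝟎 ⊕ (- (nz ⁻¹)) ⊙ lincomb cs b) (⁻¹-inverse nz)) (trans (lem′ v (lincomb cs b)) (sym (lincomb-⊙ (- (nz ⁻¹)) cs b)))))))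
    where
    lem : ∀ v w → v ≡ (1# - c * (nz ⁻¹)) ⊙ v ⊕ (nz ⁻¹) ⊙ (c ⊙ v ⊕ w) ⊕ (- (nz ⁻¹)) ⊙ w
    lem v w = vsolve (c ∷ (nz ⁻¹) ∷ []) (v ∷ w ∷ []) (λ { (c ∷ n ∷ []) (v ∷ w ∷ []) → v :≋ (:1 :- c :* n) :⊙ v :⊕ n :⊙ (c :⊙ v :⊕ w) :⊕ (:- n) :⊙ w }) refl
    lem′ : ∀ v w → (1# - 1#) ⊙ v ⊕ (nz ⁻¹) ⊙ 𝟎 ⊕ (- (nz ⁻¹)) ⊙ w ≡ (- (nz ⁻¹)) ⊙ w
    lem′ v w = vsolve ((nz ⁻¹) ∷ []) (v ∷ w ∷ []) (λ { (n ∷ []) (v ∷ w ∷ []) → (:1 :- :1) :⊙ v :⊕ n :⊙ :𝟎 :⊕ (:- n) :⊙ w :≋ (:- n) :⊙ w }) refl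

  isotropic-∷ : ∀ {k} (b : Vec V k) v → Isotropic b → (∀ x → f (v ⊕ lincomb x b) ≡ 0#) → Isotropic (v ∷ b)
  isotropic-∷ b v iso con (c ∷ x) with c ≟ 0#
  ... | yes refl = trans (cong f (lem v (lincomb x b))) (iso x)
    where
    lem : ∀ v w → 0# ⊙ v ⊕ w ≡ w
    lem v w = vsolve [] (v ∷ w ∷ []) (λ { [] (v ∷ w ∷ []) → :0 :⊙ v :⊕ w :≋ w }) refl
  ... | no nz = trans (cong f (trans (cong (c ⊙ v ⊕_) unit) (trans (lem v (lincomb x b)) (cong (λ w → c ⊙ (v ⊕ w)) (sym (lincomb-⊙ (nz ⁻¹) x b))))))
          (trans (homogeneous c _) (trans (cong (pow c (suc q) *_) (con ((nz ⁻¹) ⊙ x))) (zeroʳ _)))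
    where
    lem : ∀ v w → c ⊙ v ⊕ (c * (nz ⁻¹)) ⊙ w ≡ c ⊙ (v ⊕ (nz ⁻¹) ⊙ w)
    lem v w = vsolve (c ∷ (nz ⁻¹) ∷ []) (v ∷ w ∷ []) (λ { (c ∷ n ∷ []) (v ∷ w ∷ []) → c :⊙ v :⊕ (c :* n) :⊙ w :≋ c :⊙ (v :⊕ n :⊙ w) }) refl
    unit : lincomb x b ≡ (c * (nz ⁻¹)) ⊙ lincomb x b
    unit = trans (lem″ (lincomb x b)) (cong (_⊙ lincomb x b) (sym (⁻¹-inverse nz)))
      where
      lem″ : ∀ w → w ≡ 1# ⊙ w
      lem″ w = vsolve [] (w ∷ []) (λ { [] (w ∷ []) → w :≋ :1 :⊙ w }) refl

  Q^ : ∀ k → Q ℕ.^ k ≡ q ℕ.^ (2 ℕ.* k)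
  Q^ k = trans (cong (ℕ._^ k) (trans Q≡q² (cong (q ℕ.*_) (sym (ℕₚ.*-identityʳ q))))) (ℕₚ.^-*-assoc q 2 k)

  Q-product : ∀ k j x → x ≡ q ℕ.^ j → Q ℕ.^ k ℕ.* x ≡ q ℕ.^ (2 ℕ.* k ℕ.+ j)
  Q-product k j x refl = trans (cong (ℕ._* q ℕ.^ j) (Q^ k)) (sym (ℕₚ.^-distribˡ-+-* q (2 ℕ.* k) j))

  q≡q^1 : q ≡ q ℕ.^ 1
  q≡q^1 = sym (ℕₚ.*-identityʳ q)

  -- Says without division that q^j, with j = 2k - 1, is |U|/q for a subspace U of dimension k.
  fibre-maximum : ∀ k j → suc (suc j) ≡ 2 ℕ.* k ℕ.+ 1 → Q ℕ.* q ℕ.^ j ≡ Q ℕ.^ k ℕ.* q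
  fibre-maximum k j e = trans (trans (cong (ℕ._* q ℕ.^ j) (sym (ℕₚ.*-identityʳ Q))) (Q-product 1 j (q ℕ.^ j) refl))
    (trans (cong (q ℕ.^_) e) (sym (Q-product k 1 q q≡q^1)))

  -- Zeros in a solid when f satisfies f^q = γf.

  module Values (γ : Carrier) (values : ∀ v → pow (f v) q ≡ γ * f v) where
    -- On a line through a point off the hypersurface f takes values among the q solutions of x^q = γx, each at most q + 1 times.
    meets : ∀ v R → f R ≢ 0# → Σ Carrier λ s → f (v ⊕ s ⊙ R) ≡ 0#
    meets v R ne = K.find (λ s → f (v ⊕ s ⊙ R) ≟ 0#) λ none → ℕₚ.<-irrefl refl (begin-strict
      Q                                                                              ≤⟨ ∑-mono K.list (hit none) ⟩
      K.sum (λ s → K.sum (λ ℓ → χ (ℓ ≟ f (v ⊕ s ⊙ R)) ℕ.* χ (value? ℓ)))             ≡⟨ ∑-swap K.list K.list (λ s ℓ → χ (ℓ ≟ f (v ⊕ s ⊙ R)) ℕ.* χ (value? ℓ)) ⟩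
      K.sum (λ ℓ → K.sum (λ s → χ (ℓ ≟ f (v ⊕ s ⊙ R)) ℕ.* χ (value? ℓ)))             ≡⟨ ∑-cong K.list (λ ℓ → ∑-*ʳ K.list (λ s → χ (ℓ ≟ f (v ⊕ s ⊙ R))) (χ (value? ℓ))) ⟩
      K.sum (λ ℓ → K.count (λ s → ℓ ≟ f (v ⊕ s ⊙ R)) ℕ.* χ (value? ℓ))               ≤⟨ ∑-mono K.list (λ ℓ → ℕₚ.*-monoˡ-≤ (χ (value? ℓ)) (preimages ℓ)) ⟩
      K.sum (λ ℓ → suc q ℕ.* χ (value? ℓ))                                           ≡⟨ ∑-*ˡ K.list (suc q) (λ ℓ → χ (value? ℓ)) ⟩
      suc q ℕ.* K.count value?                                                       <⟨ ℕₚ.m<n+m _ 0<1 ⟩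
      1 ℕ.+ suc q ℕ.* K.count value?                                                 ≤⟨ few ⟩
      q ℕ.* q                                                                        ≡⟨ Q≡q² ⟨
      Q                                                                              ∎)
      where
      open ℕₚ.≤-Reasoning
      0<1 : 0 < 1
      0<1 = s≤s z≤n
      Value : Carrier → Set
      Value ℓ = ℓ ≢ 0# × pow ℓ q ≡ γ * ℓ
      value? : ∀ ℓ → Dec (Value ℓ)
      value? ℓ = ¬? (ℓ ≟ 0#) ×-dec (pow ℓ q ≟ γ * ℓ)
      hit : (∀ s → f (v ⊕ s ⊙ R) ≢ 0#) → ∀ s → 1 ≤ K.sum (λ ℓ → χ (ℓ ≟ f (v ⊕ s ⊙ R)) ℕ.* χ (value? ℓ))
      hit none s = ℕₚ.≤-reflexive (sym (trans (K.sum-δ (f (v ⊕ s ⊙ R)) (λ ℓ → χ (value? ℓ))) (χ-yes (value? (f (v ⊕ s ⊙ R))) (none s , values (v ⊕ s ⊙ R)))))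
      preimages : ∀ ℓ → K.count (λ s → ℓ ≟ f (v ⊕ s ⊙ R)) ≤ suc q
      preimages ℓ = ℕₚ.≤-trans (∑-mono K.list (λ s → χ-mono (ℓ ≟ f (v ⊕ s ⊙ R)) (evalN (suc (suc q)) c s ≟ 0#) (λ e → trans (lem (coef v R 0) ℓ s (evalN (suc q) (coef v R ∘ suc) s)) (trans (cong₂ _-_ (sym (line v R s)) e) (lem′ (f (v ⊕ s ⊙ R)))))))
          (roots-bound (suc q) c (suc q) ℕₚ.≤-refl (λ e → ne (trans (sym (coef-q+1 v R)) e)))
        where
        c : ℕ → Carrier
        c = cons (coef v R 0 - ℓ) (coef v R ∘ suc)
        lem : ∀ a l s e → (a - l) + s * e ≡ (a + s * e) - l
        lem a l s e = solve 4 (λ a l s e → a :- l :+ s :* e := a :+ s :* e :- l) refl a l s e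
        lem′ : ∀ a → a - a ≡ 0#
        lem′ a = solve 1 (λ a → a :- a := :0) refl a
      values-bound : suc (K.count value?) ≤ q
      values-bound = ℕₚ.≤-trans (ℕₚ.≤-reflexive (trans (cong (ℕ._+ K.count value?) (sym (K.once 0#))) (sym (∑-+ K.list (λ ℓ → χ (ℓ ≟ 0#)) (λ ℓ → χ (value? ℓ))))))
        (ℕₚ.≤-trans (∑-mono K.list pointwise) (roots-bound q c q ℕₚ.≤-refl top))
        where
        -- The polynomial x^q - γx, its linear part padded with zeros up to degree q.
        c : ℕ → Carrier
        c j = monomial q 1# j + append 2 (cons 0# (λ _ → - γ)) (λ _ → 0#) j
        c-eval : ∀ ℓ → evalN (suc q) c ℓ ≡ pow ℓ q - γ * ℓ
        c-eval ℓ = trans (evalN-+ (suc q) (monomial q 1#) (append 2 (cons 0# (λ _ → - γ)) (λ _ → 0#)) ℓ) (trans (cong₂ _+_ (evalN-monomial q 1# ℓ)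
          (trans (cong (λ k → evalN k (append 2 (cons 0# (λ _ → - γ)) (λ _ → 0#)) ℓ) (sym (ℕₚ.m+[n∸m]≡n {2} {suc q} (ℕₚ.≤-trans (s≤s (s≤s z≤n)) (ℕₚ.≤-trans 3≤q (ℕₚ.n≤1+n q))))))
            (evalN-pad 2 (suc q ∸ 2) (cons 0# (λ _ → - γ)) ℓ))) (lem (pow ℓ q) ℓ))
          where
          lem : ∀ p l → 1# * p + (0# + l * (- γ + l * 0#)) ≡ p - γ * l
          lem p l = solve 3 (λ p l γ → :1 :* p :+ (:0 :+ l :* ((:- γ) :+ l :* :0)) := p :- γ :* l) refl p l γ
        top : c q ≢ 0#
        top e = 1≢0 (trans (sym top-value) e)
          where
          append-left-zero : ∀ j → 2 ≤ j → append 2 (cons 0# (λ _ → - γ)) (λ _ → 0#) j ≡ 0#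
          append-left-zero (suc (suc j)) _ = refl
          append-left-zero (suc zero) (s≤s ())
          top-value : c q ≡ 1#
          top-value = trans (cong₂ _+_ (trans (cong (monomial q 1#) (sym (ℕₚ.+-identityʳ q))) (append-right q (λ _ → 0#) (λ _ → 1#) 0)) (append-left-zero q (ℕₚ.<⇒≤ 3≤q))) (+-identityʳ 1#)
        pointwise : ∀ ℓ → χ (ℓ ≟ 0#) ℕ.+ χ (value? ℓ) ≤ χ (evalN (suc q) c ℓ ≟ 0#)
        pointwise ℓ = by (ℓ ≟ 0#)
          where
          lem : ∀ a → a - a ≡ 0#
          lem a = solve 1 (λ a → a :- a := :0) refl a
          by : Dec (ℓ ≡ 0#) → χ (ℓ ≟ 0#) ℕ.+ χ (value? ℓ) ≤ χ (evalN (suc q) c ℓ ≟ 0#)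
          by (yes refl) = ℕₚ.≤-reflexive (trans (cong₂ ℕ._+_ (χ-yes (0# ≟ 0#) refl) (χ-no (value? 0#) (λ (nz , _) → nz refl)))
            (sym (χ-yes (evalN (suc q) c 0# ≟ 0#) (trans (c-eval 0#) (trans (cong (_- γ * 0#) (pow-0# q 1≤q)) lem″)))))
            where
            lem″ : 0# - γ * 0# ≡ 0#
            lem″ = solve 1 (λ γ → :0 :- γ :* :0 := :0) refl γ
          by (no nz) = ℕₚ.≤-trans (ℕₚ.≤-reflexive (cong (ℕ._+ χ (value? ℓ)) (χ-no (ℓ ≟ 0#) nz))) (χ-mono (value? ℓ) (evalN (suc q) c ℓ ≟ 0#) (λ (_ , e) → trans (c-eval ℓ) (trans (cong (_- γ * ℓ) e) (lem (γ * ℓ)))))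
      -- At most q - 1 nonzero values, each taken at most q + 1 times, account for at most q² - 1 of
      -- the q² parameters.
      few : 1 ℕ.+ suc q ℕ.* K.count value? ≤ q ℕ.* q
      few = ℕₚ.+-cancelʳ-≤ q _ _ (begin
        1 ℕ.+ suc q ℕ.* K.count value? ℕ.+ q     ≡⟨ cong suc (trans (ℕₚ.+-comm (suc q ℕ.* K.count value?) q) refl) ⟩
        suc q ℕ.+ suc q ℕ.* K.count value?       ≡⟨ ℕₚ.*-suc (suc q) (K.count value?) ⟨
        suc q ℕ.* suc (K.count value?)           ≤⟨ ℕₚ.*-monoʳ-≤ (suc q) values-bound ⟩
        suc q ℕ.* q                              ≡⟨ ℕₚ.+-comm q (q ℕ.* q) ⟩
        q ℕ.* q ℕ.+ q                            ∎)

    -- Either f vanishes on all combinations, or some ρ gives a nonzero value. In the second case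
    -- every x has a zero on its line in direction ρ, and summing over x counts each zero Q times.
    solid-count : ∀ (b₄ : Vec V 4) → Q ℕ.^ 3 ≤ Enumeration.count (𝕍 4) (λ x → f (lincomb x b₄) ≟ 0#)
    solid-count b₄ = ℕₚ.*-cancelˡ-≤ Q {{ℕ.>-nonZero (ℕₚ.<⇒≤ 1<Q)}} (begin
      Q ℕ.* Q ℕ.^ 3                                         ≡⟨ size-vectors 𝔽 4 ⟨
      S.sum (λ _ → 1)                                       ≤⟨ every (S.search (λ ρ → ¬? (f (L₄ ρ) ≟ 0#))) ⟩
      Q ℕ.* S.count (λ x → f (L₄ x) ≟ 0#)                   ∎)
      where
      open ℕₚ.≤-Reasoning
      module S = Enumeration (𝕍 4)
      L₄ : Vec Carrier 4 → V
      L₄ x = lincomb x b₄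
      every : Dec (Σ (Vec Carrier 4) λ ρ → f (L₄ ρ) ≢ 0#) → S.sum (λ _ → 1) ≤ Q ℕ.* S.count (λ x → f (L₄ x) ≟ 0#)
      every (no none) = ℕₚ.≤-trans (∑-mono S.list (λ x → ℕₚ.≤-reflexive (sym (χ-yes (f (L₄ x) ≟ 0#) (decidable-stable (f (L₄ x) ≟ 0#) (λ ne → none (x , ne)))))))
        (ℕₚ.m≤n*m (S.count (λ x → f (L₄ x) ≟ 0#)) Q {{ℕ.>-nonZero (ℕₚ.<⇒≤ 1<Q)}})
      every (yes (ρ , ne)) = begin
        S.sum (λ _ → 1)                                                   ≤⟨ ∑-mono S.list some ⟩
        S.sum (λ x → K.count (λ s → f (L₄ (x ⊕ s ⊙ ρ)) ≟ 0#))             ≡⟨ ∑-swap S.list K.list (λ x s → χ (f (L₄ (x ⊕ s ⊙ ρ)) ≟ 0#)) ⟩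
        K.sum (λ s → S.count (λ x → f (L₄ (x ⊕ s ⊙ ρ)) ≟ 0#))             ≡⟨ ∑-cong K.list (λ s → sum-translate (s ⊙ ρ) (λ x → χ (f (L₄ x) ≟ 0#))) ⟩
        K.sum (λ _ → S.count (λ x → f (L₄ x) ≟ 0#))                       ≡⟨ K.sum-const _ ⟩
        Q ℕ.* S.count (λ x → f (L₄ x) ≟ 0#)                               ∎
        where
        some : ∀ x → 1 ≤ K.count (λ s → f (L₄ (x ⊕ s ⊙ ρ)) ≟ 0#)
        some x = ℕₚ.≤-trans (ℕₚ.≤-reflexive (sym (χ-yes (f (L₄ (x ⊕ proj₁ root ⊙ ρ)) ≟ 0#) (trans (cong f (lincomb-addscale x ρ (proj₁ root) b₄)) (proj₂ root)))))
            (K.member {λ s → χ (f (L₄ (x ⊕ s ⊙ ρ)) ≟ 0#)} (proj₁ root))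
          where root = meets (L₄ x) (L₄ ρ) ne

  -- Zeros on the cosets of an isotropic subspace.

  module Subspace {k : ℕ} (b : Vec V k) (isotropic : ∀ x → f (lincomb x b) ≡ 0#) where
    private
      module X = Enumeration (𝕍 k)

    L : Vec Carrier k → V
    L x = lincomb x b

    B-L-L : ∀ x y → B (L x) (L y) ≡ 0#
    B-L-L x y = coef-vanishing (L x) (L y) (λ s → trans (cong f (sym (lincomb-addscale x y s b))) (isotropic (x ⊕ s ⊙ y))) 1 (s≤s z≤n)

    B-translate : ∀ v x y → B (L y) (v ⊕ L x) ≡ B (L y) v
    B-translate v x y = trans (B-addʳ (L y) v (L x)) (trans (cong (B (L y) v +_) (B-L-L y x)) (+-identityʳ _))

    line-q : ∀ z y s → f (z ⊕ s ⊙ L y) ≡ evalN (suc q) (coef z (L y)) s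
    line-q z y s = trans (line z (L y) s) (drop-top (suc q) (coef z (L y)) s (trans (coef-q+1 z (L y)) (isotropic y)))

    -- Since B vanishes on U, the coefficient of s^q in a direction of U is the same at all points
    -- of the coset v + U.
    top-q : ∀ v x y → coef (v ⊕ L x) (L y) q ≡ B (L y) v
    top-q v x y = trans (coef-q _ _) (B-translate v x y)

    fibre : V → ℕ
    fibre v = X.count (λ x → f (v ⊕ L x) ≟ 0#)

    lineCount : V → V → ℕ
    lineCount z u = K.count (λ s → f (z ⊕ s ⊙ u) ≟ 0#)

    L-⊕ : ∀ v x s y → v ⊕ L (x ⊕ s ⊙ y) ≡ v ⊕ L x ⊕ s ⊙ L y
    L-⊕ v x s y = trans (cong (v ⊕_) (lincomb-addscale x y s b)) (lem (L x) (L y))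
      where
      lem : ∀ a c → v ⊕ (a ⊕ s ⊙ c) ≡ v ⊕ a ⊕ s ⊙ c
      lem a c = vsolve (s ∷ []) (v ∷ a ∷ c ∷ []) (λ { (s ∷ []) (v ∷ a ∷ c ∷ []) → v :⊕ (a :⊕ s :⊙ c) :≋ v :⊕ a :⊕ s :⊙ c }) refl

    -- Averaging over a direction of U: each of the Q translates by s·u sees every zero once.
    fibre-average : ∀ v y → X.sum (λ x → lineCount (v ⊕ L x) (L y)) ≡ Q ℕ.* fibre v
    fibre-average v y = begin
      X.sum (λ x → lineCount (v ⊕ L x) (L y))
        ≡⟨ ∑-swap X.list K.list (λ x s → χ (f (v ⊕ L x ⊕ s ⊙ L y) ≟ 0#)) ⟩
      K.sum (λ s → X.count (λ x → f (v ⊕ L x ⊕ s ⊙ L y) ≟ 0#))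
        ≡⟨ ∑-cong K.list (λ s → trans (∑-cong X.list (λ x → cong (λ w → χ (f w ≟ 0#)) (sym (L-⊕ v x s y))))
             (sum-translate (s ⊙ y) (λ x → χ (f (v ⊕ L x) ≟ 0#)))) ⟩
      K.sum (λ _ → fibre v)
        ≡⟨ K.sum-const (fibre v) ⟩
      Q ℕ.* fibre v ∎
      where open ≡-Reasoning

    lineCount≤q : ∀ v x y → B (L y) v ≢ 0# → lineCount (v ⊕ L x) (L y) ≤ q
    lineCount≤q v x y ne = subst (_≤ q) (sym (count-line (v ⊕ L x) (L y) (suc q) (coef (v ⊕ L x) (L y)) (line-q (v ⊕ L x) y)))
      (roots-bound q (coef (v ⊕ L x) (L y)) q ℕₚ.≤-refl (λ e → ne (trans (sym (top-q v x y)) e)))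

    size-X : X.size ≡ Q ℕ.^ k
    size-X = size-vectors 𝔽 k

    fibre-bound : ∀ v y → B (L y) v ≢ 0# → Q ℕ.* fibre v ≤ Q ℕ.^ k ℕ.* q
    fibre-bound v y ne = subst₂ _≤_ (fibre-average v y) (trans (X.sum-const q) (cong (ℕ._* q) size-X))
      (∑-mono X.list (λ x → lineCount≤q v x y ne))

    -- All lines in directions of U through one point z₀ off the hypersurface are counted. Without
    -- the s^q term each has at most q - 1 zeros, while each zero of the coset is met once for every
    -- s ≠ 0; dividing (q² - 1)n(v) ≤ (q - 1)|U| by q - 1 gives the bound.
    fibre-bound-degenerate : ∀ v x₀ → f (v ⊕ L x₀) ≢ 0# → (∀ y → B (L y) v ≡ 0#) → suc q ℕ.* fibre v ≤ Q ℕ.^ k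
    fibre-bound-degenerate v x₀ ne deg = ℕₚ.*-cancelˡ-≤ (q ∸ 1) {{ℕ.>-nonZero q-1>0}}
      (subst₂ _≤_ left (trans (X.sum-const (q ∸ 1)) (trans (cong (ℕ._* (q ∸ 1)) size-X) (ℕₚ.*-comm (Q ℕ.^ k) (q ∸ 1))))
        (∑-mono X.list bound))
      where
      q-1>0 : 0 < q ∸ 1
      q-1>0 = ℕₚ.m<n⇒0<n∸m (ℕₚ.≤-trans (s≤s (s≤s z≤n)) 3≤q)
      q≡ : q ≡ suc (q ∸ 1)
      q≡ = sym (ℕₚ.m+[n∸m]≡n 1≤q)
      z₀ = v ⊕ L x₀
      bound : ∀ y → lineCount z₀ (L y) ≤ q ∸ 1
      bound y = subst (_≤ q ∸ 1) (sym (count-line z₀ (L y) (suc (q ∸ 1)) (coef z₀ (L y)) expand)) (root-bound (q ∸ 1) (coef z₀ (L y)) 0# nonzero)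
        where
        expand : ∀ s → f (z₀ ⊕ s ⊙ L y) ≡ evalN (suc (q ∸ 1)) (coef z₀ (L y)) s
        expand s = trans (line-q z₀ y s) (trans (drop-top q (coef z₀ (L y)) s (trans (top-q v x₀ y) (deg y))) (cong (λ m → evalN m (coef z₀ (L y)) s) q≡))
        nonzero : evalN (suc (q ∸ 1)) (coef z₀ (L y)) 0# ≢ 0#
        nonzero e = ne (trans (cong f lem) (trans (expand 0#) e))
          where
          lem : z₀ ≡ z₀ ⊕ 0# ⊙ L y
          lem = vsolve [] (z₀ ∷ L y ∷ []) (λ { [] (z₀ ∷ l ∷ []) → z₀ :≋ z₀ :⊕ :0 :⊙ l }) refl
      -- For s ≠ 0 the map y ↦ x₀ + sy permutes U, so the whole fibre is seen; for s = 0 only z₀ is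
      -- seen, which is not a zero.
      column : ∀ s → X.count (λ y → f (z₀ ⊕ s ⊙ L y) ≟ 0#) ≡ χ (¬? (s ≟ 0#)) ℕ.* fibre v
      column s with s ≟ 0#
      ... | yes refl = trans (∑-cong X.list (λ y → χ-no (f (z₀ ⊕ 0# ⊙ L y) ≟ 0#) (λ e → ne (trans (cong f (lem (L y))) e)))) (∑-zero X.list)
        where
        lem : ∀ w → z₀ ≡ z₀ ⊕ 0# ⊙ w
        lem w = vsolve [] (z₀ ∷ w ∷ []) (λ { [] (z₀ ∷ w ∷ []) → z₀ :≋ z₀ :⊕ :0 :⊙ w }) refl
      ... | no nz = trans (trans (∑-cong X.list (λ y → cong (λ w → χ (f w ≟ 0#)) (eq y)))
            (trans (sum-dilate nz (λ y → χ (f (v ⊕ L (y ⊕ x₀)) ≟ 0#))) (sum-translate x₀ (λ y → χ (f (v ⊕ L y) ≟ 0#))))) (sym (ℕₚ.*-identityˡ (fibre v)))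
        where
        eq : ∀ y → z₀ ⊕ s ⊙ L y ≡ v ⊕ L (s ⊙ y ⊕ x₀)
        eq y = trans (sym (L-⊕ v x₀ s y)) (cong (λ w → v ⊕ L w) lem)
          where
          lem : x₀ ⊕ s ⊙ y ≡ s ⊙ y ⊕ x₀
          lem = vsolve (s ∷ []) (x₀ ∷ y ∷ []) (λ { (s ∷ []) (x₀ ∷ y ∷ []) → x₀ :⊕ s :⊙ y :≋ s :⊙ y :⊕ x₀ }) refl
      left : X.sum (λ y → lineCount z₀ (L y)) ≡ (q ∸ 1) ℕ.* (suc q ℕ.* fibre v)
      left = begin
        X.sum (λ y → lineCount z₀ (L y))
          ≡⟨ ∑-swap X.list K.list (λ y s → χ (f (z₀ ⊕ s ⊙ L y) ≟ 0#)) ⟩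
        K.sum (λ s → X.count (λ y → f (z₀ ⊕ s ⊙ L y) ≟ 0#))
          ≡⟨ ∑-cong K.list column ⟩
        K.sum (λ s → χ (¬? (s ≟ 0#)) ℕ.* fibre v)
          ≡⟨ ∑-*ʳ K.list (λ s → χ (¬? (s ≟ 0#))) (fibre v) ⟩
        K.count (λ s → ¬? (s ≟ 0#)) ℕ.* fibre v
          ≡⟨ cong (ℕ._* fibre v) Q-1 ⟩
        ((q ∸ 1) ℕ.* suc q) ℕ.* fibre v
          ≡⟨ ℕₚ.*-assoc (q ∸ 1) (suc q) (fibre v) ⟩
        (q ∸ 1) ℕ.* (suc q ℕ.* fibre v) ∎
        where
        open ≡-Reasoning
        Q-1 : K.count (λ s → ¬? (s ≟ 0#)) ≡ (q ∸ 1) ℕ.* suc q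
        Q-1 = ℕₚ.suc-injective (trans (sym count-nonzero) (trans Q≡q² (trans (cong₂ ℕ._*_ q≡ q≡) (trans (suc-square (q ∸ 1)) (cong (λ m → suc ((q ∸ 1) ℕ.* suc m)) (sym q≡))))))

    fibre-total : Y.sum fibre ≡ Q ℕ.^ k ℕ.* Y.count (λ v → f v ≟ 0#)
    fibre-total = begin
      Y.sum fibre
        ≡⟨ ∑-swap Y.list X.list (λ v x → χ (f (v ⊕ L x) ≟ 0#)) ⟩
      X.sum (λ x → Y.count (λ v → f (v ⊕ L x) ≟ 0#))
        ≡⟨ ∑-cong X.list (λ x → sum-translate (L x) (λ v → χ (f v ≟ 0#))) ⟩
      X.sum (λ _ → Y.count (λ v → f v ≟ 0#))
        ≡⟨ X.sum-const _ ⟩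
      X.size ℕ.* Y.count (λ v → f v ≟ 0#)
        ≡⟨ cong (ℕ._* Y.count (λ v → f v ≟ 0#)) size-X ⟩
      Q ℕ.^ k ℕ.* Y.count (λ v → f v ≟ 0#) ∎
      where
      open ≡-Reasoning

    -- Cosets where every line in one direction carries q zeros.

    module Plane (v : V) (ξ : Vec Carrier k) (β≢0 : B (L ξ) v ≢ 0#) (full : ∀ x → lineCount (v ⊕ L x) (L ξ) ≡ q) where
      private
        u₀ = L ξ

        evalN-top : ∀ x y → coef (v ⊕ L x) (L y) q ≡ B (L y) v
        evalN-top = top-q v

        q<Q : q < Q
        q<Q = ℕₚ.≤-trans (ℕₚ.n≤1+n (suc q)) q+2≤Q

      -- The points z + r L(y + κξ) are counted twice. For fixed r ≠ 0 there are q zeros, for r = 0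
      -- all Q, which makes more than Qq in total; if no κ gave a line of zeros, each κ would
      -- contribute at most q.
      slope : ∀ x y → f (v ⊕ L x) ≡ 0# → Σ Carrier λ κ → ∀ r → f (v ⊕ L x ⊕ r ⊙ L (y ⊕ κ ⊙ ξ)) ≡ 0#
      slope x y z=0 = decidable-stable (K.search (λ κ → K.decideAll (λ r → f (z ⊕ r ⊙ L (y ⊕ κ ⊙ ξ)) ≟ 0#))) contradiction
        where
        z = v ⊕ L x
        contradiction : ¬ ¬ (Σ Carrier λ κ → ∀ r → f (z ⊕ r ⊙ L (y ⊕ κ ⊙ ξ)) ≡ 0#)
        contradiction none = ℕₚ.<-irrefl refl (ℕₚ.<-≤-trans (K.sum-strict 0# lower strict) (ℕₚ.≤-trans (ℕₚ.≤-reflexive swapped)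
            (ℕₚ.≤-trans (∑-mono K.list upper) ℕₚ.≤-refl)))
          where
          upper : ∀ κ → K.count (λ r → f (z ⊕ r ⊙ L (y ⊕ κ ⊙ ξ)) ≟ 0#) ≤ q
          upper κ with K.search (λ r → ¬? (f (z ⊕ r ⊙ L (y ⊕ κ ⊙ ξ)) ≟ 0#))
          ... | no all = ⊥-elim (none (κ , λ r → decidable-stable (f (z ⊕ r ⊙ L (y ⊕ κ ⊙ ξ)) ≟ 0#) (λ ne → all (r , ne))))
          ... | yes (r , ne) = subst (_≤ q) (sym (count-line z (L (y ⊕ κ ⊙ ξ)) (suc q) (coef z (L (y ⊕ κ ⊙ ξ))) (line-q z (y ⊕ κ ⊙ ξ))))
                  (root-bound q (coef z (L (y ⊕ κ ⊙ ξ))) r (λ e → ne (trans (line-q z (y ⊕ κ ⊙ ξ) r) e)))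
          swapped : K.sum (λ r → K.count (λ κ → f (z ⊕ r ⊙ L (y ⊕ κ ⊙ ξ)) ≟ 0#)) ≡ K.sum (λ κ → K.count (λ r → f (z ⊕ r ⊙ L (y ⊕ κ ⊙ ξ)) ≟ 0#))
          swapped = ∑-swap K.list K.list (λ r κ → χ (f (z ⊕ r ⊙ L (y ⊕ κ ⊙ ξ)) ≟ 0#))
          at-zero : K.count (λ κ → f (z ⊕ 0# ⊙ L (y ⊕ κ ⊙ ξ)) ≟ 0#) ≡ Q
          at-zero = count-all (λ κ → f (z ⊕ 0# ⊙ L (y ⊕ κ ⊙ ξ)) ≟ 0#) (λ κ → trans (cong f (lem (L (y ⊕ κ ⊙ ξ)))) z=0)
            where
            lem : ∀ w → z ⊕ 0# ⊙ w ≡ z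
            lem w = vsolve [] (z ∷ w ∷ []) (λ { [] (z ∷ w ∷ []) → z :⊕ :0 :⊙ w :≋ z }) refl
          off-zero : ∀ r → r ≢ 0# → K.count (λ κ → f (z ⊕ r ⊙ L (y ⊕ κ ⊙ ξ)) ≟ 0#) ≡ q
          off-zero r nz = trans (∑-cong K.list (λ κ → cong (λ w → χ (f w ≟ 0#)) (eq κ)))
            (trans (scalar-sum-dilate nz (λ s → χ (f (v ⊕ L (x ⊕ r ⊙ y) ⊕ s ⊙ u₀) ≟ 0#))) (full (x ⊕ r ⊙ y)))
            where
            eq : ∀ κ → z ⊕ r ⊙ L (y ⊕ κ ⊙ ξ) ≡ v ⊕ L (x ⊕ r ⊙ y) ⊕ (r * κ) ⊙ u₀
            eq κ = trans (cong (λ w → z ⊕ r ⊙ w) (lincomb-addscale y ξ κ b)) (trans (lem z (L y) u₀) (cong (_⊕ (r * κ) ⊙ u₀) (sym (L-⊕ v x r y))))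
              where
              lem : ∀ z a c → z ⊕ r ⊙ (a ⊕ κ ⊙ c) ≡ z ⊕ r ⊙ a ⊕ (r * κ) ⊙ c
              lem z a c = vsolve (r ∷ κ ∷ []) (z ∷ a ∷ c ∷ []) (λ { (r ∷ κ ∷ []) (z ∷ a ∷ c ∷ []) → z :⊕ r :⊙ (a :⊕ κ :⊙ c) :≋ z :⊕ r :⊙ a :⊕ (r :* κ) :⊙ c }) refl
          lower : ∀ r → q ≤ K.count (λ κ → f (z ⊕ r ⊙ L (y ⊕ κ ⊙ ξ)) ≟ 0#)
          lower r = by (r ≟ 0#)
            where
            by : Dec (r ≡ 0#) → q ≤ K.count (λ κ → f (z ⊕ r ⊙ L (y ⊕ κ ⊙ ξ)) ≟ 0#)
            by (yes refl) = ℕₚ.≤-trans (ℕₚ.<⇒≤ q<Q) (ℕₚ.≤-reflexive (sym at-zero))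
            by (no nz)    = ℕₚ.≤-reflexive (sym (off-zero r nz))
          strict : q < K.count (λ κ → f (z ⊕ 0# ⊙ L (y ⊕ κ ⊙ ξ)) ≟ 0#)
          strict = ℕₚ.<-≤-trans q<Q (ℕₚ.≤-reflexive (sym at-zero))

      -- Two slopes at one zero would make it a multiple zero in the direction u₀, leaving fewer than q zeros there.
      slope-unique : ∀ x y κ κ′ → (∀ r → f (v ⊕ L x ⊕ r ⊙ L (y ⊕ κ ⊙ ξ)) ≡ 0#) → (∀ r → f (v ⊕ L x ⊕ r ⊙ L (y ⊕ κ′ ⊙ ξ)) ≡ 0#) → κ ≡ κ′
      slope-unique x y κ κ′ h h′ = decidable-stable (κ ≟ κ′) λ κ≢κ′ → few (double κ≢κ′)
        where
        z = v ⊕ L x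
        c = coef z u₀
        derivative : ∀ κ → (∀ r → f (z ⊕ r ⊙ L (y ⊕ κ ⊙ ξ)) ≡ 0#) → B z (L y) + κ * B z u₀ ≡ 0#
        derivative κ h = trans (sym (B-addscaleʳ z (L y) u₀ κ)) (trans (cong (B z) (sym (lincomb-addscale y ξ κ b))) (coef-vanishing z _ h 1 (s≤s z≤n)))
        double : κ ≢ κ′ → c 1 ≡ 0#
        double ne = *-integral (difference-nonzero ne) (trans (lem (B z (L y)) (B z u₀)) (trans (cong₂ _-_ (derivative κ h) (derivative κ′ h′)) lem₀))
          where
          lem : ∀ a c → (κ - κ′) * c ≡ (a + κ * c) - (a + κ′ * c)
          lem a c = solve 4 (λ κ κ′ c a → (κ :- κ′) :* c := a :+ κ :* c :- (a :+ κ′ :* c)) refl κ κ′ c a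
          lem₀ : 0# - 0# ≡ 0#
          lem₀ = solve 0 (:0 :- :0 := :0) refl
        c0 : c 0 ≡ 0#
        c0 = trans (coef-0 z u₀) (trans (cong f (lem (L (y ⊕ κ ⊙ ξ)))) (h 0#))
          where
          lem : ∀ w → z ≡ z ⊕ 0# ⊙ w
          lem w = vsolve [] (z ∷ w ∷ []) (λ { [] (z ∷ w ∷ []) → z :≋ z :⊕ :0 :⊙ w }) refl
        few : c 1 ≡ 0# → ⊥
        few c1 = ℕₚ.<-irrefl refl (ℕₚ.≤-trans (ℕₚ.≤-reflexive (trans q″ (sym (full x)))) (ℕₚ.≤-trans (∑-mono K.list pointwise)
            (ℕₚ.≤-trans (ℕₚ.≤-reflexive (∑-+ K.list (λ s → χ (s ≟ 0#)) (λ s → χ (evalN (suc m) (c ∘ suc ∘ suc) s ≟ 0#))))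
              (ℕₚ.+-mono-≤ (ℕₚ.≤-reflexive (K.once 0#)) (roots-bound m (c ∘ suc ∘ suc) m ℕₚ.≤-refl (λ e → β≢0 (trans (sym (evalN-top x ξ)) (trans (cong c (sym q″)) e))))))))
          where
          m = q ∸ 2
          q″ : suc (suc m) ≡ q
          q″ = ℕₚ.m+[n∸m]≡n (ℕₚ.<⇒≤ 3≤q)
          factor : ∀ s → f (z ⊕ s ⊙ u₀) ≡ s * (s * evalN (suc m) (c ∘ suc ∘ suc) s)
          factor s = trans (line-q z ξ s) (trans (cong (λ m → evalN (suc m) c s) (sym q″))
            (trans (cong₂ (λ a b → a + s * (b + s * evalN (suc m) (c ∘ suc ∘ suc) s)) c0 c1) (lem (evalN (suc m) (c ∘ suc ∘ suc) s))))
            where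
            lem : ∀ e → 0# + s * (0# + s * e) ≡ s * (s * e)
            lem e = solve 2 (λ s e → :0 :+ s :* (:0 :+ s :* e) := s :* (s :* e)) refl s e
          pointwise : ∀ s → χ (f (z ⊕ s ⊙ u₀) ≟ 0#) ≤ χ (s ≟ 0#) ℕ.+ χ (evalN (suc m) (c ∘ suc ∘ suc) s ≟ 0#)
          pointwise s with s ≟ 0#
          ... | yes _ = ℕₚ.≤-trans (χ≤1 (f (z ⊕ s ⊙ u₀) ≟ 0#)) (ℕₚ.m≤m+n 1 _)
          ... | no nz = χ-mono (f (z ⊕ s ⊙ u₀) ≟ 0#) (evalN (suc m) (c ∘ suc ∘ suc) s ≟ 0#)
                          (λ e → *-integral nz (*-integral nz (trans (sym (factor s)) e)))

      -- Zero lines of different slopes through two zeros of v + x + K u₀ would meet.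
      slope-constant : ∀ x y s s′ κ κ′ →
        (∀ r → f (v ⊕ L (x ⊕ s ⊙ ξ) ⊕ r ⊙ L (y ⊕ κ ⊙ ξ)) ≡ 0#) → (∀ r → f (v ⊕ L (x ⊕ s′ ⊙ ξ) ⊕ r ⊙ L (y ⊕ κ′ ⊙ ξ)) ≡ 0#) → κ ≡ κ′
      slope-constant x y s s′ κ κ′ h h′ = decidable-stable (κ ≟ κ′) λ ne → ne (at-meeting ne)
        where
        module _ (ne : κ ≢ κ′) where
          -- The solution of s + rκ = s′ + rκ′, where the two lines meet.
          r = (s′ - s) * (difference-nonzero ne ⁻¹)
          w w′ : Vec Carrier k
          w = (x ⊕ s ⊙ ξ) ⊕ r ⊙ (y ⊕ κ ⊙ ξ)
          w′ = (x ⊕ s′ ⊙ ξ) ⊕ r ⊙ (y ⊕ κ′ ⊙ ξ)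
          w≡w′ : w ≡ w′
          w≡w′ = trans lem₁ (trans (cong (λ a → (x ⊕ r ⊙ y) ⊕ a ⊙ ξ) coefficient) (sym lem₂))
            where
            lem₁ : (x ⊕ s ⊙ ξ) ⊕ r ⊙ (y ⊕ κ ⊙ ξ) ≡ (x ⊕ r ⊙ y) ⊕ (s + r * κ) ⊙ ξ
            lem₁ = vsolve (s ∷ r ∷ κ ∷ []) (x ∷ ξ ∷ y ∷ []) (λ { (s ∷ r ∷ κ ∷ []) (x ∷ ξ ∷ y ∷ []) → x :⊕ s :⊙ ξ :⊕ r :⊙ (y :⊕ κ :⊙ ξ) :≋ x :⊕ r :⊙ y :⊕ (s :+ r :* κ) :⊙ ξ }) refl
            lem₂ : (x ⊕ s′ ⊙ ξ) ⊕ r ⊙ (y ⊕ κ′ ⊙ ξ) ≡ (x ⊕ r ⊙ y) ⊕ (s′ + r * κ′) ⊙ ξ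
            lem₂ = vsolve (s′ ∷ r ∷ κ′ ∷ []) (x ∷ ξ ∷ y ∷ []) (λ { (s′ ∷ r ∷ κ′ ∷ []) (x ∷ ξ ∷ y ∷ []) → x :⊕ s′ :⊙ ξ :⊕ r :⊙ (y :⊕ κ′ :⊙ ξ) :≋ x :⊕ r :⊙ y :⊕ (s′ :+ r :* κ′) :⊙ ξ }) refl
            coefficient : s + r * κ ≡ s′ + r * κ′
            coefficient = trans (lem₃ (difference-nonzero ne ⁻¹)) (trans (cong (λ a → s + (s′ - s) * a + r * κ′) (⁻¹-inverse (difference-nonzero ne))) lem₄)
              where
              lem₃ : ∀ i → s + (s′ - s) * i * κ ≡ s + (s′ - s) * ((κ - κ′) * i) + (s′ - s) * i * κ′
              lem₃ i = solve 5 (λ s s′ i κ κ′ → s :+ (s′ :- s) :* i :* κ := s :+ (s′ :- s) :* ((κ :- κ′) :* i) :+ (s′ :- s) :* i :* κ′) refl s s′ i κ κ′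
              lem₄ : s + (s′ - s) * 1# + r * κ′ ≡ s′ + r * κ′
              lem₄ = solve 4 (λ s s′ r κ′ → s :+ (s′ :- s) :* :1 :+ r :* κ′ := s′ :+ r :* κ′) refl s s′ r κ′
          through : ∀ s κ r → (∀ r → f (v ⊕ L (x ⊕ s ⊙ ξ) ⊕ r ⊙ L (y ⊕ κ ⊙ ξ)) ≡ 0#) → ∀ t → f (v ⊕ L ((x ⊕ s ⊙ ξ) ⊕ r ⊙ (y ⊕ κ ⊙ ξ)) ⊕ t ⊙ L (y ⊕ κ ⊙ ξ)) ≡ 0#
          through s κ r h t = trans (cong f (trans (cong (_⊕ t ⊙ L (y ⊕ κ ⊙ ξ)) (L-⊕ v (x ⊕ s ⊙ ξ) r (y ⊕ κ ⊙ ξ))) (lem (v ⊕ L (x ⊕ s ⊙ ξ)) (L (y ⊕ κ ⊙ ξ))))) (h (r + t))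
            where
            lem : ∀ a c → a ⊕ r ⊙ c ⊕ t ⊙ c ≡ a ⊕ (r + t) ⊙ c
            lem a c = vsolve (r ∷ t ∷ []) (a ∷ c ∷ []) (λ { (r ∷ t ∷ []) (a ∷ c ∷ []) → a :⊕ r :⊙ c :⊕ t :⊙ c :≋ a :⊕ (r :+ t) :⊙ c }) refl
          at-meeting : κ ≡ κ′
          at-meeting = slope-unique w y κ κ′ (through s κ r h)
            (λ t → trans (cong (λ w → f (v ⊕ L w ⊕ t ⊙ L (y ⊕ κ′ ⊙ ξ))) w≡w′) (through s′ κ′ r h′ t))

      -- All zeros on v + x + K u₀ have the same slope, so moving along that direction carries these
      -- q zeros to zeros. The polynomials of degree q before and after the move share q roots and
      -- the leading coefficient, hence coincide.
      invariant-direction : ∀ x y → Σ Carrier λ κ → ∀ r s → f (v ⊕ L x ⊕ r ⊙ L (y ⊕ κ ⊙ ξ) ⊕ s ⊙ u₀) ≡ f (v ⊕ L x ⊕ s ⊙ u₀)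
      invariant-direction x y = κ , λ r s → trans (line-q (z′ r) ξ s) (trans (same r s) (sym (line-q z ξ s)))
        where
        z = v ⊕ L x
        root : Σ Carrier λ s → f (z ⊕ s ⊙ u₀) ≡ 0#
        root = ∑-search K.list (λ s → f (z ⊕ s ⊙ u₀) ≟ 0#) (subst (1 ≤_) (sym (full x)) 1≤q)
        slopeAt : ∀ s → f (z ⊕ s ⊙ u₀) ≡ 0# → Σ Carrier λ κ → ∀ r → f (v ⊕ L (x ⊕ s ⊙ ξ) ⊕ r ⊙ L (y ⊕ κ ⊙ ξ)) ≡ 0#
        slopeAt s e = slope (x ⊕ s ⊙ ξ) y (trans (cong f (L-⊕ v x s ξ)) e)
        κ = proj₁ (slopeAt (proj₁ root) (proj₂ root))
        z′ : Carrier → V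
        z′ r = z ⊕ r ⊙ L (y ⊕ κ ⊙ ξ)
        shifted : ∀ r s → f (z ⊕ s ⊙ u₀) ≡ 0# → f (z′ r ⊕ s ⊙ u₀) ≡ 0#
        shifted r s e = trans (cong f (trans (lem z (L (y ⊕ κ ⊙ ξ)) u₀) (cong (_⊕ r ⊙ L (y ⊕ κ ⊙ ξ)) (sym (L-⊕ v x s ξ)))))
          (subst (λ κ → f (v ⊕ L (x ⊕ s ⊙ ξ) ⊕ r ⊙ L (y ⊕ κ ⊙ ξ)) ≡ 0#)
            (slope-constant x y s (proj₁ root) (proj₁ (slopeAt s e)) κ (proj₂ (slopeAt s e)) (proj₂ (slopeAt (proj₁ root) (proj₂ root))))
            (proj₂ (slopeAt s e) r))
          where
          lem : ∀ a c d → a ⊕ r ⊙ c ⊕ s ⊙ d ≡ a ⊕ s ⊙ d ⊕ r ⊙ c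
          lem a c d = vsolve (r ∷ s ∷ []) (a ∷ c ∷ d ∷ []) (λ { (r ∷ s ∷ []) (a ∷ c ∷ d ∷ []) → a :⊕ r :⊙ c :⊕ s :⊙ d :≋ a :⊕ s :⊙ d :⊕ r :⊙ c }) refl
        same : ∀ r s → evalN (suc q) (coef (z′ r) u₀) s ≡ evalN (suc q) (coef z u₀) s
        same r s = difference-zero (trans (sym (evalN-difference (suc q) (coef (z′ r) u₀) (coef z u₀) s)) (trans (drop-top q e s top) (vanish q e enough s)))
          where
          e : ℕ → Carrier
          e j = coef (z′ r) u₀ j - coef z u₀ j
          top : e q ≡ 0#
          top = trans (cong₂ _-_ (trans (cong (λ w → coef w u₀ q) (sym (L-⊕ v x r (y ⊕ κ ⊙ ξ)))) (evalN-top (x ⊕ r ⊙ (y ⊕ κ ⊙ ξ)) ξ)) (evalN-top x ξ)) lem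
            where
            lem : B u₀ v - B u₀ v ≡ 0#
            lem = solve 1 (λ b → b :- b := :0) refl (B u₀ v)
          enough : q ≤ roots q e
          enough = ℕₚ.≤-trans (ℕₚ.≤-reflexive (sym (full x))) (∑-mono K.list (λ s → χ-mono (f (z ⊕ s ⊙ u₀) ≟ 0#) (evalN q e s ≟ 0#) (λ h →
            trans (sym (drop-top q e s top)) (trans (evalN-difference (suc q) (coef (z′ r) u₀) (coef z u₀) s)
              (trans (cong₂ _-_ (trans (sym (line-q (z′ r) ξ s)) (shifted r s h)) (trans (sym (line-q z ξ s)) h)) lem)))))
            where
            lem : 0# - 0# ≡ 0#
            lem = solve 0 (:0 :- :0 := :0) refl

      -- Translation by y acts like translation by -κu₀. Comparing coefficients of s^q gives (-κ)^q
      -- B(u₀,v) = B(y,v) = 0, so κ = 0 and y itself is an invariant direction.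
      invariance : ∀ y → B (L y) v ≡ 0# → ∀ x → f (v ⊕ L x ⊕ L y) ≡ f (v ⊕ L x)
      invariance y Byv x = trans (cong f lem₁) (trans (h 1# 0#) (cong f lem₂))
        where
        z = v ⊕ L x
        κ = proj₁ (invariant-direction x y)
        h = proj₂ (invariant-direction x y)
        power : pow (- κ) q * B u₀ v ≡ 0#
        power = trans (cong (pow (- κ) q *_) (sym (evalN-top x ξ))) (trans (sym (coef-scale z u₀ (- κ) q (ℕₚ.n≤1+n q)))
          (trans (sym (coef-cong-line z (L y) z ((- κ) ⊙ u₀) along q (ℕₚ.n≤1+n q))) (trans (evalN-top x y) Byv)))
          where
          along : ∀ r → f (z ⊕ r ⊙ L y) ≡ f (z ⊕ r ⊙ ((- κ) ⊙ u₀))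
          along r = trans (cong f (trans (lem₁ z (L y) u₀ r) (cong (λ w → z ⊕ r ⊙ w ⊕ (- (r * κ)) ⊙ u₀) (sym (lincomb-addscale y ξ κ b))))) (trans (h r (- (r * κ))) (cong f (lem₂ z u₀ r)))
            where
            lem₁ : ∀ z a c r → z ⊕ r ⊙ a ≡ z ⊕ r ⊙ (a ⊕ κ ⊙ c) ⊕ (- (r * κ)) ⊙ c
            lem₁ z a c r = vsolve (r ∷ κ ∷ []) (z ∷ a ∷ c ∷ []) (λ { (r ∷ κ ∷ []) (z ∷ a ∷ c ∷ []) → z :⊕ r :⊙ a :≋ z :⊕ r :⊙ (a :⊕ κ :⊙ c) :⊕ (:- (r :* κ)) :⊙ c }) refl
            lem₂ : ∀ z c r → z ⊕ (- (r * κ)) ⊙ c ≡ z ⊕ r ⊙ ((- κ) ⊙ c)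
            lem₂ z c r = vsolve (r ∷ κ ∷ []) (z ∷ c ∷ []) (λ { (r ∷ κ ∷ []) (z ∷ c ∷ []) → z :⊕ (:- (r :* κ)) :⊙ c :≋ z :⊕ r :⊙ (:- κ) :⊙ c }) refl
        κ≡0 : κ ≡ 0#
        κ≡0 = decidable-stable (κ ≟ 0#) λ nz → *-nonzero (pow-nonzero q (λ e → nz (trans (lem κ) (trans (cong -_ e) lem′)))) β≢0 power
          where
          lem : ∀ a → a ≡ - (- a)
          lem a = solve 1 (λ a → a := :- (:- a)) refl a
          lem′ : - 0# ≡ 0#
          lem′ = solve 0 (:- :0 := :0) refl
        lem₁ : v ⊕ L x ⊕ L y ≡ z ⊕ 1# ⊙ L (y ⊕ κ ⊙ ξ) ⊕ 0# ⊙ u₀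
        lem₁ = trans (lem z (L y) u₀) (cong (λ w → z ⊕ 1# ⊙ L w ⊕ 0# ⊙ u₀) (trans lem′ (cong (λ a → y ⊕ a ⊙ ξ) (sym κ≡0))))
          where
          lem : ∀ z a c → z ⊕ a ≡ z ⊕ 1# ⊙ a ⊕ 0# ⊙ c
          lem z a c = vsolve [] (z ∷ a ∷ c ∷ []) (λ { [] (z ∷ a ∷ c ∷ []) → z :⊕ a :≋ z :⊕ :1 :⊙ a :⊕ :0 :⊙ c }) refl
          lem′ : y ≡ y ⊕ 0# ⊙ ξ
          lem′ = vsolve [] (y ∷ ξ ∷ []) (λ { [] (y ∷ ξ ∷ []) → y :≋ y :⊕ :0 :⊙ ξ }) refl
        lem₂ : z ⊕ 0# ⊙ u₀ ≡ z
        lem₂ = vsolve [] (z ∷ u₀ ∷ []) (λ { [] (z ∷ u₀ ∷ []) → z :⊕ :0 :⊙ u₀ :≋ z }) refl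

      -- Modulo translations leaving f unchanged on v + U, y equals -κξ, so B(y,v) = (-κ)^q B(u₀,v).
      -- Sliding along both invariant directions shows that y + y′ belongs to κ + κ′, and the q-th
      -- power is additive.
      additivity : ∀ y y′ → B (L (y ⊕ y′)) v ≡ B (L y) v + B (L y′) v
      additivity y y′ = begin
        B (L (y ⊕ y′)) v                                            ≡⟨ along (y ⊕ y′) (κ + κ′) both ⟩
        pow (- (κ + κ′)) q * B u₀ v                                 ≡⟨ cong (λ a → pow a q * B u₀ v) (lem κ κ′) ⟩
        pow (- κ + - κ′) q * B u₀ v                                 ≡⟨ cong (_* B u₀ v) (frobenius (- κ) (- κ′)) ⟩
        (pow (- κ) q + pow (- κ′) q) * B u₀ v                       ≡⟨ lem′ (pow (- κ) q) (pow (- κ′) q) (B u₀ v) ⟩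
        pow (- κ) q * B u₀ v + pow (- κ′) q * B u₀ v                ≡⟨ sym (cong₂ _+_ (along y κ (one y)) (along y′ κ′ (one y′))) ⟩
        B (L y) v + B (L y′) v                                      ∎
        where
        open ≡-Reasoning
        lem : ∀ a c → - (a + c) ≡ - a + - c
        lem a c = solve 2 (λ a c → :- (a :+ c) := (:- a) :+ (:- c)) refl a c
        lem′ : ∀ a c d → (a + c) * d ≡ a * d + c * d
        lem′ a c d = solve 3 (λ a c d → (a :+ c) :* d := a :* d :+ c :* d) refl a c d
        slopeOf : Vec Carrier k → Carrier
        slopeOf y = proj₁ (invariant-direction 𝟎 y)
        κ = slopeOf y
        κ′ = slopeOf y′
        v+L𝟎 : v ⊕ L 𝟎 ≡ v
        v+L𝟎 = trans (cong (v ⊕_) (lincomb-𝟎 b)) lem₀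
          where
          lem₀ : v ⊕ 𝟎 ≡ v
          lem₀ = vsolve [] (v ∷ []) (λ { [] (v ∷ []) → v :⊕ :𝟎 :≋ v }) refl
        -- Along an invariant direction f is constant from v on, so its coefficient of s^q vanishes;
        -- this makes `invariance` applicable at every point of the coset.
        flat : ∀ y → B (L (y ⊕ slopeOf y ⊙ ξ)) v ≡ 0#
        flat y = trans (sym (coef-q v (L (y ⊕ slopeOf y ⊙ ξ)))) (trans (coef-unique v (L (y ⊕ slopeOf y ⊙ ξ)) (cons (f v) (λ _ → 0#)) constant-along q (ℕₚ.n≤1+n q)) (at-q q 1≤q))
          where
          at-q : ∀ j → 1 ≤ j → cons (f v) (λ _ → 0#) j ≡ 0#
          at-q (suc j) _ = refl
          constant-along : ∀ r → f (v ⊕ r ⊙ L (y ⊕ slopeOf y ⊙ ξ)) ≡ evalN (suc (suc q)) (cons (f v) (λ _ → 0#)) r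
          constant-along r = trans (cong f (trans (cong (_⊕ r ⊙ L (y ⊕ slopeOf y ⊙ ξ)) (sym v+L𝟎)) (lem₁ (v ⊕ L 𝟎) (L (y ⊕ slopeOf y ⊙ ξ)) u₀)))
            (trans (proj₂ (invariant-direction 𝟎 y) r 0#) (trans (cong f (trans (lem₂ (v ⊕ L 𝟎) u₀) v+L𝟎))
              (sym (trans (cong (λ a → f v + r * a) (evalN-zero (suc q) (λ _ → 0#) r (λ _ _ → refl))) (lem₃ (f v))))))
            where
            lem₁ : ∀ z a c → z ⊕ r ⊙ a ≡ z ⊕ r ⊙ a ⊕ 0# ⊙ c
            lem₁ z a c = vsolve (r ∷ []) (z ∷ a ∷ c ∷ []) (λ { (r ∷ []) (z ∷ a ∷ c ∷ []) → z :⊕ r :⊙ a :≋ z :⊕ r :⊙ a :⊕ :0 :⊙ c }) refl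
            lem₂ : ∀ z c → z ⊕ 0# ⊙ c ≡ z
            lem₂ z c = vsolve [] (z ∷ c ∷ []) (λ { [] (z ∷ c ∷ []) → z :⊕ :0 :⊙ c :≋ z }) refl
            lem₃ : ∀ a → a + r * 0# ≡ a
            lem₃ a = solve 2 (λ a r → a :+ r :* :0 := a) refl a r
        slide : ∀ y x r → f (v ⊕ L (x ⊕ r ⊙ (y ⊕ slopeOf y ⊙ ξ))) ≡ f (v ⊕ L x)
        slide y x r = trans (cong f eq) (invariance (r ⊙ (y ⊕ slopeOf y ⊙ ξ)) scaled x)
          where
          scaled : B (L (r ⊙ (y ⊕ slopeOf y ⊙ ξ))) v ≡ 0#
          scaled = trans (cong (λ w → B w v) (lincomb-⊙ r (y ⊕ slopeOf y ⊙ ξ) b)) (trans (B-scaleˡ r _ v) (trans (cong (pow r q *_) (flat y)) (zeroʳ _)))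
          eq : v ⊕ L (x ⊕ r ⊙ (y ⊕ slopeOf y ⊙ ξ)) ≡ v ⊕ L x ⊕ L (r ⊙ (y ⊕ slopeOf y ⊙ ξ))
          eq = trans (L-⊕ v x r (y ⊕ slopeOf y ⊙ ξ)) (cong (v ⊕ L x ⊕_) (sym (lincomb-⊙ r (y ⊕ slopeOf y ⊙ ξ) b)))
        along : ∀ w κ → (∀ r → f (v ⊕ L (r ⊙ w)) ≡ f (v ⊕ L ((- (r * κ)) ⊙ ξ))) → B (L w) v ≡ pow (- κ) q * B u₀ v
        along w κ h = trans (sym (coef-q v (L w))) (trans (coef-cong-line v (L w) v ((- κ) ⊙ u₀) lines q (ℕₚ.n≤1+n q))
            (trans (coef-scale v u₀ (- κ) q (ℕₚ.n≤1+n q)) (cong (pow (- κ) q *_) (coef-q v u₀))))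
          where
          lines : ∀ r → f (v ⊕ r ⊙ L w) ≡ f (v ⊕ r ⊙ ((- κ) ⊙ u₀))
          lines r = trans (cong (λ a → f (v ⊕ a)) (sym (lincomb-⊙ r w b))) (trans (h r) (cong (λ a → f (v ⊕ a)) (trans (lincomb-⊙ (- (r * κ)) ξ b) (lem₁ u₀))))
            where
            lem₁ : ∀ c → (- (r * κ)) ⊙ c ≡ r ⊙ ((- κ) ⊙ c)
            lem₁ c = vsolve (r ∷ κ ∷ []) (c ∷ []) (λ { (r ∷ κ ∷ []) (c ∷ []) → (:- (r :* κ)) :⊙ c :≋ r :⊙ (:- κ) :⊙ c }) refl
        one : ∀ y r → f (v ⊕ L (r ⊙ y)) ≡ f (v ⊕ L ((- (r * slopeOf y)) ⊙ ξ))
        one y r = trans (cong (λ w → f (v ⊕ L w)) (lem₁ (slopeOf y))) (slide y ((- (r * slopeOf y)) ⊙ ξ) r)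
          where
          lem₁ : ∀ κ → r ⊙ y ≡ (- (r * κ)) ⊙ ξ ⊕ r ⊙ (y ⊕ κ ⊙ ξ)
          lem₁ κ = vsolve (r ∷ κ ∷ []) (y ∷ ξ ∷ []) (λ { (r ∷ κ ∷ []) (y ∷ ξ ∷ []) → r :⊙ y :≋ (:- (r :* κ)) :⊙ ξ :⊕ r :⊙ (y :⊕ κ :⊙ ξ) }) refl
        both : ∀ r → f (v ⊕ L (r ⊙ (y ⊕ y′))) ≡ f (v ⊕ L ((- (r * (κ + κ′))) ⊙ ξ))
        both r = trans (cong (λ w → f (v ⊕ L w)) (lem₁ κ κ′)) (trans (slide y′ ((- (r * (κ + κ′))) ⊙ ξ ⊕ r ⊙ (y ⊕ κ ⊙ ξ)) r) (slide y ((- (r * (κ + κ′))) ⊙ ξ) r))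
          where
          lem₁ : ∀ κ κ′ → r ⊙ (y ⊕ y′) ≡ (- (r * (κ + κ′))) ⊙ ξ ⊕ r ⊙ (y ⊕ κ ⊙ ξ) ⊕ r ⊙ (y′ ⊕ κ′ ⊙ ξ)
          lem₁ κ κ′ = vsolve (r ∷ κ ∷ κ′ ∷ []) (y ∷ y′ ∷ ξ ∷ []) (λ { (r ∷ κ ∷ κ′ ∷ []) (y ∷ y′ ∷ ξ ∷ []) → r :⊙ (y :⊕ y′) :≋ (:- (r :* (κ :+ κ′))) :⊙ ξ :⊕ r :⊙ (y :⊕ κ :⊙ ξ) :⊕ r :⊙ (y′ :⊕ κ′ :⊙ ξ) }) refl

    private
      Q>0 : 0 < Q
      Q>0 = ℕₚ.<⇒≤ 1<Q

      instance
        Q≢0 : ℕ.NonZero Q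
        Q≢0 = ℕ.>-nonZero Q>0

      Q^k>0 : 0 < Q ℕ.^ k
      Q^k>0 = ℕₚ.m^n>0 Q k

      instance
        Q^k≢0 : ℕ.NonZero (Q ℕ.^ k)
        Q^k≢0 = ℕ.>-nonZero Q^k>0

    -- Kernel, exceptional vectors and the weighted count.

    InU : V → Set
    InU v = Σ (Vec Carrier k) λ x → v ≡ L x

    InU? : ∀ v → Dec (InU v)
    InU? v = X.search (λ x → Y._≟_ v (L x))

    Contained : V → Set
    Contained v = ∀ x → f (v ⊕ L x) ≡ 0#

    Contained? : ∀ v → Dec (Contained v)
    Contained? v = X.decideAll (λ x → f (v ⊕ L x) ≟ 0#)

    Kernel : V → Set
    Kernel v = ∀ y → B (L y) v ≡ 0#

    Kernel? : ∀ v → Dec (Kernel v)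
    Kernel? v = X.decideAll (λ y → B (L y) v ≟ 0#)

    InU⇒Kernel : ∀ {v} → InU v → Kernel v
    InU⇒Kernel (x , refl) y = B-L-L y x

    count-InU : Y.count InU? ≤ Q ℕ.^ k
    count-InU = begin
      Y.count InU?                                       ≤⟨ ∑-mono Y.list some ⟩
      Y.sum (λ v → X.count (λ x → Y._≟_ v (L x)))        ≡⟨ ∑-swap Y.list X.list (λ v x → χ (Y._≟_ v (L x))) ⟩
      X.sum (λ x → Y.count (λ v → Y._≟_ v (L x)))        ≡⟨ ∑-cong X.list (λ x → Y.once (L x)) ⟩
      X.sum (λ _ → 1)                                    ≡⟨ size-X ⟩
      Q ℕ.^ k                                            ∎
      where
      open ℕₚ.≤-Reasoning
      some : ∀ v → χ (InU? v) ≤ X.count (λ x → Y._≟_ v (L x))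
      some v with InU? v
      ... | no _ = z≤n
      ... | yes (x , e) = ℕₚ.≤-trans (ℕₚ.≤-reflexive (sym (χ-yes (Y._≟_ v (L x)) e))) (X.member {λ x → χ (Y._≟_ v (L x))} x)

    fibre≤ : ∀ v → fibre v ≤ Q ℕ.^ k
    fibre≤ v = ℕₚ.≤-trans (∑-mono X.list (λ x → χ≤1 (f (v ⊕ L x) ≟ 0#))) (ℕₚ.≤-reflexive size-X)

    outside : ∀ v → ¬ Contained v → Σ (Vec Carrier k) λ x → f (v ⊕ L x) ≢ 0#
    outside v nc = X.find (λ x → ¬? (f (v ⊕ L x) ≟ 0#)) (λ none → nc (λ x → decidable-stable (f (v ⊕ L x) ≟ 0#) (none x)))

    kernel-fibre : ∀ v → ¬ Contained v → Kernel v → suc q ℕ.* fibre v ≤ Q ℕ.^ k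
    kernel-fibre v nc = fibre-bound-degenerate v (proj₁ (outside v nc)) (proj₂ (outside v nc))

    Q≤q*[q+1] : Q ≤ q ℕ.* suc q
    Q≤q*[q+1] = subst (_≤ q ℕ.* suc q) (sym Q≡q²) (ℕₚ.*-monoʳ-≤ q (ℕₚ.n≤1+n q))

    not-kernel : ∀ v → ¬ Kernel v → Σ (Vec Carrier k) λ y → B (L y) v ≢ 0#
    not-kernel v nk = X.find (λ y → ¬? (B (L y) v ≟ 0#)) (λ none → nk (λ y → decidable-stable (B (L y) v ≟ 0#) (none y)))

    fibre-max : ∀ v → ¬ Contained v → Q ℕ.* fibre v ≤ Q ℕ.^ k ℕ.* q
    fibre-max v nc with Kernel? v
    ... | no nk = fibre-bound v (proj₁ (not-kernel v nk)) (proj₂ (not-kernel v nk))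
    ... | yes ke = begin
      Q ℕ.* fibre v              ≤⟨ ℕₚ.*-monoˡ-≤ (fibre v) Q≤q*[q+1] ⟩
      q ℕ.* suc q ℕ.* fibre v    ≡⟨ ℕₚ.*-assoc q (suc q) (fibre v) ⟩
      q ℕ.* (suc q ℕ.* fibre v)  ≤⟨ ℕₚ.*-monoʳ-≤ q (kernel-fibre v nc ke) ⟩
      q ℕ.* Q ℕ.^ k              ≡⟨ ℕₚ.*-comm q (Q ℕ.^ k) ⟩
      Q ℕ.^ k ℕ.* q              ∎
      where open ℕₚ.≤-Reasoning

    module Good (v : V) (good : Q ℕ.* fibre v ≡ Q ℕ.^ k ℕ.* q) where

      not-contained : ¬ Contained v
      not-contained c = ℕₚ.<-irrefl (sym good) (begin-strict
        Q ℕ.^ k ℕ.* q    <⟨ ℕₚ.*-monoʳ-< (Q ℕ.^ k) (ℕₚ.≤-trans (ℕₚ.n≤1+n (suc q)) q+2≤Q) ⟩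
        Q ℕ.^ k ℕ.* Q    ≡⟨ ℕₚ.*-comm (Q ℕ.^ k) Q ⟩
        Q ℕ.* Q ℕ.^ k    ≡⟨ cong (Q ℕ.*_) (trans (sym size-X) (∑-cong X.list (λ x → sym (χ-yes (f (v ⊕ L x) ≟ 0#) (c x))))) ⟩
        Q ℕ.* fibre v    ∎)
        where open ℕₚ.≤-Reasoning

      good-not-kernel : ¬ Kernel v
      good-not-kernel ke = ℕₚ.<-irrefl refl (begin-strict
        Q ℕ.^ k ℕ.* Q                    ≡⟨ cong (Q ℕ.^ k ℕ.*_) Q≡q² ⟩
        Q ℕ.^ k ℕ.* (q ℕ.* q)            <⟨ ℕₚ.*-monoʳ-< (Q ℕ.^ k) (ℕₚ.*-monoʳ-< q {{ℕ.>-nonZero 1≤q}} (ℕₚ.n<1+n q)) ⟩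
        Q ℕ.^ k ℕ.* (q ℕ.* suc q)        ≡⟨ ℕₚ.*-assoc (Q ℕ.^ k) q (suc q) ⟨
        Q ℕ.^ k ℕ.* q ℕ.* suc q          ≡⟨ cong (ℕ._* suc q) (sym good) ⟩
        Q ℕ.* fibre v ℕ.* suc q          ≡⟨ trans (ℕₚ.*-assoc Q (fibre v) (suc q)) (cong (Q ℕ.*_) (ℕₚ.*-comm (fibre v) (suc q))) ⟩
        Q ℕ.* (suc q ℕ.* fibre v)        ≤⟨ ℕₚ.*-monoʳ-≤ Q (kernel-fibre v not-contained ke) ⟩
        Q ℕ.* Q ℕ.^ k                    ≡⟨ ℕₚ.*-comm Q (Q ℕ.^ k) ⟩
        Q ℕ.^ k ℕ.* Q                    ∎)
        where open ℕₚ.≤-Reasoning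

      ξ : Vec Carrier k
      ξ = proj₁ (not-kernel v good-not-kernel)

      β≢0 : B (L ξ) v ≢ 0#
      β≢0 = proj₂ (not-kernel v good-not-kernel)

      -- The line counts are at most q and by `good` their average is q, so none falls short.
      full : ∀ y → B (L y) v ≢ 0# → ∀ x → lineCount (v ⊕ L x) (L y) ≡ q
      full y ne x with lineCount (v ⊕ L x) (L y) ℕ.≟ q
      ... | yes e = e
      ... | no ¬e = ⊥-elim (ℕₚ.<-irrefl (trans (trans (fibre-average v y) good) (sym (trans (X.sum-const q) (cong (ℕ._* q) size-X))))
                      (X.sum-strict x (λ x → lineCount≤q v x y ne) (ℕₚ.≤∧≢⇒< (lineCount≤q v x y ne) ¬e)))

      open Plane v ξ β≢0 (full ξ β≢0) public
        using (invariance; additivity)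

    -- If some e in A has B(u,e) ≠ 0, every v in A can be moved into the zero set of B(u,·) by a
    -- multiple of e; hence one linear condition divides the size by at most Q.
    kernel-count : ∀ {A : V → Set} (A? : ∀ v → Dec (A v)) → (∀ v s w → A v → A w → A (v ⊕ s ⊙ w)) →
                   ∀ u → Y.count A? ≤ Q ℕ.* Y.count (λ v → A? v ×-dec (B u v ≟ 0#))
    kernel-count A? closed u with Y.search (λ v → A? v ×-dec ¬? (B u v ≟ 0#))
    ... | no none = ℕₚ.≤-trans (∑-mono Y.list (λ v → χ-mono (A? v) (A? v ×-dec (B u v ≟ 0#))
                      (λ a → a , decidable-stable (B u v ≟ 0#) (λ ne → none (v , a , ne))))) (ℕₚ.m≤n*m (Y.count (λ v → A? v ×-dec (B u v ≟ 0#))) Q)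
    ... | yes (e , a , ne) = begin
      Y.count A?                                                               ≤⟨ ∑-mono Y.list some ⟩
      Y.sum (λ v → K.sum (λ s → g (v ⊕ s ⊙ e)))                                ≡⟨ ∑-swap Y.list K.list (λ v s → g (v ⊕ s ⊙ e)) ⟩
      K.sum (λ s → Y.sum (λ v → g (v ⊕ s ⊙ e)))                                ≡⟨ ∑-cong K.list (λ s → sum-translate (s ⊙ e) g) ⟩
      K.sum (λ _ → Y.sum g)                                                    ≡⟨ K.sum-const (Y.sum g) ⟩
      Q ℕ.* Y.sum g                                                            ∎
      where
      open ℕₚ.≤-Reasoning
      g : V → ℕ
      g v = χ (A? v ×-dec (B u v ≟ 0#))
      some : ∀ v → χ (A? v) ≤ K.sum (λ s → g (v ⊕ s ⊙ e))
      some v with A? v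
      ... | no _   = z≤n
      ... | yes av = ℕₚ.≤-trans (ℕₚ.≤-reflexive (sym (χ-yes (A? (v ⊕ s ⊙ e) ×-dec (B u (v ⊕ s ⊙ e) ≟ 0#)) (closed v s e av a , zero-at))))
                       (K.member {λ s → g (v ⊕ s ⊙ e)} s)
        where
        s = - (B u v * (ne ⁻¹))
        zero-at : B u (v ⊕ s ⊙ e) ≡ 0#
        zero-at = trans (B-addscaleʳ u v e s) (trans (lem (B u v) (ne ⁻¹) (B u e)) (trans (cong (λ a → B u v - B u v * a) (⁻¹-inverse ne)) (lem′ (B u v))))
          where
          lem : ∀ a i c → a + (- (a * i)) * c ≡ a - a * (c * i)
          lem a i c = solve 3 (λ a i c → a :+ (:- (a :* i)) :* c := a :- a :* (c :* i)) refl a i c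
          lem′ : ∀ a → a - a * 1# ≡ 0#
          lem′ a = solve 1 (λ a → a :- a :* :1 := :0) refl a

    Annihilated : ∀ {m} → Vec V m → V → Set
    Annihilated []       v = ⊤
    Annihilated (u ∷ us) v = Annihilated us v × B u v ≡ 0#

    Annihilated? : ∀ {m} (us : Vec V m) v → Dec (Annihilated us v)
    Annihilated? []       v = yes tt
    Annihilated? (u ∷ us) v = Annihilated? us v ×-dec (B u v ≟ 0#)

    Annihilated-closed : ∀ {m} (us : Vec V m) v s w → Annihilated us v → Annihilated us w → Annihilated us (v ⊕ s ⊙ w)
    Annihilated-closed []       v s w _ _ = tt
    Annihilated-closed (u ∷ us) v s w (p , e) (p′ , e′) = Annihilated-closed us v s w p p′ ,
      trans (B-addscaleʳ u v w s) (trans (cong₂ (λ a c → a + s * c) e e′) lem)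
      where
      lem : 0# + s * 0# ≡ 0#
      lem = solve 1 (λ s → :0 :+ s :* :0 := :0) refl s

    annihilated-count : ∀ {m} (us : Vec V m) → Q ℕ.^ n ≤ Q ℕ.^ m ℕ.* Y.count (Annihilated? us)
    annihilated-count [] = ℕₚ.≤-reflexive (sym (trans (ℕₚ.*-identityˡ _) (size-vectors 𝔽 n)))
    annihilated-count {suc m} (u ∷ us) = begin
      Q ℕ.^ n                                                    ≤⟨ annihilated-count us ⟩
      Q ℕ.^ m ℕ.* Y.count (Annihilated? us)                      ≤⟨ ℕₚ.*-monoʳ-≤ (Q ℕ.^ m) (kernel-count (Annihilated? us) (Annihilated-closed us) u) ⟩
      Q ℕ.^ m ℕ.* (Q ℕ.* Y.count (Annihilated? (u ∷ us)))        ≡⟨ ℕₚ.*-assoc (Q ℕ.^ m) Q _ ⟨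
      Q ℕ.^ m ℕ.* Q ℕ.* Y.count (Annihilated? (u ∷ us))          ≡⟨ cong (ℕ._* Y.count (Annihilated? (u ∷ us))) (ℕₚ.*-comm (Q ℕ.^ m) Q) ⟩
      Q ℕ.^ suc m ℕ.* Y.count (Annihilated? (u ∷ us))            ∎
      where open ℕₚ.≤-Reasoning

    -- M is |U|/q, the maximal fibre outside U. The hypothesis `proper` says that U lies in no
    -- isotropic subspace of one dimension more.
    module Counting (M : ℕ) (Q*M : Q ℕ.* M ≡ Q ℕ.^ k ℕ.* q) (proper : ∀ v → ¬ InU v → ¬ Contained v) where

      fibre≤M : ∀ v → ¬ InU v → fibre v ≤ M
      fibre≤M v nu = ℕₚ.*-cancelˡ-≤ Q (ℕₚ.≤-trans (fibre-max v (proper v nu)) (ℕₚ.≤-reflexive (sym Q*M)))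

      -- Sums pointwise bounds: a vector outside U has at most M zeros, and at most M - e if it
      -- satisfies A. Vectors of U get the extra allowance |U|, which together with e ≤ M also
      -- covers those of them that satisfy A.
      weighted : ∀ {A : V → Set} (A? : ∀ v → Dec (A v)) e → e ≤ M → (∀ v → ¬ InU v → A v → fibre v ℕ.+ e ≤ M) →
                 Q ℕ.^ k ℕ.* zeros ℕ.+ e ℕ.* Y.count A? ≤ Q ℕ.^ n ℕ.* M ℕ.+ Q ℕ.^ k ℕ.* Q ℕ.^ k
      weighted A? e e≤M h = begin
        Q ℕ.^ k ℕ.* zeros ℕ.+ e ℕ.* Y.count A?                   ≡⟨ sym (cong₂ ℕ._+_ fibre-total (∑-*ˡ Y.list e (λ v → χ (A? v)))) ⟩
        Y.sum fibre ℕ.+ Y.sum (λ v → e ℕ.* χ (A? v))             ≡⟨ sym (∑-+ Y.list fibre (λ v → e ℕ.* χ (A? v))) ⟩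
        Y.sum (λ v → fibre v ℕ.+ e ℕ.* χ (A? v))                 ≤⟨ ∑-mono Y.list pointwise ⟩
        Y.sum (λ v → M ℕ.+ Q ℕ.^ k ℕ.* χ (InU? v))               ≡⟨ ∑-+ Y.list (λ _ → M) (λ v → Q ℕ.^ k ℕ.* χ (InU? v)) ⟩
        Y.sum (λ _ → M) ℕ.+ Y.sum (λ v → Q ℕ.^ k ℕ.* χ (InU? v)) ≡⟨ cong₂ ℕ._+_ (trans (Y.sum-const M) (cong (ℕ._* M) (size-vectors 𝔽 n))) (∑-*ˡ Y.list (Q ℕ.^ k) (λ v → χ (InU? v))) ⟩
        Q ℕ.^ n ℕ.* M ℕ.+ Q ℕ.^ k ℕ.* Y.count InU?               ≤⟨ ℕₚ.+-monoʳ-≤ (Q ℕ.^ n ℕ.* M) (ℕₚ.*-monoʳ-≤ (Q ℕ.^ k) count-InU) ⟩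
        Q ℕ.^ n ℕ.* M ℕ.+ Q ℕ.^ k ℕ.* Q ℕ.^ k                    ∎
        where
        open ℕₚ.≤-Reasoning
        e*χ≤ : ∀ v → e ℕ.* χ (A? v) ≤ e
        e*χ≤ v = ℕₚ.≤-trans (ℕₚ.*-monoʳ-≤ e (χ≤1 (A? v))) (ℕₚ.≤-reflexive (ℕₚ.*-identityʳ e))
        pointwise : ∀ v → fibre v ℕ.+ e ℕ.* χ (A? v) ≤ M ℕ.+ Q ℕ.^ k ℕ.* χ (InU? v)
        pointwise v with InU? v
        ... | yes _ = ℕₚ.≤-trans (ℕₚ.+-mono-≤ (fibre≤ v) (ℕₚ.≤-trans (e*χ≤ v) e≤M)) (ℕₚ.≤-reflexive (trans (ℕₚ.+-comm (Q ℕ.^ k) M) (cong (M ℕ.+_) (sym (ℕₚ.*-identityʳ (Q ℕ.^ k))))))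
        ... | no nu with A? v
        ...   | yes a = ℕₚ.≤-trans (ℕₚ.≤-reflexive (cong (fibre v ℕ.+_) (ℕₚ.*-identityʳ e))) (ℕₚ.≤-trans (h v nu a) (ℕₚ.m≤m+n M _))
        ...   | no _  = ℕₚ.+-mono-≤ (fibre≤M v nu) (ℕₚ.≤-reflexive (trans (ℕₚ.*-zeroʳ e) (sym (ℕₚ.*-zeroʳ (Q ℕ.^ k)))))

      Bad : V → Set
      Bad v = ¬ InU v × fibre v ≢ M

      Bad? : ∀ v → Dec (Bad v)
      Bad? v = ¬? (InU? v) ×-dec ¬? (fibre v ℕ.≟ M)

      M≥1 : 1 ≤ M
      M≥1 = positive M Q*M
        where
        positive : ∀ M → Q ℕ.* M ≡ Q ℕ.^ k ℕ.* q → 1 ≤ M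
        positive (suc M) _ = s≤s z≤n
        positive zero    e = ⊥-elim (ℕₚ.<-irrefl (trans (sym (ℕₚ.*-zeroʳ Q)) e) (ℕₚ.*-mono-≤ Q^k>0 1≤q))

      bad-count : Q ℕ.^ k ℕ.* zeros ℕ.+ Y.count Bad? ≤ Q ℕ.^ n ℕ.* M ℕ.+ Q ℕ.^ k ℕ.* Q ℕ.^ k
      bad-count = ℕₚ.≤-trans (ℕₚ.≤-reflexive (cong (Q ℕ.^ k ℕ.* zeros ℕ.+_) (sym (ℕₚ.*-identityˡ _))))
        (weighted Bad? 1 M≥1 (λ v nu (_ , ne) → subst (_≤ M) (ℕₚ.+-comm 1 (fibre v)) (ℕₚ.≤∧≢⇒< (fibre≤M v nu) ne)))

      not-bad : ∀ v → ¬ InU v → ¬ Bad v → Q ℕ.* fibre v ≡ Q ℕ.^ k ℕ.* q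
      not-bad v nu nb = trans (cong (Q ℕ.*_) (decidable-stable (fibre v ℕ.≟ M) (λ ne → nb (nu , ne)))) Q*M

      module Additive (β : ℕ) (few-bad : Y.count Bad? ≤ β) (many : Q ℕ.^ k ℕ.+ β ℕ.+ Q ℕ.^ (n ∸ 1) < Q ℕ.^ n) where

        -- The defect of additivity is linear in v and vanishes at every good v, hence at more than Q^(n-1) vectors.
        B-additive : ∀ y y′ v → B (L (y ⊕ y′)) v ≡ B (L y) v + B (L y′) v
        B-additive y y′ v₀ = difference-zero (decidable-stable (λ₀ v₀ ≟ 0#) λ ne → ℕₚ.<-irrefl refl (ℕₚ.<-≤-trans many (begin
          Q ℕ.^ n                                                            ≡⟨ size-vectors 𝔽 n ⟨
          Y.sum (λ _ → 1)                                                    ≤⟨ ∑-mono Y.list cover ⟩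
          Y.sum (λ v → χ (InU? v) ℕ.+ χ (Bad? v) ℕ.+ χ (λ₀ v ≟ 0#))          ≡⟨ ∑-+ Y.list (λ v → χ (InU? v) ℕ.+ χ (Bad? v)) (λ v → χ (λ₀ v ≟ 0#)) ⟩
          Y.sum (λ v → χ (InU? v) ℕ.+ χ (Bad? v)) ℕ.+ Y.count (λ v → λ₀ v ≟ 0#) ≡⟨ cong (ℕ._+ Y.count (λ v → λ₀ v ≟ 0#)) (∑-+ Y.list (λ v → χ (InU? v)) (λ v → χ (Bad? v))) ⟩
          Y.count InU? ℕ.+ Y.count Bad? ℕ.+ Y.count (λ v → λ₀ v ≟ 0#)        ≤⟨ ℕₚ.+-mono-≤ (ℕₚ.+-mono-≤ count-InU few-bad) (hyperplane ne) ⟩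
          Q ℕ.^ k ℕ.+ β ℕ.+ Q ℕ.^ (n ∸ 1)                                    ∎)))
          where
          open ℕₚ.≤-Reasoning
          λ₀ : V → Carrier
          λ₀ v = B (L (y ⊕ y′)) v - (B (L y) v + B (L y′) v)
          cover : ∀ v → 1 ≤ χ (InU? v) ℕ.+ χ (Bad? v) ℕ.+ χ (λ₀ v ≟ 0#)
          cover v = by (InU? v) (Bad? v)
            where
            lem : ∀ a → a - a ≡ 0#
            lem a = solve 1 (λ a → a :- a := :0) refl a
            by : Dec (InU v) → Dec (Bad v) → 1 ≤ χ (InU? v) ℕ.+ χ (Bad? v) ℕ.+ χ (λ₀ v ≟ 0#)
            by (yes u) _       = ℕₚ.≤-trans (ℕₚ.≤-reflexive (sym (χ-yes (InU? v) u))) (ℕₚ.≤-trans (ℕₚ.m≤m+n _ (χ (Bad? v))) (ℕₚ.m≤m+n _ (χ (λ₀ v ≟ 0#))))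
            by (no nu) (yes p) = ℕₚ.≤-trans (ℕₚ.≤-reflexive (sym (χ-yes (Bad? v) p))) (ℕₚ.≤-trans (ℕₚ.m≤n+m _ (χ (InU? v))) (ℕₚ.m≤m+n _ (χ (λ₀ v ≟ 0#))))
            by (no nu) (no nb) = ℕₚ.≤-trans (ℕₚ.≤-reflexive (sym (χ-yes (λ₀ v ≟ 0#)
              (trans (cong (_- (B (L y) v + B (L y′) v)) (Good.additivity v (not-bad v nu nb) y y′)) (lem (B (L y) v + B (L y′) v)))))) (ℕₚ.m≤n+m _ (χ (InU? v) ℕ.+ χ (Bad? v)))
          λ₀-linear : ∀ v s w → λ₀ (v ⊕ s ⊙ w) ≡ λ₀ v + s * λ₀ w
          λ₀-linear v s w = trans (cong₂ (λ a c → a - c) (B-addscaleʳ _ v w s) (cong₂ _+_ (B-addscaleʳ _ v w s) (B-addscaleʳ _ v w s)))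
            (lem (B (L (y ⊕ y′)) v) (B (L (y ⊕ y′)) w) (B (L y) v) (B (L y) w) (B (L y′) v) (B (L y′) w))
            where
            lem : ∀ a a′ c c′ d d′ → (a + s * a′) - ((c + s * c′) + (d + s * d′)) ≡ (a - (c + d)) + s * (a′ - (c′ + d′))
            lem a a′ c c′ d d′ = solve 7 (λ a s a′ c c′ d d′ → a :+ s :* a′ :- (c :+ s :* c′ :+ (d :+ s :* d′)) := a :- (c :+ d) :+ s :* (a′ :- (c′ :+ d′))) refl a s a′ c c′ d d′
          -- Every line in the direction v₀ meets the zero set of the functional at most once;
          -- averaging over the Q translates divides the size of the space by Q.
          hyperplane : λ₀ v₀ ≢ 0# → Y.count (λ v → λ₀ v ≟ 0#) ≤ Q ℕ.^ (n ∸ 1)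
          hyperplane ne = bound n refl
            where
            averaged : Q ℕ.* Y.count (λ v → λ₀ v ≟ 0#) ≤ Q ℕ.^ n
            averaged = begin
              Q ℕ.* Y.count (λ v → λ₀ v ≟ 0#)                               ≡⟨ K.sum-const (Y.count (λ v → λ₀ v ≟ 0#)) ⟨
              K.sum (λ _ → Y.count (λ v → λ₀ v ≟ 0#))                       ≡⟨ ∑-cong K.list (λ s → sym (sum-translate (s ⊙ v₀) (λ v → χ (λ₀ v ≟ 0#)))) ⟩
              K.sum (λ s → Y.count (λ v → λ₀ (v ⊕ s ⊙ v₀) ≟ 0#))            ≡⟨ ∑-swap K.list Y.list (λ s v → χ (λ₀ (v ⊕ s ⊙ v₀) ≟ 0#)) ⟩
              Y.sum (λ v → K.count (λ s → λ₀ (v ⊕ s ⊙ v₀) ≟ 0#))            ≤⟨ ∑-mono Y.list one ⟩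
              Y.sum (λ _ → 1)                                               ≡⟨ size-vectors 𝔽 n ⟩
              Q ℕ.^ n                                                       ∎
              where
              one : ∀ v → K.count (λ s → λ₀ (v ⊕ s ⊙ v₀) ≟ 0#) ≤ 1
              one v = ℕₚ.≤-trans (ℕₚ.≤-reflexive (∑-cong K.list (λ s → χ-cong (λ₀ (v ⊕ s ⊙ v₀) ≟ 0#) (evalN 2 c s ≟ 0#) (trans (sym (expand s))) (trans (expand s)))))
                (roots-bound 1 c 1 (s≤s (s≤s z≤n)) ne)
                where
                c : ℕ → Carrier
                c = cons (λ₀ v) (λ _ → λ₀ v₀)
                expand : ∀ s → λ₀ (v ⊕ s ⊙ v₀) ≡ evalN 2 c s
                expand s = trans (λ₀-linear v s v₀) (lem (λ₀ v) (λ₀ v₀))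
                  where
                  lem : ∀ a d → a + s * d ≡ a + s * (d + s * 0#)
                  lem a d = solve 3 (λ a s d → a :+ s :* d := a :+ s :* (d :+ s :* :0)) refl a s d
            bound : ∀ m → n ≡ m → Y.count (λ v → λ₀ v ≟ 0#) ≤ Q ℕ.^ (m ∸ 1)
            -- In dimension 0 truncated subtraction makes the bound Q^0, which is the size of the
            -- whole space.
            bound zero    e = ℕₚ.≤-trans (∑-mono Y.list (λ v → χ≤1 (λ₀ v ≟ 0#))) (ℕₚ.≤-reflexive (trans (size-vectors 𝔽 n) (cong (Q ℕ.^_) e)))
            bound (suc m) e = ℕₚ.*-cancelˡ-≤ Q (ℕₚ.≤-trans averaged (ℕₚ.≤-reflexive (cong (Q ℕ.^_) e)))

        private
          unit : ∀ {m} → Fin m → Vec Carrier m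
          unit Fin.zero    = 1# ∷ 𝟎
          unit (Fin.suc i) = 0# ∷ unit i

          -- Scaling is only required to preserve vanishing, because y ↦ B(L y, v) is semilinear,
          -- with scalars entering by their q-th powers.
          units-suffice : ∀ m (g : Vec Carrier m → Carrier) → (∀ x y → g (x ⊕ y) ≡ g x + g y) → (∀ s x → g x ≡ 0# → g (s ⊙ x) ≡ 0#) →
                          (∀ i → g (unit i) ≡ 0#) → ∀ x → g x ≡ 0#
          units-suffice zero g additive scaled units [] = trans lem (trans (cong₂ (λ a c → a - c) (sym (additive [] [])) refl) lem′)
            where
            lem : g [] ≡ (g [] + g []) - g []
            lem = solve 1 (λ g → g := g :+ g :- g) refl (g [])
            lem′ : g [] - g [] ≡ 0#
            lem′ = solve 1 (λ g → g :- g := :0) refl (g [])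
          units-suffice (suc m) g additive scaled units (x ∷ xs) = trans (cong g split) (trans (additive (x ⊙ (1# ∷ 𝟎)) (0# ∷ xs))
              (trans (cong₂ _+_ (scaled x (1# ∷ 𝟎) (units Fin.zero)) (units-suffice m (λ ys → g (0# ∷ ys)) additive′ scaled′ (λ i → units (Fin.suc i)) xs)) (+-identityˡ 0#)))
            where
            split : x ∷ xs ≡ x ⊙ (1# ∷ 𝟎) ⊕ (0# ∷ xs)
            split = cong₂ _∷_ lem lem′
              where
              lem : x ≡ x * 1# + 0#
              lem = solve 1 (λ x → x := x :* :1 :+ :0) refl x
              lem′ : xs ≡ x ⊙ 𝟎 ⊕ xs
              lem′ = vsolve (x ∷ []) (xs ∷ []) (λ { (x ∷ []) (xs ∷ []) → xs :≋ x :⊙ :𝟎 :⊕ xs }) refl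
            additive′ : ∀ ys zs → g (0# ∷ (ys ⊕ zs)) ≡ g (0# ∷ ys) + g (0# ∷ zs)
            additive′ ys zs = trans (cong (λ a → g (a ∷ (ys ⊕ zs))) (sym (+-identityˡ 0#))) (additive (0# ∷ ys) (0# ∷ zs))
            scaled′ : ∀ s ys → g (0# ∷ ys) ≡ 0# → g (0# ∷ (s ⊙ ys)) ≡ 0#
            scaled′ s ys e = trans (cong (λ a → g (a ∷ (s ⊙ ys))) (sym (zeroʳ s))) (scaled s (0# ∷ ys) e)

        B-L-scale : ∀ s y v → B (L (s ⊙ y)) v ≡ pow s q * B (L y) v
        B-L-scale s y v = trans (cong (λ w → B w v) (lincomb-⊙ s y b)) (B-scaleˡ s (L y) v)

        directions : ∀ m → (Fin m → Fin k) → Vec V m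
        directions zero    h = []
        directions (suc m) h = L (unit (h Fin.zero)) ∷ directions m (h ∘ Fin.suc)

        directions-annihilate : ∀ m h v → Annihilated (directions m h) v → ∀ i → B (L (unit (h i))) v ≡ 0#
        directions-annihilate (suc m) h v (p , e) Fin.zero    = e
        directions-annihilate (suc m) h v (p , e) (Fin.suc i) = directions-annihilate m (h ∘ Fin.suc) v p i

        -- The kernel is defined by conditions at all vectors of U; additivity reduces them to k
        -- linear conditions at the basis.
        kernel-lower : Q ℕ.^ n ≤ Q ℕ.^ k ℕ.* Y.count Kernel?
        kernel-lower = ℕₚ.≤-trans (annihilated-count (directions k id)) (ℕₚ.*-monoʳ-≤ (Q ℕ.^ k) (∑-mono Y.list (λ v → χ-mono (Annihilated? (directions k id) v) (Kernel? v)
          (λ a → units-suffice k (λ y → B (L y) v) (λ x y → B-additive x y v) (λ s x e → trans (B-L-scale s x v) (trans (cong (pow s q *_) e) (zeroʳ (pow s q))))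
            (directions-annihilate k id v a)))))

-- A zero set of N points has 1 + (q² − 1)N vectors; for the given N this is q^13 + q^6 − q^7.
module SevenDimensional {F : DiscreteField} {q : ℕ} (𝓕 : Form F q 7)
  (zeros-count : FormTheory.zeros 𝓕 ℕ.+ q ℕ.^ 7 ≡ q ℕ.^ 13 ℕ.+ q ℕ.^ 6) where
  open FieldTheory F
  open Polynomials F
  open LinearSums F
  open Form 𝓕
  open Geometry (toFiniteField F) using (lincomb) renaming (_+ᵥ_ to infixl 6 _⊕_; _·ᵥ_ to infixr 7 _⊙_; zeroᵥ to 𝟎)
  open FormTheory 𝓕
  open Estimates q 3≤q
  private
    module K = Enumeration 𝔽
    module Y = Enumeration (𝕍 7)

  -- A point, a line and a plane inside the hypersurface.

  private
    extension : ∀ {k} (b : Vec V k) → Independent b → Isotropic b → ¬ (∀ v → ¬ InSpan b v → ¬ (∀ x → f (v ⊕ lincomb x b) ≡ 0#)) →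
                Σ (Vec V (suc k)) λ b′ → Independent b′ × Isotropic b′
    extension b ind iso h = (proj₁ found ∷ b) , independent-∷ b _ ind (proj₁ (proj₂ found)) , isotropic-∷ b _ iso (proj₂ (proj₂ found))
      where
      open Subspace b iso using (InU?; Contained?)
      found = Y.find (λ v → ¬? (InU? v) ×-dec Contained? v) (λ none → h (λ v nu c → none v (nu , c)))

  isotropic-point : Σ (Vec V 1) λ b → Independent b × Isotropic b
  isotropic-point = extension [] (λ { [] _ → refl }) (λ { [] → f-𝟎 }) λ proper →
    ℕₚ.<-irrefl refl (ℕₚ.≤-trans (two-zeros zeros-count) (ℕₚ.≤-trans (∑-mono Y.list (λ v → χ-mono (f v ≟ 0#) (Y._≟_ v 𝟎) (only proper v))) (ℕₚ.≤-reflexive (Y.once 𝟎))))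
    where
    only : (∀ v → ¬ InSpan [] v → ¬ (∀ x → f (v ⊕ lincomb x []) ≡ 0#)) → ∀ v → f v ≡ 0# → v ≡ 𝟎
    only proper v e with Y._≟_ v 𝟎
    ... | yes v≡𝟎 = v≡𝟎
    ... | no ne = ⊥-elim (proper v (λ { ([] , p) → ne p }) (λ { [] → trans (cong f lem) e }))
      where
      lem : v ⊕ 𝟎 ≡ v
      lem = vsolve [] (v ∷ []) (λ { [] (v ∷ []) → v :⊕ :𝟎 :≋ v }) refl

  -- On a one-dimensional U the scaling rule alone turns vanishing at the basis vector into
  -- membership in the kernel, so the size of the kernel is known before any additivity.
  isotropic-line : Σ (Vec V 2) λ b → Independent b × Isotropic b
  isotropic-line = extension b ind iso contradiction
    where
    b = proj₁ isotropic-point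
    ind = proj₁ (proj₂ isotropic-point)
    iso = proj₂ (proj₂ isotropic-point)
    open Subspace b iso
    contradiction : ¬ (∀ v → ¬ InSpan b v → ¬ (∀ x → f (v ⊕ lincomb x b) ≡ 0#))
    contradiction proper = point-estimate zeros-count bound many
      where
      open Counting q (trans (cong (Q ℕ.*_) q≡q^1) (fibre-maximum 1 1 refl)) proper
      bound : q ℕ.^ 2 ℕ.* zeros ℕ.+ Y.count Kernel? ≤ q ℕ.^ 15 ℕ.+ q ℕ.^ 4
      bound = subst₂ _≤_ (cong₂ (λ a c → a ℕ.* zeros ℕ.+ c) (Q^ 1) (ℕₚ.*-identityˡ _))
        (cong₂ ℕ._+_ (Q-product 7 1 q q≡q^1) (Q-product 1 2 (Q ℕ.^ 1) (Q^ 1)))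
        (weighted Kernel? 1 M≥1 (λ v nu ke → point-fibre (subst (suc q ℕ.* fibre v ≤_) (Q^ 1) (kernel-fibre v (proper v nu) ke))))
      many : q ℕ.^ 12 ≤ Y.count Kernel?
      many = ℕₚ.*-cancelˡ-≤ (q ℕ.^ 2) {{ℕₚ.m^n≢0 q 2}} (begin
        q ℕ.^ 2 ℕ.* q ℕ.^ 12                                   ≡⟨ ℕₚ.^-distribˡ-+-* q 2 12 ⟨
        q ℕ.^ 14                                               ≡⟨ Q^ 7 ⟨
        Q ℕ.^ 7                                                ≤⟨ annihilated-count b ⟩
        Q ℕ.^ 1 ℕ.* Y.count (Annihilated? b)            ≡⟨ cong (ℕ._* Y.count (Annihilated? b)) (Q^ 1) ⟩
        q ℕ.^ 2 ℕ.* Y.count (Annihilated? b)            ≤⟨ ℕₚ.*-monoʳ-≤ (q ℕ.^ 2) (∑-mono Y.list (λ v → χ-mono (Annihilated? b v) (Kernel? v) (kernel v))) ⟩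
        q ℕ.^ 2 ℕ.* Y.count Kernel?                            ∎)
        where
        open ℕₚ.≤-Reasoning
        kernel : ∀ v → Annihilated b v → Kernel v
        kernel v a y = go b a y
          where
          go : ∀ b → Annihilated b v → ∀ (y : Vec Carrier 1) → B (lincomb y b) v ≡ 0#
          go (P ∷ []) (_ , e) (y ∷ []) = trans (cong (λ w → B w v) lem) (trans (B-scaleˡ y P v) (trans (cong (pow y q *_) e) (zeroʳ _)))
            where
            lem : y ⊙ P ⊕ 𝟎 ≡ y ⊙ P
            lem = vsolve (y ∷ []) (P ∷ []) (λ { (y ∷ []) (P ∷ []) → y :⊙ P :⊕ :𝟎 :≋ y :⊙ P }) refl

  -- If the line could not be extended, bad vectors would be rare and B additive on it. Its kernel
  -- would then have at least q^10 vectors, and a loss of q zeros at each of those outside U exceeds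
  -- the deficit.
  isotropic-plane : Σ (Vec V 3) λ b → Independent b × Isotropic b
  isotropic-plane = extension b ind iso contradiction
    where
    b = proj₁ isotropic-line
    ind = proj₁ (proj₂ isotropic-line)
    iso = proj₂ (proj₂ isotropic-line)
    open Subspace b iso
    contradiction : ¬ (∀ v → ¬ InSpan b v → ¬ (∀ x → f (v ⊕ lincomb x b) ≡ 0#))
    contradiction proper = line-estimate zeros-count bound (ℕₚ.*-cancelˡ-≤ (q ℕ.^ 4) {{ℕₚ.m^n≢0 q 4}} many)
      where
      open Counting (q ℕ.^ 3) (fibre-maximum 2 3 refl) proper
      few : Y.count Bad? ≤ q ℕ.^ 8 ℕ.+ q ℕ.^ 11
      few = line-bad zeros-count (subst₂ _≤_ (cong (λ a → a ℕ.* zeros ℕ.+ Y.count Bad?) (Q^ 2))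
        (cong₂ ℕ._+_ (Q-product 7 3 (q ℕ.^ 3) refl) (Q-product 2 4 (Q ℕ.^ 2) (Q^ 2))) bad-count)
      open Additive (q ℕ.^ 8 ℕ.+ q ℕ.^ 11) few
        (subst₂ _<_ (cong₂ (λ a c → a ℕ.+ (q ℕ.^ 8 ℕ.+ q ℕ.^ 11) ℕ.+ c) (sym (Q^ 2)) (sym (Q^ 6))) (sym (Q^ 7)) line-many)
      bound : q ℕ.^ 4 ℕ.* zeros ℕ.+ q ℕ.* Y.count Kernel? ≤ q ℕ.^ 17 ℕ.+ q ℕ.^ 8
      bound = subst₂ _≤_ (cong (λ a → a ℕ.* zeros ℕ.+ q ℕ.* Y.count Kernel?) (Q^ 2))
        (cong₂ ℕ._+_ (Q-product 7 3 (q ℕ.^ 3) refl) (Q-product 2 4 (Q ℕ.^ 2) (Q^ 2)))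
        (weighted Kernel? q (ℕₚ.≤-trans (ℕₚ.≤-reflexive q≡q^1) (power-≤ 1 3 {s≤s z≤n}))
          (λ v nu ke → line-fibre (subst (suc q ℕ.* fibre v ≤_) (Q^ 2) (kernel-fibre v (proper v nu) ke))))
      many : q ℕ.^ 4 ℕ.* q ℕ.^ 10 ≤ q ℕ.^ 4 ℕ.* Y.count Kernel?
      many = subst₂ _≤_ (trans (Q^ 7) (ℕₚ.^-distribˡ-+-* q 4 10)) (cong (ℕ._* Y.count Kernel?) (Q^ 2)) kernel-lower

  -- The kernel of an isotropic plane when no solid is isotropic.

  module Solidless (no-solid : ∀ (b : Vec V 4) → Independent b → ¬ Isotropic b)
    (b : Vec V 3) (independent : Independent b) (isotropic : Isotropic b) where
    open Subspace b isotropic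
    private module X = Enumeration (𝕍 3)

    proper : ∀ v → ¬ InU v → ¬ Contained v
    proper v nu c = no-solid (v ∷ b) (independent-∷ b v independent nu) (isotropic-∷ b v isotropic c)

    open Counting (q ℕ.^ 5) (fibre-maximum 3 5 refl) proper

    few-bad : Y.count Bad? ≤ q ℕ.^ 13
    few-bad = plane-bad zeros-count (subst₂ _≤_ (cong (λ a → a ℕ.* zeros ℕ.+ Y.count Bad?) (Q^ 3))
      (cong₂ ℕ._+_ (Q-product 7 5 (q ℕ.^ 5) refl) (Q-product 3 6 (Q ℕ.^ 3) (Q^ 3))) bad-count)

    open Additive (q ℕ.^ 13) few-bad
      (subst₂ _<_ (cong₂ (λ a c → a ℕ.+ q ℕ.^ 13 ℕ.+ c) (sym (Q^ 3)) (sym (Q^ 6))) (sym (Q^ 7)) plane-many) public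

    -- As Q^5 = q^10, this excludes five independent vectors; with `kernel-large` the kernel has
    -- dimension exactly 4.
    kernel-small : Y.count Kernel? < q ℕ.^ 10
    kernel-small = plane-kernel zeros-count (subst₂ _≤_ (cong (λ a → a ℕ.* zeros ℕ.+ suc (q ℕ.^ 3) ℕ.* Y.count Kernel?) (Q^ 3))
      (cong₂ ℕ._+_ (Q-product 7 5 (q ℕ.^ 5) refl) (Q-product 3 6 (Q ℕ.^ 3) (Q^ 3)))
      (weighted Kernel? (suc (q ℕ.^ 3)) (ℕₚ.≤-trans (power-< 3) (power-≤ 4 5 {ℕₚ.n≤1+n 4}))
        (λ v nu ke → plane-fibre (subst (suc q ℕ.* fibre v ≤_) (Q^ 3) (kernel-fibre v (proper v nu) ke)))))

    kernel-large : q ℕ.^ 8 ≤ Y.count Kernel?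
    kernel-large = ℕₚ.*-cancelˡ-≤ (q ℕ.^ 6) {{ℕₚ.m^n≢0 q 6}}
      (subst₂ _≤_ (trans (Q^ 7) (ℕₚ.^-distribˡ-+-* q 6 8)) (cong (ℕ._* Y.count Kernel?) (Q^ 3)) kernel-lower)

    Kernel-closed : ∀ v s w → Kernel v → Kernel w → Kernel (v ⊕ s ⊙ w)
    Kernel-closed v s w kv kw y = trans (B-addscaleʳ (L y) v w s) (trans (cong₂ (λ a c → a + s * c) (kv y) (kw y)) lem)
      where
      lem : 0# + s * 0# ≡ 0#
      lem = solve 1 (λ s → :0 :+ s :* :0 := :0) refl s

    private
      kernel-vector : Σ V λ v → Kernel v × ¬ InU v
      kernel-vector = Y.find (λ v → Kernel? v ×-dec ¬? (InU? v)) λ none → ℕₚ.<-irrefl refl (begin-strict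
        q ℕ.^ 6           <⟨ ℕₚ.≤-trans (power-< 6) (power-≤ 7 8 {ℕₚ.n≤1+n 7}) ⟩
        q ℕ.^ 8           ≤⟨ kernel-large ⟩
        Y.count Kernel?   ≤⟨ ∑-mono Y.list (λ v → χ-mono (Kernel? v) (InU? v) (λ ke → decidable-stable (InU? v) (λ nu → none v (ke , nu)))) ⟩
        Y.count InU?      ≤⟨ count-InU ⟩
        Q ℕ.^ 3           ≡⟨ Q^ 3 ⟩
        q ℕ.^ 6           ∎)
        where open ℕₚ.≤-Reasoning

    abstract
      w₀ : V
      w₀ = proj₁ kernel-vector

      w₀-kernel : Kernel w₀
      w₀-kernel = proj₁ (proj₂ kernel-vector)

      w₀-outside : ¬ InU w₀
      w₀-outside = proj₂ (proj₂ kernel-vector)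

    -- A kernel vector outside the span of w₀ and U would make a five-dimensional space of kernel
    -- vectors, against `kernel-small`.
    kernel-span : ∀ v → Kernel v → InSpan (w₀ ∷ b) v
    kernel-span v kv = decidable-stable (Y₄.search (λ x → Y._≟_ v (lincomb x (w₀ ∷ b)))) λ outside → ℕₚ.<-irrefl refl (ℕₚ.<-≤-trans kernel-small (begin
      q ℕ.^ 10                                        ≡⟨ Q^ 5 ⟨
      Q ℕ.^ 5                                         ≡⟨ size-vectors 𝔽 5 ⟨
      Y₅.sum (λ _ → 1)                                ≡⟨ ∑-cong Y₅.list (λ x → sym (χ-yes (Kernel? (lincomb x b₅)) (inside x))) ⟩
      Y₅.sum (λ x → χ (Kernel? (lincomb x b₅)))       ≤⟨ sum-injective (𝕍 5) (𝕍 7) (λ x → lincomb x b₅) (injective (independent-∷ (w₀ ∷ b) v (independent-∷ b w₀ independent w₀-outside) outside)) (λ v → χ (Kernel? v)) ⟩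
      Y.count Kernel?                                 ∎))
      where
      open ℕₚ.≤-Reasoning
      module Y₄ = Enumeration (𝕍 4)
      module Y₅ = Enumeration (𝕍 5)
      b₅ : Vec V 5
      b₅ = v ∷ w₀ ∷ b
      inside : ∀ x → Kernel (lincomb x b₅)
      inside (a ∷ c ∷ x) = subst Kernel (lem v w₀ (L x)) (Kernel-closed _ a v (Kernel-closed (L x) c w₀ (InU⇒Kernel (x , refl)) w₀-kernel) kv)
        where
        lem : ∀ v w u → u ⊕ c ⊙ w ⊕ a ⊙ v ≡ a ⊙ v ⊕ (c ⊙ w ⊕ u)
        lem v w u = vsolve (c ∷ a ∷ []) (u ∷ w ∷ v ∷ []) (λ { (c ∷ a ∷ []) (u ∷ w ∷ v ∷ []) → u :⊕ c :⊙ w :⊕ a :⊙ v :≋ a :⊙ v :⊕ (c :⊙ w :⊕ u) }) refl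
      injective : Independent b₅ → ∀ {x y} → lincomb x b₅ ≡ lincomb y b₅ → x ≡ y
      injective ind {x} {y} e = trans lem₁ (trans (cong (_⊕ y) (ind (x ⊕ (- 1#) ⊙ y) (trans (lincomb-addscale x y (- 1#) b₅) (trans (cong (_⊕ (- 1#) ⊙ lincomb y b₅) e) (lem₂ (lincomb y b₅)))))) lem₃)
        where
        lem₁ : x ≡ x ⊕ (- 1#) ⊙ y ⊕ y
        lem₁ = vsolve [] (x ∷ y ∷ []) (λ { [] (x ∷ y ∷ []) → x :≋ x :⊕ (:- :1) :⊙ y :⊕ y }) refl
        lem₂ : ∀ w → w ⊕ (- 1#) ⊙ w ≡ 𝟎
        lem₂ w = vsolve [] (w ∷ []) (λ { [] (w ∷ []) → w :⊕ (:- :1) :⊙ w :≋ :𝟎 }) refl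
        lem₃ : 𝟎 ⊕ y ≡ y
        lem₃ = vsolve [] (y ∷ []) (λ { [] (y ∷ []) → :𝟎 :⊕ y :≋ y }) refl

    B-combination : ∀ y u c v → B (L (y ⊕ (- c) ⊙ u)) v ≡ B (L y) v - pow c q * B (L u) v
    B-combination y u c v = trans (B-additive y ((- c) ⊙ u) v) (cong (B (L y) v +_) (trans (B-L-scale (- c) u v) (trans (cong (_* B (L u) v) (pow-neg c)) (lem (pow c q) (B (L u) v)))))
      where
      lem : ∀ a e → (- a) * e ≡ - (a * e)
      lem a e = solve 2 (λ a e → (:- a) :* e := :- (a :* e)) refl a e

    -- The functional of v on U is a multiple of that of w. The relation is not symmetric: a kernel
    -- vector v is dependent on every w.
    Dependent : V → V → Set
    Dependent w v = Σ Carrier λ κ → ∀ y → B (L y) v ≡ κ * B (L y) w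

    Dependent? : ∀ w v → Dec (Dependent w v)
    Dependent? w v = K.search (λ κ → X.decideAll (λ y → B (L y) v ≟ κ * B (L y) w))

    -- Dependence puts v - κw into the kernel for some κ, so the vectors in question lie in Q
    -- translates of the kernel.
    dependent-count : ∀ w → Y.count (Dependent? w) ≤ q ℕ.^ 12
    dependent-count w = begin
      Y.count (Dependent? w)                                                 ≤⟨ ∑-mono Y.list some ⟩
      Y.sum (λ v → K.count (λ κ → Kernel? (v ⊕ (- κ) ⊙ w)))                  ≡⟨ ∑-swap Y.list K.list (λ v κ → χ (Kernel? (v ⊕ (- κ) ⊙ w))) ⟩
      K.sum (λ κ → Y.count (λ v → Kernel? (v ⊕ (- κ) ⊙ w)))                  ≡⟨ ∑-cong K.list (λ κ → sum-translate ((- κ) ⊙ w) (λ v → χ (Kernel? v))) ⟩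
      K.sum (λ _ → Y.count Kernel?)                                          ≡⟨ K.sum-const (Y.count Kernel?) ⟩
      Q ℕ.* Y.count Kernel?                                                  ≤⟨ ℕₚ.*-monoʳ-≤ Q (ℕₚ.<⇒≤ kernel-small) ⟩
      Q ℕ.* q ℕ.^ 10                                                         ≡⟨ cong (ℕ._* q ℕ.^ 10) (sym (ℕₚ.*-identityʳ Q)) ⟩
      Q ℕ.^ 1 ℕ.* q ℕ.^ 10                                                   ≡⟨ Q-product 1 10 (q ℕ.^ 10) refl ⟩
      q ℕ.^ 12                                                               ∎
      where
      open ℕₚ.≤-Reasoning
      some : ∀ v → χ (Dependent? w v) ≤ K.count (λ κ → Kernel? (v ⊕ (- κ) ⊙ w))
      some v with Dependent? w v
      ... | no _ = z≤n
      ... | yes (κ , h) = ℕₚ.≤-trans (ℕₚ.≤-reflexive (sym (χ-yes (Kernel? (v ⊕ (- κ) ⊙ w)) (λ y → trans (B-addscaleʳ (L y) v w (- κ)) (trans (cong (_+ (- κ) * B (L y) w) (h y)) (lem (B (L y) w)))))))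
              (K.member {λ κ → χ (Kernel? (v ⊕ (- κ) ⊙ w))} κ)
        where
        lem : ∀ a → κ * a + (- κ) * a ≡ 0#
        lem a = solve 2 (λ κ a → κ :* a :+ (:- κ) :* a := :0) refl κ a

    -- Elimination for two functionals: a vector y separating them is corrected by a multiple of y₁
    -- so that the first functional vanishes, and then normalised.
    dual : ∀ w w′ → ¬ Kernel w → ¬ Dependent w w′ → Σ (Vec Carrier 3) λ u → B (L u) w ≡ 0# × B (L u) w′ ≡ 1#
    dual w w′ nk nd = s ⊙ u , trans (B-L-scale s u w) (trans (cong (pow s q *_) u-w) (zeroʳ _)) ,
        trans (B-L-scale s u w′) (trans (cong (_* B (L u) w′) (pow-Q (u-w′ ⁻¹))) (trans (*-comm _ _) (⁻¹-inverse u-w′)))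
      where
      y₁ = proj₁ (not-kernel w nk)
      a≢0 = proj₂ (not-kernel w nk)
      κ = (a≢0 ⁻¹) * B (L y₁) w′
      found : Σ (Vec Carrier 3) λ y → B (L y) w′ ≢ κ * B (L y) w
      found = X.find (λ y → ¬? (B (L y) w′ ≟ κ * B (L y) w)) (λ none → nd (κ , λ y → decidable-stable (B (L y) w′ ≟ κ * B (L y) w) (none y)))
      y = proj₁ found
      ratio = B (L y) w * (a≢0 ⁻¹)
      -- The functionals are q-semilinear, so the scalar c has to satisfy c^q = ratio; since raising
      -- to the power q twice is the identity, ratio^q does.
      c = pow ratio q
      u = y ⊕ (- c) ⊙ y₁
      u-w : B (L u) w ≡ 0#
      u-w = trans (B-combination y y₁ c w) (trans (cong (λ r → B (L y) w - r * B (L y₁) w) (pow-Q ratio)) (trans (lem (B (L y) w) (a≢0 ⁻¹) (B (L y₁) w)) (trans (cong (λ r → B (L y) w - B (L y) w * r) (⁻¹-inverse a≢0)) (lem′ (B (L y) w)))))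
        where
        lem : ∀ x i a → x - x * i * a ≡ x - x * (a * i)
        lem x i a = solve 3 (λ x i a → x :- x :* i :* a := x :- x :* (a :* i)) refl x i a
        lem′ : ∀ x → x - x * 1# ≡ 0#
        lem′ x = solve 1 (λ x → x :- x :* :1 := :0) refl x
      u-w′ : B (L u) w′ ≢ 0#
      u-w′ e = proj₂ found (difference-zero (trans (lem (B (L y) w′) (a≢0 ⁻¹) (B (L y₁) w′) (B (L y) w))
          (trans (cong (λ r → B (L y) w′ - r * B (L y₁) w′) (sym (pow-Q ratio))) (trans (sym (B-combination y y₁ c w′)) e))))
        where
        lem : ∀ x i a z → x - i * a * z ≡ x - z * i * a
        lem x i a z = solve 4 (λ x i a z → x :- i :* a :* z := x :- z :* i :* a) refl x i a z
      s = pow (u-w′ ⁻¹) q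

    -- Otherwise more than q of the vectors w + s w₀ are good, enough to determine a polynomial of degree q in s.
    Poor : V → Set
    Poor w = Q ∸ q ≤ K.count (λ s → Bad? (w ⊕ s ⊙ w₀))

    Poor? : ∀ w → Dec (Poor w)
    Poor? w = (Q ∸ q) ℕₚ.≤? K.count (λ s → Bad? (w ⊕ s ⊙ w₀))

    -- A poor w has at least Q - q = q(q - 1) bad vectors on its line in direction w₀, and each bad
    -- vector is counted by Q translates.
    poor-count : (q ∸ 1) ℕ.* Y.count Poor? ≤ q ℕ.^ 14
    poor-count = ℕₚ.*-cancelˡ-≤ q {{ℕ.>-nonZero 1≤q}} (begin
      q ℕ.* ((q ∸ 1) ℕ.* Y.count Poor?)                            ≡⟨ ℕₚ.*-assoc q (q ∸ 1) (Y.count Poor?) ⟨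
      q ℕ.* (q ∸ 1) ℕ.* Y.count Poor?                              ≡⟨ cong (ℕ._* Y.count Poor?) (trans (ℕₚ.*-distribˡ-∸ q q 1) (cong₂ _∸_ (sym Q≡q²) (ℕₚ.*-identityʳ q))) ⟩
      (Q ∸ q) ℕ.* Y.count Poor?                                    ≡⟨ ∑-*ˡ Y.list (Q ∸ q) (λ w → χ (Poor? w)) ⟨
      Y.sum (λ w → (Q ∸ q) ℕ.* χ (Poor? w))                        ≤⟨ ∑-mono Y.list some ⟩
      Y.sum (λ w → K.count (λ s → Bad? (w ⊕ s ⊙ w₀)))              ≡⟨ ∑-swap Y.list K.list (λ w s → χ (Bad? (w ⊕ s ⊙ w₀))) ⟩
      K.sum (λ s → Y.count (λ w → Bad? (w ⊕ s ⊙ w₀)))              ≡⟨ ∑-cong K.list (λ s → sum-translate (s ⊙ w₀) (λ v → χ (Bad? v))) ⟩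
      K.sum (λ _ → Y.count Bad?)                                   ≡⟨ K.sum-const (Y.count Bad?) ⟩
      Q ℕ.* Y.count Bad?                                           ≤⟨ ℕₚ.*-monoʳ-≤ Q few-bad ⟩
      Q ℕ.* q ℕ.^ 13                                               ≡⟨ cong (ℕ._* q ℕ.^ 13) (sym (ℕₚ.*-identityʳ Q)) ⟩
      Q ℕ.^ 1 ℕ.* q ℕ.^ 13                                         ≡⟨ Q-product 1 13 (q ℕ.^ 13) refl ⟩
      q ℕ.^ 15                                                     ∎)
      where
      open ℕₚ.≤-Reasoning
      some : ∀ w → (Q ∸ q) ℕ.* χ (Poor? w) ≤ K.count (λ s → Bad? (w ⊕ s ⊙ w₀))
      some w with Poor? w
      ... | yes p = ℕₚ.≤-trans (ℕₚ.≤-reflexive (ℕₚ.*-identityʳ (Q ∸ q))) p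
      ... | no _  = ℕₚ.≤-trans (ℕₚ.≤-reflexive (ℕₚ.*-zeroʳ (Q ∸ q))) z≤n

    -- The poor vectors fill at most q^14/(q - 1), no more than half of the space as q ≥ 3, and the
    -- dependent ones at most q^12.
    rich-independent : ∀ w → Σ V λ v → ¬ Poor v × ¬ Dependent w v
    rich-independent w = Y.find (λ v → ¬? (Poor? v) ×-dec ¬? (Dependent? w v)) λ none → nice-estimate poor-count (begin
      q ℕ.^ 14                                              ≡⟨ Q^ 7 ⟨
      Q ℕ.^ 7                                               ≡⟨ size-vectors 𝔽 7 ⟨
      Y.sum (λ _ → 1)                                       ≤⟨ ∑-mono Y.list (λ v → cover v none (Poor? v)) ⟩
      Y.sum (λ v → χ (Poor? v) ℕ.+ χ (Dependent? w v))      ≡⟨ ∑-+ Y.list (λ v → χ (Poor? v)) (λ v → χ (Dependent? w v)) ⟩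
      Y.count Poor? ℕ.+ Y.count (Dependent? w)              ≤⟨ ℕₚ.+-monoʳ-≤ (Y.count Poor?) (dependent-count w) ⟩
      Y.count Poor? ℕ.+ q ℕ.^ 12                            ∎)
      where
      open ℕₚ.≤-Reasoning
      cover : ∀ v → (∀ v → ¬ (¬ Poor v × ¬ Dependent w v)) → Dec (Poor v) → 1 ≤ χ (Poor? v) ℕ.+ χ (Dependent? w v)
      cover v none (yes p) = ℕₚ.≤-trans (ℕₚ.≤-reflexive (sym (χ-yes (Poor? v) p))) (ℕₚ.m≤m+n _ _)
      cover v none (no np) = ℕₚ.≤-trans (ℕₚ.≤-reflexive (sym (χ-yes (Dependent? w v) (decidable-stable (Dependent? w v) (λ nd → none v (np , nd)))))) (ℕₚ.m≤n+m _ (χ (Poor? v)))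

    kernel-dependent : ∀ w v → Kernel v → Dependent w v
    kernel-dependent w v kv = 0# , λ y → trans (kv y) (sym (zeroˡ _))

    -- A polynomial in s of degree ≤ q vanishing at every s with w + s w₀ good is zero.
    rich-invariance : ∀ w → ¬ Poor w → ¬ Kernel w → ∀ x y → B (L y) w ≡ 0# → ∀ s → f (w ⊕ L x ⊕ L y ⊕ s ⊙ w₀) ≡ f (w ⊕ L x ⊕ s ⊙ w₀)
    rich-invariance w rich nk x y e s = difference-zero (trans (cong₂ _-_ (line z′ w₀ s) (line z w₀ s)) (trans (sym (evalN-difference (suc (suc q)) (coef z′ w₀) (coef z w₀) s))
        (trans (drop-top (suc q) d s top) (vanish (suc q) d enough s))))
      where
      z = w ⊕ L x
      z′ = w ⊕ L x ⊕ L y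
      d : ℕ → Carrier
      d j = coef z′ w₀ j - coef z w₀ j
      sub-self : ∀ a → a - a ≡ 0#
      sub-self a = solve 1 (λ a → a :- a := :0) refl a
      top : d (suc q) ≡ 0#
      top = trans (cong₂ _-_ (coef-q+1 z′ w₀) (coef-q+1 z w₀)) (sub-self (f w₀))
      good-value : ∀ s → ¬ Bad (w ⊕ s ⊙ w₀) → evalN (suc q) d s ≡ 0#
      good-value s nb = trans (sym (drop-top (suc q) d s top)) (trans (evalN-difference (suc (suc q)) (coef z′ w₀) (coef z w₀) s)
          (trans (cong₂ _-_ (trans (sym (line z′ w₀ s)) (trans (cong f (lem₁ w (L x) (L y) w₀)) (trans (Good.invariance W (not-bad W nu nb) y BW x) (cong f (lem₂ w (L x) w₀))))) (sym (line z w₀ s))) (sub-self _)))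
        where
        W = w ⊕ s ⊙ w₀
        B-W : ∀ y → B (L y) W ≡ B (L y) w
        B-W y = trans (B-addscaleʳ (L y) w w₀ s) (trans (cong (λ a → B (L y) w + s * a) (w₀-kernel y)) (lem (B (L y) w)))
          where
          lem : ∀ a → a + s * 0# ≡ a
          lem a = solve 2 (λ a s → a :+ s :* :0 := a) refl a s
        BW : B (L y) W ≡ 0#
        BW = trans (B-W y) e
        nu : ¬ InU W
        nu u = nk (λ y → trans (sym (B-W y)) (InU⇒Kernel u y))
        lem₁ : ∀ w x y w₀ → w ⊕ x ⊕ y ⊕ s ⊙ w₀ ≡ w ⊕ s ⊙ w₀ ⊕ x ⊕ y
        lem₁ w x y w₀ = vsolve (s ∷ []) (w ∷ x ∷ y ∷ w₀ ∷ []) (λ { (s ∷ []) (w ∷ x ∷ y ∷ w₀ ∷ []) → w :⊕ x :⊕ y :⊕ s :⊙ w₀ :≋ w :⊕ s :⊙ w₀ :⊕ x :⊕ y }) refl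
        lem₂ : ∀ w x w₀ → w ⊕ s ⊙ w₀ ⊕ x ≡ w ⊕ x ⊕ s ⊙ w₀
        lem₂ w x w₀ = vsolve (s ∷ []) (w ∷ w₀ ∷ x ∷ []) (λ { (s ∷ []) (w ∷ w₀ ∷ x ∷ []) → w :⊕ s :⊙ w₀ :⊕ x :≋ w :⊕ x :⊕ s :⊙ w₀ }) refl
      enough : suc q ≤ roots (suc q) d
      enough = ℕₚ.+-cancelʳ-≤ (K.count (λ s → Bad? (w ⊕ s ⊙ w₀))) _ _ (begin
        suc q ℕ.+ K.count (λ s → Bad? (w ⊕ s ⊙ w₀))           ≤⟨ ℕₚ.≤-trans (ℕₚ.≤-reflexive (sym (ℕₚ.+-suc q _))) (ℕₚ.+-monoʳ-≤ q (ℕₚ.≰⇒> rich)) ⟩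
        q ℕ.+ (Q ∸ q)                                         ≡⟨ ℕₚ.m+[n∸m]≡n (ℕₚ.≤-trans (ℕₚ.≤-trans (ℕₚ.n≤1+n q) (ℕₚ.n≤1+n (suc q))) q+2≤Q) ⟩
        Q                                                     ≤⟨ ∑-mono K.list (λ s → cover s (Bad? (w ⊕ s ⊙ w₀))) ⟩
        K.sum (λ s → χ (evalN (suc q) d s ≟ 0#) ℕ.+ χ (Bad? (w ⊕ s ⊙ w₀)))  ≡⟨ ∑-+ K.list (λ s → χ (evalN (suc q) d s ≟ 0#)) (λ s → χ (Bad? (w ⊕ s ⊙ w₀))) ⟩
        roots (suc q) d ℕ.+ K.count (λ s → Bad? (w ⊕ s ⊙ w₀)) ∎)
        where
        open ℕₚ.≤-Reasoning
        cover : ∀ s → Dec (Bad (w ⊕ s ⊙ w₀)) → 1 ≤ χ (evalN (suc q) d s ≟ 0#) ℕ.+ χ (Bad? (w ⊕ s ⊙ w₀))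
        cover s (yes p) = ℕₚ.≤-trans (ℕₚ.≤-reflexive (sym (χ-yes (Bad? (w ⊕ s ⊙ w₀)) p))) (ℕₚ.m≤n+m _ _)
        cover s (no np) = ℕₚ.≤-trans (ℕₚ.≤-reflexive (sym (χ-yes (evalN (suc q) d s ≟ 0#) (good-value s np)))) (ℕₚ.m≤m+n _ _)

    -- The invariance on w + U + K w₀ is read off at infinity: f(w₀ + u) is the coefficient of
    -- s^(q+1) in f(w + s(w₀ + u)).
    rich-shift : ∀ w → ¬ Poor w → ¬ Kernel w → ∀ x y → B (L y) w ≡ 0# → f (w₀ ⊕ L x ⊕ L y) ≡ f (w₀ ⊕ L x)
    rich-shift w rich nk x y e = trans (sym (coef-q+1 w (w₀ ⊕ L x ⊕ L y))) (trans (coef-cong-line w (w₀ ⊕ L x ⊕ L y) w (w₀ ⊕ L x) along (suc q) ℕₚ.≤-refl) (coef-q+1 w (w₀ ⊕ L x)))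
      where
      along : ∀ s → f (w ⊕ s ⊙ (w₀ ⊕ L x ⊕ L y)) ≡ f (w ⊕ s ⊙ (w₀ ⊕ L x))
      along s = trans (cong f (trans (lem₁ w w₀ (L x) (L y)) (cong₂ (λ a c → w ⊕ a ⊕ c ⊕ s ⊙ w₀) (sym (lincomb-⊙ s x b)) (sym (lincomb-⊙ s y b)))))
          (trans (rich-invariance w rich nk (s ⊙ x) (s ⊙ y) (trans (B-L-scale s y w) (trans (cong (pow s q *_) e) (zeroʳ _))) s)
            (cong f (trans (cong (λ a → w ⊕ a ⊕ s ⊙ w₀) (lincomb-⊙ s x b)) (lem₂ w w₀ (L x)))))
        where
        lem₁ : ∀ w w₀ x y → w ⊕ s ⊙ (w₀ ⊕ x ⊕ y) ≡ w ⊕ s ⊙ x ⊕ s ⊙ y ⊕ s ⊙ w₀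
        lem₁ w w₀ x y = vsolve (s ∷ []) (w ∷ w₀ ∷ x ∷ y ∷ []) (λ { (s ∷ []) (w ∷ w₀ ∷ x ∷ y ∷ []) → w :⊕ s :⊙ (w₀ :⊕ x :⊕ y) :≋ w :⊕ s :⊙ x :⊕ s :⊙ y :⊕ s :⊙ w₀ }) refl
        lem₂ : ∀ w w₀ x → w ⊕ s ⊙ x ⊕ s ⊙ w₀ ≡ w ⊕ s ⊙ (w₀ ⊕ x)
        lem₂ w w₀ x = vsolve (s ∷ []) (w ∷ x ∷ w₀ ∷ []) (λ { (s ∷ []) (w ∷ x ∷ w₀ ∷ []) → w :⊕ s :⊙ x :⊕ s :⊙ w₀ :≋ w :⊕ s :⊙ (w₀ :⊕ x) }) refl

    -- `rich-shift` gives invariance under the zeros of one functional. Two independent functionals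
    -- have zero sets that together span U: y splits into cu, annihilated by w₁, and y″, annihilated
    -- by w₂.
    w₀-constant : ∀ y → f (w₀ ⊕ L y) ≡ f w₀
    w₀-constant y = begin
      f (w₀ ⊕ L y)                       ≡⟨ cong (λ a → f (w₀ ⊕ a)) split ⟩
      f (w₀ ⊕ (L y″ ⊕ L (c ⊙ u)))        ≡⟨ cong f (lem₁ w₀ (L y″) (L (c ⊙ u))) ⟩
      f (w₀ ⊕ L y″ ⊕ L (c ⊙ u))          ≡⟨ rich-shift w₁ rich₁ nk₁ y″ (c ⊙ u) (trans (B-L-scale c u w₁) (trans (cong (pow c q *_) (proj₁ (proj₂ pair))) (zeroʳ _))) ⟩
      f (w₀ ⊕ L y″)                      ≡⟨ cong f (trans (lem₂ w₀ (L y″)) (cong (λ a → w₀ ⊕ a ⊕ L y″) (sym (lincomb-𝟎 b)))) ⟩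
      f (w₀ ⊕ L 𝟎 ⊕ L y″)                ≡⟨ rich-shift w₂ rich₂ nk₂ 𝟎 y″ flat ⟩
      f (w₀ ⊕ L 𝟎)                       ≡⟨ cong f (trans (cong (w₀ ⊕_) (lincomb-𝟎 b)) (lem₃ w₀)) ⟩
      f w₀                               ∎
      where
      open ≡-Reasoning
      -- Kernel vectors are dependent on every vector, so independence from `𝟎` is a way to ask for
      -- a vector outside the kernel.
      first = rich-independent 𝟎
      w₁ = proj₁ first
      rich₁ = proj₁ (proj₂ first)
      nk₁ : ¬ Kernel w₁
      nk₁ k = proj₂ (proj₂ first) (kernel-dependent 𝟎 w₁ k)
      second = rich-independent w₁
      w₂ = proj₁ second
      rich₂ = proj₁ (proj₂ second)
      nk₂ : ¬ Kernel w₂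
      nk₂ k = proj₂ (proj₂ second) (kernel-dependent w₁ w₂ k)
      pair = dual w₁ w₂ nk₁ (proj₂ (proj₂ second))
      u = proj₁ pair
      c = pow (B (L y) w₂) q
      y″ = y ⊕ (- c) ⊙ u
      split : L y ≡ L y″ ⊕ L (c ⊙ u)
      split = trans (cong L (lem y u c)) (lincomb-⊕ y″ (c ⊙ u) b)
        where
        lem : ∀ y u c → y ≡ y ⊕ (- c) ⊙ u ⊕ c ⊙ u
        lem y u c = vsolve (c ∷ []) (y ∷ u ∷ []) (λ { (c ∷ []) (y ∷ u ∷ []) → y :≋ y :⊕ (:- c) :⊙ u :⊕ c :⊙ u }) refl
      flat : B (L y″) w₂ ≡ 0#
      flat = trans (B-combination y u c w₂) (trans (cong₂ (λ a d → B (L y) w₂ - a * d) (pow-Q (B (L y) w₂)) (proj₂ (proj₂ pair))) (lem (B (L y) w₂)))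
        where
        lem : ∀ a → a - a * 1# ≡ 0#
        lem a = solve 1 (λ a → a :- a :* :1 := :0) refl a
      lem₁ : ∀ w a c → w ⊕ (a ⊕ c) ≡ w ⊕ a ⊕ c
      lem₁ w a c = vsolve [] (w ∷ a ∷ c ∷ []) (λ { [] (w ∷ a ∷ c ∷ []) → w :⊕ (a :⊕ c) :≋ w :⊕ a :⊕ c }) refl
      lem₂ : ∀ w a → w ⊕ a ≡ w ⊕ 𝟎 ⊕ a
      lem₂ w a = vsolve [] (w ∷ a ∷ []) (λ { [] (w ∷ a ∷ []) → w :⊕ a :≋ w :⊕ :𝟎 :⊕ a }) refl
      lem₃ : ∀ w → w ⊕ 𝟎 ≡ w
      lem₃ w = vsolve [] (w ∷ []) (λ { [] (w ∷ []) → w :⊕ :𝟎 :≋ w }) refl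

    f-w₀ : f w₀ ≢ 0#
    f-w₀ e = proper w₀ w₀-outside (λ x → trans (w₀-constant x) e)

    -- Such a v is cw₀ + u with c ≠ 0, so by homogeneity f takes on v + U only the nonzero value
    -- c^(q+1) f(w₀).
    kernel-fibre-empty : ∀ v → Kernel v → ¬ InU v → fibre v ≡ 0
    kernel-fibre-empty v kv nu = trans (∑-cong X.list (λ x → χ-no (f (v ⊕ L x) ≟ 0#) (nonzero x (kernel-span v kv)))) (∑-zero X.list)
      where
      nonzero : ∀ x → InSpan (w₀ ∷ b) v → f (v ⊕ L x) ≢ 0#
      nonzero x ((c ∷ y) , refl) e with c ≟ 0#
      ... | yes refl = nu (y , lem w₀ (L y))
        where
        lem : ∀ w a → 0# ⊙ w ⊕ a ≡ a
        lem w a = vsolve [] (w ∷ a ∷ []) (λ { [] (w ∷ a ∷ []) → :0 :⊙ w :⊕ a :≋ a }) refl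
      ... | no nz = *-nonzero (pow-nonzero (suc q) nz) f-w₀ (trans (cong (pow c (suc q) *_) (sym (w₀-constant ((nz ⁻¹) ⊙ (y ⊕ x))))) (trans (sym (homogeneous c _)) (trans (cong f eq) e)))
        where
        eq : c ⊙ (w₀ ⊕ L ((nz ⁻¹) ⊙ (y ⊕ x))) ≡ c ⊙ w₀ ⊕ L y ⊕ L x
        eq = trans (cong (λ a → c ⊙ (w₀ ⊕ a)) (trans (lincomb-⊙ (nz ⁻¹) (y ⊕ x) b) (cong ((nz ⁻¹) ⊙_) (lincomb-⊕ y x b))))
          (trans (lem w₀ (L y) (L x)) (trans (cong (λ a → c ⊙ w₀ ⊕ a ⊙ (L y ⊕ L x)) (⁻¹-inverse nz)) (lem′ w₀ (L y) (L x))))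
          where
          lem : ∀ w a d → c ⊙ (w ⊕ (nz ⁻¹) ⊙ (a ⊕ d)) ≡ c ⊙ w ⊕ (c * (nz ⁻¹)) ⊙ (a ⊕ d)
          lem w a d = vsolve (c ∷ (nz ⁻¹) ∷ []) (w ∷ a ∷ d ∷ []) (λ { (c ∷ n ∷ []) (w ∷ a ∷ d ∷ []) → c :⊙ (w :⊕ n :⊙ (a :⊕ d)) :≋ c :⊙ w :⊕ (c :* n) :⊙ (a :⊕ d) }) refl
          lem′ : ∀ w a d → c ⊙ w ⊕ 1# ⊙ (a ⊕ d) ≡ c ⊙ w ⊕ a ⊕ d
          lem′ w a d = vsolve (c ∷ []) (w ∷ a ∷ d ∷ []) (λ { (c ∷ []) (w ∷ a ∷ d ∷ []) → c :⊙ w :⊕ :1 :⊙ (a :⊕ d) :≋ c :⊙ w :⊕ a :⊕ d }) refl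

    -- The kernel already spends the whole deficit, q^5 zeros for each of at least q^8 vectors. One
    -- zero missing at a single vector outside the kernel would exceed it.
    kernel-or-good : ∀ v → ¬ Kernel v → Q ℕ.* fibre v ≡ Q ℕ.^ 3 ℕ.* q
    kernel-or-good v₀ nk = trans (cong (Q ℕ.*_) (decidable-stable (fibre v₀ ℕ.≟ q ℕ.^ 5) λ ne → all-good zeros-count (excess ne) kernel-large)) (fibre-maximum 3 5 refl)
      where
      excess : fibre v₀ ≢ q ℕ.^ 5 → q ℕ.^ 6 ℕ.* zeros ℕ.+ (1 ℕ.+ q ℕ.^ 5 ℕ.* Y.count Kernel?) ≤ q ℕ.^ 19 ℕ.+ q ℕ.^ 12
      excess ne = begin
        q ℕ.^ 6 ℕ.* zeros ℕ.+ (1 ℕ.+ q ℕ.^ 5 ℕ.* Y.count Kernel?)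
          ≡⟨ sym (cong₂ ℕ._+_ (trans fibre-total (cong (ℕ._* zeros) (Q^ 3))) (cong₂ ℕ._+_ (Y.once v₀) (∑-*ˡ Y.list (q ℕ.^ 5) (λ v → χ (Kernel? v))))) ⟩
        Y.sum fibre ℕ.+ (Y.sum (λ v → χ (Y._≟_ v v₀)) ℕ.+ Y.sum (λ v → q ℕ.^ 5 ℕ.* χ (Kernel? v)))
          ≡⟨ sym (trans (∑-+ Y.list fibre (λ v → χ (Y._≟_ v v₀) ℕ.+ q ℕ.^ 5 ℕ.* χ (Kernel? v))) (cong (Y.sum fibre ℕ.+_) (∑-+ Y.list (λ v → χ (Y._≟_ v v₀)) (λ v → q ℕ.^ 5 ℕ.* χ (Kernel? v))))) ⟩
        Y.sum (λ v → fibre v ℕ.+ (χ (Y._≟_ v v₀) ℕ.+ q ℕ.^ 5 ℕ.* χ (Kernel? v)))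
          ≤⟨ ∑-mono Y.list (λ v → pointwise v (Y._≟_ v v₀) (Kernel? v) (InU? v)) ⟩
        Y.sum (λ v → q ℕ.^ 5 ℕ.+ Q ℕ.^ 3 ℕ.* χ (InU? v))
          ≡⟨ ∑-+ Y.list (λ _ → q ℕ.^ 5) (λ v → Q ℕ.^ 3 ℕ.* χ (InU? v)) ⟩
        Y.sum (λ _ → q ℕ.^ 5) ℕ.+ Y.sum (λ v → Q ℕ.^ 3 ℕ.* χ (InU? v))
          ≡⟨ cong₂ ℕ._+_ (trans (Y.sum-const (q ℕ.^ 5)) (trans (cong (ℕ._* q ℕ.^ 5) (size-vectors 𝔽 7)) (Q-product 7 5 (q ℕ.^ 5) refl))) (∑-*ˡ Y.list (Q ℕ.^ 3) (λ v → χ (InU? v))) ⟩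
        q ℕ.^ 19 ℕ.+ Q ℕ.^ 3 ℕ.* Y.count InU?
          ≤⟨ ℕₚ.+-monoʳ-≤ (q ℕ.^ 19) (ℕₚ.*-monoʳ-≤ (Q ℕ.^ 3) count-InU) ⟩
        q ℕ.^ 19 ℕ.+ Q ℕ.^ 3 ℕ.* Q ℕ.^ 3
          ≡⟨ cong (q ℕ.^ 19 ℕ.+_) (Q-product 3 6 (Q ℕ.^ 3) (Q^ 3)) ⟩
        q ℕ.^ 19 ℕ.+ q ℕ.^ 12 ∎
        where
        open ℕₚ.≤-Reasoning
        Goal : V → Set
        Goal v = fibre v ℕ.+ (χ (Y._≟_ v v₀) ℕ.+ q ℕ.^ 5 ℕ.* χ (Kernel? v)) ≤ q ℕ.^ 5 ℕ.+ Q ℕ.^ 3 ℕ.* χ (InU? v)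
        weight : ∀ v {a c} → χ (Y._≟_ v v₀) ≡ a → χ (Kernel? v) ≡ c → χ (Y._≟_ v v₀) ℕ.+ q ℕ.^ 5 ℕ.* χ (Kernel? v) ≡ a ℕ.+ q ℕ.^ 5 ℕ.* c
        weight v refl refl = refl
        pointwise : ∀ v → Dec (v ≡ v₀) → Dec (Kernel v) → Dec (InU v) → Goal v
        pointwise v (yes refl) (yes ke) _ = ⊥-elim (nk ke)
        pointwise v (yes refl) (no nke) _ = begin
          fibre v ℕ.+ (χ (Y._≟_ v v₀) ℕ.+ q ℕ.^ 5 ℕ.* χ (Kernel? v))   ≡⟨ cong (fibre v ℕ.+_) (trans (weight v (χ-yes (Y._≟_ v v₀) refl) (χ-no (Kernel? v) nke)) (cong suc (ℕₚ.*-zeroʳ (q ℕ.^ 5)))) ⟩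
          fibre v ℕ.+ 1                                                ≡⟨ ℕₚ.+-comm (fibre v) 1 ⟩
          suc (fibre v)                                                ≤⟨ ℕₚ.≤∧≢⇒< (fibre≤M v (λ u → nke (InU⇒Kernel u))) ne ⟩
          q ℕ.^ 5                                                      ≤⟨ ℕₚ.m≤m+n (q ℕ.^ 5) _ ⟩
          q ℕ.^ 5 ℕ.+ Q ℕ.^ 3 ℕ.* χ (InU? v)                           ∎
        pointwise v (no v≢) _ (yes u) = begin
          fibre v ℕ.+ (χ (Y._≟_ v v₀) ℕ.+ q ℕ.^ 5 ℕ.* χ (Kernel? v))   ≡⟨ cong (fibre v ℕ.+_) (trans (weight v (χ-no (Y._≟_ v v₀) v≢) (χ-yes (Kernel? v) (InU⇒Kernel u))) (ℕₚ.*-identityʳ (q ℕ.^ 5))) ⟩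
          fibre v ℕ.+ q ℕ.^ 5                                          ≤⟨ ℕₚ.+-monoˡ-≤ (q ℕ.^ 5) (fibre≤ v) ⟩
          Q ℕ.^ 3 ℕ.+ q ℕ.^ 5                                          ≡⟨ ℕₚ.+-comm (Q ℕ.^ 3) (q ℕ.^ 5) ⟩
          q ℕ.^ 5 ℕ.+ Q ℕ.^ 3                                          ≡⟨ cong (q ℕ.^ 5 ℕ.+_) (sym (trans (cong (Q ℕ.^ 3 ℕ.*_) (χ-yes (InU? v) u)) (ℕₚ.*-identityʳ (Q ℕ.^ 3)))) ⟩
          q ℕ.^ 5 ℕ.+ Q ℕ.^ 3 ℕ.* χ (InU? v)                           ∎
        pointwise v (no v≢) (yes ke) (no nu) = begin
          fibre v ℕ.+ (χ (Y._≟_ v v₀) ℕ.+ q ℕ.^ 5 ℕ.* χ (Kernel? v))   ≡⟨ cong₂ ℕ._+_ (kernel-fibre-empty v ke nu) (trans (weight v (χ-no (Y._≟_ v v₀) v≢) (χ-yes (Kernel? v) ke)) (ℕₚ.*-identityʳ (q ℕ.^ 5))) ⟩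
          q ℕ.^ 5                                                      ≤⟨ ℕₚ.m≤m+n (q ℕ.^ 5) _ ⟩
          q ℕ.^ 5 ℕ.+ Q ℕ.^ 3 ℕ.* χ (InU? v)                           ∎
        pointwise v (no v≢) (no nke) (no nu) = begin
          fibre v ℕ.+ (χ (Y._≟_ v v₀) ℕ.+ q ℕ.^ 5 ℕ.* χ (Kernel? v))   ≡⟨ cong (fibre v ℕ.+_) (trans (weight v (χ-no (Y._≟_ v v₀) v≢) (χ-no (Kernel? v) nke)) (ℕₚ.*-zeroʳ (q ℕ.^ 5))) ⟩
          fibre v ℕ.+ 0                                                ≤⟨ ℕₚ.+-mono-≤ (fibre≤M v nu) z≤n ⟩
          q ℕ.^ 5 ℕ.+ Q ℕ.^ 3 ℕ.* χ (InU? v)                           ∎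

    -- The polynomials s ↦ f(w + su) for u in the plane.

    module _ (w : V) (nk : ¬ Kernel w) where
      -- By invariance f(w + su) depends on u only through B(u,w): the difference u - u′ is
      -- annihilated, and so are its multiples.
      same-section : ∀ u u′ → B (L u) w ≡ B (L u′) w → ∀ j → j ≤ suc q → coef w (L u) j ≡ coef w (L u′) j
      same-section u u′ e = coef-cong-line w (L u) w (L u′) along
        where
        y = u ⊕ (- 1#) ⊙ u′
        pow-1#q : pow 1# q ≡ 1#
        pow-1#q = pow-1# q
        flat : B (L y) w ≡ 0#
        flat = trans (B-combination u u′ 1# w) (trans (cong₂ (λ a c → B (L u) w - a * c) pow-1#q (sym e)) (lem (B (L u) w)))
          where
          lem : ∀ a → a - 1# * a ≡ 0#
          lem a = solve 1 (λ a → a :- :1 :* a := :0) refl a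
        along : ∀ s → f (w ⊕ s ⊙ L u) ≡ f (w ⊕ s ⊙ L u′)
        along s = begin
          f (w ⊕ s ⊙ L u)                     ≡⟨ cong (λ a → f (w ⊕ a)) (trans (sym (lincomb-⊙ s u b)) (trans (cong L (lem₁ u u′)) (lincomb-⊕ (s ⊙ u′) (s ⊙ y) b))) ⟩
          f (w ⊕ (L (s ⊙ u′) ⊕ L (s ⊙ y)))    ≡⟨ cong f (lem₂ w (L (s ⊙ u′)) (L (s ⊙ y))) ⟩
          f (w ⊕ L (s ⊙ u′) ⊕ L (s ⊙ y))      ≡⟨ Good.invariance w (kernel-or-good w nk) (s ⊙ y) (trans (B-L-scale s y w) (trans (cong (pow s q *_) flat) (zeroʳ _))) (s ⊙ u′) ⟩
          f (w ⊕ L (s ⊙ u′))                  ≡⟨ cong (λ a → f (w ⊕ a)) (lincomb-⊙ s u′ b) ⟩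
          f (w ⊕ s ⊙ L u′)                    ∎
          where
          open ≡-Reasoning
          lem₁ : ∀ u u′ → s ⊙ u ≡ s ⊙ u′ ⊕ s ⊙ (u ⊕ (- 1#) ⊙ u′)
          lem₁ u u′ = vsolve (s ∷ []) (u ∷ u′ ∷ []) (λ { (s ∷ []) (u ∷ u′ ∷ []) → s :⊙ u :≋ s :⊙ u′ :⊕ s :⊙ (u :⊕ (:- :1) :⊙ u′) }) refl
          lem₂ : ∀ w a c → w ⊕ (a ⊕ c) ≡ w ⊕ a ⊕ c
          lem₂ w a c = vsolve [] (w ∷ a ∷ c ∷ []) (λ { [] (w ∷ a ∷ c ∷ []) → w :⊕ (a :⊕ c) :≋ w :⊕ a :⊕ c }) refl

    -- For dual pairs the coefficients p_j, p′_j along w + t w′ satisfy p′_j(t) = t^(qj) p_j(t); comparing degrees forces p_j to be 0 or constant.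
    module DualPair (w w′ : V) (u u′ : Vec Carrier 3)
                    (u-w : B (L u) w ≡ 1#) (u-w′ : B (L u) w′ ≡ 0#) (u′-w : B (L u′) w ≡ 0#) (u′-w′ : B (L u′) w′ ≡ 1#) where

      private
        W : Carrier → V
        W t = w ⊕ t ⊙ w′

        B-u-W : ∀ t → B (L u) (W t) ≡ 1#
        B-u-W t = trans (B-addscaleʳ (L u) w w′ t) (trans (cong₂ (λ a c → a + t * c) u-w u-w′) lem)
          where
          lem : 1# + t * 0# ≡ 1#
          lem = solve 1 (λ t → :1 :+ t :* :0 := :1) refl t

        B-u′-W : ∀ t → B (L u′) (W t) ≡ t
        B-u′-W t = trans (B-addscaleʳ (L u′) w w′ t) (trans (cong₂ (λ a c → a + t * c) u′-w u′-w′) lem)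
          where
          lem : 0# + t * 1# ≡ t
          lem = solve 1 (λ t → :0 :+ t :* :1 := t) refl t

        W-not-kernel : ∀ t → ¬ Kernel (W t)
        W-not-kernel t k = 1≢0 (trans (sym (B-u-W t)) (k u))

        coefficients : ∀ j → j ≤ suc q → ∀ t → coef (W t) (L u′) j ≡ pow t (q ℕ.* j) * coef (W t) (L u) j
        coefficients j j≤ t = trans (same-section (W t) (W-not-kernel t) u′ (pow t q ⊙ u) same j j≤)
          (trans (cong (λ a → coef (W t) a j) (lincomb-⊙ (pow t q) u b)) (trans (coef-scale (W t) (L u) (pow t q) j j≤) (cong (_* coef (W t) (L u) j) (sym (pow-* t q j)))))
          where
          same : B (L u′) (W t) ≡ B (L (pow t q ⊙ u)) (W t)
          same = trans (B-u′-W t) (sym (trans (B-L-scale (pow t q) u (W t)) (trans (cong₂ _*_ (pow-Q t) (B-u-W t)) (*-identityʳ t))))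

        p : ∀ u j → j ≤ suc q → Σ (ℕ → Carrier) λ c → ∀ t → coef (W t) (L u) j ≡ evalN (suc (suc q ∸ j)) c t
        p u j j≤ = univariate {suc q ∸ j} {λ v → coef (w ⊕ head v ⊙ w′) (L u) j} (coef-polynomial w w′ (L u) j j≤)

        W-0 : W 0# ≡ w
        W-0 = lem w w′
          where
          lem : ∀ w w′ → w ⊕ 0# ⊙ w′ ≡ w
          lem w w′ = vsolve [] (w ∷ w′ ∷ []) (λ { [] (w ∷ w′ ∷ []) → w :⊕ :0 :⊙ w′ :≋ w }) refl

      middle-zero : ∀ j → 2 ≤ j → j < q → coef w (L u) j ≡ 0#
      middle-zero j 2≤j j<q = trans (cong (λ a → coef a (L u) j) (sym W-0)) (trans (proj₂ (p u j j≤) 0#)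
          (evalN-zero m (proj₁ (p u j j≤)) 0# (degree-gap m m (q ℕ.* j) (proj₁ (p u j j≤)) (proj₁ (p u′ j j≤)) m≤ small
            (λ t → trans (sym (proj₂ (p u′ j j≤) t)) (trans (coefficients j j≤ t) (cong (pow t (q ℕ.* j) *_) (proj₂ (p u j j≤) t)))))))
        where
        j≤ : j ≤ suc q
        j≤ = ℕₚ.≤-trans (ℕₚ.<⇒≤ j<q) (ℕₚ.n≤1+n q)
        m = suc (suc q ∸ j)
        m≤q : m ≤ q
        m≤q = ℕₚ.≤-trans (s≤s (ℕₚ.∸-monoʳ-≤ (suc q) 2≤j)) (ℕₚ.≤-reflexive (ℕₚ.m+[n∸m]≡n 1≤q))
        m≤ : m ≤ q ℕ.* j
        m≤ = ℕₚ.≤-trans m≤q (ℕₚ.≤-trans (ℕₚ.≤-reflexive (sym (ℕₚ.*-identityʳ q))) (ℕₚ.*-monoʳ-≤ q (ℕₚ.≤-trans (s≤s z≤n) 2≤j)))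
        -- Here j < q is used: at most qj + q ≤ q² coefficients occur, so functions on the field
        -- still determine them.
        small : q ℕ.* j ℕ.+ m ≤ Q
        small = ℕₚ.≤-trans (ℕₚ.+-monoʳ-≤ (q ℕ.* j) m≤q) (ℕₚ.≤-trans (ℕₚ.≤-reflexive (trans (ℕₚ.+-comm (q ℕ.* j) q) (sym (ℕₚ.*-suc q j))))
          (ℕₚ.≤-trans (ℕₚ.*-monoʳ-≤ q j<q) (ℕₚ.≤-reflexive (sym Q≡q²))))

      -- For j = 1 the two sides can share the term t^q, so the constant term of p₁ is first moved
      -- to the left. The remainder is t^(q+1) times a polynomial with q coefficients, facing one of
      -- degree at most q.
      linear-constant : ∀ t → coef (W t) (L u) 1 ≡ coef w (L u) 1
      linear-constant t = trans (constant-value t) (sym (trans (cong (λ a → coef a (L u) 1) (sym W-0)) (constant-value 0#)))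
        where
        c c′ : ℕ → Carrier
        c = proj₁ (p u 1 (s≤s z≤n))
        c′ = proj₁ (p u′ 1 (s≤s z≤n))
        tail-zero : ∀ j → j < q → c (suc j) ≡ 0#
        tail-zero = degree-gap q (suc q) (suc q) (c ∘ suc) (λ j → c′ j - monomial q (c 0) j) ℕₚ.≤-refl (ℕₚ.≤-trans small 3q≤Q) λ t → begin
          evalN (suc q) (λ j → c′ j - monomial q (c 0) j) t                       ≡⟨ evalN-difference (suc q) c′ (monomial q (c 0)) t ⟩
          evalN (suc q) c′ t - evalN (suc q) (monomial q (c 0)) t                 ≡⟨ cong₂ _-_ (trans (sym (proj₂ (p u′ 1 (s≤s z≤n)) t)) (coefficients 1 (s≤s z≤n) t)) (evalN-monomial q (c 0) t) ⟩
          pow t (q ℕ.* 1) * coef (W t) (L u) 1 - c 0 * pow t q                    ≡⟨ cong₂ (λ k a → pow t k * a - c 0 * pow t q) (ℕₚ.*-identityʳ q) (proj₂ (p u 1 (s≤s z≤n)) t) ⟩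
          pow t q * (c 0 + t * evalN q (c ∘ suc) t) - c 0 * pow t q               ≡⟨ lem (pow t q) (c 0) t (evalN q (c ∘ suc) t) ⟩
          pow t (suc q) * evalN q (c ∘ suc) t                                     ∎
          where
          open ≡-Reasoning
          lem : ∀ p c t e → p * (c + t * e) - c * p ≡ t * p * e
          lem p c t e = solve 4 (λ p c t e → p :* (c :+ t :* e) :- c :* p := t :* p :* e) refl p c t e
          small : suc q ℕ.+ q ≤ 3 ℕ.* q
          small = ℕₚ.≤-trans (ℕₚ.≤-reflexive (sym (ℕₚ.+-suc q q))) (ℕₚ.+-monoʳ-≤ q (ℕₚ.≤-trans (ℕₚ.≤-reflexive (ℕₚ.+-comm 1 q)) (ℕₚ.+-monoʳ-≤ q (ℕₚ.≤-trans 1≤q (ℕₚ.m≤m+n q 0)))))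
        constant-value : ∀ t → coef (W t) (L u) 1 ≡ c 0
        constant-value t = trans (proj₂ (p u 1 (s≤s z≤n)) t) (trans (cong (λ e → c 0 + t * e) (evalN-zero q (c ∘ suc) t tail-zero)) (lem (c 0) t))
          where
          lem : ∀ a t → a + t * 0# ≡ a
          lem a t = solve 2 (λ a t → a :+ t :* :0 := a) refl a t

    dependent-symmetric : ∀ w w′ → ¬ Kernel w → Dependent w′ w → Dependent w w′
    dependent-symmetric w w′ nk (κ , h) = (nz ⁻¹) , λ y → sym (trans (cong ((nz ⁻¹) *_) (h y)) (trans (lem (nz ⁻¹) κ (B (L y) w′)) (trans (cong (_* B (L y) w′) (⁻¹-inverse nz)) (*-identityˡ _))))
      where
      nz : κ ≢ 0#
      nz refl′ = nk (λ y → trans (h y) (trans (cong (_* B (L y) w′) refl′) (zeroˡ _)))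
      lem : ∀ i k a → i * (k * a) ≡ (k * i) * a
      lem i k a = solve 3 (λ i k a → i :* (k :* a) := k :* i :* a) refl i k a

    record Dual (w w′ : V) : Set where
      field
        u u′  : Vec Carrier 3
        u-w   : B (L u) w ≡ 1#
        u-w′  : B (L u) w′ ≡ 0#
        u′-w  : B (L u′) w ≡ 0#
        u′-w′ : B (L u′) w′ ≡ 1#

    dual-pair : ∀ w w′ → ¬ Kernel w → ¬ Dependent w w′ → Dual w w′
    dual-pair w w′ nk nd = record { u = proj₁ d′ ; u′ = proj₁ d ; u-w = proj₂ (proj₂ d′) ; u-w′ = proj₁ (proj₂ d′) ; u′-w = proj₁ (proj₂ d) ; u′-w′ = proj₂ (proj₂ d) }
      where
      d = dual w w′ nk nd
      d′ = dual w′ w (λ k → nd (kernel-dependent w w′ k)) (λ dep → nd (dependent-symmetric w w′ nk dep))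

    unit-vector : ∀ w → ¬ Kernel w → Σ (Vec Carrier 3) λ u → B (L u) w ≡ 1#
    unit-vector w nk = Dual.u d , Dual.u-w d
      where d = dual-pair w (proj₁ (rich-independent w)) nk (proj₂ (proj₂ (rich-independent w)))

    -- The intermediate coefficients vanish for a vector u₁ belonging to some dual pair with w, and
    -- `same-section` transfers this to the given u.
    section : ∀ w → ¬ Kernel w → ∀ u → B (L u) w ≡ 1# → ∀ s → f (w ⊕ s ⊙ L u) ≡ f w + s * coef w (L u) 1 + pow s q
    section w nk u e s = begin
      f (w ⊕ s ⊙ L u)                                            ≡⟨ line-q w u s ⟩
      evalN (suc q) c s                                          ≡⟨ evalN-snoc q c s ⟩
      evalN q c s + c q * pow s q                                ≡⟨ cong₂ (λ k a → evalN k c s + a * pow s q) (sym q″) (trans (coef-q w (L u)) e) ⟩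
      c 0 + s * (c 1 + s * evalN m (λ j → c (2 ℕ.+ j)) s) + 1# * pow s q
        ≡⟨ cong₂ (λ a z → a + s * (c 1 + s * z) + 1# * pow s q) (coef-0 w (L u)) (evalN-zero m (λ j → c (2 ℕ.+ j)) s zeros-between) ⟩
      f w + s * (c 1 + s * 0#) + 1# * pow s q                    ≡⟨ lem (f w) (c 1) (pow s q) ⟩
      f w + s * c 1 + pow s q                                    ∎
      where
      open ≡-Reasoning
      c = coef w (L u)
      m = q ∸ 2
      q″ : suc (suc m) ≡ q
      q″ = ℕₚ.m+[n∸m]≡n (ℕₚ.<⇒≤ 3≤q)
      w′ = proj₁ (rich-independent w)
      d = dual-pair w w′ nk (proj₂ (proj₂ (rich-independent w)))
      open Dual d using (u-w; u-w′; u′-w; u′-w′) renaming (u to u₁; u′ to u₂)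
      zeros-between : ∀ j → j < m → c (suc (suc j)) ≡ 0#
      zeros-between j j<m = trans (same-section w nk u u₁ (trans e (sym u-w)) (suc (suc j)) (ℕₚ.≤-trans (ℕₚ.<⇒≤ jq) (ℕₚ.n≤1+n q)))
          (DualPair.middle-zero w w′ u₁ u₂ u-w u-w′ u′-w u′-w′ (suc (suc j)) (s≤s (s≤s z≤n)) jq)
        where
        jq : suc (suc j) < q
        jq = ℕₚ.≤-trans (s≤s (s≤s j<m)) (ℕₚ.≤-reflexive q″)
      lem : ∀ a c p → a + s * (c + s * 0#) + 1# * p ≡ a + s * c + p
      lem a c p = solve 4 (λ a s c p → a :+ s :* (c :+ s :* :0) :+ :1 :* p := a :+ s :* c :+ p) refl a s c p

    -- The vector w + w′ connects both sides: it shares the coefficient with w along u₁ and with w′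
    -- along u₂, and it pairs to 1 with both u₁ and u₂.
    linear-coefficient : ∀ w w′ → ¬ Kernel w → ¬ Dependent w w′ → ∀ u u′ → B (L u) w ≡ 1# → B (L u′) w′ ≡ 1# → coef w (L u) 1 ≡ coef w′ (L u′) 1
    linear-coefficient w w′ nk nd u u′ e e′ = begin
      coef w (L u) 1              ≡⟨ same-section w nk u u₁ (trans e (sym u-w)) 1 (s≤s z≤n) ⟩
      coef w (L u₁) 1             ≡⟨ DualPair.linear-constant w w′ u₁ u₂ u-w u-w′ u′-w u′-w′ 1# ⟨
      coef (w ⊕ 1# ⊙ w′) (L u₁) 1 ≡⟨ same-section (w ⊕ 1# ⊙ w′) nkW u₁ u₂ (trans B₁ (sym B₂)) 1 (s≤s z≤n) ⟩
      coef (w ⊕ 1# ⊙ w′) (L u₂) 1 ≡⟨ cong (λ a → coef a (L u₂) 1) (swap w w′) ⟩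
      coef (w′ ⊕ 1# ⊙ w) (L u₂) 1 ≡⟨ DualPair.linear-constant w′ w u₂ u₁ u′-w′ u′-w u-w′ u-w 1# ⟩
      coef w′ (L u₂) 1            ≡⟨ same-section w′ (λ k → nd (kernel-dependent w w′ k)) u₂ u′ (trans u′-w′ (sym e′)) 1 (s≤s z≤n) ⟩
      coef w′ (L u′) 1            ∎
      where
      open ≡-Reasoning
      open Dual (dual-pair w w′ nk nd) using (u-w; u-w′; u′-w; u′-w′) renaming (u to u₁; u′ to u₂)
      swap : ∀ w w′ → w ⊕ 1# ⊙ w′ ≡ w′ ⊕ 1# ⊙ w
      swap w w′ = vsolve [] (w ∷ w′ ∷ []) (λ { [] (w ∷ w′ ∷ []) → w :⊕ :1 :⊙ w′ :≋ w′ :⊕ :1 :⊙ w }) refl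
      B₁ : B (L u₁) (w ⊕ 1# ⊙ w′) ≡ 1#
      B₁ = trans (B-addscaleʳ (L u₁) w w′ 1#) (trans (cong₂ (λ a c → a + 1# * c) u-w u-w′) lem)
        where
        lem : 1# + 1# * 0# ≡ 1#
        lem = solve 0 (:1 :+ :1 :* :0 := :1) refl
      B₂ : B (L u₂) (w ⊕ 1# ⊙ w′) ≡ 1#
      B₂ = trans (B-addscaleʳ (L u₂) w w′ 1#) (trans (cong₂ (λ a c → a + 1# * c) u′-w u′-w′) lem)
        where
        lem : 0# + 1# * 1# ≡ 1#
        lem = solve 0 (:0 :+ :1 :* :1 := :1) refl
      nkW : ¬ Kernel (w ⊕ 1# ⊙ w′)
      nkW k = 1≢0 (trans (sym B₁) (k u₁))

    -- The factor γ, Hermitian symmetry and nondegeneracy.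

    private
      base = rich-independent 𝟎

    w₁ : V
    w₁ = proj₁ base

    w₁-not-kernel : ¬ Kernel w₁
    w₁-not-kernel k = proj₂ (proj₂ base) (kernel-dependent 𝟎 w₁ k)

    private
      u₁ = unit-vector w₁ w₁-not-kernel

    c₁ : Carrier
    c₁ = coef w₁ (L (proj₁ u₁)) 1

    γ : Carrier
    γ = pow c₁ q

    two-roots : ∀ w → ¬ Kernel w → ∀ u → B (L u) w ≡ 1# → Σ Carrier λ s → Σ Carrier λ s′ → s ≢ s′ × f (w ⊕ s ⊙ L u) ≡ 0# × f (w ⊕ s′ ⊙ L u) ≡ 0#
    two-roots w nk u e = s , proj₁ other , proj₁ (proj₂ other) , proj₂ first , proj₂ (proj₂ other)
      where
      count : K.count (λ s → f (w ⊕ s ⊙ L u) ≟ 0#) ≡ q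
      count = trans (cong (λ a → lineCount a (L u)) (trans (lem w) (cong (w ⊕_) (sym (lincomb-𝟎 b))))) (Good.full w (kernel-or-good w nk) u (λ z → 1≢0 (trans (sym e) z)) 𝟎)
        where
        lem : ∀ w → w ≡ w ⊕ 𝟎
        lem w = vsolve [] (w ∷ []) (λ { [] (w ∷ []) → w :≋ w :⊕ :𝟎 }) refl
      first : Σ Carrier λ s → f (w ⊕ s ⊙ L u) ≡ 0#
      first = ∑-search K.list (λ s → f (w ⊕ s ⊙ L u) ≟ 0#) (subst (1 ≤_) (sym count) 1≤q)
      s = proj₁ first
      other : Σ Carrier λ s′ → s ≢ s′ × f (w ⊕ s′ ⊙ L u) ≡ 0#
      other = K.find (λ s′ → ¬? (s ≟ s′) ×-dec (f (w ⊕ s′ ⊙ L u) ≟ 0#)) λ none → ℕₚ.<⇒≱ 3≤q (ℕₚ.≤-trans (ℕₚ.≤-reflexive (sym count))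
        (ℕₚ.≤-trans (∑-mono K.list (λ s′ → χ-mono (f (w ⊕ s′ ⊙ L u) ≟ 0#) (s′ ≟ s) (λ z → sym (decidable-stable (s ≟ s′) (λ ne → none s′ (ne , z))))))
          (ℕₚ.≤-trans (ℕₚ.≤-reflexive (K.once s)) (s≤s z≤n))))

    private
      module Roots (w : V) (nk : ¬ Kernel w) (u : Vec Carrier 3) (e : B (L u) w ≡ 1#) where
        c = coef w (L u) 1
        s = proj₁ (two-roots w nk u e)
        s′ = proj₁ (proj₂ (two-roots w nk u e))
        s≢s′ = proj₁ (proj₂ (proj₂ (two-roots w nk u e)))
        equation : f w + s * c + pow s q ≡ 0#
        equation = trans (sym (section w nk u e s)) (proj₁ (proj₂ (proj₂ (proj₂ (two-roots w nk u e)))))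
        equation′ : f w + s′ * c + pow s′ q ≡ 0#
        equation′ = trans (sym (section w nk u e s′)) (proj₂ (proj₂ (proj₂ (proj₂ (two-roots w nk u e)))))
        δ = s - s′
        δ-power : pow δ q ≡ - (δ * c)
        δ-power = trans (pow-sub s s′) (trans (lem (f w) c s s′ (pow s q) (pow s′ q)) (trans (cong₂ (λ a d → a - d - δ * c) equation equation′) (lem′ (δ * c))))
          where
          lem : ∀ a c s s′ p p′ → p - p′ ≡ (a + s * c + p) - (a + s′ * c + p′) - (s - s′) * c
          lem a c s s′ p p′ = solve 6 (λ p p′ a s c s′ → p :- p′ := a :+ s :* c :+ p :- (a :+ s′ :* c :+ p′) :- (s :- s′) :* c) refl p p′ a s c s′
          lem′ : ∀ d → 0# - 0# - d ≡ - d
          lem′ d = solve 1 (λ d → :0 :- :0 :- d := :- d) refl d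
        -- The difference δ of two roots satisfies δ^q = -cδ. Raising to the power q once more
        -- returns δ on one side and c^(q+1) δ on the other.
        norm : c * pow c q ≡ 1#
        norm = *-cancelˡ (difference-nonzero s≢s′) (sym (begin
          δ * 1#                        ≡⟨ *-identityʳ δ ⟩
          δ                             ≡⟨ pow-Q δ ⟨
          pow (pow δ q) q               ≡⟨ cong (λ a → pow a q) δ-power ⟩
          pow (- (δ * c)) q             ≡⟨ pow-neg (δ * c) ⟩
          - pow (δ * c) q               ≡⟨ cong -_ (trans (pow-product δ c q) (cong (_* pow c q) δ-power)) ⟩
          - ((- (δ * c)) * pow c q)     ≡⟨ lem δ c (pow c q) ⟩
          δ * (c * pow c q)             ∎))
          where
          open ≡-Reasoning
          lem : ∀ d c p → - ((- (d * c)) * p) ≡ d * (c * p)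
          lem d c p = solve 3 (λ d c p → :- ((:- (d :* c)) :* p) := d :* (c :* p)) refl d c p
        value : f w ≡ - (s * c + pow s q)
        value = trans (lem (f w) (s * c) (pow s q)) (trans (cong (_- (s * c + pow s q)) equation) (+-identityˡ _))
          where
          lem : ∀ a x y → a ≡ a + x + y - (x + y)
          lem a x y = solve 3 (λ a x y → a := a :+ x :+ y :- (x :+ y)) refl a x y
        -- A root s expresses f(w) as -(sc + s^q). The q-th power exchanges the two terms up to the
        -- factor c^q, because c^(q+1) = 1.
        value-power : pow (f w) q ≡ pow c q * f w
        value-power = begin
          pow (f w) q                                       ≡⟨ cong (λ a → pow a q) value ⟩
          pow (- (s * c + pow s q)) q                       ≡⟨ trans (pow-neg _) (cong -_ (trans (frobenius _ _) (cong₂ _+_ (pow-product s c q) (pow-Q s)))) ⟩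
          - (pow s q * pow c q + s)                         ≡⟨ cong (λ a → - (pow s q * pow c q + a)) (trans (sym (*-identityʳ s)) (cong (s *_) (sym norm))) ⟩
          - (pow s q * pow c q + s * (c * pow c q))         ≡⟨ lem (pow s q) (pow c q) s c ⟩
          pow c q * (- (s * c + pow s q))                   ≡⟨ cong (pow c q *_) (sym value) ⟩
          pow c q * f w                                     ∎
          where
          open ≡-Reasoning
          lem : ∀ p d s c → - (p * d + s * (c * d)) ≡ d * (- (s * c + p))
          lem p d s c = solve 4 (λ p d s c → :- (p :* d :+ s :* (c :* d)) := d :* (:- (s :* c :+ p))) refl p d s c

    γ-nonzero : γ ≢ 0#
    γ-nonzero e = 1≢0 (trans (sym (Roots.norm w₁ w₁-not-kernel (proj₁ u₁) (proj₂ u₁))) (trans (cong (c₁ *_) e) (zeroʳ c₁)))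

    private
      independent-values : ∀ w → ¬ Dependent w₁ w → pow (f w) q ≡ γ * f w
      independent-values w nd = trans (Roots.value-power w nk (proj₁ u) (proj₂ u))
          (cong (λ c → pow c q * f w) (sym (linear-coefficient w₁ w w₁-not-kernel nd (proj₁ u₁) (proj₁ u) (proj₂ u₁) (proj₂ u))))
        where
        nk : ¬ Kernel w
        nk k = nd (kernel-dependent w₁ w k)
        u = unit-vector w nk

    -- Comparison of the coefficients of t⁰ and t¹ in f(v + tw)^q = γ f(v + tw), reduced modulo t^Q = t.
    frobenius-coefficients : ∀ v w → (∀ t → t ≢ 0# → pow (f (v ⊕ t ⊙ w)) q ≡ γ * f (v ⊕ t ⊙ w)) →
                             pow (f v) q ≡ γ * f v × pow (B w v) q ≡ γ * B v w
    frobenius-coefficients v w h = trans (cong (λ a → pow a q) (sym (coef-0 v w))) (trans (difference-zero (total-zero 0 (s≤s z≤n))) (cong (γ *_) (coef-0 v w))) ,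
        trans (cong (λ a → pow a q) (sym (coef-q v w))) (difference-zero (total-zero 1 (s≤s (s≤s z≤n))))
      where
      a b′ : ℕ → Carrier
      a = coef v w
      b′ j = pow (a j) q
      m = q ∸ 2
      q″ : suc (suc m) ≡ q
      q″ = ℕₚ.m+[n∸m]≡n (ℕₚ.<⇒≤ 3≤q)
      M N R : Vec Carrier 1 → Carrier
      M x = evalN (suc m) (b′ ∘ suc) (pow (head x) q)
      N x = evalN (suc (suc m)) (λ j → a (2 ℕ.+ j)) (head x)
      -- With t^(q²) = t and t^(q²+q) = t^(q+1), the difference f^q - γf along the line is its terms
      -- of degree 0 and 1 plus t²R(t).
      R x = (pow (head x) m * M x + b′ (suc q) * pow (head x) (suc m)) + (- γ) * N x
      D = m ℕ.+ m ℕ.* q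
      m+1≤D : suc m ≤ D
      m+1≤D = ℕₚ.≤-trans (ℕₚ.≤-reflexive (ℕₚ.+-comm 1 m)) (ℕₚ.+-monoʳ-≤ m (ℕₚ.*-mono-≤ (s≤s⁻¹ (s≤s⁻¹ (ℕₚ.≤-trans 3≤q (ℕₚ.≤-reflexive (sym q″))))) 1≤q))
      1*≡ : ∀ k → k ℕ.* 1 ≡ k
      1*≡ = ℕₚ.*-identityʳ
      R-pol : Pol 1 D R
      R-pol = Pol-+ (Pol-+ first second) third
        where
        first : Pol 1 D (λ x → pow (head x) m * M x)
        first = subst (λ k → Pol 1 k (λ x → pow (head x) m * M x)) (cong₂ ℕ._+_ (1*≡ m) (cong (m ℕ.*_) (1*≡ q)))
          (Pol-* (Pol-pow m Pol-coordinate) (Pol-evalN m (b′ ∘ suc) (Pol-pow q Pol-coordinate)))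
        second : Pol 1 D (λ x → b′ (suc q) * pow (head x) (suc m))
        second = Pol-≤ m+1≤D (subst (λ k → Pol 1 k (λ x → b′ (suc q) * pow (head x) (suc m))) (1*≡ (suc m)) (Pol-* (Pol-const 1 0 (b′ (suc q))) (Pol-pow (suc m) Pol-coordinate)))
        third : Pol 1 D (λ x → (- γ) * N x)
        third = Pol-≤ m+1≤D (subst (λ k → Pol 1 k (λ x → (- γ) * N x)) (1*≡ (suc m)) (Pol-* (Pol-const 1 0 (- γ)) (Pol-evalN (suc m) (λ j → a (2 ℕ.+ j)) Pol-coordinate)))
      e : ℕ → Carrier
      e = proj₁ (univariate {D} {R} R-pol)
      R-eval : ∀ t → R (t ∷ []) ≡ evalN (suc D) e t
      R-eval = proj₂ (univariate {D} {R} R-pol)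
      total : ℕ → Carrier
      total = cons (b′ 0 - γ * a 0) (cons (b′ q - γ * a 1) e)
      q-power : ∀ t → pow t q ≡ t * (t * pow t m)
      q-power t = cong (pow t) (sym q″)
      left : ∀ t → pow (f (v ⊕ t ⊙ w)) q ≡ b′ 0 + pow t q * M (t ∷ []) + b′ q * t + b′ (suc q) * (pow t q * t)
      left t = trans (cong (λ z → pow z q) (line v w t)) (trans (evalN-frobenius (suc (suc q)) a t) (trans (evalN-snoc (suc q) b′ (pow t q))
        (trans (cong (_+ b′ (suc q) * pow (pow t q) (suc q)) (trans (evalN-snoc q b′ (pow t q)) (cong (λ k → evalN k b′ (pow t q) + b′ q * pow (pow t q) q) (sym q″))))
          (cong₂ (λ x y → b′ 0 + pow t q * M (t ∷ []) + b′ q * x + b′ (suc q) * (pow t q * y)) (pow-Q t) (pow-Q t)))))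
      right : ∀ t → f (v ⊕ t ⊙ w) ≡ a 0 + t * (a 1 + t * N (t ∷ []))
      right t = trans (line v w t) (cong (λ k → a 0 + t * (a 1 + t * evalN k (λ j → a (2 ℕ.+ j)) t)) (sym q″))
      vanishes : ∀ t → t ≢ 0# → evalN (suc (suc (suc D))) total t ≡ 0#
      vanishes t nz = begin
        (b′ 0 - γ * a 0) + t * ((b′ q - γ * a 1) + t * evalN (suc D) e t)
          ≡⟨ cong (λ z → (b′ 0 - γ * a 0) + t * ((b′ q - γ * a 1) + t * z)) (sym (R-eval t)) ⟩
        (b′ 0 - γ * a 0) + t * ((b′ q - γ * a 1) + t * R (t ∷ []))
          ≡⟨ lem (b′ 0) (a 0) t (b′ q) (a 1) (pow t m) (M (t ∷ [])) (b′ (suc q)) (N (t ∷ [])) ⟩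
        (b′ 0 + t * (t * pow t m) * M (t ∷ []) + b′ q * t + b′ (suc q) * (t * (t * pow t m) * t)) - γ * (a 0 + t * (a 1 + t * N (t ∷ [])))
          ≡⟨ cong (λ z → (b′ 0 + z * M (t ∷ []) + b′ q * t + b′ (suc q) * (z * t)) - γ * (a 0 + t * (a 1 + t * N (t ∷ [])))) (sym (q-power t)) ⟩
        (b′ 0 + pow t q * M (t ∷ []) + b′ q * t + b′ (suc q) * (pow t q * t)) - γ * (a 0 + t * (a 1 + t * N (t ∷ [])))
          ≡⟨ cong₂ (λ x y → x - γ * y) (sym (left t)) (sym (right t)) ⟩
        pow (f (v ⊕ t ⊙ w)) q - γ * f (v ⊕ t ⊙ w)
          ≡⟨ cong (_- γ * f (v ⊕ t ⊙ w)) (h t nz) ⟩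
        γ * f (v ⊕ t ⊙ w) - γ * f (v ⊕ t ⊙ w)
          ≡⟨ lem′ (γ * f (v ⊕ t ⊙ w)) ⟩
        0# ∎
        where
        open ≡-Reasoning
        lem : ∀ b₀ a₀ t bq a₁ p M bq′ N → (b₀ - γ * a₀) + t * ((bq - γ * a₁) + t * ((p * M + bq′ * (t * p)) + (- γ) * N))
            ≡ (b₀ + t * (t * p) * M + bq * t + bq′ * (t * (t * p) * t)) - γ * (a₀ + t * (a₁ + t * N))
        lem b₀ a₀ t bq a₁ p M bq′ N = solve 10 (λ b₀ γ a₀ t bq a₁ p M bq′ N → b₀ :- γ :* a₀ :+ t :* (bq :- γ :* a₁ :+ t :* (p :* M :+ bq′ :* (t :* p) :+ (:- γ) :* N)) := b₀ :+ t :* (t :* p) :* M :+ bq :* t :+ bq′ :* (t :* (t :* p) :* t) :- γ :* (a₀ :+ t :* (a₁ :+ t :* N))) refl b₀ γ a₀ t bq a₁ p M bq′ N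
        lem′ : ∀ x → x - x ≡ 0#
        lem′ x = solve 1 (λ x → x :- x := :0) refl x
      -- The reduced degree is at most D + 2 = q² - q, so vanishing at the nonzero t determines all
      -- coefficients.
      small : suc (suc (suc D)) < Q
      small = ℕₚ.≤-trans (ℕₚ.+-monoˡ-≤ (m ℕ.* q) (ℕₚ.+-mono-≤ (ℕₚ.<⇒≤ 3≤q) (ℕₚ.≤-reflexive q″))) (ℕₚ.≤-reflexive total-Q)
        where
        total-Q : q ℕ.+ q ℕ.+ m ℕ.* q ≡ Q
        total-Q = trans (ℕₚ.+-assoc q q (m ℕ.* q)) (trans (cong (ℕ._* q) q″) (sym Q≡q²))
      total-zero : ∀ j → j < 2 → total j ≡ 0#
      total-zero j j<2 = zero-off-zero (suc (suc (suc D))) total small vanishes j (ℕₚ.≤-trans j<2 (s≤s (s≤s z≤n)))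

    -- If v is dependent on w₁, then v + tw₂ is not for any t ≠ 0. The equation there is an identity
    -- of polynomials in t, and its constant term is the claim for v.
    values : ∀ v → pow (f v) q ≡ γ * f v
    values v = by (Dependent? w₁ v)
      where
      w₂ = proj₁ (rich-independent w₁)
      still : Dependent w₁ v → ∀ t → t ≢ 0# → ¬ Dependent w₁ (v ⊕ t ⊙ w₂)
      still (κ , dep) t nz (κ′ , dep′) = proj₂ (proj₂ (rich-independent w₁)) ((nz ⁻¹) * (κ′ - κ) , λ y → *-cancelˡ nz (begin
        t * B (L y) w₂                                      ≡⟨ lem (B (L y) v) (t * B (L y) w₂) ⟩
        (B (L y) v + t * B (L y) w₂) - B (L y) v            ≡⟨ cong₂ _-_ (trans (sym (B-addscaleʳ (L y) v w₂ t)) (dep′ y)) (dep y) ⟩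
        κ′ * B (L y) w₁ - κ * B (L y) w₁                    ≡⟨ lem₁ (B (L y) w₁) ⟩
        1# * ((κ′ - κ) * B (L y) w₁)                        ≡⟨ cong (_* ((κ′ - κ) * B (L y) w₁)) (sym (⁻¹-inverse nz)) ⟩
        t * (nz ⁻¹) * ((κ′ - κ) * B (L y) w₁)               ≡⟨ lem₂ (nz ⁻¹) (B (L y) w₁) ⟩
        t * ((nz ⁻¹) * (κ′ - κ) * B (L y) w₁)               ∎))
        where
        open ≡-Reasoning
        lem : ∀ a c → c ≡ (a + c) - a
        lem a c = solve 2 (λ c a → c := a :+ c :- a) refl c a
        lem₁ : ∀ a → κ′ * a - κ * a ≡ 1# * ((κ′ - κ) * a)
        lem₁ a = solve 3 (λ κ′ a κ → κ′ :* a :- κ :* a := :1 :* ((κ′ :- κ) :* a)) refl κ′ a κ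
        lem₂ : ∀ i a → t * i * ((κ′ - κ) * a) ≡ t * (i * (κ′ - κ) * a)
        lem₂ i a = solve 5 (λ t i κ′ κ a → t :* i :* ((κ′ :- κ) :* a) := t :* (i :* (κ′ :- κ) :* a)) refl t i κ′ κ a
      by : Dec (Dependent w₁ v) → pow (f v) q ≡ γ * f v
      by (no nd)   = independent-values v nd
      by (yes dep) = proj₁ (frobenius-coefficients v w₂ (λ t nz → independent-values (v ⊕ t ⊙ w₂) (still dep t nz)))

    B-hermitian : ∀ u v → pow (B u v) q ≡ γ * B v u
    B-hermitian u v = proj₂ (frobenius-coefficients v u (λ t _ → values (v ⊕ t ⊙ u)))

    B-addˡ : ∀ u u′ v → B (u ⊕ u′) v ≡ B u v + B u′ v
    B-addˡ u u′ v = *-cancelˡ γ-nonzero (begin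
      γ * B (u ⊕ u′) v                ≡⟨ B-hermitian v (u ⊕ u′) ⟨
      pow (B v (u ⊕ u′)) q            ≡⟨ cong (λ a → pow a q) (B-addʳ v u u′) ⟩
      pow (B v u + B v u′) q          ≡⟨ frobenius (B v u) (B v u′) ⟩
      pow (B v u) q + pow (B v u′) q  ≡⟨ cong₂ _+_ (B-hermitian v u) (B-hermitian v u′) ⟩
      γ * B u v + γ * B u′ v          ≡⟨ lem γ (B u v) (B u′ v) ⟩
      γ * (B u v + B u′ v)            ∎)
      where
      open ≡-Reasoning
      lem : ∀ g a c → g * a + g * c ≡ g * (a + c)
      lem g a c = solve 3 (λ g a c → g :* a :+ g :* c := g :* (a :+ c)) refl g a c

    B-symmetric-zero : ∀ u v → B u v ≡ 0# → B v u ≡ 0#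
    B-symmetric-zero u v e = *-integral γ-nonzero (trans (sym (B-hermitian u v)) (trans (cong (λ a → pow a q) e) (pow-0# q 1≤q)))

    private
      -- If x in U pairs to zero with everything, the kernel is cut out by the two conditions at y₁
      -- and y₂ and has at least Q^5 = q^10 vectors.
      too-large : ∀ x y₁ y₂ → (∀ y → Σ Carrier λ r → Σ Carrier λ s → Σ Carrier λ t → y ≡ r ⊙ x ⊕ s ⊙ y₁ ⊕ t ⊙ y₂) → ¬ (∀ v → B (L x) v ≡ 0#)
      too-large x y₁ y₂ span null = ℕₚ.<⇒≱ kernel-small (ℕₚ.*-cancelˡ-≤ (q ℕ.^ 4) {{ℕₚ.m^n≢0 q 4}} (begin
        q ℕ.^ 4 ℕ.* q ℕ.^ 10                         ≡⟨ ℕₚ.^-distribˡ-+-* q 4 10 ⟨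
        q ℕ.^ 14                                     ≡⟨ Q^ 7 ⟨
        Q ℕ.^ 7                                      ≤⟨ annihilated-count (L y₁ ∷ L y₂ ∷ []) ⟩
        Q ℕ.^ 2 ℕ.* Y.count (Annihilated? (L y₁ ∷ L y₂ ∷ []))  ≡⟨ cong (ℕ._* Y.count (Annihilated? (L y₁ ∷ L y₂ ∷ []))) (Q^ 2) ⟩
        q ℕ.^ 4 ℕ.* Y.count (Annihilated? (L y₁ ∷ L y₂ ∷ []))  ≤⟨ ℕₚ.*-monoʳ-≤ (q ℕ.^ 4) (∑-mono Y.list (λ v → χ-mono (Annihilated? (L y₁ ∷ L y₂ ∷ []) v) (Kernel? v) (inKernel v))) ⟩
        q ℕ.^ 4 ℕ.* Y.count Kernel?                  ∎))
        where
        open ℕₚ.≤-Reasoning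
        inKernel : ∀ v → Annihilated (L y₁ ∷ L y₂ ∷ []) v → Kernel v
        inKernel v ((_ , e₂) , e₁) y = from (span y)
          where
          from : (Σ Carrier λ r → Σ Carrier λ s → Σ Carrier λ t → y ≡ r ⊙ x ⊕ s ⊙ y₁ ⊕ t ⊙ y₂) → B (L y) v ≡ 0#
          from (r , s , t , refl) = trans (B-additive (r ⊙ x ⊕ s ⊙ y₁) (t ⊙ y₂) v) (trans (cong₂ _+_ (trans (B-additive (r ⊙ x) (s ⊙ y₁) v)
              (cong₂ _+_ (trans (B-L-scale r x v) (cong (pow r q *_) (null v))) (trans (B-L-scale s y₁ v) (cong (pow s q *_) e₁)))) (trans (B-L-scale t y₂ v) (cong (pow t q *_) e₂)))
              (lem (pow r q) (pow s q) (pow t q)))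
            where
            lem : ∀ r s t → r * 0# + s * 0# + t * 0# ≡ 0#
            lem r s t = solve 3 (λ r s t → r :* :0 :+ s :* :0 :+ t :* :0 := :0) refl r s t

    -- When a coordinate of x is nonzero, x can replace that unit vector in the standard basis, and
    -- `too-large` applies with the other two.
    B-nonzero-on-U : ∀ x → (∀ v → B (L x) v ≡ 0#) → x ≡ 𝟎
    B-nonzero-on-U (x₁ ∷ x₂ ∷ x₃ ∷ []) null = by (x₁ ≟ 0#) (x₂ ≟ 0#) (x₃ ≟ 0#)
      where
      x : Vec Carrier 3
      x = x₁ ∷ x₂ ∷ x₃ ∷ []
      vec3 : ∀ {a a′ c c′ d d′ : Carrier} → a ≡ a′ → c ≡ c′ → d ≡ d′ → _≡_ {A = Vec Carrier 3} (a ∷ c ∷ d ∷ []) (a′ ∷ c′ ∷ d′ ∷ [])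
      vec3 refl refl refl = refl
      main : ∀ {x} (nz : x ≢ 0#) p s t → p ≡ p * (nz ⁻¹) * x + s * 0# + t * 0#
      main {x} nz p s t = trans (trans (sym (*-identityʳ p)) (cong (p *_) (sym (⁻¹-inverse nz)))) (lem (nz ⁻¹))
        where
        lem : ∀ i → p * (x * i) ≡ p * i * x + s * 0# + t * 0#
        lem i = solve 5 (λ p x i s t → p :* (x :* i) := p :* i :* x :+ s :* :0 :+ t :* :0) refl p x i s t
      side₁ : ∀ k r t → r ≡ k + (r - k) * 1# + t * 0#
      side₁ k r t = solve 3 (λ r k t → r := k :+ (r :- k) :* :1 :+ t :* :0) refl r k t
      side₂ : ∀ k s t → s ≡ k + t * 0# + (s - k) * 1#
      side₂ k s t = solve 3 (λ s k t → s := k :+ t :* :0 :+ (s :- k) :* :1) refl s k t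
      e₁ e₂ e₃ : Vec Carrier 3
      e₁ = 1# ∷ 0# ∷ 0# ∷ []
      e₂ = 0# ∷ 1# ∷ 0# ∷ []
      e₃ = 0# ∷ 0# ∷ 1# ∷ []
      by : Dec (x₁ ≡ 0#) → Dec (x₂ ≡ 0#) → Dec (x₃ ≡ 0#) → x ≡ 𝟎
      by (yes p) (yes r) (yes s) = vec3 p r s
      by (no nz) _ _ = ⊥-elim (too-large x e₂ e₃ (λ { (p ∷ r ∷ s ∷ []) →
        p * (nz ⁻¹) , r - p * (nz ⁻¹) * x₂ , s - p * (nz ⁻¹) * x₃ , vec3 (main nz p _ _) (side₁ _ r _) (side₂ _ s _) }) null)
      by (yes _) (no nz) _ = ⊥-elim (too-large x e₁ e₃ (λ { (p ∷ r ∷ s ∷ []) →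
        r * (nz ⁻¹) , p - r * (nz ⁻¹) * x₁ , s - r * (nz ⁻¹) * x₃ , vec3 (side₁ _ p _) (main nz r _ _) (side₂ _ s _) }) null)
      by (yes _) (yes _) (no nz) = ⊥-elim (too-large x e₁ e₂ (λ { (p ∷ r ∷ s ∷ []) →
        s * (nz ⁻¹) , p - s * (nz ⁻¹) * x₁ , r - s * (nz ⁻¹) * x₂ , vec3 (side₁ _ p _) (side₂ _ r _) (main nz s _ _) }) null)

    -- A radical vector lies in the kernel, hence is cw₀ + u′ with u′ in U. Pairing with w₀ leaves
    -- c^q f(w₀), so c = 0, and `B-nonzero-on-U` finishes.
    B-nondegenerate : ∀ u → (∀ v → B u v ≡ 0#) → u ≡ 𝟎
    B-nondegenerate u null = from (kernel-span u (λ y → B-symmetric-zero u (L y) (null (L y)))) null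
      where
      from : ∀ {u} → InSpan (w₀ ∷ b) u → (∀ v → B u v ≡ 0#) → u ≡ 𝟎
      from ((c ∷ x) , refl) null = by (c ≟ 0#)
        where
        at-w₀ : pow c q * f w₀ ≡ 0#
        at-w₀ = trans (cong (pow c q *_) (sym (B-diagonal w₀))) (trans (sym (B-scaleˡ c w₀ w₀)) (trans (sym (trans (cong (B (c ⊙ w₀) w₀ +_) (w₀-kernel x)) (+-identityʳ _)))
          (trans (sym (B-addˡ (c ⊙ w₀) (L x) w₀)) (null w₀))))
        by : Dec (c ≡ 0#) → c ⊙ w₀ ⊕ L x ≡ 𝟎
        by (no nz) = ⊥-elim (*-nonzero (pow-nonzero q nz) f-w₀ at-w₀)
        by (yes refl) = trans (lem w₀ (L x)) (trans (cong L (B-nonzero-on-U x (λ v → trans (cong (λ a → B a v) (sym (lem w₀ (L x)))) (null v)))) (lincomb-𝟎 b))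
          where
          lem : ∀ w a → 0# ⊙ w ⊕ a ≡ a
          lem w a = vsolve [] (w ∷ a ∷ []) (λ { [] (w ∷ a ∷ []) → :0 :⊙ w :⊕ a :≋ a }) refl

    μ : Carrier
    μ = f-w₀ ⁻¹

    μ-nonzero : μ ≢ 0#
    μ-nonzero = ⁻¹-nonzero f-w₀

    -- The inverse of f(w₀) absorbs γ because f(w₀)^q = γ f(w₀); this is what makes the multiple μB
    -- Hermitian.
    μ-power : pow μ q * γ ≡ μ
    μ-power = *-cancelˡ f-w₀ (*-cancelˡ (pow-nonzero q f-w₀) (begin
      pow φ q * (φ * (pow μ q * γ))           ≡⟨ lem (pow φ q) φ (pow μ q) γ ⟩
      (pow φ q * pow μ q) * (γ * φ)           ≡⟨ cong₂ _*_ (trans (sym (pow-product φ μ q)) (trans (cong (λ a → pow a q) (⁻¹-inverse f-w₀)) (pow-1# q))) (sym (values w₀)) ⟩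
      1# * pow φ q                            ≡⟨ *-comm 1# _ ⟩
      pow φ q * 1#                            ≡⟨ cong (pow φ q *_) (sym (⁻¹-inverse f-w₀)) ⟩
      pow φ q * (φ * μ)                       ∎))
      where
      open ≡-Reasoning
      φ = f w₀
      lem : ∀ p φ m g → p * (φ * (m * g)) ≡ (p * m) * (g * φ)
      lem p φ m g = solve 4 (λ p φ m g → p :* (φ :* (m :* g)) := p :* m :* (g :* φ)) refl p φ m g

-- Projective points against vectors, and homogeneous polynomials.

β : Bool → ℕ
β true  = 1
β false = 0

length-filterᵇ : ∀ {a} {A : Set a} (p : A → Bool) xs → length (filterᵇ p xs) ≡ ∑ xs (β ∘ p)
length-filterᵇ p []       = refl
length-filterᵇ p (x ∷ xs) with p x
... | true  = cong suc (length-filterᵇ p xs)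
... | false = length-filterᵇ p xs

β-⌊⌋ : ∀ {a} {A : Set a} (d : Dec A) → β ⌊ d ⌋ ≡ χ d
β-⌊⌋ (yes _) = refl
β-⌊⌋ (no _)  = refl

module Points (F : DiscreteField) where
  open FieldTheory F
  open LinearSums F
  open Geometry (toFiniteField F) using (allVecs; normalisedᵇ; countPoints; monomials; monomialValue; eval)
    renaming (_+ᵥ_ to infixl 6 _⊕_; _·ᵥ_ to infixr 7 _⊙_; zeroᵥ to 𝟎)
  open Polynomials F using (Pol; Pol-+; Pol-*; Pol-const; Pol-pow; Pol-coordinate; Pol-tail)
  private module K = Enumeration 𝔽

  ∑-allVecs : ∀ n g → ∑ (allVecs n) g ≡ Enumeration.sum (𝕍 n) g
  ∑-allVecs zero    g = trans (ℕₚ.+-identityʳ (g [])) (sym (∑-vectors-zero 𝔽 g))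
  ∑-allVecs (suc n) g = trans (∑-concatMap (λ x → L.map (x ∷_) (allVecs n)) elements g)
    (trans (∑-cong elements (λ x → trans (∑-map (x ∷_) (allVecs n) g) (∑-allVecs n (λ v → g (x ∷ v))))) (sym (∑-vectors 𝔽 n g)))

  units : ℕ
  units = K.count (λ s → ¬? (s ≟ 0#))

  private
    sum-split : ∀ g c → (∀ x → x ≢ 0# → g x ≡ c) → K.sum g ≡ g 0# ℕ.+ units ℕ.* c
    sum-split g c h = trans (∑-cong elements (λ x → pointwise x (x ≟ 0#))) (trans (∑-+ elements (λ x → χ (x ≟ 0#) ℕ.* g x) (λ x → χ (¬? (x ≟ 0#)) ℕ.* c))
        (cong₂ ℕ._+_ (K.sum-δ 0# g) (∑-*ʳ elements (λ x → χ (¬? (x ≟ 0#))) c)))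
      where
      pointwise : ∀ x → Dec (x ≡ 0#) → g x ≡ χ (x ≟ 0#) ℕ.* g x ℕ.+ χ (¬? (x ≟ 0#)) ℕ.* c
      pointwise x (yes e) = sym (trans (cong₂ (λ a b → a ℕ.* g x ℕ.+ b ℕ.* c) (χ-yes (x ≟ 0#) e) (χ-no (¬? (x ≟ 0#)) (λ ne → ne e))) (trans (ℕₚ.+-identityʳ _) (ℕₚ.*-identityˡ (g x))))
      pointwise x (no ne) = trans (h x ne) (sym (trans (cong₂ (λ a b → a ℕ.* g x ℕ.+ b ℕ.* c) (χ-no (x ≟ 0#) ne) (χ-yes (¬? (x ≟ 0#)) ne)) (ℕₚ.*-identityˡ c)))

  -- Every nonzero vector is a unit multiple of exactly one normalised vector.
  points-and-vectors : ∀ n (P : Vec Carrier n → Bool) → (∀ s v → s ≢ 0# → P (s ⊙ v) ≡ P v) →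
    Enumeration.sum (𝕍 n) (β ∘ P) ≡ β (P 𝟎) ℕ.+ units ℕ.* Enumeration.sum (𝕍 n) (λ v → β (normalisedᵇ v ∧ P v))
  points-and-vectors zero P inv = trans (∑-vectors-zero 𝔽 (β ∘ P)) (sym (trans (cong (λ a → β (P []) ℕ.+ units ℕ.* a) (∑-vectors-zero 𝔽 (λ v → β (normalisedᵇ v ∧ P v))))
    (trans (cong (β (P []) ℕ.+_) (ℕₚ.*-zeroʳ units)) (ℕₚ.+-identityʳ _))))
  points-and-vectors (suc n) P inv = begin
    Enumeration.sum (𝕍 (suc n)) (β ∘ P)                        ≡⟨ ∑-vectors 𝔽 n (β ∘ P) ⟩
    K.sum g                                                    ≡⟨ sum-split g (g 1#) (λ x nz → by-scaling x nz) ⟩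
    g 0# ℕ.+ units ℕ.* g 1#                                    ≡⟨ cong (ℕ._+ units ℕ.* g 1#) (points-and-vectors n (λ v → P (0# ∷ v)) inv′) ⟩
    β (P 𝟎) ℕ.+ units ℕ.* N ℕ.+ units ℕ.* g 1#                 ≡⟨ trans (ℕₚ.+-assoc (β (P 𝟎)) _ _) (cong (β (P 𝟎) ℕ.+_) (sym (ℕₚ.*-distribˡ-+ units N (g 1#)))) ⟩
    β (P 𝟎) ℕ.+ units ℕ.* (N ℕ.+ g 1#)                         ≡⟨ cong (λ a → β (P 𝟎) ℕ.+ units ℕ.* a) (sym normalised-sum) ⟩
    β (P 𝟎) ℕ.+ units ℕ.* Enumeration.sum (𝕍 (suc n)) (λ v → β (normalisedᵇ v ∧ P v)) ∎
    where
    open ≡-Reasoning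
    open Enumeration (𝕍 n) using (sum; list)
    g h : Carrier → ℕ
    g x = sum (λ v → β (P (x ∷ v)))
    h x = sum (λ v → β (normalisedᵇ (x ∷ v) ∧ P (x ∷ v)))
    N = sum (λ v → β (normalisedᵇ v ∧ P (0# ∷ v)))
    inv′ : ∀ s v → s ≢ 0# → P (0# ∷ (s ⊙ v)) ≡ P (0# ∷ v)
    inv′ s v nz = trans (cong (λ a → P (a ∷ (s ⊙ v))) (sym (zeroʳ s))) (inv s (0# ∷ v) nz)
    by-scaling : ∀ x → x ≢ 0# → g x ≡ g 1#
    by-scaling x nz = trans (sym (sum-dilate nz (λ v → β (P (x ∷ v))))) (∑-cong list (λ v → cong β (trans (cong (λ a → P (a ∷ (x ⊙ v))) (sym (*-identityʳ x))) (inv x (1# ∷ v) nz))))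
    -- A first coordinate 0 leaves the decision to the tail, 1 admits every tail, and any other
    -- value admits none.
    normalised-value : ∀ x → h x ≡ χ (x ≟ 0#) ℕ.* N ℕ.+ χ (x ≟ 1#) ℕ.* g 1#
    normalised-value x with x ≟ 0# | x ≟ 1#
    ... | yes refl | yes e = ⊥-elim (0≢1 e)
    ... | yes refl | no _ = sym (trans (ℕₚ.+-identityʳ _) (ℕₚ.*-identityˡ N))
    ... | no _ | yes refl = sym (ℕₚ.*-identityˡ (g 1#))
    ... | no _ | no _ = ∑-zero list
    normalised-sum : Enumeration.sum (𝕍 (suc n)) (λ v → β (normalisedᵇ v ∧ P v)) ≡ N ℕ.+ g 1#
    normalised-sum = trans (∑-vectors 𝔽 n (λ v → β (normalisedᵇ v ∧ P v))) (trans (∑-cong elements normalised-value)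
      (trans (∑-+ elements (λ x → χ (x ≟ 0#) ℕ.* N) (λ x → χ (x ≟ 1#) ℕ.* g 1#)) (cong₂ ℕ._+_ (K.sum-δ 0# (λ _ → N)) (K.sum-δ 1# (λ _ → g 1#)))))

  zeros-and-points : ∀ {n} (g : Vec Carrier n → Carrier) d → (∀ s v → g (s ⊙ v) ≡ pow s d * g v) → g 𝟎 ≡ 0# →
    Enumeration.count (𝕍 n) (λ v → g v ≟ 0#) ≡ suc (units ℕ.* countPoints n (λ v → ⌊ g v ≟ 0# ⌋))
  zeros-and-points {n} g d hom g𝟎 = trans (∑-cong Y.list (λ v → sym (β-⌊⌋ (g v ≟ 0#)))) (trans (points-and-vectors n P inv)
      (cong₂ (λ a c → a ℕ.+ units ℕ.* c) (trans (β-⌊⌋ (g 𝟎 ≟ 0#)) (χ-yes (g 𝟎 ≟ 0#) g𝟎))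
        (sym (trans (length-filterᵇ (λ v → normalisedᵇ v ∧ P v) (allVecs n)) (∑-allVecs n (λ v → β (normalisedᵇ v ∧ P v)))))))
    where
    module Y = Enumeration (𝕍 n)
    P : Vec Carrier n → Bool
    P v = ⌊ g v ≟ 0# ⌋
    inv : ∀ s v → s ≢ 0# → P (s ⊙ v) ≡ P v
    inv s v nz with g v ≟ 0# | g (s ⊙ v) ≟ 0#
    ... | yes _ | yes _ = refl
    ... | no _  | no _  = refl
    ... | yes e | no ne = ⊥-elim (ne (trans (hom s v) (trans (cong (pow s d *_) e) (zeroʳ _))))
    ... | no ne | yes e = ⊥-elim (*-nonzero (pow-nonzero d nz) ne (trans (sym (hom s v)) e))

  monomials-degree : ∀ d n → All (λ e → V.sum e ≡ d) (monomials d n)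
  monomials-degree zero    zero = refl ∷ []
  monomials-degree (suc d) zero = []
  monomials-degree d (suc n) = Allₚ.concat⁺ (Allₚ.map⁺ (Allₚ.applyUpTo⁺₁ (λ e → e) (suc d)
    (λ {e} e≤d → Allₚ.map⁺ (All.map (λ s → trans (cong (e ℕ.+_) s) (ℕₚ.m+[n∸m]≡n (s≤s⁻¹ e≤d))) (monomials-degree (d ∸ e) n)))))

  monomial-homogeneous : ∀ {n} (e : Vec ℕ n) s v → monomialValue e (s ⊙ v) ≡ pow s (V.sum e) * monomialValue e v
  monomial-homogeneous []       s []       = sym (*-identityˡ 1#)
  monomial-homogeneous (e ∷ es) s (x ∷ xs) = trans (cong₂ _*_ (pow-product s x e) (monomial-homogeneous es s xs))
      (trans (lem (pow s e) (pow x e) (pow s (V.sum es)) (monomialValue es xs)) (cong (_* (pow x e * monomialValue es xs)) (sym (pow-+ s e (V.sum es)))))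
    where
    lem : ∀ a b c d → a * b * (c * d) ≡ a * c * (b * d)
    lem a b c d = solve 4 (λ a b c d → a :* b :* (c :* d) := a :* c :* (b :* d)) refl a b c d

  monomial-planar : ∀ {n} (e : Vec ℕ n) z u u′ → Pol 2 (V.sum e) (λ x → monomialValue e (z ⊕ head x ⊙ u ⊕ head (tail x) ⊙ u′))
  monomial-planar []       []       []       []         = Pol-const 2 0 1#
  monomial-planar (e ∷ es) (z ∷ zs) (u ∷ us) (u′ ∷ us′) =
    Pol-* (subst (λ k → Pol 2 k (λ x → pow (z + head x * u + head (tail x) * u′) e)) (ℕₚ.*-identityʳ e) (Pol-pow e coordinate)) (monomial-planar es zs us us′)
    where
    coordinate : Pol 2 1 (λ x → z + head x * u + head (tail x) * u′)
    coordinate = Pol-+ (Pol-+ (Pol-const 2 1 z) (Pol-* Pol-coordinate (Pol-const 2 0 u))) (Pol-* (Pol-tail Pol-coordinate) (Pol-const 2 0 u′))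

  private
    form : (es : List (Vec ℕ 7)) → (Vec ℕ 7 → Carrier) → Vec Carrier 7 → Carrier
    form es c v = L.foldr _+_ 0# (L.map (λ e → c e * monomialValue e v) es)

    form-homogeneous : ∀ d es c → All (λ e → V.sum e ≡ d) es → ∀ s v → form es c (s ⊙ v) ≡ pow s d * form es c v
    form-homogeneous d []       c []         s v = sym (zeroʳ (pow s d))
    form-homogeneous d (e ∷ es) c (refl ∷ a) s v = trans (cong₂ (λ x y → c e * x + y) (monomial-homogeneous e s v) (form-homogeneous d es c a s v))
        (lem (c e) (pow s d) (monomialValue e v) (form es c v))
      where
      lem : ∀ c p m r → c * (p * m) + p * r ≡ p * (c * m + r)
      lem c p m r = solve 4 (λ c p m r → c :* (p :* m) :+ p :* r := p :* (c :* m :+ r)) refl c p m r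

    form-planar : ∀ d es c → All (λ e → V.sum e ≡ d) es → ∀ z u u′ → Pol 2 d (λ x → form es c (z ⊕ head x ⊙ u ⊕ head (tail x) ⊙ u′))
    form-planar d []       c []         z u u′ = Pol-const 2 d 0#
    form-planar d (e ∷ es) c (refl ∷ a) z u u′ = Pol-+ (Pol-* (Pol-const 2 0 (c e)) (monomial-planar e z u u′)) (form-planar d es c a z u u′)

  eval-homogeneous : ∀ d c s v → eval d 7 c (s ⊙ v) ≡ pow s d * eval d 7 c v
  eval-homogeneous d c = form-homogeneous d (monomials d 7) c (monomials-degree d 7)

  eval-planar : ∀ d c z u u′ → Pol 2 d (λ x → eval d 7 c (z ⊕ head x ⊙ u ⊕ head (tail x) ⊙ u′))
  eval-planar d c = form-planar d (monomials d 7) c (monomials-degree d 7)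

module PointArithmetic (q : ℕ) where
  open +-*-Solver

  -- Adding N to both sides completes (q² - 1)N to q²N and avoids subtraction.
  vectors-from-points : ∀ {Z k N} → Z ≡ suc (k ℕ.* N) → q ℕ.* q ≡ suc k → N ≡ q ℕ.^ 11 ℕ.+ q ℕ.^ 9 ℕ.+ q ℕ.^ 7 ℕ.+ q ℕ.^ 4 ℕ.+ q ℕ.^ 2 ℕ.+ 1 →
                        Z ℕ.+ q ℕ.^ 7 ≡ q ℕ.^ 13 ℕ.+ q ℕ.^ 6
  vectors-from-points {Z} {k} {N} Z≡ Q≡ N≡ = ℕₚ.+-cancelʳ-≡ N _ _ (begin
    Z ℕ.+ q ℕ.^ 7 ℕ.+ N                          ≡⟨ cong (λ z → z ℕ.+ q ℕ.^ 7 ℕ.+ N) Z≡ ⟩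
    suc (k ℕ.* N) ℕ.+ q ℕ.^ 7 ℕ.+ N              ≡⟨ solve 3 (λ k n s → con 1 :+ k :* n :+ s :+ n := con 1 :+ (con 1 :+ k) :* n :+ s) refl k N (q ℕ.^ 7) ⟩
    suc (suc k ℕ.* N) ℕ.+ q ℕ.^ 7                ≡⟨ cong₂ (λ a n → suc (a ℕ.* n) ℕ.+ q ℕ.^ 7) (sym Q≡) N≡ ⟩
    suc (q ℕ.* q ℕ.* (q ℕ.^ 11 ℕ.+ q ℕ.^ 9 ℕ.+ q ℕ.^ 7 ℕ.+ q ℕ.^ 4 ℕ.+ q ℕ.^ 2 ℕ.+ 1)) ℕ.+ q ℕ.^ 7
      ≡⟨ solve 1 (λ q → con 1 :+ q :* q :* (q :^ 11 :+ q :^ 9 :+ q :^ 7 :+ q :^ 4 :+ q :^ 2 :+ con 1) :+ q :^ 7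
                     := q :^ 13 :+ q :^ 6 :+ (q :^ 11 :+ q :^ 9 :+ q :^ 7 :+ q :^ 4 :+ q :^ 2 :+ con 1)) refl q ⟩
    q ℕ.^ 13 ℕ.+ q ℕ.^ 6 ℕ.+ (q ℕ.^ 11 ℕ.+ q ℕ.^ 9 ℕ.+ q ℕ.^ 7 ℕ.+ q ℕ.^ 4 ℕ.+ q ℕ.^ 2 ℕ.+ 1)
      ≡⟨ cong (q ℕ.^ 13 ℕ.+ q ℕ.^ 6 ℕ.+_) (sym N≡) ⟩
    q ℕ.^ 13 ℕ.+ q ℕ.^ 6 ℕ.+ N ∎)
    where open ≡-Reasoning

  -- By q^6 - 1 = (q² - 1)(q^4 + q² + 1), the bound of q^6 vectors is exactly the required number of
  -- points.
  points-from-vectors : ∀ {Z k N} → Z ≡ suc (k ℕ.* N) → q ℕ.* q ≡ suc k → 1 ≤ k → (q ℕ.* q) ℕ.^ 3 ≤ Z → q ℕ.^ 4 ℕ.+ q ℕ.^ 2 ℕ.+ 1 ≤ N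
  points-from-vectors {Z} {k} {N} Z≡ Q≡ k≥1 Z≥ = ℕₚ.*-cancelˡ-≤ k {{ℕ.>-nonZero k≥1}} (s≤s⁻¹ (begin
    suc (k ℕ.* T)           ≡⟨ cubic ⟩
    (q ℕ.* q) ℕ.^ 3         ≤⟨ Z≥ ⟩
    Z                       ≡⟨ Z≡ ⟩
    suc (k ℕ.* N)           ∎))
    where
    open ℕₚ.≤-Reasoning
    T = q ℕ.^ 4 ℕ.+ q ℕ.^ 2 ℕ.+ 1
    cubic : suc (k ℕ.* T) ≡ (q ℕ.* q) ℕ.^ 3
    cubic = ℕₚ.+-cancelʳ-≡ T _ _ (trans (solve 2 (λ k t → con 1 :+ k :* t :+ t := con 1 :+ (con 1 :+ k) :* t) refl k T)
      (trans (cong (λ a → suc (a ℕ.* T)) (sym Q≡)) (solve 1 (λ q → con 1 :+ q :* q :* (q :^ 4 :+ q :^ 2 :+ con 1) := (q :* q) :^ 3 :+ (q :^ 4 :+ q :^ 2 :+ con 1)) refl q)))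

-- The theorem over a field with propositional equality.

module DiscreteTheorem (F : DiscreteField) (q : ℕ) (prime-power : IsPrimePower q) (2<q : 2 < q)
  (order : length (DiscreteField.elements F) ≡ q ℕ.^ 2)
  (c : Vec ℕ 7 → DiscreteField.Carrier F) where

  open FieldTheory F
  open LinearSums F
  open Polynomials F using (count-nonzero; Pol)
  open Points F
  open Geometry (toFiniteField F) using (lincomb; eval; countPoints; LinearlyIndependent; isZeroᵇ)
    renaming (_+ᵥ_ to infixl 6 _⊕_; _·ᵥ_ to infixr 7 _⊙_; zeroᵥ to 𝟎)

  f : Vec Carrier 7 → Carrier
  f = eval (q ℕ.+ 1) 7 c

  private
    length-∑ : ∀ {A : Set} (xs : List A) → ∑ xs (λ _ → 1) ≡ length xs
    length-∑ []       = refl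
    length-∑ (x ∷ xs) = cong suc (length-∑ xs)

  Q≡q^2 : Q ≡ q ℕ.^ 2
  Q≡q^2 = trans (length-∑ elements) order

  Q≡q² : Q ≡ q ℕ.* q
  Q≡q² = trans Q≡q^2 (cong (q ℕ.*_) (ℕₚ.*-identityʳ q))

  frobenius : ∀ x y → pow (x + y) q ≡ pow x q + pow y q
  frobenius = pow-q-+ q prime-power Q≡q^2

  homogeneous : ∀ s v → f (s ⊙ v) ≡ pow s (suc q) * f v
  homogeneous s v = trans (eval-homogeneous (q ℕ.+ 1) c s v) (cong (λ k → pow s k * f v) (ℕₚ.+-comm q 1))

  planar : ∀ z u u′ → Pol 2 (suc q) (λ x → f (z ⊕ head x ⊙ u ⊕ head (tail x) ⊙ u′))
  planar z u u′ = subst (λ k → Pol 2 k (λ x → f (z ⊕ head x ⊙ u ⊕ head (tail x) ⊙ u′))) (ℕₚ.+-comm q 1) (eval-planar (q ℕ.+ 1) c z u u′)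

  𝓕 : Form F q 7
  𝓕 = record { 2<q = 2<q ; Q≡q² = Q≡q² ; frobenius = frobenius ; f = f ; homogeneous = homogeneous ; planar = planar }

  independent⇒linear : ∀ {k} (b : Vec (Vec Carrier 7) k) → (∀ cs → lincomb cs b ≡ 𝟎 → cs ≡ 𝟎) → LinearlyIndependent b
  independent⇒linear b ind cs e i = trans (cong (λ v → V.lookup v i) (ind cs (lookup-ext e))) (zero-lookup i)
    where
    zero-lookup : ∀ {k} (i : _) → V.lookup (𝟎 {k}) i ≡ 0#
    zero-lookup {suc k} Fin.zero = refl
    zero-lookup {suc k} (Fin.suc i) = zero-lookup {k} i

  units-suc : q ℕ.* q ≡ suc units
  units-suc = trans (sym Q≡q²) count-nonzero

  module _ (no-solid : ∀ (b : Vec (Vec Carrier 7) 4) → LinearlyIndependent b → ¬ (∀ cs → f (lincomb cs b) ≡ 0#))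
           (count : countPoints 7 (λ v → isZeroᵇ (f v)) ≡ q ℕ.^ 11 ℕ.+ q ℕ.^ 9 ℕ.+ q ℕ.^ 7 ℕ.+ q ℕ.^ 4 ℕ.+ q ℕ.^ 2 ℕ.+ 1) where

    open PointArithmetic q
    open FormTheory 𝓕 using (B; f-𝟎; B-addʳ; B-scaleʳ; B-scaleˡ; B-diagonal; 1<Q; module Values)

    zeros-count : FormTheory.zeros 𝓕 ℕ.+ q ℕ.^ 7 ≡ q ℕ.^ 13 ℕ.+ q ℕ.^ 6
    zeros-count = vectors-from-points (zeros-and-points f (suc q) homogeneous f-𝟎) units-suc count

    open SevenDimensional 𝓕 zeros-count using (isotropic-plane; module Solidless)
    open Solidless (λ b ind iso → no-solid b (independent⇒linear b ind) iso)
      (proj₁ isotropic-plane) (proj₁ (proj₂ isotropic-plane)) (proj₂ (proj₂ isotropic-plane))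
      using (γ; values; μ; μ-nonzero; μ-power; B-hermitian; B-addˡ; B-nondegenerate)

    solid-points : ∀ (b : Vec (Vec Carrier 7) 4) → q ℕ.^ 4 ℕ.+ q ℕ.^ 2 ℕ.+ 1 ≤ countPoints 4 (λ cs → isZeroᵇ (f (lincomb cs b)))
    solid-points b = points-from-vectors (zeros-and-points (λ cs → f (lincomb cs b)) (suc q) hom (trans (cong f (lincomb-𝟎 b)) f-𝟎)) units-suc
        (s≤s⁻¹ (ℕₚ.≤-trans 1<Q (ℕₚ.≤-reflexive count-nonzero))) (subst (λ Q → Q ℕ.^ 3 ≤ Enumeration.count (𝕍 4) (λ cs → f (lincomb cs b) ≟ 0#)) Q≡q² (Values.solid-count γ values b))
      where
      hom : ∀ s v → f (lincomb (s ⊙ v) b) ≡ pow s (suc q) * f (lincomb v b)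
      hom s v = trans (cong f (lincomb-⊙ s v b)) (homogeneous s (lincomb v b))

    η : Vec Carrier 7 → Vec Carrier 7 → Carrier
    η u v = μ * B u v

    η-addʳ : ∀ u v w → η u (v ⊕ w) ≡ η u v + η u w
    η-addʳ u v w = trans (cong (μ *_) (B-addʳ u v w)) (lem μ (B u v) (B u w))
      where
      lem : ∀ m a b → m * (a + b) ≡ m * a + m * b
      lem m a b = solve 3 (λ m a b → m :* (a :+ b) := m :* a :+ m :* b) refl m a b

    η-addˡ : ∀ u v w → η (u ⊕ v) w ≡ η u w + η v w
    η-addˡ u v w = trans (cong (μ *_) (B-addˡ u v w)) (lem μ (B u w) (B v w))
      where
      lem : ∀ m a b → m * (a + b) ≡ m * a + m * b
      lem m a b = solve 3 (λ m a b → m :* (a :+ b) := m :* a :+ m :* b) refl m a b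

    η-scaleʳ : ∀ a u v → η u (a ⊙ v) ≡ a * η u v
    η-scaleʳ a u v = trans (cong (μ *_) (B-scaleʳ a u v)) (lem μ (B u v))
      where
      lem : ∀ m b → m * (a * b) ≡ a * (m * b)
      lem m b = solve 3 (λ m a b → m :* (a :* b) := a :* (m :* b)) refl m a b

    η-scaleˡ : ∀ a u v → η (a ⊙ u) v ≡ pow a q * η u v
    η-scaleˡ a u v = trans (cong (μ *_) (B-scaleˡ a u v)) (lem μ (pow a q) (B u v))
      where
      lem : ∀ m p b → m * (p * b) ≡ p * (m * b)
      lem m p b = solve 3 (λ m p b → m :* (p :* b) := p :* (m :* b)) refl m p b

    η-hermitian : ∀ u v → η u v ≡ pow (η v u) q
    η-hermitian u v = sym (trans (pow-product μ (B v u) q) (trans (cong (pow μ q *_) (B-hermitian v u)) (trans (sym (*-assoc (pow μ q) γ (B u v))) (cong (_* B u v) μ-power))))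

    η-nondegenerate : ∀ u → (∀ v → η u v ≡ 0#) → u ≡ 𝟎
    η-nondegenerate u h = B-nondegenerate u (λ v → *-integral μ-nonzero (h v))

    f⇒η : ∀ v → f v ≡ 0# → η v v ≡ 0#
    f⇒η v e = trans (cong (μ *_) (trans (B-diagonal v) e)) (zeroʳ μ)

    η⇒f : ∀ v → η v v ≡ 0# → f v ≡ 0#
    η⇒f v e = trans (sym (B-diagonal v)) (*-integral μ-nonzero e)

-- Transfer to a field with an arbitrary equality.

⌊⌋-iff : ∀ {a b} {A : Set a} {B : Set b} (d : Dec A) (e : Dec B) → (A → B) → (B → A) → ⌊ d ⌋ ≡ ⌊ e ⌋
⌊⌋-iff (yes _) (yes _) f g = refl
⌊⌋-iff (no _)  (no _)  f g = refl
⌊⌋-iff (yes a) (no ¬b) f g = ⊥-elim (¬b (f a))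
⌊⌋-iff (no ¬a) (yes b) f g = ⊥-elim (¬a (g b))

-- The position of an element in the list of all elements replaces the setoid equality ≈ by ≡.
module Transport {c ℓ : Level} (F : FiniteField c ℓ) where
  open FiniteField F renaming (refl to ≈-refl; sym to ≈-sym; trans to ≈-trans)

  m : ℕ
  m = length elements

  el : Fin m → Carrier
  el = L.lookup elements

  idx : Carrier → Fin m
  idx x = Any.index (complete x)

  el-idx : ∀ x → el (idx x) ≈ x
  el-idx x = ≈-sym (lookup-index (complete x))

  el-injective : ∀ {i j} → el i ≈ el j → i ≡ j
  el-injective = go elements distinct _ _
    where
    differs : ∀ {x} xs → All (λ y → ¬ (x ≈ y)) xs → ∀ j → ¬ (x ≈ L.lookup xs j)
    differs (y ∷ ys) (p ∷ ps) Fin.zero    e = p e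
    differs (y ∷ ys) (p ∷ ps) (Fin.suc j) e = differs ys ps j e
    go : ∀ xs → AllPairs (λ x y → ¬ (x ≈ y)) xs → ∀ i j → L.lookup xs i ≈ L.lookup xs j → i ≡ j
    go (x ∷ xs) (p ∷ ps) Fin.zero    Fin.zero    e = refl
    go (x ∷ xs) (p ∷ ps) Fin.zero    (Fin.suc j) e = ⊥-elim (differs xs p j e)
    go (x ∷ xs) (p ∷ ps) (Fin.suc i) Fin.zero    e = ⊥-elim (differs xs p i (≈-sym e))
    go (x ∷ xs) (p ∷ ps) (Fin.suc i) (Fin.suc j) e = cong Fin.suc (go xs ps i j e)

  -- `complete` need not respect `≈`, but distinctness of the list leaves only one position for each
  -- class.
  idx-cong : ∀ {x y} → x ≈ y → idx x ≡ idx y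
  idx-cong {x} {y} e = el-injective (≈-trans (el-idx x) (≈-trans e (≈-sym (el-idx y))))

  idx-el : ∀ i → idx (el i) ≡ i
  idx-el i = el-injective (el-idx (el i))

  infixl 6 _+̂_
  infixl 7 _*̂_
  _+̂_ _*̂_ : Fin m → Fin m → Fin m
  i +̂ j = idx (el i + el j)
  i *̂ j = idx (el i * el j)

  -̂_ : Fin m → Fin m
  -̂ i = idx (- el i)

  private
    -- Each ring law for positions is the law of the field between the elements that both sides
    -- stand for; a position is determined by its element.
    via : ∀ {x y i j} → el i ≈ x → el j ≈ y → x ≈ y → i ≡ j
    via p r e = el-injective (≈-trans p (≈-trans e (≈-sym r)))

    el-+ : ∀ {i j x y} → el i ≈ x → el j ≈ y → el (i +̂ j) ≈ x + y
    el-+ p r = ≈-trans (el-idx _) (+-cong p r)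

    el-* : ∀ {i j x y} → el i ≈ x → el j ≈ y → el (i *̂ j) ≈ x * y
    el-* p r = ≈-trans (el-idx _) (*-cong p r)

    el-neg : ∀ {i x} → el i ≈ x → el (-̂ i) ≈ - x
    el-neg p = ≈-trans (el-idx _) (-‿cong p)

  isCommutativeRinĝ : IsCommutativeRing _≡_ _+̂_ _*̂_ -̂_ (idx 0#) (idx 1#)
  isCommutativeRinĝ = record
    { isRing = record
      { +-isAbelianGroup = record
        { isGroup = record
          { isMonoid = record
            { isSemigroup = record
              { isMagma = record { isEquivalence = ≡.isEquivalence ; ∙-cong = cong₂ _+̂_ }
              ; assoc = λ i j k → via (el-+ (el-+ ≈-refl ≈-refl) ≈-refl) (el-+ ≈-refl (el-+ ≈-refl ≈-refl)) (+-assoc _ _ _) }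
            ; identity = (λ i → via (el-+ (el-idx 0#) ≈-refl) ≈-refl (+-identityˡ _)) , (λ i → via (el-+ ≈-refl (el-idx 0#)) ≈-refl (+-identityʳ _)) }
          ; inverse = (λ i → via (el-+ (el-neg ≈-refl) ≈-refl) (el-idx 0#) (-‿inverseˡ _)) , (λ i → via (el-+ ≈-refl (el-neg ≈-refl)) (el-idx 0#) (-‿inverseʳ _))
          ; ⁻¹-cong = cong -̂_ }
        ; comm = λ i j → via (el-+ ≈-refl ≈-refl) (el-+ ≈-refl ≈-refl) (+-comm _ _) }
      ; *-cong = cong₂ _*̂_
      ; *-assoc = λ i j k → via (el-* (el-* ≈-refl ≈-refl) ≈-refl) (el-* ≈-refl (el-* ≈-refl ≈-refl)) (*-assoc _ _ _)
      ; *-identity = (λ i → via (el-* (el-idx 1#) ≈-refl) ≈-refl (*-identityˡ _)) , (λ i → via (el-* ≈-refl (el-idx 1#)) ≈-refl (*-identityʳ _))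
      ; distrib = (λ i j k → via (el-* ≈-refl (el-+ ≈-refl ≈-refl)) (el-+ (el-* ≈-refl ≈-refl) (el-* ≈-refl ≈-refl)) (distribˡ _ _ _)) ,
                  (λ i j k → via (el-* (el-+ ≈-refl ≈-refl) ≈-refl) (el-+ (el-* ≈-refl ≈-refl) (el-* ≈-refl ≈-refl)) (distribʳ _ _ _)) }
    ; *-comm = λ i j → via (el-* ≈-refl ≈-refl) (el-* ≈-refl ≈-refl) (*-comm _ _) }

  el-zero : ∀ {i} → i ≡ idx 0# → el i ≈ 0#
  el-zero refl = el-idx 0#

  zero-el : ∀ {i} → el i ≈ 0# → i ≡ idx 0#
  zero-el e = el-injective (≈-trans e (≈-sym (el-idx 0#)))

  F̂ : DiscreteField
  F̂ = record
    { Carrier = Fin m ; _+_ = _+̂_ ; _*_ = _*̂_ ; -_ = -̂_ ; 0# = idx 0# ; 1# = idx 1#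
    ; isCommutativeRing = isCommutativeRinĝ
    ; 0≢1 = λ e → 0≉1 (≈-trans (≈-sym (el-idx 0#)) (≈-trans (reflexive (cong el e)) (el-idx 1#)))
    ; inverse = λ i nz → idx (proj₁ (inverse (el i) (λ e → nz (zero-el e)))) ,
        via (el-* ≈-refl (el-idx _)) (el-idx 1#) (proj₂ (inverse (el i) (λ e → nz (zero-el e))))
    ; _≟_ = Fin._≟_
    ; elements = allFin m
    ; complete = ∈-allFin
    ; distinct = allFin⁺ m }

  module G = Geometry F
  module Ĝ = Geometry (toFiniteField F̂)

  order̂ : length (DiscreteField.elements F̂) ≡ order
  order̂ = length-tabulate (λ i → i)

  elᵥ : ∀ {n} → Vec (Fin m) n → Vec Carrier n
  elᵥ = V.map el

  idxᵥ : ∀ {n} → Vec Carrier n → Vec (Fin m) n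
  idxᵥ = V.map idx

  idxᵥ-elᵥ : ∀ {n} (v : Vec (Fin m) n) → idxᵥ (elᵥ v) ≡ v
  idxᵥ-elᵥ []      = refl
  idxᵥ-elᵥ (i ∷ v) = cong₂ _∷_ (idx-el i) (idxᵥ-elᵥ v)

  elᵥ-idxᵥ : ∀ {n} (v : Vec Carrier n) → elᵥ (idxᵥ v) G.≈ᵥ v
  elᵥ-idxᵥ (x ∷ v) Fin.zero    = el-idx x
  elᵥ-idxᵥ (x ∷ v) (Fin.suc i) = elᵥ-idxᵥ v i

  idxᵥ-cong : ∀ {n} {u v : Vec Carrier n} → u G.≈ᵥ v → idxᵥ u ≡ idxᵥ v
  idxᵥ-cong {u = []}    {[]}    e = refl
  idxᵥ-cong {u = x ∷ u} {y ∷ v} e = cong₂ _∷_ (idx-cong (e Fin.zero)) (idxᵥ-cong (λ i → e (Fin.suc i)))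

  idxᵥ-+ : ∀ {n} (u v : Vec Carrier n) → idxᵥ (u G.+ᵥ v) ≡ idxᵥ u Ĝ.+ᵥ idxᵥ v
  idxᵥ-+ []      []      = refl
  idxᵥ-+ (x ∷ u) (y ∷ v) = cong₂ _∷_ (sym (idx-cong (+-cong (el-idx x) (el-idx y)))) (idxᵥ-+ u v)

  idxᵥ-· : ∀ {n} a (v : Vec Carrier n) → idxᵥ (a G.·ᵥ v) ≡ idx a Ĝ.·ᵥ idxᵥ v
  idxᵥ-· a []      = refl
  idxᵥ-· a (x ∷ v) = cong₂ _∷_ (sym (idx-cong (*-cong (el-idx a) (el-idx x)))) (idxᵥ-· a v)

  ≈ᵥ-trans : ∀ {n} {u v w : Vec Carrier n} → u G.≈ᵥ v → v G.≈ᵥ w → u G.≈ᵥ w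
  ≈ᵥ-trans p r i = ≈-trans (p i) (r i)

  +ᵥ-cong : ∀ {n} {u u′ v v′ : Vec Carrier n} → u G.≈ᵥ u′ → v G.≈ᵥ v′ → (u G.+ᵥ v) G.≈ᵥ (u′ G.+ᵥ v′)
  +ᵥ-cong {u = x ∷ u} {x′ ∷ u′} {y ∷ v} {y′ ∷ v′} p r Fin.zero    = +-cong (p Fin.zero) (r Fin.zero)
  +ᵥ-cong {u = x ∷ u} {x′ ∷ u′} {y ∷ v} {y′ ∷ v′} p r (Fin.suc i) = +ᵥ-cong {u = u} {u′} {v} {v′} (λ j → p (Fin.suc j)) (λ j → r (Fin.suc j)) i

  ·ᵥ-cong : ∀ {n a a′} {v v′ : Vec Carrier n} → a ≈ a′ → v G.≈ᵥ v′ → (a G.·ᵥ v) G.≈ᵥ (a′ G.·ᵥ v′)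
  ·ᵥ-cong {v = x ∷ v} {x′ ∷ v′} p r Fin.zero    = *-cong p (r Fin.zero)
  ·ᵥ-cong {v = x ∷ v} {x′ ∷ v′} p r (Fin.suc i) = ·ᵥ-cong {v = v} {v′} p (λ j → r (Fin.suc j)) i

  elᵥ-+ : ∀ {n} (u v : Vec (Fin m) n) → elᵥ (u Ĝ.+ᵥ v) G.≈ᵥ (elᵥ u G.+ᵥ elᵥ v)
  elᵥ-+ (i ∷ u) (j ∷ v) Fin.zero    = el-idx _
  elᵥ-+ (i ∷ u) (j ∷ v) (Fin.suc k) = elᵥ-+ u v k

  elᵥ-· : ∀ {n} a (v : Vec (Fin m) n) → elᵥ (a Ĝ.·ᵥ v) G.≈ᵥ (el a G.·ᵥ elᵥ v)
  elᵥ-· a (i ∷ v) Fin.zero    = el-idx _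
  elᵥ-· a (i ∷ v) (Fin.suc k) = elᵥ-· a v k

  elᵥ-zero : ∀ n → elᵥ (Ĝ.zeroᵥ {n}) G.≈ᵥ G.zeroᵥ
  elᵥ-zero (suc n) Fin.zero    = el-idx 0#
  elᵥ-zero (suc n) (Fin.suc k) = elᵥ-zero n k

  lincomb-cong : ∀ {k n} (cs ds : Vec Carrier k) (b b′ : Vec (Vec Carrier n) k) → cs G.≈ᵥ ds → (∀ i → V.lookup b i G.≈ᵥ V.lookup b′ i) →
                 G.lincomb cs b G.≈ᵥ G.lincomb ds b′
  lincomb-cong []       []       []      []        p r = λ i → ≈-refl
  lincomb-cong (a ∷ cs) (d ∷ ds) (v ∷ b) (v′ ∷ b′) p r = +ᵥ-cong {u = a G.·ᵥ v} {d G.·ᵥ v′} {G.lincomb cs b} {G.lincomb ds b′}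
    (·ᵥ-cong {v = v} {v′} (p Fin.zero) (r Fin.zero)) (lincomb-cong cs ds b b′ (λ i → p (Fin.suc i)) (λ i → r (Fin.suc i)))

  elᵥ-lincomb : ∀ {k n} (cs : Vec (Fin m) k) (b : Vec (Vec (Fin m) n) k) → elᵥ (Ĝ.lincomb cs b) G.≈ᵥ G.lincomb (elᵥ cs) (V.map elᵥ b)
  elᵥ-lincomb {n = n} []       []      = elᵥ-zero n
  elᵥ-lincomb (a ∷ cs) (v ∷ b) = ≈ᵥ-trans {u = elᵥ ((a Ĝ.·ᵥ v) Ĝ.+ᵥ Ĝ.lincomb cs b)} {elᵥ (a Ĝ.·ᵥ v) G.+ᵥ elᵥ (Ĝ.lincomb cs b)} {G.lincomb (elᵥ (a ∷ cs)) (V.map elᵥ (v ∷ b))}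
    (elᵥ-+ (a Ĝ.·ᵥ v) (Ĝ.lincomb cs b))
    (+ᵥ-cong {u = elᵥ (a Ĝ.·ᵥ v)} {el a G.·ᵥ elᵥ v} {elᵥ (Ĝ.lincomb cs b)} {G.lincomb (elᵥ cs) (V.map elᵥ b)} (elᵥ-· a v) (elᵥ-lincomb cs b))

  pow-cong : ∀ {x y} e → x ≈ y → G.pow x e ≈ G.pow y e
  pow-cong zero    p = ≈-refl
  pow-cong (suc e) p = *-cong p (pow-cong e p)

  monomial-cong : ∀ {n} (e : Vec ℕ n) u v → u G.≈ᵥ v → G.monomialValue e u ≈ G.monomialValue e v
  monomial-cong []       []      []      p = ≈-refl
  monomial-cong (e ∷ es) (x ∷ u) (y ∷ v) p = *-cong (pow-cong e (p Fin.zero)) (monomial-cong es u v (λ i → p (Fin.suc i)))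

  eval-cong : ∀ d n f u v → u G.≈ᵥ v → G.eval d n f u ≈ G.eval d n f v
  eval-cong d n f u v p = go (G.monomials d n)
    where
    go : ∀ es → L.foldr _+_ 0# (L.map (λ e → f e * G.monomialValue e u) es) ≈ L.foldr _+_ 0# (L.map (λ e → f e * G.monomialValue e v) es)
    go []       = ≈-refl
    go (e ∷ es) = +-cong (*-congˡ (monomial-cong e u v p)) (go es)

  el-pow : ∀ i e → el (Ĝ.pow i e) ≈ G.pow (el i) e
  el-pow i zero    = el-idx 1#
  el-pow i (suc e) = ≈-trans (el-idx _) (*-congˡ (el-pow i e))

  el-monomial : ∀ {n} (e : Vec ℕ n) v → el (Ĝ.monomialValue e v) ≈ G.monomialValue e (elᵥ v)
  el-monomial []       []      = el-idx 1#
  el-monomial (e ∷ es) (i ∷ v) = ≈-trans (el-idx _) (*-cong (el-pow i e) (el-monomial es v))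

  -- The instances of `monomials` for the two fields are defined by the same recursion and have to
  -- be identified before the forms can be compared term by term.
  monomials≡ : ∀ d n → Ĝ.monomials d n ≡ G.monomials d n
  monomials≡ d zero    = refl
  monomials≡ d (suc n) = cong L.concat (map-cong (λ e → cong (L.map (e ∷_)) (monomials≡ (d ℕ.∸ e) n)) (L.upTo (suc d)))
    where
    map-cong : ∀ {A B : Set} {g h : A → B} → (∀ x → g x ≡ h x) → ∀ xs → L.map g xs ≡ L.map h xs
    map-cong p []       = refl
    map-cong p (x ∷ xs) = cong₂ _∷_ (p x) (map-cong p xs)

  el-eval : ∀ d n f v → el (Ĝ.eval d n (λ e → idx (f e)) v) ≈ G.eval d n f (elᵥ v)
  el-eval d n f v rewrite monomials≡ d n = go (G.monomials d n)
    where
    go : ∀ es → el (L.foldr _+̂_ (idx 0#) (L.map (λ e → idx (f e) *̂ Ĝ.monomialValue e v) es)) ≈ L.foldr _+_ 0# (L.map (λ e → f e * G.monomialValue e (elᵥ v)) es)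
    go []       = el-idx 0#
    go (e ∷ es) = ≈-trans (el-idx _) (+-cong (≈-trans (el-idx _) (*-cong (el-idx (f e)) (el-monomial e v))) (go es))

  ∑-elements : ∀ (g : Carrier → ℕ) → ∑ elements g ≡ ∑ (allFin m) (λ i → g (el i))
  ∑-elements g = trans (cong (λ xs → ∑ xs g) (sym (trans (map-tabulate (λ i → i) el) (tabulate-lookup elements)))) (∑-map el (allFin m) g)

  ∑-allVecs-elᵥ : ∀ n (g : Vec Carrier n → ℕ) → ∑ (G.allVecs n) g ≡ ∑ (Ĝ.allVecs n) (λ v → g (elᵥ v))
  ∑-allVecs-elᵥ zero    g = refl
  ∑-allVecs-elᵥ (suc n) g = trans (∑-concatMap (λ x → L.map (x ∷_) (G.allVecs n)) elements g)
    (trans (∑-cong elements (λ x → ∑-map (x ∷_) (G.allVecs n) g))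
    (trans (∑-elements (λ x → ∑ (G.allVecs n) (λ v → g (x ∷ v))))
    (trans (∑-cong (allFin m) (λ i → trans (∑-allVecs-elᵥ n (λ v → g (el i ∷ v))) (sym (∑-map (i ∷_) (Ĝ.allVecs n) (λ v → g (elᵥ v))))))
      (sym (∑-concatMap (λ i → L.map (i ∷_) (Ĝ.allVecs n)) (allFin m) (λ v → g (elᵥ v)))))))

  isZero-el : ∀ i x → el i ≈ x → G.isZeroᵇ x ≡ Ĝ.isZeroᵇ i
  isZero-el i x e = ⌊⌋-iff (x ≟ 0#) (i Fin.≟ idx 0#) (λ p → zero-el (≈-trans e p)) (λ p → ≈-trans (≈-sym e) (el-zero p))

  normalised-elᵥ : ∀ {n} (v : Vec (Fin m) n) → G.normalisedᵇ (elᵥ v) ≡ Ĝ.normalisedᵇ v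
  normalised-elᵥ []      = refl
  normalised-elᵥ (i ∷ v) rewrite isZero-el i (el i) ≈-refl with Ĝ.isZeroᵇ i
  ... | true  = normalised-elᵥ v
  ... | false = ⌊⌋-iff (el i ≟ 1#) (i Fin.≟ idx 1#) (λ p → el-injective (≈-trans p (≈-sym (el-idx 1#)))) (λ { refl → el-idx 1# })

  countPoints-el : ∀ n (P : Vec Carrier n → Bool) (P̂ : Vec (Fin m) n → Bool) → (∀ v → P (elᵥ v) ≡ P̂ v) → G.countPoints n P ≡ Ĝ.countPoints n P̂
  countPoints-el n P P̂ h = trans (length-filterᵇ (λ v → G.normalisedᵇ v ∧ P v) (G.allVecs n))
    (trans (∑-allVecs-elᵥ n (λ v → β (G.normalisedᵇ v ∧ P v)))
    (trans (∑-cong (Ĝ.allVecs n) (λ v → cong β (cong₂ _∧_ (normalised-elᵥ v) (h v))))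
      (sym (length-filterᵇ (λ v → Ĝ.normalisedᵇ v ∧ P̂ v) (Ĝ.allVecs n)))))

  lookup-idxᵥ : ∀ {n} (v : Vec Carrier n) i → V.lookup (idxᵥ v) i ≡ idx (V.lookup v i)
  lookup-idxᵥ (x ∷ v) Fin.zero    = refl
  lookup-idxᵥ (x ∷ v) (Fin.suc i) = lookup-idxᵥ v i

  elᵥ-injective : ∀ {n} {u v : Vec (Fin m) n} → elᵥ u G.≈ᵥ elᵥ v → u ≡ v
  elᵥ-injective {u = u} {v} e = trans (sym (idxᵥ-elᵥ u)) (trans (idxᵥ-cong e) (idxᵥ-elᵥ v))

  lincomb-idx : ∀ {k n} (cs : Vec Carrier k) (b : Vec (Vec (Fin m) n) k) → elᵥ (Ĝ.lincomb (idxᵥ cs) b) G.≈ᵥ G.lincomb cs (V.map elᵥ b)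
  lincomb-idx cs b = ≈ᵥ-trans {u = elᵥ (Ĝ.lincomb (idxᵥ cs) b)} {G.lincomb (elᵥ (idxᵥ cs)) (V.map elᵥ b)} {G.lincomb cs (V.map elᵥ b)}
    (elᵥ-lincomb (idxᵥ cs) b) (lincomb-cong (elᵥ (idxᵥ cs)) cs (V.map elᵥ b) (V.map elᵥ b) (elᵥ-idxᵥ cs) (λ i j → ≈-refl))

  independent-elᵥ : ∀ {k n} (b : Vec (Vec (Fin m) n) k) → Ĝ.LinearlyIndependent b → G.LinearlyIndependent (V.map elᵥ b)
  independent-elᵥ {n = n} b ind cs e i = ≈-trans (≈-sym (el-idx _)) (el-zero (trans (sym (lookup-idxᵥ cs i)) (ind (idxᵥ cs) (λ j → cong (λ v → V.lookup v j) null) i)))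
    where
    null : Ĝ.lincomb (idxᵥ cs) b ≡ Ĝ.zeroᵥ
    null = elᵥ-injective (λ j → ≈-trans (lincomb-idx cs b j) (≈-trans (e j) (≈-sym (elᵥ-zero n j))))

  elᵥ-idxᵥ-rows : ∀ {k n} (b : Vec (Vec Carrier n) k) i → V.lookup (V.map elᵥ (V.map idxᵥ b)) i G.≈ᵥ V.lookup b i
  elᵥ-idxᵥ-rows (v ∷ b) Fin.zero    = elᵥ-idxᵥ v
  elᵥ-idxᵥ-rows (v ∷ b) (Fin.suc i) = elᵥ-idxᵥ-rows b i

  module Hypersurface (q : ℕ) (prime-power : IsPrimePower q) (2<q : 2 < q) (order≡ : order ≡ q ℕ.^ 2)
           (f : Vec ℕ 7 → Carrier)
           (no-solid : ∀ (b : Vec (Vec Carrier 7) 4) → G.LinearlyIndependent b → ¬ (∀ cs → G.eval (q ℕ.+ 1) 7 f (G.lincomb cs b) ≈ 0#))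
           (count : G.countPoints 7 (λ v → G.isZeroᵇ (G.eval (q ℕ.+ 1) 7 f v)) ≡ q ℕ.^ 11 ℕ.+ q ℕ.^ 9 ℕ.+ q ℕ.^ 7 ℕ.+ q ℕ.^ 4 ℕ.+ q ℕ.^ 2 ℕ.+ 1)
           where

    private
      f̂ : Vec (Fin m) 7 → Fin m
      f̂ = Ĝ.eval (q ℕ.+ 1) 7 (λ e → idx (f e))

      el-f̂ : ∀ v → el (f̂ v) ≈ G.eval (q ℕ.+ 1) 7 f (elᵥ v)
      el-f̂ = el-eval (q ℕ.+ 1) 7 f

      el-f̂-idx : ∀ v → el (f̂ (idxᵥ v)) ≈ G.eval (q ℕ.+ 1) 7 f v
      el-f̂-idx v = ≈-trans (el-f̂ (idxᵥ v)) (eval-cong (q ℕ.+ 1) 7 f (elᵥ (idxᵥ v)) v (elᵥ-idxᵥ v))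

      no-solid̂ : ∀ (b : Vec (Vec (Fin m) 7) 4) → Ĝ.LinearlyIndependent b → ¬ (∀ cs → f̂ (Ĝ.lincomb cs b) ≡ idx 0#)
      no-solid̂ b ind h = no-solid (V.map elᵥ b) (independent-elᵥ b ind) λ cs →
        ≈-trans (eval-cong (q ℕ.+ 1) 7 f (G.lincomb cs (V.map elᵥ b)) (elᵥ (Ĝ.lincomb (idxᵥ cs) b)) (λ i → ≈-sym (lincomb-idx cs b i))) (≈-trans (≈-sym (el-f̂ (Ĝ.lincomb (idxᵥ cs) b))) (el-zero (h (idxᵥ cs))))

      coun̂t : Ĝ.countPoints 7 (λ v → Ĝ.isZeroᵇ (f̂ v)) ≡ q ℕ.^ 11 ℕ.+ q ℕ.^ 9 ℕ.+ q ℕ.^ 7 ℕ.+ q ℕ.^ 4 ℕ.+ q ℕ.^ 2 ℕ.+ 1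
      coun̂t = trans (sym (countPoints-el 7 _ _ (λ v → isZero-el (f̂ v) _ (el-f̂ v)))) count

      module T = DiscreteTheorem F̂ q prime-power 2<q (trans order̂ order≡) (λ e → idx (f e))

      η̂ : Vec (Fin m) 7 → Vec (Fin m) 7 → Fin m
      η̂ = T.η no-solid̂ coun̂t

    solids : ∀ (b : Vec (Vec Carrier 7) 4) → q ℕ.^ 4 ℕ.+ q ℕ.^ 2 ℕ.+ 1 ≤ G.countPoints 4 (λ cs → G.isZeroᵇ (G.eval (q ℕ.+ 1) 7 f (G.lincomb cs b)))
    solids b = subst (q ℕ.^ 4 ℕ.+ q ℕ.^ 2 ℕ.+ 1 ≤_) (sym (countPoints-el 4 _ _ (λ cs → isZero-el (f̂ (Ĝ.lincomb cs b̂)) _ (agree cs)))) (T.solid-points no-solid̂ coun̂t b̂)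
      where
      b̂ = V.map idxᵥ b
      agree : ∀ cs → el (f̂ (Ĝ.lincomb cs b̂)) ≈ G.eval (q ℕ.+ 1) 7 f (G.lincomb (elᵥ cs) b)
      agree cs = ≈-trans (el-f̂ (Ĝ.lincomb cs b̂)) (eval-cong (q ℕ.+ 1) 7 f (elᵥ (Ĝ.lincomb cs b̂)) (G.lincomb (elᵥ cs) b) (≈ᵥ-trans {u = elᵥ (Ĝ.lincomb cs b̂)} {G.lincomb (elᵥ cs) (V.map elᵥ b̂)} {G.lincomb (elᵥ cs) b}
        (elᵥ-lincomb cs b̂) (lincomb-cong (elᵥ cs) (elᵥ cs) (V.map elᵥ b̂) b (λ i → ≈-refl) (elᵥ-idxᵥ-rows b))))

    hermitian : G.HermitianForm q 7
    hermitian = record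
      { η        = λ u v → el (η̂ (idxᵥ u) (idxᵥ v))
      ; η-cong   = λ {u} {u′} {v} {v′} p r → reflexive (cong₂ (λ a b → el (η̂ a b)) (idxᵥ-cong {u = u} {u′} p) (idxᵥ-cong {u = v} {v′} r))
      ; η-addʳ   = λ u v w → ≈-trans (reflexive (cong el (trans (cong (η̂ (idxᵥ u)) (idxᵥ-+ v w)) (T.η-addʳ no-solid̂ coun̂t (idxᵥ u) (idxᵥ v) (idxᵥ w))))) (el-idx _)
      ; η-scaleʳ = λ a u v → ≈-trans (reflexive (cong el (trans (cong (η̂ (idxᵥ u)) (idxᵥ-· a v)) (T.η-scaleʳ no-solid̂ coun̂t (idx a) (idxᵥ u) (idxᵥ v))))) (≈-trans (el-idx _) (*-congʳ (el-idx a)))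
      ; η-addˡ   = λ u v w → ≈-trans (reflexive (cong el (trans (cong (λ a → η̂ a (idxᵥ w)) (idxᵥ-+ u v)) (T.η-addˡ no-solid̂ coun̂t (idxᵥ u) (idxᵥ v) (idxᵥ w))))) (el-idx _)
      ; η-scaleˡ = λ a u v → ≈-trans (reflexive (cong el (trans (cong (λ w → η̂ w (idxᵥ v)) (idxᵥ-· a u)) (T.η-scaleˡ no-solid̂ coun̂t (idx a) (idxᵥ u) (idxᵥ v)))))
                     (≈-trans (el-idx _) (*-congʳ (≈-trans (el-pow (idx a) q) (pow-cong q (el-idx a)))))
      ; η-herm   = λ u v → ≈-trans (reflexive (cong el (T.η-hermitian no-solid̂ coun̂t (idxᵥ u) (idxᵥ v)))) (el-pow _ q)
      }

    hermitian-nondegenerate : G.HermitianForm.NonDegenerate hermitian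
    hermitian-nondegenerate u h i = ≈-trans (≈-sym (elᵥ-idxᵥ u i)) (≈-trans (reflexive (cong (λ v → V.lookup (elᵥ v) i) null)) (elᵥ-zero 7 i))
      where
      null : idxᵥ u ≡ Ĝ.zeroᵥ
      null = T.η-nondegenerate no-solid̂ coun̂t (idxᵥ u) (λ v → zero-el (≈-trans (reflexive (cong (λ w → el (η̂ (idxᵥ u) w)) (sym (idxᵥ-elᵥ v)))) (h (elᵥ v))))

    points : ∀ v → (G.eval (q ℕ.+ 1) 7 f v ≈ 0# → G.HermitianForm.η hermitian v v ≈ 0#) × (G.HermitianForm.η hermitian v v ≈ 0# → G.eval (q ℕ.+ 1) 7 f v ≈ 0#)
    points v = (λ e → el-zero (T.f⇒η no-solid̂ coun̂t (idxᵥ v) (zero-el (≈-trans (el-f̂-idx v) e)))) ,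
               (λ e → ≈-trans (≈-sym (el-f̂-idx v)) (el-zero (T.η⇒f no-solid̂ coun̂t (idxᵥ v) (zero-el e))))

open import Data.Nat using (_+_; _^_)

theorem1p1 : {c ℓ : Level} (q : ℕ) → IsPrimePower q → 2 < q →
    (F : FiniteField c ℓ) → FiniteField.order F ≡ q ^ 2 →
    let open Geometry F in (f : Vec ℕ 7 → Carrier) →
    NonZeroForm (q + 1) 7 f →
    (∀ (b : Vec (Vec Carrier 7) 4) → LinearlyIndependent b →
    ¬ (∀ (cs : Vec Carrier 4) → eval (q + 1) 7 f (lincomb cs b) ≈ 0#)) →
    countPoints 7 (λ v → isZeroᵇ (eval (q + 1) 7 f v))
    ≡ q ^ 11 + q ^ 9 + q ^ 7 + q ^ 4 + q ^ 2 + 1 →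
    (∀ (b : Vec (Vec Carrier 7) 4) → LinearlyIndependent b →
    q ^ 4 + q ^ 2 + 1
    ≤ countPoints 4 (λ cs → isZeroᵇ (eval (q + 1) 7 f (lincomb cs b))))
    ×
    ((Σ (Vec (Vec Carrier 7) 4) λ b → LinearlyIndependent b ×
    (countPoints 4 (λ cs → isZeroᵇ (eval (q + 1) 7 f (lincomb cs b)))
    ≡ q ^ 4 + q ^ 2 + 1)) →
    Σ (HermitianForm q 7) λ H →
    HermitianForm.NonDegenerate H ×
    (∀ (v : Vec Carrier 7) →
    (eval (q + 1) 7 f v ≈ 0# → HermitianForm.η H v v ≈ 0#) ×
    (HermitianForm.η H v v ≈ 0# → eval (q + 1) 7 f v ≈ 0#)))
theorem1p1 q prime-power 2<q F order≡ f _ no-solid count =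
  (λ b _ → T.solids b) , λ _ → T.hermitian , T.hermitian-nondegenerate , T.points
  where module T = Transport.Hypersurface F q prime-power 2<q order≡ f no-solid count
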